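{- The following inequalities hold: $$\frac{7}{3}\leq e_r^*(5)\leq 3,\qquad \frac{17}{5}\leq e_r^*(7)\leq 5,\qquad \frac{31}{7}\leq e_r^*(9)\leq 7.$$
   Context: All polynomials have integer coefficients. For an integer polynomial $P(x)$ of degree $d\ge 2$, let $\mathrm{H}(P)$ denote its naïve height, i.e. the maximum of the absolute values of its coefficients. If $P$ has at least two distinct complex roots, its root separation is $$\mathrm{sep}(P):=\min_{\substack{P(\alpha)=P(\beta)=0,\\ \alpha\neq\beta}}|\alpha-\beta|,$$ where the minimum is over pairs of distinct complex roots of $P$. The quantity $e(P)$ is defined (when $\mathrm{H}(P)>1$) by $\mathrm{sep}(P)=\mathrm{H}(P)^{ -e(P)}$, that is, $e(P)=-\log \mathrm{sep}(P)/\log \mathrm{H}(P)$. For $d\ge 2$, set $$e_r^*(d):=\limsup_{\deg(P)=d,\ \mathrm{H}(P)\to+\infty} e(P)=\lim_{H\to+\infty}\ \sup\{e(P): \deg P=d,\ \mathrm{H}(P)\ge H\},$$ where $P$ ranges over the monic integer polynomials of degree $d$ that are reducible over $\mathbb{Q}$ and have at least two distinct complex roots (the roots are not required to be simple). -}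

module Defs where

open import Level using (0ℓ)
open import Algebra.Bundles using (RawSemiring)
import Algebra.Definitions.RawSemiring as RawSemiringDefinitions
open import Data.Integer.Base as ℤ using (ℤ; +_; -[1+_])
open import Data.List.Base using (List; []; _∷_; foldr; map)
open import Data.Nat.Base as ℕ using (ℕ; zero; suc; NonTrivial)
import Data.Nat.Properties as ℕ
open import Data.Product using (Σ; ∃; ∃₂; _×_; _,_; proj₁; proj₂)
open import Data.Rational.Base as ℚ using (ℚ; 0ℚ; 1ℚ; ½; _/_; ↥_; ↧ₙ_)
import Data.Rational.Properties as ℚ
open import Data.Rational.Solver using (module +-*-Solver)
open import Relation.Binary.PropositionalEquality
open import Relation.Nullary using (¬_)

------------------------------------------------------------------------
-- Real numbers, as Cauchy sequences of rationals

Eventually : (ℕ → Set) → Set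
Eventually P = ∃ λ N → ∀ n → N ℕ.≤ n → P n

Cauchy : (ℕ → ℚ) → Set
Cauchy x = ∀ ε → 0ℚ ℚ.< ε →
  ∃ λ N → ∀ m n → N ℕ.≤ m → N ℕ.≤ n → ℚ.∣ x m ℚ.- x n ∣ ℚ.< ε

record ℝ : Set where
  constructor mkℝ
  field
    seq    : ℕ → ℚ
    cauchy : Cauchy seq

open ℝ public

infix 4 _≈ᴿ_ _<ᴿ_ _≤ᴿ_

_≈ᴿ_ : ℝ → ℝ → Set
x ≈ᴿ y = ∀ ε → 0ℚ ℚ.< ε → Eventually λ n → ℚ.∣ seq x n ℚ.- seq y n ∣ ℚ.< ε

_<ᴿ_ : ℝ → ℝ → Set
x <ᴿ y = ∃ λ ε → 0ℚ ℚ.< ε × Eventually λ n → seq x n ℚ.+ ε ℚ.< seq y n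

_≤ᴿ_ : ℝ → ℝ → Set
x ≤ᴿ y = ¬ (y <ᴿ x)

half+half : ∀ ε → ½ ℚ.* ε ℚ.+ ½ ℚ.* ε ≡ ε
half+half ε = trans (sym (ℚ.*-distribʳ-+ ε ½ ½)) (ℚ.*-identityˡ ε)

half>0 : ∀ ε → 0ℚ ℚ.< ε → 0ℚ ℚ.< ½ ℚ.* ε
half>0 ε ε>0 =
  subst (ℚ._< ½ ℚ.* ε) (ℚ.*-zeroʳ ½) (ℚ.*-monoʳ-<-pos ½ ε>0)

fromℚ-cauchy : ∀ q → Cauchy (λ _ → q)
fromℚ-cauchy q ε ε>0 = 0 , λ _ _ _ _ →
  subst (λ z → ℚ.∣ z ∣ ℚ.< ε) (sym (ℚ.+-inverseʳ q)) ε>0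

open +-*-Solver using (solve; _:+_; _:*_; _:-_; _:=_)

+-rearrange : ∀ a b c d →
  (a ℚ.+ b) ℚ.- (c ℚ.+ d) ≡ (a ℚ.- c) ℚ.+ (b ℚ.- d)
+-rearrange = solve 4
  (λ a b c d → (a :+ b) :- (c :+ d) := (a :- c) :+ (b :- d)) refl

*-rearrange : ∀ a b c d →
  a ℚ.* b ℚ.- c ℚ.* d ≡ a ℚ.* (b ℚ.- d) ℚ.+ (a ℚ.- c) ℚ.* d
*-rearrange = solve 4
  (λ a b c d → a :* b :- c :* d := a :* (b :- d) :+ (a :- c) :* d) refl

recentre : ∀ a b → a ≡ b ℚ.+ (a ℚ.- b)
recentre = solve 2 (λ a b → a := b :+ (a :- b)) refl

factor-out : ∀ b c e r →
  b ℚ.* (e ℚ.* r) ℚ.+ (e ℚ.* r) ℚ.* c ≡ e ℚ.* ((b ℚ.+ c) ℚ.* r)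
factor-out = solve 4
  (λ b c e r → b :* (e :* r) :+ (e :* r) :* c := e :* ((b :+ c) :* r)) refl

+-cauchy : ∀ x y → Cauchy x → Cauchy y → Cauchy (λ n → x n ℚ.+ y n)
+-cauchy x y cx cy ε ε>0
  with cx (½ ℚ.* ε) (half>0 ε ε>0) | cy (½ ℚ.* ε) (half>0 ε ε>0)
... | M , xM | N , yN = M ℕ.⊔ N , λ m n ≤m ≤n → begin-strict
  ℚ.∣ (x m ℚ.+ y m) ℚ.- (x n ℚ.+ y n) ∣
    ≡⟨ cong ℚ.∣_∣ (+-rearrange (x m) (y m) (x n) (y n)) ⟩
  ℚ.∣ (x m ℚ.- x n) ℚ.+ (y m ℚ.- y n) ∣
    ≤⟨ ℚ.∣p+q∣≤∣p∣+∣q∣ (x m ℚ.- x n) (y m ℚ.- y n) ⟩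
  ℚ.∣ x m ℚ.- x n ∣ ℚ.+ ℚ.∣ y m ℚ.- y n ∣
    <⟨ ℚ.+-mono-<
         (xM m n (ℕ.m⊔n≤o⇒m≤o M N ≤m) (ℕ.m⊔n≤o⇒m≤o M N ≤n))
         (yN m n (ℕ.m⊔n≤o⇒n≤o M N ≤m) (ℕ.m⊔n≤o⇒n≤o M N ≤n)) ⟩
  ½ ℚ.* ε ℚ.+ ½ ℚ.* ε
    ≡⟨ half+half ε ⟩
  ε ∎
  where
  open ℚ.≤-Reasoning

neg-cauchy : ∀ x → Cauchy x → Cauchy (λ n → ℚ.- x n)
neg-cauchy x cx ε ε>0 with cx ε ε>0
... | N , xN = N , λ m n ≤m ≤n →
  subst (ℚ._< ε)
    (trans (sym (ℚ.∣-p∣≡∣p∣ (x m ℚ.- x n)))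
           (cong ℚ.∣_∣ (ℚ.neg-distrib-+ (x m) (ℚ.- x n))))
    (xN m n ≤m ≤n)

eventually-bounded : ∀ x → Cauchy x →
  ∃ λ B → ℚ.Positive B × Eventually λ n → ℚ.∣ x n ∣ ℚ.≤ B
eventually-bounded x cx with cx 1ℚ (ℚ.positive⁻¹ 1ℚ)
... | N , xN =
  ℚ.∣ x N ∣ ℚ.+ 1ℚ ,
  ℚ.nonNeg+pos⇒pos ℚ.∣ x N ∣ {{ℚ.∣-∣-nonNeg (x N)}} 1ℚ ,
  N , λ n ≤n → begin
    ℚ.∣ x n ∣
      ≡⟨ cong ℚ.∣_∣ (recentre (x n) (x N)) ⟩
    ℚ.∣ x N ℚ.+ (x n ℚ.- x N) ∣
      ≤⟨ ℚ.∣p+q∣≤∣p∣+∣q∣ (x N) (x n ℚ.- x N) ⟩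
    ℚ.∣ x N ∣ ℚ.+ ℚ.∣ x n ℚ.- x N ∣
      ≤⟨ ℚ.+-monoʳ-≤ ℚ.∣ x N ∣ (ℚ.<⇒≤ (xN n N ≤n ℕ.≤-refl)) ⟩
    ℚ.∣ x N ∣ ℚ.+ 1ℚ ∎
  where
  open ℚ.≤-Reasoning

split-tolerance : ∀ B C → .{{ℚ.Positive B}} → .{{ℚ.Positive C}} →
  ∀ ε → 0ℚ ℚ.< ε → ∃ λ δ → 0ℚ ℚ.< δ × B ℚ.* δ ℚ.+ δ ℚ.* C ≡ ε
split-tolerance B C ε ε>0 = go (B ℚ.+ C) {{ℚ.pos+pos⇒pos B C}} refl
  where
  go : ∀ S → .{{ℚ.Positive S}} → B ℚ.+ C ≡ S →
    ∃ λ δ → 0ℚ ℚ.< δ × B ℚ.* δ ℚ.+ δ ℚ.* C ≡ ε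
  go S B+C≡S = ε ℚ.* r ,
    subst (ℚ._< ε ℚ.* r) (ℚ.*-zeroˡ r)
      (ℚ.*-monoˡ-<-pos r {{ℚ.1/pos⇒pos S}} ε>0) ,
    trans (factor-out B C ε r)
      (trans (cong (λ z → ε ℚ.* (z ℚ.* r)) B+C≡S)
        (trans (cong (ε ℚ.*_) (ℚ.*-inverseʳ S {{ℚ.pos⇒nonZero S}}))
          (ℚ.*-identityʳ ε)))
    where
    r = ℚ.1/_ S {{ℚ.pos⇒nonZero S}}

product-bound : ∀ B C → .{{ℚ.Positive B}} → .{{ℚ.Positive C}} →
  ∀ δ a b c d → ℚ.∣ a ∣ ℚ.≤ B → ℚ.∣ d ∣ ℚ.≤ C →
  ℚ.∣ a ℚ.- c ∣ ℚ.< δ → ℚ.∣ b ℚ.- d ∣ ℚ.< δ →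
  ℚ.∣ a ℚ.* b ℚ.- c ℚ.* d ∣ ℚ.< B ℚ.* δ ℚ.+ δ ℚ.* C
product-bound B C δ a b c d a≤B d≤C ac<δ bd<δ = begin-strict
  ℚ.∣ a ℚ.* b ℚ.- c ℚ.* d ∣
    ≡⟨ cong ℚ.∣_∣ (*-rearrange a b c d) ⟩
  ℚ.∣ a ℚ.* (b ℚ.- d) ℚ.+ (a ℚ.- c) ℚ.* d ∣
    ≤⟨ ℚ.∣p+q∣≤∣p∣+∣q∣ (a ℚ.* (b ℚ.- d)) ((a ℚ.- c) ℚ.* d) ⟩
  ℚ.∣ a ℚ.* (b ℚ.- d) ∣ ℚ.+ ℚ.∣ (a ℚ.- c) ℚ.* d ∣
    ≡⟨ cong₂ ℚ._+_ (ℚ.∣p*q∣≡∣p∣*∣q∣ a (b ℚ.- d)) (ℚ.∣p*q∣≡∣p∣*∣q∣ (a ℚ.- c) d) ⟩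
  ℚ.∣ a ∣ ℚ.* ℚ.∣ b ℚ.- d ∣ ℚ.+ ℚ.∣ a ℚ.- c ∣ ℚ.* ℚ.∣ d ∣
    ≤⟨ ℚ.+-mono-≤
         (ℚ.*-monoʳ-≤-nonNeg ℚ.∣ b ℚ.- d ∣ {{ℚ.∣-∣-nonNeg (b ℚ.- d)}} a≤B)
         (ℚ.*-monoˡ-≤-nonNeg ℚ.∣ a ℚ.- c ∣ {{ℚ.∣-∣-nonNeg (a ℚ.- c)}} d≤C) ⟩
  B ℚ.* ℚ.∣ b ℚ.- d ∣ ℚ.+ ℚ.∣ a ℚ.- c ∣ ℚ.* C
    <⟨ ℚ.+-mono-< (ℚ.*-monoʳ-<-pos B bd<δ) (ℚ.*-monoˡ-<-pos C ac<δ) ⟩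
  B ℚ.* δ ℚ.+ δ ℚ.* C ∎
  where
  open ℚ.≤-Reasoning

*-cauchy : ∀ x y → Cauchy x → Cauchy y → Cauchy (λ n → x n ℚ.* y n)
*-cauchy x y cx cy ε ε>0 =
  let B , B>0 , K , xK = eventually-bounded x cx
      C , C>0 , L , yL = eventually-bounded y cy
      δ , δ>0 , total  = split-tolerance B C {{B>0}} {{C>0}} ε ε>0
      M₁ , xM = cx δ δ>0
      M₂ , yM = cy δ δ>0
  in bound B C B>0 C>0 δ total K xK L yL M₁ xM M₂ yM
  where
  bound : ∀ B C → ℚ.Positive B → ℚ.Positive C →
    ∀ δ → B ℚ.* δ ℚ.+ δ ℚ.* C ≡ ε →
    ∀ K → (∀ n → K ℕ.≤ n → ℚ.∣ x n ∣ ℚ.≤ B) →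
    ∀ L → (∀ n → L ℕ.≤ n → ℚ.∣ y n ∣ ℚ.≤ C) →
    ∀ M₁ → (∀ m n → M₁ ℕ.≤ m → M₁ ℕ.≤ n → ℚ.∣ x m ℚ.- x n ∣ ℚ.< δ) →
    ∀ M₂ → (∀ m n → M₂ ℕ.≤ m → M₂ ℕ.≤ n → ℚ.∣ y m ℚ.- y n ∣ ℚ.< δ) →
    ∃ λ N → ∀ m n → N ℕ.≤ m → N ℕ.≤ n →
      ℚ.∣ x m ℚ.* y m ℚ.- x n ℚ.* y n ∣ ℚ.< ε
  bound B C B>0 C>0 δ total K xK L yL M₁ xM M₂ yM =
    (M₁ ℕ.⊔ M₂) ℕ.⊔ (K ℕ.⊔ L) , λ m n ≤m ≤n →
    let m≥M = ℕ.m⊔n≤o⇒m≤o (M₁ ℕ.⊔ M₂) (K ℕ.⊔ L) ≤m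
        n≥M = ℕ.m⊔n≤o⇒m≤o (M₁ ℕ.⊔ M₂) (K ℕ.⊔ L) ≤n
        m≥K = ℕ.m⊔n≤o⇒m≤o K L (ℕ.m⊔n≤o⇒n≤o (M₁ ℕ.⊔ M₂) (K ℕ.⊔ L) ≤m)
        n≥L = ℕ.m⊔n≤o⇒n≤o K L (ℕ.m⊔n≤o⇒n≤o (M₁ ℕ.⊔ M₂) (K ℕ.⊔ L) ≤n)
    in subst (ℚ.∣ x m ℚ.* y m ℚ.- x n ℚ.* y n ∣ ℚ.<_) total
         (product-bound B C {{B>0}} {{C>0}} δ (x m) (y m) (x n) (y n)
           (xK m m≥K) (yL n n≥L)
           (xM m n (ℕ.m⊔n≤o⇒m≤o M₁ M₂ m≥M) (ℕ.m⊔n≤o⇒m≤o M₁ M₂ n≥M))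
           (yM m n (ℕ.m⊔n≤o⇒n≤o M₁ M₂ m≥M) (ℕ.m⊔n≤o⇒n≤o M₁ M₂ n≥M)))

fromℚ : ℚ → ℝ
fromℚ q = mkℝ (λ _ → q) (fromℚ-cauchy q)

0ᴿ 1ᴿ : ℝ
0ᴿ = fromℚ 0ℚ
1ᴿ = fromℚ 1ℚ

infixl 6 _+ᴿ_ _-ᴿ_
infixl 7 _*ᴿ_
infix  8 -ᴿ_

-ᴿ_ : ℝ → ℝ
-ᴿ x = mkℝ (λ n → ℚ.- seq x n) (neg-cauchy (seq x) (cauchy x))

_+ᴿ_ _*ᴿ_ _-ᴿ_ : ℝ → ℝ → ℝ
x +ᴿ y = mkℝ (λ n → seq x n ℚ.+ seq y n)
  (+-cauchy (seq x) (seq y) (cauchy x) (cauchy y))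
x *ᴿ y = mkℝ (λ n → seq x n ℚ.* seq y n)
  (*-cauchy (seq x) (seq y) (cauchy x) (cauchy y))
x -ᴿ y = x +ᴿ (-ᴿ y)

ℝ-rawSemiring : RawSemiring 0ℓ 0ℓ
ℝ-rawSemiring = record
  { _≈_ = _≈ᴿ_ ; _+_ = _+ᴿ_ ; _*_ = _*ᴿ_ ; 0# = 0ᴿ ; 1# = 1ᴿ }

open RawSemiringDefinitions ℝ-rawSemiring public
  using () renaming (_^_ to _^ᴿ_)

IsMinimum : (ℝ → Set) → ℝ → Set
IsMinimum S s = S s × (∀ t → S t → s ≤ᴿ t)

_^ℤ_ : (b : ℕ) → .{{NonTrivial b}} → ℤ → ℚ
b ^ℤ (+ n)    = (+ (b ℕ.^ n)) / 1
b ^ℤ -[1+ n ] = _/_ (+ 1) (b ℕ.^ suc n) {{ℕ.m^n≢0 b (suc n) {{ℕ.nonTrivial⇒nonZero b}}}}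

-- y = bˣ for an integer b > 1 and real x: y is the positive real lying
-- above bʳ for every rational r < x and below bʳ for every rational r > x.
-- With r = p/q in lowest terms, the comparison of bʳ with y is that of bᵖ
-- with y^q.
IsPower : (b : ℕ) → .{{NonTrivial b}} → ℝ → ℝ → Set
IsPower b x y =
  0ᴿ <ᴿ y ×
  (∀ r → fromℚ r <ᴿ x → fromℚ (b ^ℤ (↥ r)) <ᴿ y ^ᴿ (↧ₙ r)) ×
  (∀ r → x <ᴿ fromℚ r → y ^ᴿ (↧ₙ r) <ᴿ fromℚ (b ^ℤ (↥ r)))

------------------------------------------------------------------------
-- Complex numbers

record ℂ : Set where
  constructor _+i_
  field
    re im : ℝ

open ℂ public

infix  4 _≈ᶜ_
infixl 6 _+ᶜ_ _-ᶜ_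
infixl 7 _*ᶜ_

_≈ᶜ_ : ℂ → ℂ → Set
z ≈ᶜ w = re z ≈ᴿ re w × im z ≈ᴿ im w

_+ᶜ_ _*ᶜ_ _-ᶜ_ : ℂ → ℂ → ℂ
z +ᶜ w = (re z +ᴿ re w) +i (im z +ᴿ im w)
z -ᶜ w = (re z -ᴿ re w) +i (im z -ᴿ im w)
z *ᶜ w = (re z *ᴿ re w -ᴿ im z *ᴿ im w) +i (re z *ᴿ im w +ᴿ im z *ᴿ re w)

fromℤᶜ : ℤ → ℂ
fromℤᶜ a = fromℚ (a / 1) +i 0ᴿ

ℂ-rawSemiring : RawSemiring 0ℓ 0ℓ
ℂ-rawSemiring = record
  { _≈_ = _≈ᶜ_ ; _+_ = _+ᶜ_ ; _*_ = _*ᶜ_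
  ; 0# = fromℤᶜ (+ 0) ; 1# = fromℤᶜ (+ 1) }

-- r = |z|
IsModulus : ℂ → ℝ → Set
IsModulus z r = 0ᴿ ≤ᴿ r × r *ᴿ r ≈ᴿ re z *ᴿ re z +ᴿ im z *ᴿ im z

------------------------------------------------------------------------
-- Polynomials, as lists of coefficients, constant term first. Trailing
-- zeros are allowed, so polynomials are compared coefficientwise.

module Polynomial {c ℓ} (R : RawSemiring c ℓ) where
  open RawSemiring R

  Poly : Set c
  Poly = List Carrier

  coeff : Poly → ℕ → Carrier
  coeff []      _       = 0#
  coeff (a ∷ p) zero    = a
  coeff (a ∷ p) (suc k) = coeff p k

  infix 4 _≋_
  _≋_ : Poly → Poly → Set ℓ
  p ≋ q = ∀ k → coeff p k ≈ coeff q k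

  HasDegree : Poly → ℕ → Set ℓ
  HasDegree p d = coeff p d ≉ 0# × (∀ k → d ℕ.< k → coeff p k ≈ 0#)

  Monic : Poly → ℕ → Set ℓ
  Monic p d = HasDegree p d × coeff p d ≈ 1#

  infixl 6 _⊕_
  _⊕_ : Poly → Poly → Poly
  []      ⊕ q       = q
  (a ∷ p) ⊕ []      = a ∷ p
  (a ∷ p) ⊕ (b ∷ q) = a + b ∷ p ⊕ q

  infixl 7 _⊛_
  _⊛_ : Poly → Poly → Poly
  []      ⊛ q = []
  (a ∷ p) ⊛ q = map (a *_) q ⊕ (0# ∷ p ⊛ q)

  eval : Poly → Carrier → Carrier
  eval p x = foldr (λ a v → a + x * v) 0# p

module ℤ[X] = Polynomial ℤ.+-*-rawSemiring
module ℚ[X] = Polynomial ℚ.+-*-rawSemiring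
module ℂ[X] = Polynomial ℂ-rawSemiring

height : ℤ[X].Poly → ℕ
height = foldr (λ a h → ℤ.∣ a ∣ ℕ.⊔ h) 0

ReducibleOverℚ : ℤ[X].Poly → Set
ReducibleOverℚ P = ∃₂ λ A B →
  (∃ λ a → 1 ℕ.≤ a × ℚ[X].HasDegree A a) ×
  (∃ λ b → 1 ℕ.≤ b × ℚ[X].HasDegree B b) ×
  map (_/ 1) P ℚ[X].≋ A ℚ[X].⊛ B

Root : ℤ[X].Poly → ℂ → Set
Root P α = ℂ[X].eval (map fromℤᶜ P) α ≈ᶜ fromℤᶜ (+ 0)

HasDistinctRoots : ℤ[X].Poly → Set
HasDistinctRoots P = ∃₂ λ α β → Root P α × Root P β × ¬ (α ≈ᶜ β)

RootDistance : ℤ[X].Poly → ℝ → Set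
RootDistance P t = ∃₂ λ α β →
  Root P α × Root P β × ¬ (α ≈ᶜ β) × IsModulus (α -ᶜ β) t

-- s = sep(P)
IsSep : ℤ[X].Poly → ℝ → Set
IsSep P = IsMinimum (RootDistance P)

-- e = e(P), that is, H(P) > 1 and sep(P) = H(P)⁻ᵉ
IsExponent : ℤ[X].Poly → ℝ → Set
IsExponent P e = Σ (NonTrivial (height P)) λ H>1 →
  ∃ λ s → IsSep P s × IsPower (height P) {{H>1}} (-ᴿ e) s

------------------------------------------------------------------------
-- Suprema and limits superior in [-∞, +∞]

-- An extended real is presented by a set of rationals of which it is the
-- infimum; the empty set presents +∞. Every family of reals then has a
-- supremum, presented by its rational upper bounds, without the omniscience
-- needed to approximate that supremum by rationals.
ExtendedReal : Set₁
ExtendedReal = ℚ → Set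

infix 4 _≤ᴱ_ _ᴱ≤_

_≤ᴱ_ : ℚ → ExtendedReal → Set
c ≤ᴱ E = ∀ q → E q → c ℚ.≤ q

_ᴱ≤_ : ExtendedReal → ℚ → Set
E ᴱ≤ c = ∀ q → c ℚ.< q → ∃ λ q′ → E q′ × q′ ℚ.≤ q

supremum : (ℝ → Set) → ExtendedReal
supremum S q = ∀ x → S x → x ≤ᴿ fromℚ q

-- The limit of a non-increasing sequence is its infimum.
limit-nonincreasing : (ℕ → ExtendedReal) → ExtendedReal
limit-nonincreasing E q = ∃ λ H → E H q

ExponentsFrom : (d H : ℕ) → ℝ → Set
ExponentsFrom d H e = ∃ λ P →
  ℤ[X].Monic P d × ReducibleOverℚ P × HasDistinctRoots P ×
  H ℕ.≤ height P × IsExponent P e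

e*ᵣ : ℕ → ExtendedReal
e*ᵣ d = limit-nonincreasing λ H → supremum (ExponentsFrom d H)

{- Lower bounds. For d = 2k + 1 let G = x² − mᵏ x − m and F = x^(2k−1) + m x^(2k−3) + … + m^(k−1) x + 1.
   Since F · (x² − m) = x^d + G, the real root of F near −m^(1−k) almost annihilates G, and lies within
   2 m^(1−2k²) of a root of G. The height of F G is of the order of m^(2k−1), and (2k² − 1) / (2k − 1)
   is 7/3, 17/5, 31/7 for k = 2, 3, 4.

   Upper bounds. Let δ be the distance of two roots of P, and f, g their monic minimal polynomials. These
   divide P, are integral by Gauss' lemma, and their heights have product O(H(P)) by Gelfond's inequality.
   If f ≠ g, the determinant of the Bezoutian of f and g is a nonzero integer; replacing a column by the
   combination of all columns with the powers of a root as coefficients shows that it is O(δ H^(d−2)).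
   If f = g, the degree of f is less than d by reducibility, and the discriminant gives
   1 = O(δ² H^(2d−4)). In both cases δ is at least a constant times H^(2−d).

   Real numbers being Cauchy sequences, the estimates are made for Gaussian rationals approximating the
   roots, with determinants expanded in an exterior algebra. All inequalities to be proved are negative or
   decidable, so that case distinctions about real numbers, in particular the existence of a minimal
   distance between the roots, are needed only under a double negation. -}

{-# OPTIONS --safe #-}
module Submission where

open import Defs
open import Data.Empty using (⊥; ⊥-elim)
open import Data.Nat.Base as ℕ using (ℕ; zero; suc; z≤n; s≤s)
import Data.Nat.Properties as ℕ
open import Data.Product using (Σ; ∃; _×_; _,_; proj₁; proj₂)
open import Data.Rational.Base using (ℚ; 0ℚ; 1ℚ; ½)
import Data.Rational.Properties as ℚ
open import Data.Sum using (_⊎_; inj₁; inj₂)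
open import Function.Base using (_∘_)
open import Relation.Binary.PropositionalEquality
open import Relation.Nullary using (¬_; yes; no; Dec)

-- The obstacle to a uniform upper bound is that roots may be as large as `H`, while every estimate
-- at a root `z` brings in powers of `z`. Three things keep the exponent at `d − 2`. The
-- coefficients of `f(x) / (x − z)` are `O(H)` however large `z` is. Replacing row `p` of the
-- Bezoutian multiplies its determinant by `z^p`, and `p` may be chosen: `p = 0` for small `z`, a
-- higher power for large `z`, which balances the growth of the replaced row. Finally, factors are
-- counted: with `f` of the larger degree `a`, the Bezoutian has `a` rows of size `O(FG)`, and
-- `a ≤ d − 2` unless `g` is linear, when `f` is evaluated at the integer root of `g` instead; in
-- the discriminant the last row and column are only linear in the coefficients of the monic `f`,
-- which saves a factor `F²`. Constants are never optimised: a rational exponent strictly off the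
-- bound leaves a spare power, of the height or of `m`, that outweighs them in the end.

-- Ordered-field arithmetic of the rationals and of the integers in them

module Rationals where
  open import Level using (0ℓ)
  open import Data.Integer.Base as ℤ using (ℤ; +_; -[1+_])
  import Data.Integer.Properties as ℤ
  open import Data.Rational.Base using (_/_; ↥_; ↧ₙ_; _+_; _*_; _-_; -_; ∣_∣; _≤_; _<_; *≤*; 1/_; mkℚ; positive; nonNegative; toℚᵘ)
  import Data.Rational.Unnormalised.Base as ℚᵘ
  import Data.Rational.Unnormalised.Properties as ℚᵘ
  open import Algebra.Definitions.RawSemiring ℚ.+-*-rawSemiring using (_^_) public
  open import Relation.Nullary.Decidable.Core using (dec⇒maybe)
  open import Tactic.RingSolver using (solve-∀)
  open import Tactic.RingSolver.Core.AlmostCommutativeRing using (AlmostCommutativeRing; fromCommutativeRing)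

  ℚ-ring : AlmostCommutativeRing 0ℓ 0ℓ
  ℚ-ring = fromCommutativeRing ℚ.+-*-commutativeRing λ x → dec⇒maybe (0ℚ ℚ.≟ x)

  0≤1 : 0ℚ ≤ 1ℚ
  0≤1 = ℚ.nonNegative⁻¹ 1ℚ

  0<1 : 0ℚ < 1ℚ
  0<1 = ℚ.positive⁻¹ 1ℚ

  +-nonNeg : ∀ {a b} → 0ℚ ≤ a → 0ℚ ≤ b → 0ℚ ≤ a + b
  +-nonNeg = ℚ.+-mono-≤

  +-pos-nonNeg : ∀ {a b} → 0ℚ < a → 0ℚ ≤ b → 0ℚ < a + b
  +-pos-nonNeg = ℚ.+-mono-<-≤

  ≤-+ʳ : ∀ {a b} → 0ℚ ≤ b → a ≤ a + b
  ≤-+ʳ {a} {b} 0≤b = subst (_≤ a + b) (ℚ.+-identityʳ a) (ℚ.+-monoʳ-≤ a 0≤b)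

  ≤-+ˡ : ∀ {a b} → 0ℚ ≤ b → a ≤ b + a
  ≤-+ˡ {a} {b} 0≤b = subst (_≤ b + a) (ℚ.+-identityˡ a) (ℚ.+-monoˡ-≤ a 0≤b)

  *-monoʳ : ∀ {a b c} → 0ℚ ≤ c → a ≤ b → c * a ≤ c * b
  *-monoʳ {c = c} 0≤c = ℚ.*-monoˡ-≤-nonNeg c {{nonNegative 0≤c}}

  *-monoˡ : ∀ {a b c} → 0ℚ ≤ c → a ≤ b → a * c ≤ b * c
  *-monoˡ {c = c} 0≤c = ℚ.*-monoʳ-≤-nonNeg c {{nonNegative 0≤c}}

  *-mono : ∀ {a b c d} → 0ℚ ≤ c → 0ℚ ≤ b → a ≤ b → c ≤ d → a * c ≤ b * d
  *-mono 0≤c 0≤b a≤b c≤d = ℚ.≤-trans (*-monoˡ 0≤c a≤b) (*-monoʳ 0≤b c≤d)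

  *-mono<ʳ : ∀ {a b c} → 0ℚ < c → a < b → c * a < c * b
  *-mono<ʳ {c = c} 0<c = ℚ.*-monoʳ-<-pos c {{positive 0<c}}

  *-mono<ˡ : ∀ {a b c} → 0ℚ < c → a < b → a * c < b * c
  *-mono<ˡ {c = c} 0<c = ℚ.*-monoˡ-<-pos c {{positive 0<c}}

  *-cancel≤ʳ : ∀ {a b c} → 0ℚ < c → c * a ≤ c * b → a ≤ b
  *-cancel≤ʳ {c = c} 0<c = ℚ.*-cancelˡ-≤-pos c {{positive 0<c}}

  *-cancel<ʳ : ∀ {a b c} → 0ℚ ≤ c → c * a < c * b → a < b
  *-cancel<ʳ {c = c} 0≤c = ℚ.*-cancelˡ-<-nonNeg c {{nonNegative 0≤c}}

  *-nonNeg : ∀ {a b} → 0ℚ ≤ a → 0ℚ ≤ b → 0ℚ ≤ a * b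
  *-nonNeg {a} {b} 0≤a 0≤b = subst (_≤ a * b) (ℚ.*-zeroʳ a) (*-monoʳ 0≤a 0≤b)

  *-pos : ∀ {a b} → 0ℚ < a → 0ℚ < b → 0ℚ < a * b
  *-pos {a} {b} 0<a 0<b = subst (_< a * b) (ℚ.*-zeroʳ a) (*-mono<ʳ 0<a 0<b)

  ≤-*ʳ : ∀ {a b} → 0ℚ ≤ a → 1ℚ ≤ b → a ≤ a * b
  ≤-*ʳ {a} {b} 0≤a 1≤b = subst (_≤ a * b) (ℚ.*-identityʳ a) (*-monoʳ 0≤a 1≤b)

  ≤-*ˡ : ∀ {a b} → 0ℚ ≤ a → 1ℚ ≤ b → a ≤ b * a
  ≤-*ˡ {a} {b} 0≤a 1≤b = subst (_≤ b * a) (ℚ.*-identityˡ a) (*-monoˡ 0≤a 1≤b)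

  neg*neg : ∀ a → - a * - a ≡ a * a
  neg*neg = solve-∀ ℚ-ring

  square-nonNeg : ∀ a → 0ℚ ≤ a * a
  square-nonNeg a = subst (0ℚ ≤_)
    (trans (sym (ℚ.∣p*q∣≡∣p∣*∣q∣ a a)) (lemma (ℚ.≤-total 0ℚ a)))
    (*-nonNeg (ℚ.0≤∣p∣ a) (ℚ.0≤∣p∣ a))
    where
    lemma : _ → ∣ a * a ∣ ≡ a * a
    lemma (inj₁ 0≤a) = ℚ.0≤p⇒∣p∣≡p (*-nonNeg 0≤a 0≤a)
    lemma (inj₂ a≤0) = ℚ.0≤p⇒∣p∣≡p
      (subst (0ℚ ≤_) (neg*neg a) (*-nonNeg (ℚ.neg-antimono-≤ a≤0) (ℚ.neg-antimono-≤ a≤0)))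

  recover : ∀ a b → a + (b - a) ≡ b
  recover = solve-∀ ℚ-ring

  ≤-by-difference : ∀ {a b} → 0ℚ ≤ b - a → a ≤ b
  ≤-by-difference {a} {b} h = subst (a ≤_) (recover a b) (≤-+ʳ {a} h)

  difference-nonNeg : ∀ {a b} → a ≤ b → 0ℚ ≤ b - a
  difference-nonNeg {a} {b} h = subst (_≤ b - a) (ℚ.+-inverseʳ a) (ℚ.+-monoˡ-≤ (- a) h)

  difference-pos : ∀ {a b} → a < b → 0ℚ < b - a
  difference-pos {a} {b} h = subst (_< b - a) (ℚ.+-inverseʳ a) (ℚ.+-monoˡ-< (- a) h)

  <-by-difference : ∀ {a b} → 0ℚ < b - a → a < b
  <-by-difference {a} {b} h =
    subst₂ _<_ (ℚ.+-identityʳ a) (recover a b) (ℚ.+-monoʳ-< a h)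

  p≤∣p∣ : ∀ p → p ≤ ∣ p ∣
  p≤∣p∣ p with ℚ.≤-total 0ℚ p
  ... | inj₁ 0≤p = ℚ.≤-reflexive (sym (ℚ.0≤p⇒∣p∣≡p 0≤p))
  ... | inj₂ p≤0 = ℚ.≤-trans p≤0 (ℚ.0≤∣p∣ p)

  -p≤∣p∣ : ∀ p → - p ≤ ∣ p ∣
  -p≤∣p∣ p = subst (- p ≤_) (ℚ.∣-p∣≡∣p∣ p) (p≤∣p∣ (- p))

  ∣p∣≤ : ∀ {p r} → p ≤ r → - p ≤ r → ∣ p ∣ ≤ r
  ∣p∣≤ {p} h₁ h₂ with ℚ.∣p∣≡p∨∣p∣≡-p p
  ... | inj₁ e = ℚ.≤-trans (ℚ.≤-reflexive e) h₁
  ... | inj₂ e = ℚ.≤-trans (ℚ.≤-reflexive e) h₂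

  ∣p-q∣≡∣q-p∣ : ∀ p q → ∣ p - q ∣ ≡ ∣ q - p ∣
  ∣p-q∣≡∣q-p∣ p q = trans (sym (ℚ.∣-p∣≡∣p∣ (p - q))) (cong ∣_∣ (negated p q))
    where
    negated : ∀ p q → - (p - q) ≡ q - p
    negated = solve-∀ ℚ-ring

  ∣p∣*∣p∣≡p*p : ∀ p → ∣ p ∣ * ∣ p ∣ ≡ p * p
  ∣p∣*∣p∣≡p*p p = trans (sym (ℚ.∣p*q∣≡∣p∣*∣q∣ p p)) (ℚ.0≤p⇒∣p∣≡p (square-nonNeg p))

  square-cancel-≤ : ∀ {a b} → 0ℚ ≤ b → a * a ≤ b * b → a ≤ b
  square-cancel-≤ {a} {b} 0≤b h with a ℚ.≤? b
  ... | yes a≤b = a≤b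
  ... | no  a≰b = ⊥-elim (ℚ.<-irrefl refl (ℚ.<-≤-trans
          (ℚ.≤-<-trans (*-monoʳ 0≤b (ℚ.<⇒≤ b<a)) (*-mono<ˡ (ℚ.≤-<-trans 0≤b b<a) b<a)) h))
    where b<a = ℚ.≰⇒> a≰b

  square-cancel-< : ∀ {a b} → 0ℚ ≤ b → a * a < b * b → a < b
  square-cancel-< {a} {b} 0≤b h with a ℚ.<? b
  ... | yes a<b = a<b
  ... | no  a≮b = ⊥-elim (ℚ.<-irrefl refl (ℚ.<-≤-trans h
          (*-mono 0≤b (ℚ.≤-trans 0≤b b≤a) b≤a b≤a)))
    where b≤a = ℚ.≮⇒≥ a≮b

  ^-nonNeg : ∀ {a} n → 0ℚ ≤ a → 0ℚ ≤ a ^ n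
  ^-nonNeg zero    h = 0≤1
  ^-nonNeg (suc n) h = *-nonNeg h (^-nonNeg n h)

  ^-pos : ∀ {a} n → 0ℚ < a → 0ℚ < a ^ n
  ^-pos zero    h = 0<1
  ^-pos (suc n) h = *-pos h (^-pos n h)

  1≤^ : ∀ {a} n → 1ℚ ≤ a → 1ℚ ≤ a ^ n
  1≤^ zero    h = ℚ.≤-refl
  1≤^ {a} (suc n) h = ℚ.≤-trans h (≤-*ʳ (ℚ.≤-trans 0≤1 h) (1≤^ n h))

  ^-mono : ∀ {a b} n → 0ℚ ≤ a → a ≤ b → a ^ n ≤ b ^ n
  ^-mono zero    0≤a a≤b = ℚ.≤-refl
  ^-mono (suc n) 0≤a a≤b =
    *-mono (^-nonNeg n 0≤a) (ℚ.≤-trans 0≤a a≤b) a≤b (^-mono n 0≤a a≤b)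

  ^-mono< : ∀ {a b} n → 0ℚ ≤ a → a < b → a ^ suc n < b ^ suc n
  ^-mono< {a} {b} n 0≤a a<b = ℚ.≤-<-trans (*-monoʳ 0≤a (^-mono n 0≤a (ℚ.<⇒≤ a<b)))
    (*-mono<ˡ (^-pos n (ℚ.≤-<-trans 0≤a a<b)) a<b)

  ^-cancel< : ∀ {a b} n → 0ℚ ≤ b → a ^ n < b ^ n → a < b
  ^-cancel< {a} {b} n 0≤b h with a ℚ.<? b
  ... | yes a<b = a<b
  ... | no  a≮b = ⊥-elim (ℚ.<-irrefl refl (ℚ.<-≤-trans h (^-mono n 0≤b (ℚ.≮⇒≥ a≮b))))

  ^-+ : ∀ a m n → a ^ (m ℕ.+ n) ≡ a ^ m * a ^ n
  ^-+ a zero    n = sym (ℚ.*-identityˡ _)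
  ^-+ a (suc m) n = trans (cong (a *_) (^-+ a m n)) (sym (ℚ.*-assoc a (a ^ m) (a ^ n)))

  ^-distrib-* : ∀ a b n → (a * b) ^ n ≡ a ^ n * b ^ n
  ^-distrib-* a b zero    = refl
  ^-distrib-* a b (suc n) = trans (cong (a * b *_) (^-distrib-* a b n)) (lemma a b (a ^ n) (b ^ n))
    where
    lemma : ∀ a b c d → a * b * (c * d) ≡ a * c * (b * d)
    lemma = solve-∀ ℚ-ring

  1^n≡1 : ∀ n → 1ℚ ^ n ≡ 1ℚ
  1^n≡1 zero    = refl
  1^n≡1 (suc n) = trans (ℚ.*-identityˡ _) (1^n≡1 n)

  ^-* : ∀ a m n → a ^ (m ℕ.* n) ≡ (a ^ m) ^ n
  ^-* a m zero    = cong (a ^_) (ℕ.*-zeroʳ m)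
  ^-* a m (suc n) = trans (cong (a ^_) (ℕ.*-suc m n))
    (trans (^-+ a m (m ℕ.* n)) (cong (a ^ m *_) (^-* a m n)))

  ^-monoʳ : ∀ {a m n} → 1ℚ ≤ a → m ℕ.≤ n → a ^ m ≤ a ^ n
  ^-monoʳ {a} {m} {n} 1≤a m≤n = subst (λ k → a ^ m ≤ a ^ k) (ℕ.m+[n∸m]≡n m≤n)
    (subst (a ^ m ≤_) (sym (^-+ a m (n ℕ.∸ m)))
      (≤-*ʳ (^-nonNeg m (ℚ.≤-trans 0≤1 1≤a)) (1≤^ (n ℕ.∸ m) 1≤a)))

  fromℤ : ℤ → ℚ
  fromℤ a = a / 1

  toℚᵘ-fromℤ : ∀ a → toℚᵘ (fromℤ a) ℚᵘ.≃ ℚᵘ.mkℚᵘ a 0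
  toℚᵘ-fromℤ a = ℚ.toℚᵘ-fromℚᵘ (ℚᵘ.mkℚᵘ a 0)

  fromℤ-+ : ∀ a b → fromℤ (a ℤ.+ b) ≡ fromℤ a + fromℤ b
  fromℤ-+ a b = ℚ.toℚᵘ-injective (begin
    toℚᵘ (fromℤ (a ℤ.+ b))                  ≈⟨ toℚᵘ-fromℤ (a ℤ.+ b) ⟩
    ℚᵘ.mkℚᵘ (a ℤ.+ b) 0                     ≈⟨ ℚᵘ.≃-reflexive (cong₂ (λ x y → ℚᵘ.mkℚᵘ (x ℤ.+ y) 0) (sym (ℤ.*-identityʳ a)) (sym (ℤ.*-identityʳ b))) ⟩
    ℚᵘ.mkℚᵘ a 0 ℚᵘ.+ ℚᵘ.mkℚᵘ b 0            ≈⟨ ℚᵘ.+-cong (ℚᵘ.≃-sym (toℚᵘ-fromℤ a)) (ℚᵘ.≃-sym (toℚᵘ-fromℤ b)) ⟩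
    toℚᵘ (fromℤ a) ℚᵘ.+ toℚᵘ (fromℤ b)      ≈⟨ ℚᵘ.≃-sym (ℚ.toℚᵘ-homo-+ (fromℤ a) (fromℤ b)) ⟩
    toℚᵘ (fromℤ a + fromℤ b)  ∎)
    where open ℚᵘ.≃-Reasoning

  fromℤ-* : ∀ a b → fromℤ (a ℤ.* b) ≡ fromℤ a * fromℤ b
  fromℤ-* a b = ℚ.toℚᵘ-injective (begin
    toℚᵘ (fromℤ (a ℤ.* b))                  ≈⟨ toℚᵘ-fromℤ (a ℤ.* b) ⟩
    ℚᵘ.mkℚᵘ a 0 ℚᵘ.* ℚᵘ.mkℚᵘ b 0            ≈⟨ ℚᵘ.*-cong (ℚᵘ.≃-sym (toℚᵘ-fromℤ a)) (ℚᵘ.≃-sym (toℚᵘ-fromℤ b)) ⟩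
    toℚᵘ (fromℤ a) ℚᵘ.* toℚᵘ (fromℤ b)      ≈⟨ ℚᵘ.≃-sym (ℚ.toℚᵘ-homo-* (fromℤ a) (fromℤ b)) ⟩
    toℚᵘ (fromℤ a * fromℤ b)  ∎)
    where open ℚᵘ.≃-Reasoning

  fromℤ-neg : ∀ a → fromℤ (ℤ.- a) ≡ - fromℤ a
  fromℤ-neg a = begin
    fromℤ (ℤ.- a)  ≡⟨ sym (ℚ.+-identityʳ _) ⟩
    fromℤ (ℤ.- a) + 0ℚ  ≡⟨ cong (λ z → fromℤ (ℤ.- a) + z) (sym (ℚ.+-inverseʳ (fromℤ a))) ⟩
    fromℤ (ℤ.- a) + (fromℤ a - fromℤ a)  ≡⟨ sym (ℚ.+-assoc (fromℤ (ℤ.- a)) (fromℤ a) (- fromℤ a)) ⟩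
    fromℤ (ℤ.- a) + fromℤ a - fromℤ a  ≡⟨ cong (_- fromℤ a) (trans (sym (fromℤ-+ (ℤ.- a) a)) (cong fromℤ (ℤ.+-inverseˡ a))) ⟩
    0ℚ - fromℤ a  ≡⟨ ℚ.+-identityˡ _ ⟩
    - fromℤ a  ∎
    where open ≡-Reasoning

  fromℤ-mono : ∀ {a b} → a ℤ.≤ b → fromℤ a ≤ fromℤ b
  fromℤ-mono {a} {b} a≤b = ℚ.toℚᵘ-cancel-≤
    (ℚᵘ.≤-respˡ-≃ (ℚᵘ.≃-sym (toℚᵘ-fromℤ a)) (ℚᵘ.≤-respʳ-≃ (ℚᵘ.≃-sym (toℚᵘ-fromℤ b))
      (ℚᵘ.*≤* (subst₂ ℤ._≤_ (sym (ℤ.*-identityʳ a)) (sym (ℤ.*-identityʳ b)) a≤b))))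

  fromℤ-cancel : ∀ {a b} → fromℤ a ≤ fromℤ b → a ℤ.≤ b
  fromℤ-cancel {a} {b} h = subst₂ ℤ._≤_ (ℤ.*-identityʳ a) (ℤ.*-identityʳ b)
    (ℚᵘ.drop-*≤* (ℚᵘ.≤-respˡ-≃ (toℚᵘ-fromℤ a) (ℚᵘ.≤-respʳ-≃ (toℚᵘ-fromℤ b) (ℚ.toℚᵘ-mono-≤ h))))

  fromℤ-injective : ∀ {a b} → fromℤ a ≡ fromℤ b → a ≡ b
  fromℤ-injective e = ℤ.≤-antisym (fromℤ-cancel (ℚ.≤-reflexive e)) (fromℤ-cancel (ℚ.≤-reflexive (sym e)))

  fromℕ : ℕ → ℚ
  fromℕ n = fromℤ (+ n)

  fromℕ-+ : ∀ m n → fromℕ (m ℕ.+ n) ≡ fromℕ m + fromℕ n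
  fromℕ-+ m n = fromℤ-+ (+ m) (+ n)

  fromℕ-* : ∀ m n → fromℕ (m ℕ.* n) ≡ fromℕ m * fromℕ n
  fromℕ-* m n = trans (cong fromℤ (ℤ.pos-* m n)) (fromℤ-* (+ m) (+ n))

  fromℕ-^ : ∀ m n → fromℕ (m ℕ.^ n) ≡ fromℕ m ^ n
  fromℕ-^ m zero    = refl
  fromℕ-^ m (suc n) = trans (fromℕ-* m (m ℕ.^ n)) (cong (fromℕ m *_) (fromℕ-^ m n))

  fromℕ-mono : ∀ {m n} → m ℕ.≤ n → fromℕ m ≤ fromℕ n
  fromℕ-mono m≤n = fromℤ-mono (ℤ.+≤+ m≤n)

  fromℕ-mono< : ∀ {m n} → m ℕ.< n → fromℕ m < fromℕ n
  fromℕ-mono< {m} {n} m<n = ℚ.≰⇒> λ h → ℕ.<⇒≱ m<n (ℤ.drop‿+≤+ (fromℤ-cancel h))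

  fromℕ-cancel< : ∀ {m n} → fromℕ m < fromℕ n → m ℕ.< n
  fromℕ-cancel< {m} {n} h = ℕ.≰⇒> λ n≤m → ℚ.<-irrefl refl (ℚ.<-≤-trans h (fromℕ-mono n≤m))

  fromℕ-nonNeg : ∀ n → 0ℚ ≤ fromℕ n
  fromℕ-nonNeg n = fromℕ-mono {0} {n} ℕ.z≤n

  1≤fromℕ : ∀ {n} → 1 ℕ.≤ n → 1ℚ ≤ fromℕ n
  1≤fromℕ = fromℕ-mono

  ∣fromℤ∣ : ∀ a → ∣ fromℤ a ∣ ≡ fromℕ ℤ.∣ a ∣
  ∣fromℤ∣ (+ n)    = ℚ.0≤p⇒∣p∣≡p (fromℕ-nonNeg n)
  ∣fromℤ∣ -[1+ n ] = trans (cong ∣_∣ (fromℤ-neg (+ suc n)))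
    (trans (ℚ.∣-p∣≡∣p∣ (fromℕ (suc n))) (ℚ.0≤p⇒∣p∣≡p (fromℕ-nonNeg (suc n))))

  numerator/denominator : ∀ q → q * fromℕ (↧ₙ q) ≡ fromℤ (↥ q)
  numerator/denominator q@(mkℚ n d _) = ℚ.toℚᵘ-injective (begin
    toℚᵘ (q * fromℕ (↧ₙ q))             ≈⟨ ℚ.toℚᵘ-homo-* q (fromℕ (↧ₙ q)) ⟩
    toℚᵘ q ℚᵘ.* toℚᵘ (fromℕ (↧ₙ q))     ≈⟨ ℚᵘ.*-congˡ {toℚᵘ q} (toℚᵘ-fromℤ (+ ↧ₙ q)) ⟩
    toℚᵘ q ℚᵘ.* ℚᵘ.mkℚᵘ (+ ↧ₙ q) 0      ≈⟨ lemma ⟩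
    ℚᵘ.mkℚᵘ (↥ q) 0                     ≈⟨ ℚᵘ.≃-sym (toℚᵘ-fromℤ (↥ q)) ⟩
    toℚᵘ (fromℤ (↥ q))  ∎)
    where
    open ℚᵘ.≃-Reasoning
    lemma : toℚᵘ q ℚᵘ.* ℚᵘ.mkℚᵘ (+ ↧ₙ q) 0 ℚᵘ.≃ ℚᵘ.mkℚᵘ (↥ q) 0
    lemma = ℚᵘ.*≡* (trans (ℤ.*-identityʳ (n ℤ.* + suc d))
      (cong (λ k → n ℤ.* (+ suc k)) (sym (ℕ.*-identityʳ d))))

  1≤denominator : ∀ q → 1 ℕ.≤ ↧ₙ q
  1≤denominator (mkℚ _ _ _) = ℕ.s≤s ℕ.z≤n

  archimedean : ∀ q → ∃ λ n → q ≤ fromℕ n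
  archimedean q = ℤ.∣ ↥ q ∣ , ℚ.≤-trans (p≤∣p∣ q)
    (ℚ.≤-trans (≤-*ʳ (ℚ.0≤∣p∣ q) (1≤fromℕ (1≤denominator q)))
      (ℚ.≤-reflexive (begin
        ∣ q ∣ * fromℕ (↧ₙ q)  ≡⟨ cong (∣ q ∣ *_) (sym (ℚ.0≤p⇒∣p∣≡p (fromℕ-nonNeg (↧ₙ q)))) ⟩
        ∣ q ∣ * ∣ fromℕ (↧ₙ q) ∣  ≡⟨ sym (ℚ.∣p*q∣≡∣p∣*∣q∣ q _) ⟩
        ∣ q * fromℕ (↧ₙ q) ∣  ≡⟨ cong ∣_∣ (numerator/denominator q) ⟩
        ∣ fromℤ (↥ q) ∣  ≡⟨ ∣fromℤ∣ (↥ q) ⟩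
        fromℕ ℤ.∣ ↥ q ∣  ∎)))
    where open ≡-Reasoning

  inverse : ∀ {q} → 0ℚ < q → ∃ λ r → 0ℚ < r × q * r ≡ 1ℚ
  inverse {q} 0<q = (1/ q) {{nz}} , ℚ.positive⁻¹ _ {{ℚ.1/pos⇒pos q {{positive 0<q}}}} , ℚ.*-inverseʳ q {{nz}}
    where nz = ℚ.pos⇒nonZero q {{positive 0<q}}

  -- The value `ε / (∣ K ∣ + 1)` serves whatever the sign of `K`. Tolerances below are chosen in
  -- this way.
  shrink : ∀ K ε → 0ℚ < ε → ∃ λ η → 0ℚ < η × K * η ≤ ε
  shrink K ε 0<ε with inverse {∣ K ∣ + 1ℚ} (ℚ.+-mono-≤-< (ℚ.0≤∣p∣ K) 0<1)
  ... | r , 0<r , e = ε * r , *-pos 0<ε 0<r , ℚ.≤-trans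
    (*-monoˡ (ℚ.<⇒≤ (*-pos 0<ε 0<r)) (ℚ.≤-trans (p≤∣p∣ K) (≤-+ʳ 0≤1)))
    (ℚ.≤-reflexive (trans (lemma (∣ K ∣ + 1ℚ) ε r) (trans (cong (ε *_) e) (ℚ.*-identityʳ ε))))
    where
    lemma : ∀ a b c → a * (b * c) ≡ b * (a * c)
    lemma = solve-∀ ℚ-ring

-- Gaussian rationals and their norm

module Gaussian where
  open import Level using (0ℓ)
  open import Algebra.Bundles using (CommutativeRing; RawSemiring)
  open import Data.Maybe.Base using (Maybe; just; nothing)
  open import Data.Rational.Base using (_+_; _*_; _-_; -_; ∣_∣; _≤_; _<_)
  open import Relation.Binary.PropositionalEquality.Properties using (isEquivalence)
  open import Tactic.RingSolver using (solve-∀)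
  open import Tactic.RingSolver.Core.AlmostCommutativeRing using (AlmostCommutativeRing; fromCommutativeRing)
  open Rationals

  -- Without eta, the operations, which match on both components, stay folded when applied to
  -- variables; equations are then solved in `𝔾` as a ring instead of componentwise.
  record 𝔾 : Set where
    no-eta-equality
    pattern
    constructor _⊹_
    field
      Re Im : ℚ
  open 𝔾 public

  infixl 6 _+ᵍ_ _-ᵍ_
  infixl 7 _*ᵍ_
  infix  8 -ᵍ_

  0ᵍ 1ᵍ : 𝔾
  0ᵍ = 0ℚ ⊹ 0ℚ
  1ᵍ = 1ℚ ⊹ 0ℚ

  -ᵍ_ : 𝔾 → 𝔾
  -ᵍ_ (a ⊹ b) = (- a) ⊹ (- b)

  _+ᵍ_ _*ᵍ_ _-ᵍ_ : 𝔾 → 𝔾 → 𝔾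
  (a ⊹ b) +ᵍ (c ⊹ d) = (a + c) ⊹ (b + d)
  (a ⊹ b) *ᵍ (c ⊹ d) = (a * c - b * d) ⊹ (a * d + b * c)
  z -ᵍ w = z +ᵍ -ᵍ w

  private
    *-assoc-re : ∀ a b c d e f → (a * c - b * d) * e - (a * d + b * c) * f ≡ a * (c * e - d * f) - b * (c * f + d * e)
    *-assoc-re = solve-∀ ℚ-ring
    *-assoc-im : ∀ a b c d e f → (a * c - b * d) * f + (a * d + b * c) * e ≡ a * (c * f + d * e) + b * (c * e - d * f)
    *-assoc-im = solve-∀ ℚ-ring
    *-comm-re : ∀ a b c d → a * c - b * d ≡ c * a - d * b
    *-comm-re = solve-∀ ℚ-ring
    *-comm-im : ∀ a b c d → a * d + b * c ≡ c * b + d * a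
    *-comm-im = solve-∀ ℚ-ring
    *-id-re : ∀ a b → 1ℚ * a - 0ℚ * b ≡ a
    *-id-re = solve-∀ ℚ-ring
    *-id-im : ∀ a b → 1ℚ * b + 0ℚ * a ≡ b
    *-id-im = solve-∀ ℚ-ring
    distrib-re : ∀ a b c d e f → a * (c + e) - b * (d + f) ≡ (a * c - b * d) + (a * e - b * f)
    distrib-re = solve-∀ ℚ-ring
    distrib-im : ∀ a b c d e f → a * (d + f) + b * (c + e) ≡ (a * d + b * c) + (a * f + b * e)
    distrib-im = solve-∀ ℚ-ring

  𝔾-commutativeRing : CommutativeRing 0ℓ 0ℓ
  𝔾-commutativeRing = record
    { Carrier = 𝔾 ; _≈_ = _≡_ ; _+_ = _+ᵍ_ ; _*_ = _*ᵍ_ ; -_ = λ z → -ᵍ z ; 0# = 0ᵍ ; 1# = 1ᵍ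
    ; isCommutativeRing = record
      { isRing = record
        { +-isAbelianGroup = record
          { isGroup = record
            { isMonoid = record
              { isSemigroup = record
                { isMagma = record { isEquivalence = isEquivalence ; ∙-cong = cong₂ _+ᵍ_ }
                ; assoc = λ { (a ⊹ b) (c ⊹ d) (e ⊹ f) → cong₂ _⊹_ (ℚ.+-assoc a c e) (ℚ.+-assoc b d f) } }
              ; identity = (λ { (a ⊹ b) → cong₂ _⊹_ (ℚ.+-identityˡ a) (ℚ.+-identityˡ b) })
                         , (λ { (a ⊹ b) → cong₂ _⊹_ (ℚ.+-identityʳ a) (ℚ.+-identityʳ b) }) }
            ; inverse = (λ { (a ⊹ b) → cong₂ _⊹_ (ℚ.+-inverseˡ a) (ℚ.+-inverseˡ b) })
                      , (λ { (a ⊹ b) → cong₂ _⊹_ (ℚ.+-inverseʳ a) (ℚ.+-inverseʳ b) })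
            ; ⁻¹-cong = cong (λ z → -ᵍ z) }
          ; comm = λ { (a ⊹ b) (c ⊹ d) → cong₂ _⊹_ (ℚ.+-comm a c) (ℚ.+-comm b d) } }
        ; *-cong = cong₂ _*ᵍ_
        ; *-assoc = λ { (a ⊹ b) (c ⊹ d) (e ⊹ f) →
            cong₂ _⊹_ (*-assoc-re a b c d e f) (*-assoc-im a b c d e f) }
        ; *-identity = identityˡ , λ x → trans (comm x 1ᵍ) (identityˡ x)
        ; distrib = distribˡ , λ x y z → trans (comm (y +ᵍ z) x)
            (trans (distribˡ x y z) (cong₂ _+ᵍ_ (comm x y) (comm x z))) }
      ; *-comm = comm } }
    where
    comm : ∀ x y → x *ᵍ y ≡ y *ᵍ x
    comm (a ⊹ b) (c ⊹ d) = cong₂ _⊹_ (*-comm-re a b c d) (*-comm-im a b c d)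
    identityˡ : ∀ x → 1ᵍ *ᵍ x ≡ x
    identityˡ (a ⊹ b) = cong₂ _⊹_ (*-id-re a b) (*-id-im a b)
    distribˡ : ∀ x y z → x *ᵍ (y +ᵍ z) ≡ x *ᵍ y +ᵍ x *ᵍ z
    distribˡ (a ⊹ b) (c ⊹ d) (e ⊹ f) = cong₂ _⊹_ (distrib-re a b c d e f) (distrib-im a b c d e f)

  isZeroᵍ : ∀ z → Maybe (0ᵍ ≡ z)
  isZeroᵍ (a ⊹ b) with 0ℚ ℚ.≟ a | 0ℚ ℚ.≟ b
  ... | yes p | yes q = just (cong₂ _⊹_ p q)
  ... | _     | _     = nothing

  𝔾-ring : AlmostCommutativeRing 0ℓ 0ℓ
  𝔾-ring = fromCommutativeRing 𝔾-commutativeRing isZeroᵍ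

  module 𝔾ᵣ = CommutativeRing 𝔾-commutativeRing

  𝔾-rawSemiring : RawSemiring 0ℓ 0ℓ
  𝔾-rawSemiring = record { _≈_ = _≡_ ; _+_ = _+ᵍ_ ; _*_ = _*ᵍ_ ; 0# = 0ᵍ ; 1# = 1ᵍ }

  open import Algebra.Definitions.RawSemiring 𝔾-rawSemiring public using () renaming (_^_ to _^ᵍ_)

  real : ℚ → 𝔾
  real q = q ⊹ 0ℚ

  private
    real-*-re : ∀ a b → a * b ≡ a * b - 0ℚ * 0ℚ
    real-*-re = solve-∀ ℚ-ring
    real-*-im : ∀ a b → 0ℚ ≡ a * 0ℚ + 0ℚ * b
    real-*-im = solve-∀ ℚ-ring
    scale-re : ∀ q a b → q * a - 0ℚ * b ≡ q * a
    scale-re = solve-∀ ℚ-ring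
    scale-im : ∀ q a b → q * b + 0ℚ * a ≡ q * b
    scale-im = solve-∀ ℚ-ring

  real-* : ∀ a b → real (a * b) ≡ real a *ᵍ real b
  real-* a b = cong₂ _⊹_ (real-*-re a b) (real-*-im a b)

  real-injective : ∀ {a b} → real a ≡ real b → a ≡ b
  real-injective = cong Re

  real*- : ∀ q z → real q *ᵍ z ≡ (q * Re z) ⊹ (q * Im z)
  real*- q (a ⊹ b) = cong₂ _⊹_ (scale-re q a b) (scale-im q a b)

  opaque
    -- The ℓ¹ norm replaces the modulus, which need not be rational. It is submultiplicative (`‖*‖`)
    -- and multiplicative up to a factor 2 (`‖*‖-lower`).
    ‖_‖ : 𝔾 → ℚ
    ‖ z ‖ = ∣ Re z ∣ + ∣ Im z ∣

  opaque
    unfolding ‖_‖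

    ‖⊹‖ : ∀ a b → ‖ a ⊹ b ‖ ≡ ∣ a ∣ + ∣ b ∣
    ‖⊹‖ a b = refl

    ‖0‖ : ‖ 0ᵍ ‖ ≡ 0ℚ
    ‖0‖ = refl

    ‖1‖ : ‖ 1ᵍ ‖ ≡ 1ℚ
    ‖1‖ = refl

    ‖‖-nonNeg : ∀ z → 0ℚ ≤ ‖ z ‖
    ‖‖-nonNeg z = +-nonNeg (ℚ.0≤∣p∣ (Re z)) (ℚ.0≤∣p∣ (Im z))

    interchange : ∀ a b c d → a + b + (c + d) ≡ a + c + (b + d)
    interchange = solve-∀ ℚ-ring

    ‖+‖ : ∀ z w → ‖ z +ᵍ w ‖ ≤ ‖ z ‖ + ‖ w ‖
    ‖+‖ z@(_ ⊹ _) w@(_ ⊹ _) = ℚ.≤-trans (ℚ.+-mono-≤ (ℚ.∣p+q∣≤∣p∣+∣q∣ (Re z) (Re w)) (ℚ.∣p+q∣≤∣p∣+∣q∣ (Im z) (Im w)))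
      (ℚ.≤-reflexive (interchange (∣ Re z ∣) (∣ Re w ∣) (∣ Im z ∣) (∣ Im w ∣)))

    ‖neg‖ : ∀ z → ‖ -ᵍ z ‖ ≡ ‖ z ‖
    ‖neg‖ z@(_ ⊹ _) = cong₂ _+_ (ℚ.∣-p∣≡∣p∣ (Re z)) (ℚ.∣-p∣≡∣p∣ (Im z))

    ‖-‖ : ∀ z w → ‖ z -ᵍ w ‖ ≤ ‖ z ‖ + ‖ w ‖
    ‖-‖ z w = subst (λ n → ‖ z -ᵍ w ‖ ≤ ‖ z ‖ + n) (‖neg‖ w) (‖+‖ z (-ᵍ w))

    ‖-‖-comm : ∀ z w → ‖ z -ᵍ w ‖ ≡ ‖ w -ᵍ z ‖
    ‖-‖-comm z@(_ ⊹ _) w@(_ ⊹ _) = cong₂ _+_ (∣p-q∣≡∣q-p∣ (Re z) (Re w)) (∣p-q∣≡∣q-p∣ (Im z) (Im w))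

    ‖real‖ : ∀ q → ‖ real q ‖ ≡ ∣ q ∣
    ‖real‖ q = ℚ.+-identityʳ ∣ q ∣

    ‖*‖ : ∀ z w → ‖ z *ᵍ w ‖ ≤ ‖ z ‖ * ‖ w ‖
    ‖*‖ (a ⊹ b) (c ⊹ d) = begin
      ∣ a * c - b * d ∣ + ∣ a * d + b * c ∣
        ≤⟨ ℚ.+-mono-≤ (ℚ.∣p-q∣≤∣p∣+∣q∣ (a * c) (b * d)) (ℚ.∣p+q∣≤∣p∣+∣q∣ (a * d) (b * c)) ⟩
      ∣ a * c ∣ + ∣ b * d ∣ + (∣ a * d ∣ + ∣ b * c ∣)
        ≡⟨ cong₂ _+_ (cong₂ _+_ (ℚ.∣p*q∣≡∣p∣*∣q∣ a c) (ℚ.∣p*q∣≡∣p∣*∣q∣ b d))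
                     (cong₂ _+_ (ℚ.∣p*q∣≡∣p∣*∣q∣ a d) (ℚ.∣p*q∣≡∣p∣*∣q∣ b c)) ⟩
      ∣ a ∣ * ∣ c ∣ + ∣ b ∣ * ∣ d ∣ + (∣ a ∣ * ∣ d ∣ + ∣ b ∣ * ∣ c ∣)
        ≡⟨ expand (∣ a ∣) (∣ b ∣) (∣ c ∣) (∣ d ∣) ⟩
      (∣ a ∣ + ∣ b ∣) * (∣ c ∣ + ∣ d ∣) ∎
      where
      open ℚ.≤-Reasoning
      expand : ∀ a b c d → a * c + b * d + (a * d + b * c) ≡ (a + b) * (c + d)
      expand = solve-∀ ℚ-ring

    ‖real*‖ : ∀ q z → ‖ real q *ᵍ z ‖ ≡ ∣ q ∣ * ‖ z ‖
    ‖real*‖ q z = trans (cong ‖_‖ (real*- q z))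
      (trans (cong₂ _+_ (ℚ.∣p*q∣≡∣p∣*∣q∣ q (Re z)) (ℚ.∣p*q∣≡∣p∣*∣q∣ q (Im z)))
             (sym (ℚ.*-distribˡ-+ (∣ q ∣) (∣ Re z ∣) (∣ Im z ∣))))

  conj : 𝔾 → 𝔾
  conj z = Re z ⊹ (- Im z)

  2ℚ : ℚ
  2ℚ = 1ℚ + 1ℚ

  0<2 : 0ℚ < 2ℚ
  0<2 = +-pos-nonNeg 0<1 0≤1

  1≤2 : 1ℚ ≤ 2ℚ
  1≤2 = ≤-+ʳ 0≤1

  ∣z∣² : 𝔾 → ℚ
  ∣z∣² z = Re z * Re z + Im z * Im z

  ∣z∣²-nonNeg : ∀ z → 0ℚ ≤ ∣z∣² z
  ∣z∣²-nonNeg z = +-nonNeg (square-nonNeg (Re z)) (square-nonNeg (Im z))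

  opaque
    unfolding ‖_‖

    ‖z‖²≤2∣z∣² : ∀ z → ‖ z ‖ * ‖ z ‖ ≤ 2ℚ * ∣z∣² z
    ‖z‖²≤2∣z∣² (a ⊹ b) = begin
      (∣ a ∣ + ∣ b ∣) * (∣ a ∣ + ∣ b ∣)
        ≤⟨ ≤-+ʳ (square-nonNeg (∣ a ∣ - ∣ b ∣)) ⟩
      (∣ a ∣ + ∣ b ∣) * (∣ a ∣ + ∣ b ∣) + (∣ a ∣ - ∣ b ∣) * (∣ a ∣ - ∣ b ∣)
        ≡⟨ parallelogram (∣ a ∣) (∣ b ∣) ⟩
      2ℚ * (∣ a ∣ * ∣ a ∣ + ∣ b ∣ * ∣ b ∣)
        ≡⟨ cong (2ℚ *_) (cong₂ _+_ (∣p∣*∣p∣≡p*p a) (∣p∣*∣p∣≡p*p b)) ⟩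
      2ℚ * (a * a + b * b) ∎
      where
      open ℚ.≤-Reasoning
      parallelogram : ∀ a b → (a + b) * (a + b) + (a - b) * (a - b) ≡ (1ℚ + 1ℚ) * (a * a + b * b)
      parallelogram = solve-∀ ℚ-ring

  opaque
    unfolding ‖_‖

    ‖conj‖ : ∀ z → ‖ conj z ‖ ≡ ‖ z ‖
    ‖conj‖ z = cong (∣ Re z ∣ +_) (ℚ.∣-p∣≡∣p∣ (Im z))

  conj-* : ∀ z w → conj z *ᵍ (z *ᵍ w) ≡ real (∣z∣² z) *ᵍ w
  conj-* (a ⊹ b) (c ⊹ d) = cong₂ _⊹_ (re-part a b c d) (im-part a b c d)
    where
    re-part : ∀ a b c d → a * (a * c - b * d) - - b * (a * d + b * c) ≡ (a * a + b * b) * c - 0ℚ * d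
    re-part = solve-∀ ℚ-ring
    im-part : ∀ a b c d → a * (a * d + b * c) + - b * (a * c - b * d) ≡ (a * a + b * b) * d + 0ℚ * c
    im-part = solve-∀ ℚ-ring

  -- z̄ z w = |z|² w turns submultiplicativity into a bound from below.
  ‖*‖-lower : ∀ z w → ‖ z ‖ * ‖ w ‖ ≤ 2ℚ * ‖ z *ᵍ w ‖
  ‖*‖-lower z w with 0ℚ ℚ.<? ‖ z ‖
  ... | no ≮ = ℚ.≤-trans (ℚ.≤-reflexive (trans (cong (_* ‖ w ‖) (ℚ.≤-antisym (ℚ.≮⇒≥ ≮) (‖‖-nonNeg z))) (ℚ.*-zeroˡ (‖ w ‖))))
                  (*-nonNeg (ℚ.<⇒≤ 0<2) (‖‖-nonNeg (z *ᵍ w)))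
  ... | yes 0<z = *-cancel≤ʳ 0<z (begin
    ‖ z ‖ * (‖ z ‖ * ‖ w ‖)  ≡⟨ sym (ℚ.*-assoc (‖ z ‖) (‖ z ‖) (‖ w ‖)) ⟩
    ‖ z ‖ * ‖ z ‖ * ‖ w ‖  ≤⟨ *-monoˡ (‖‖-nonNeg w) (‖z‖²≤2∣z∣² z) ⟩
    2ℚ * ∣z∣² z * ‖ w ‖  ≡⟨ ℚ.*-assoc 2ℚ (∣z∣² z) (‖ w ‖) ⟩
    2ℚ * (∣z∣² z * ‖ w ‖)  ≡⟨ cong (λ t → 2ℚ * (t * ‖ w ‖)) (sym (ℚ.0≤p⇒∣p∣≡p (∣z∣²-nonNeg z))) ⟩
    2ℚ * (∣ ∣z∣² z ∣ * ‖ w ‖)  ≡⟨ cong (2ℚ *_) (sym (‖real*‖ (∣z∣² z) w)) ⟩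
    2ℚ * ‖ real (∣z∣² z) *ᵍ w ‖  ≡⟨ cong (λ t → 2ℚ * ‖ t ‖) (sym (conj-* z w)) ⟩
    2ℚ * ‖ conj z *ᵍ (z *ᵍ w) ‖  ≤⟨ *-monoʳ (ℚ.<⇒≤ 0<2) (‖*‖ (conj z) (z *ᵍ w)) ⟩
    2ℚ * (‖ conj z ‖ * ‖ z *ᵍ w ‖)  ≡⟨ cong (λ t → 2ℚ * (t * ‖ z *ᵍ w ‖)) (‖conj‖ z) ⟩
    2ℚ * (‖ z ‖ * ‖ z *ᵍ w ‖)  ≡⟨ swap 2ℚ (‖ z ‖) (‖ z *ᵍ w ‖) ⟩
    ‖ z ‖ * (2ℚ * ‖ z *ᵍ w ‖)  ∎)
    where
    open ℚ.≤-Reasoning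
    swap : ∀ a b c → a * (b * c) ≡ b * (a * c)
    swap = solve-∀ ℚ-ring

  ‖^‖-lower : ∀ z n → ‖ z ‖ ^ n ≤ 2ℚ ^ n * ‖ z ^ᵍ n ‖
  ‖^‖-lower z zero    = ℚ.≤-reflexive (sym (trans (ℚ.*-identityˡ _) ‖1‖))
  ‖^‖-lower z (suc n) = begin
    ‖ z ‖ * ‖ z ‖ ^ n  ≤⟨ *-monoʳ (‖‖-nonNeg z) (‖^‖-lower z n) ⟩
    ‖ z ‖ * (2ℚ ^ n * ‖ z ^ᵍ n ‖)  ≡⟨ swap (‖ z ‖) (2ℚ ^ n) (‖ z ^ᵍ n ‖) ⟩
    2ℚ ^ n * (‖ z ‖ * ‖ z ^ᵍ n ‖)  ≤⟨ *-monoʳ (^-nonNeg n (ℚ.<⇒≤ 0<2)) (‖*‖-lower z (z ^ᵍ n)) ⟩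
    2ℚ ^ n * (2ℚ * ‖ z *ᵍ z ^ᵍ n ‖)  ≡⟨ regroup (2ℚ ^ n) 2ℚ (‖ z *ᵍ z ^ᵍ n ‖) ⟩
    2ℚ * 2ℚ ^ n * ‖ z *ᵍ z ^ᵍ n ‖  ∎
    where
    open ℚ.≤-Reasoning
    swap : ∀ a b c → a * (b * c) ≡ b * (a * c)
    swap = solve-∀ ℚ-ring
    regroup : ∀ a b c → a * (b * c) ≡ b * a * c
    regroup = solve-∀ ℚ-ring

  opaque
    unfolding ‖_‖

    ‖‖-eq0 : ∀ {z} → ‖ z ‖ ≤ 0ℚ → z ≡ 0ᵍ
    ‖‖-eq0 {a ⊹ b} h = cong₂ _⊹_
      (ℚ.∣p∣≡0⇒p≡0 a (ℚ.≤-antisym (ℚ.≤-trans (≤-+ʳ (ℚ.0≤∣p∣ b)) h) (ℚ.0≤∣p∣ a)))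
      (ℚ.∣p∣≡0⇒p≡0 b (ℚ.≤-antisym (ℚ.≤-trans (≤-+ˡ (ℚ.0≤∣p∣ a)) h) (ℚ.0≤∣p∣ b)))

  ∣z∣²-pos : ∀ {z} → z ≢ 0ᵍ → 0ℚ < ∣z∣² z
  ∣z∣²-pos {z} z≢0 = ℚ.≰⇒> λ h → z≢0 (‖‖-eq0 (square-cancel-≤ ℚ.≤-refl
    (ℚ.≤-trans (‖z‖²≤2∣z∣² z) (*-monoʳ (ℚ.<⇒≤ 0<2) h))))

  invᵍ : ∀ z → z ≢ 0ᵍ → ∃ λ w → z *ᵍ w ≡ 1ᵍ
  invᵍ z z≢0 with inverse (∣z∣²-pos z≢0)
  ... | r , _ , e = conj z *ᵍ real r , (begin
    z *ᵍ (conj z *ᵍ real r)  ≡⟨ assoc z (conj z) (real r) ⟩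
    conj z *ᵍ (z *ᵍ real r)  ≡⟨ conj-* z (real r) ⟩
    real (∣z∣² z) *ᵍ real r  ≡⟨ sym (real-* (∣z∣² z) r) ⟩
    real (∣z∣² z * r)  ≡⟨ cong real e ⟩
    1ᵍ  ∎)
    where
    open ≡-Reasoning
    assoc : ∀ a b c → a *ᵍ (b *ᵍ c) ≡ b *ᵍ (a *ᵍ c)
    assoc = solve-∀ 𝔾-ring

-- Exterior algebra, determinants and their size

module ExteriorAlgebra where
  open import Data.Bool.Base using (Bool; true; false)
  import Data.Integer.Base as ℤ
  open import Data.Rational.Base using (_+_; _*_; _≤_; _<_)
  open import Data.Vec.Base using (Vec; []; _∷_; replicate)
  open import Tactic.RingSolver using (solve-∀)
  open Rationals
  open Gaussian

  -1ᵍ : 𝔾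
  -1ᵍ = -ᵍ 1ᵍ

  sumᵍ : ℕ → (ℕ → 𝔾) → 𝔾
  sumᵍ zero    f = 0ᵍ
  sumᵍ (suc n) f = f 0 +ᵍ sumᵍ n (f ∘ suc)

  sumᵍ-cong : ∀ n {f g : ℕ → 𝔾} → (∀ i → i ℕ.< n → f i ≡ g i) → sumᵍ n f ≡ sumᵍ n g
  sumᵍ-cong zero    e = refl
  sumᵍ-cong (suc n) e = cong₂ _+ᵍ_ (e 0 (s≤s z≤n)) (sumᵍ-cong n λ i i<n → e (suc i) (s≤s i<n))

  sumᵍ-linear : ∀ n a b (f g : ℕ → 𝔾) →
    sumᵍ n (λ i → a *ᵍ f i +ᵍ b *ᵍ g i) ≡ a *ᵍ sumᵍ n f +ᵍ b *ᵍ sumᵍ n g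
  sumᵍ-linear zero    a b f g = lemma a b
    where
    lemma : ∀ a b → 0ᵍ ≡ a *ᵍ 0ᵍ +ᵍ b *ᵍ 0ᵍ
    lemma = solve-∀ 𝔾-ring
  sumᵍ-linear (suc n) a b f g =
    trans (cong (a *ᵍ f 0 +ᵍ b *ᵍ g 0 +ᵍ_) (sumᵍ-linear n a b (f ∘ suc) (g ∘ suc)))
          (lemma a b (f 0) (g 0) (sumᵍ n (f ∘ suc)) (sumᵍ n (g ∘ suc)))
    where
    lemma : ∀ a b c d e f → a *ᵍ c +ᵍ b *ᵍ d +ᵍ (a *ᵍ e +ᵍ b *ᵍ f) ≡ a *ᵍ (c +ᵍ e) +ᵍ b *ᵍ (d +ᵍ f)
    lemma = solve-∀ 𝔾-ring

  sumᵍ-zero : ∀ n {f : ℕ → 𝔾} → (∀ i → i ℕ.< n → f i ≡ 0ᵍ) → sumᵍ n f ≡ 0ᵍ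
  sumᵍ-zero zero    e = refl
  sumᵍ-zero (suc n) e = cong₂ _+ᵍ_ (e 0 (s≤s z≤n)) (sumᵍ-zero n λ i i<n → e (suc i) (s≤s i<n))

  update : {A : Set} → (ℕ → A) → ℕ → A → ℕ → A
  update f zero    v zero    = v
  update f zero    v (suc i) = f (suc i)
  update f (suc p) v zero    = f 0
  update f (suc p) v (suc i) = update (f ∘ suc) p v i

  -- An element of the exterior algebra on n generators, by its coordinates:
  -- the Boolean vector tells which generators occur.
  Λ : ℕ → Set
  Λ n = Vec Bool n → 𝔾

  -- Left multiplication by the vector `r`. If `x = x₀ + e₀ ∧ x₁`, the part of `r ∧ x` divisible by
  -- `e₀` is `r 0 · x₀ − r′ ∧ x₁`, the sign arising when the remainder `r′` of `r` moves past `e₀`.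
  wedge : ∀ n → (ℕ → 𝔾) → Λ n → Λ n
  wedge zero    r x π           = 0ᵍ
  wedge (suc n) r x (false ∷ π) = wedge n (r ∘ suc) (λ σ → x (false ∷ σ)) π
  wedge (suc n) r x (true ∷ π)  = r 0 *ᵍ x (false ∷ π) +ᵍ -1ᵍ *ᵍ wedge n (r ∘ suc) (λ σ → x (true ∷ σ)) π

  wedge-cong : ∀ n {r s : ℕ → 𝔾} {x y : Λ n} → (∀ i → r i ≡ s i) → (∀ σ → x σ ≡ y σ) →
    ∀ π → wedge n r x π ≡ wedge n s y π
  wedge-cong zero    e h π           = refl
  wedge-cong (suc n) e h (false ∷ π) = wedge-cong n (e ∘ suc) (λ σ → h (false ∷ σ)) π
  wedge-cong (suc n) e h (true ∷ π)  =
    cong₂ (λ a b → a +ᵍ -1ᵍ *ᵍ b) (cong₂ _*ᵍ_ (e 0) (h (false ∷ π)))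
          (wedge-cong n (e ∘ suc) (λ σ → h (true ∷ σ)) π)

  private
    0≡lin : ∀ a b → 0ᵍ ≡ a *ᵍ 0ᵍ +ᵍ b *ᵍ 0ᵍ
    0≡lin = solve-∀ 𝔾-ring
    lin-x : ∀ a b r x y u v → r *ᵍ (a *ᵍ x +ᵍ b *ᵍ y) +ᵍ -ᵍ 1ᵍ *ᵍ (a *ᵍ u +ᵍ b *ᵍ v)
          ≡ a *ᵍ (r *ᵍ x +ᵍ -ᵍ 1ᵍ *ᵍ u) +ᵍ b *ᵍ (r *ᵍ y +ᵍ -ᵍ 1ᵍ *ᵍ v)
    lin-x = solve-∀ 𝔾-ring
    lin-r : ∀ a b r s x u v → (a *ᵍ r +ᵍ b *ᵍ s) *ᵍ x +ᵍ -ᵍ 1ᵍ *ᵍ (a *ᵍ u +ᵍ b *ᵍ v)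
          ≡ a *ᵍ (r *ᵍ x +ᵍ -ᵍ 1ᵍ *ᵍ u) +ᵍ b *ᵍ (s *ᵍ x +ᵍ -ᵍ 1ᵍ *ᵍ v)
    lin-r = solve-∀ 𝔾-ring

  wedge-linearʳ : ∀ n r a b (x y : Λ n) π →
    wedge n r (λ σ → a *ᵍ x σ +ᵍ b *ᵍ y σ) π ≡ a *ᵍ wedge n r x π +ᵍ b *ᵍ wedge n r y π
  wedge-linearʳ zero    r a b x y π           = 0≡lin a b
  wedge-linearʳ (suc n) r a b x y (false ∷ π) = wedge-linearʳ n (r ∘ suc) a b _ _ π
  wedge-linearʳ (suc n) r a b x y (true ∷ π)  =
    trans (cong (λ t → r 0 *ᵍ (a *ᵍ x (false ∷ π) +ᵍ b *ᵍ y (false ∷ π)) +ᵍ -1ᵍ *ᵍ t)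
                (wedge-linearʳ n (r ∘ suc) a b _ _ π))
          (lin-x a b (r 0) (x (false ∷ π)) (y (false ∷ π)) _ _)

  wedge-linearˡ : ∀ n a b (r s : ℕ → 𝔾) (x : Λ n) π →
    wedge n (λ i → a *ᵍ r i +ᵍ b *ᵍ s i) x π ≡ a *ᵍ wedge n r x π +ᵍ b *ᵍ wedge n s x π
  wedge-linearˡ zero    a b r s x π           = 0≡lin a b
  wedge-linearˡ (suc n) a b r s x (false ∷ π) = wedge-linearˡ n a b (r ∘ suc) (s ∘ suc) _ π
  wedge-linearˡ (suc n) a b r s x (true ∷ π)  =
    trans (cong (λ t → (a *ᵍ r 0 +ᵍ b *ᵍ s 0) *ᵍ x (false ∷ π) +ᵍ -1ᵍ *ᵍ t)
                (wedge-linearˡ n a b (r ∘ suc) (s ∘ suc) _ π))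
          (lin-r a b (r 0) (s 0) (x (false ∷ π)) _ _)

  wedge-zeroʳ : ∀ n r {x : Λ n} → (∀ σ → x σ ≡ 0ᵍ) → ∀ π → wedge n r x π ≡ 0ᵍ
  wedge-zeroʳ n r {x} h π =
    trans (wedge-cong n {r} {r} {x} {λ σ → 0ᵍ *ᵍ x σ +ᵍ 0ᵍ *ᵍ x σ} (λ _ → refl) (λ σ → trans (h σ) (lemma (x σ))) π)
          (trans (wedge-linearʳ n r 0ᵍ 0ᵍ x x π) (sym (lemma (wedge n r x π))))
    where
    lemma : ∀ t → 0ᵍ ≡ 0ᵍ *ᵍ t +ᵍ 0ᵍ *ᵍ t
    lemma = solve-∀ 𝔾-ring

  wedge-anticomm : ∀ n r s (x : Λ n) π → wedge n r (wedge n s x) π ≡ -1ᵍ *ᵍ wedge n s (wedge n r x) π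
  wedge-anticomm zero    r s x π           = refl
  wedge-anticomm (suc n) r s x (false ∷ π) = wedge-anticomm n (r ∘ suc) (s ∘ suc) _ π
  wedge-anticomm (suc n) r s x (true ∷ π)  = begin
    r 0 *ᵍ S x₀ π +ᵍ -1ᵍ *ᵍ R (λ σ → s 0 *ᵍ x₀ σ +ᵍ -1ᵍ *ᵍ S x₁ σ) π
      ≡⟨ cong (λ t → r 0 *ᵍ S x₀ π +ᵍ -1ᵍ *ᵍ t)
           (trans (wedge-linearʳ n (r ∘ suc) (s 0) -1ᵍ x₀ (S x₁) π)
                  (cong (λ t → s 0 *ᵍ R x₀ π +ᵍ -1ᵍ *ᵍ t) (wedge-anticomm n (r ∘ suc) (s ∘ suc) x₁ π))) ⟩
    r 0 *ᵍ S x₀ π +ᵍ -1ᵍ *ᵍ (s 0 *ᵍ R x₀ π +ᵍ -1ᵍ *ᵍ (-1ᵍ *ᵍ S (R x₁) π))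
      ≡⟨ lemma (r 0) (s 0) (R x₀ π) (S x₀ π) (S (R x₁) π) ⟩
    -1ᵍ *ᵍ (s 0 *ᵍ R x₀ π +ᵍ -1ᵍ *ᵍ (r 0 *ᵍ S x₀ π +ᵍ -1ᵍ *ᵍ S (R x₁) π))
      ≡⟨ cong (λ t → -1ᵍ *ᵍ (s 0 *ᵍ R x₀ π +ᵍ -1ᵍ *ᵍ t)) (sym (wedge-linearʳ n (s ∘ suc) (r 0) -1ᵍ x₀ (R x₁) π)) ⟩
    -1ᵍ *ᵍ (s 0 *ᵍ R x₀ π +ᵍ -1ᵍ *ᵍ S (λ σ → r 0 *ᵍ x₀ σ +ᵍ -1ᵍ *ᵍ R x₁ σ) π) ∎
    where
    open ≡-Reasoning
    R S : Λ n → Λ n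
    R = wedge n (r ∘ suc)
    S = wedge n (s ∘ suc)
    x₀ x₁ : Λ n
    x₀ σ = x (false ∷ σ)
    x₁ σ = x (true ∷ σ)
    lemma : ∀ r s a b c → r *ᵍ b +ᵍ -ᵍ 1ᵍ *ᵍ (s *ᵍ a +ᵍ -ᵍ 1ᵍ *ᵍ (-ᵍ 1ᵍ *ᵍ c))
          ≡ -ᵍ 1ᵍ *ᵍ (s *ᵍ a +ᵍ -ᵍ 1ᵍ *ᵍ (r *ᵍ b +ᵍ -ᵍ 1ᵍ *ᵍ c))
    lemma = solve-∀ 𝔾-ring

  wedge-square : ∀ n r (x : Λ n) π → wedge n r (wedge n r x) π ≡ 0ᵍ
  wedge-square zero    r x π           = refl
  wedge-square (suc n) r x (false ∷ π) = wedge-square n (r ∘ suc) _ π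
  wedge-square (suc n) r x (true ∷ π)  =
    trans (cong (λ t → r 0 *ᵍ R x₀ π +ᵍ -1ᵍ *ᵍ t)
            (trans (wedge-linearʳ n (r ∘ suc) (r 0) -1ᵍ x₀ (R x₁) π)
                   (cong (λ t → r 0 *ᵍ R x₀ π +ᵍ -1ᵍ *ᵍ t) (wedge-square n (r ∘ suc) x₁ π))))
          (lemma (r 0) (R x₀ π))
    where
    R : Λ n → Λ n
    R = wedge n (r ∘ suc)
    x₀ x₁ : Λ n
    x₀ σ = x (false ∷ σ)
    x₁ σ = x (true ∷ σ)
    lemma : ∀ r a → r *ᵍ a +ᵍ -ᵍ 1ᵍ *ᵍ (r *ᵍ a +ᵍ -ᵍ 1ᵍ *ᵍ 0ᵍ) ≡ 0ᵍ
    lemma = solve-∀ 𝔾-ring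

  wedge-sum : ∀ n k (c : ℕ → 𝔾) (rows : ℕ → ℕ → 𝔾) (x : Λ n) π →
    wedge n (λ i → sumᵍ k (λ j → c j *ᵍ rows j i)) x π ≡ sumᵍ k (λ j → c j *ᵍ wedge n (rows j) x π)
  wedge-sum n zero    c rows x π =
    trans (wedge-cong n {s = λ i → 0ᵍ *ᵍ rows 0 i +ᵍ 0ᵍ *ᵍ rows 0 i} (λ i → lemma (rows 0 i)) (λ _ → refl) π)
          (trans (wedge-linearˡ n 0ᵍ 0ᵍ (rows 0) (rows 0) x π) (sym (lemma (wedge n (rows 0) x π))))
    where
    lemma : ∀ t → 0ᵍ ≡ 0ᵍ *ᵍ t +ᵍ 0ᵍ *ᵍ t
    lemma = solve-∀ 𝔾-ring
  wedge-sum n (suc k) c rows x π =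
    trans (wedge-cong n (λ i → cong (c 0 *ᵍ rows 0 i +ᵍ_) (one* _)) (λ _ → refl) π)
      (trans (wedge-linearˡ n (c 0) 1ᵍ (rows 0) _ x π)
        (cong (c 0 *ᵍ wedge n (rows 0) x π +ᵍ_)
          (trans (sym (one* _)) (wedge-sum n k (c ∘ suc) (rows ∘ suc) x π))))
    where
    one* : ∀ t → t ≡ 1ᵍ *ᵍ t
    one* = solve-∀ 𝔾-ring

  one : ∀ {n} → Λ n
  one []          = 1ᵍ
  one (false ∷ π) = one π
  one (true ∷ π)  = 0ᵍ

  wedges : ∀ n → ℕ → (ℕ → ℕ → 𝔾) → Λ n
  wedges n zero    rows = one
  wedges n (suc k) rows = wedge n (rows 0) (wedges n k (rows ∘ suc))

  det : ℕ → (ℕ → ℕ → 𝔾) → 𝔾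
  det n rows = wedges n n rows (replicate n true)

  wedges-cong : ∀ n k {rows rows′ : ℕ → ℕ → 𝔾} → (∀ j i → rows j i ≡ rows′ j i) →
    ∀ π → wedges n k rows π ≡ wedges n k rows′ π
  wedges-cong n zero    e π = refl
  wedges-cong n (suc k) e π = wedge-cong n (e 0) (wedges-cong n k (e ∘ suc)) π

  det-cong : ∀ n {rows rows′ : ℕ → ℕ → 𝔾} → (∀ j i → rows j i ≡ rows′ j i) → det n rows ≡ det n rows′
  det-cong n e = wedges-cong n n e (replicate n true)

  wedge-repeated : ∀ n k rows j → j ℕ.< k → ∀ π → wedge n (rows j) (wedges n k rows) π ≡ 0ᵍ
  wedge-repeated n (suc k) rows zero    _         π = wedge-square n (rows 0) _ π
  wedge-repeated n (suc k) rows (suc j) (s≤s j<k) π =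
    trans (wedge-anticomm n (rows (suc j)) (rows 0) _ π)
      (cong (-1ᵍ *ᵍ_) (wedge-zeroʳ n (rows 0) (wedge-repeated n k (rows ∘ suc) j j<k) π))

  wedge-combination : ∀ n k (rows : ℕ → ℕ → 𝔾) (c : ℕ → 𝔾) π →
    wedge n (λ i → sumᵍ k (λ j → c j *ᵍ rows j i)) (wedges n k rows) π ≡ 0ᵍ
  wedge-combination n k rows c π = trans (wedge-sum n k c rows _ π)
    (sumᵍ-zero k λ j j<k → trans (cong (c j *ᵍ_) (wedge-repeated n k rows j j<k π)) (zero* (c j)))
    where
    zero* : ∀ t → t *ᵍ 0ᵍ ≡ 0ᵍ
    zero* = solve-∀ 𝔾-ring

  wedges-linear : ∀ n k rows p → p ℕ.< k → ∀ a b r s π →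
    wedges n k (update rows p (λ i → a *ᵍ r i +ᵍ b *ᵍ s i)) π
      ≡ a *ᵍ wedges n k (update rows p r) π +ᵍ b *ᵍ wedges n k (update rows p s) π
  wedges-linear n (suc k) rows zero    _         a b r s π = wedge-linearˡ n a b r s _ π
  wedges-linear n (suc k) rows (suc p) (s≤s p<k) a b r s π =
    trans (wedge-cong n (λ _ → refl) (wedges-linear n k (rows ∘ suc) p p<k a b r s) π)
          (wedge-linearʳ n (rows 0) a b _ _ π)

  wedges-row-repeated : ∀ n k rows p → p ℕ.< k → ∀ r π → wedge n r (wedges n k (update rows p r)) π ≡ 0ᵍ
  wedges-row-repeated n (suc k) rows zero    _         r π = wedge-square n r _ π
  wedges-row-repeated n (suc k) rows (suc p) (s≤s p<k) r π =
    trans (wedge-anticomm n r (rows 0) _ π)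
      (cong (-1ᵍ *ᵍ_) (wedge-zeroʳ n (rows 0) (wedges-row-repeated n k (rows ∘ suc) p p<k r) π))

  private
    one* : ∀ t → t ≡ 1ᵍ *ᵍ t
    one* = solve-∀ 𝔾-ring
    first-only : ∀ a x → a *ᵍ x +ᵍ 1ᵍ *ᵍ 0ᵍ ≡ a *ᵍ x
    first-only = solve-∀ 𝔾-ring
    second-only : ∀ a y → a *ᵍ 0ᵍ +ᵍ 1ᵍ *ᵍ y ≡ y
    second-only = solve-∀ 𝔾-ring

  wedges-update-cong : ∀ n k rows p {r s : ℕ → 𝔾} → (∀ i → r i ≡ s i) → ∀ π →
    wedges n k (update rows p r) π ≡ wedges n k (update rows p s) π
  wedges-update-cong n zero    rows p       e π = refl
  wedges-update-cong n (suc k) rows zero    e π = wedge-cong n e (λ _ → refl) π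
  wedges-update-cong n (suc k) rows (suc p) e π =
    wedge-cong n (λ _ → refl) (wedges-update-cong n k (rows ∘ suc) p e) π

  -- By linearity only the multiple of row `p` itself survives, since every other summand repeats a
  -- factor of the product. It is applied with the powers of an approximate root as coefficients
  -- `c`.
  row-operation : ∀ n k (rows : ℕ → ℕ → 𝔾) (c : ℕ → 𝔾) p → p ℕ.< k → ∀ π →
    wedges n k (update rows p (λ i → sumᵍ k (λ j → c j *ᵍ rows j i))) π ≡ c p *ᵍ wedges n k rows π
  row-operation n (suc k) rows c zero    _         π =
    trans (wedge-cong n (λ i → cong (c 0 *ᵍ rows 0 i +ᵍ_) (one* _)) (λ _ → refl) π)
      (trans (wedge-linearˡ n (c 0) 1ᵍ (rows 0) _ _ π)
        (trans (cong (λ t → c 0 *ᵍ wedges n (suc k) rows π +ᵍ 1ᵍ *ᵍ t)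
                     (wedge-combination n k (rows ∘ suc) (c ∘ suc) π))
               (first-only (c 0) _)))
  row-operation n (suc k) rows c (suc p) (s≤s p<k) π =
    trans (wedge-cong n (λ _ → refl)
            (λ σ → trans (wedges-update-cong n k (rows ∘ suc) p (λ i → cong (c 0 *ᵍ rows 0 i +ᵍ_) (one* _)) σ)
                         (wedges-linear n k (rows ∘ suc) p p<k (c 0) 1ᵍ (rows 0) _ σ)) π)
      (trans (wedge-linearʳ n (rows 0) (c 0) 1ᵍ _ _ π)
        (trans (cong (λ t → c 0 *ᵍ t +ᵍ 1ᵍ *ᵍ wedge n (rows 0) (wedges n k (update (rows ∘ suc) p _)) π)
                     (wedges-row-repeated n k (rows ∘ suc) p p<k (rows 0) π))
          (trans (second-only (c 0) _)
            (trans (wedge-cong n (λ _ → refl) (row-operation n k (rows ∘ suc) (c ∘ suc) p p<k) π)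
              (trans (wedge-cong n (λ _ → refl) (λ σ → pad (c (suc p)) (wedges n k (rows ∘ suc) σ)) π)
                (trans (wedge-linearʳ n (rows 0) (c (suc p)) 0ᵍ _ _ π) (sym (pad (c (suc p)) _))))))))
    where
    pad : ∀ a x → a *ᵍ x ≡ a *ᵍ x +ᵍ 0ᵍ *ᵍ x
    pad = solve-∀ 𝔾-ring

  -- The interior product with the functional `φ`; `contract-wedge` is its Leibniz rule.
  contract : ∀ n → (ℕ → 𝔾) → Λ n → Λ n
  contract zero    φ x π           = 0ᵍ
  contract (suc n) φ x (false ∷ π) = φ 0 *ᵍ x (true ∷ π) +ᵍ contract n (φ ∘ suc) (λ σ → x (false ∷ σ)) π
  contract (suc n) φ x (true ∷ π)  = -1ᵍ *ᵍ contract n (φ ∘ suc) (λ σ → x (true ∷ σ)) π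

  contract-linear : ∀ n φ a b (x y : Λ n) π →
    contract n φ (λ σ → a *ᵍ x σ +ᵍ b *ᵍ y σ) π ≡ a *ᵍ contract n φ x π +ᵍ b *ᵍ contract n φ y π
  contract-linear zero    φ a b x y π           = 0≡lin a b
  contract-linear (suc n) φ a b x y (false ∷ π) =
    trans (cong (φ 0 *ᵍ (a *ᵍ x (true ∷ π) +ᵍ b *ᵍ y (true ∷ π)) +ᵍ_) (contract-linear n (φ ∘ suc) a b _ _ π))
          (lemma a b (φ 0) (x (true ∷ π)) (y (true ∷ π)) _ _)
    where
    lemma : ∀ a b r x y u v → r *ᵍ (a *ᵍ x +ᵍ b *ᵍ y) +ᵍ (a *ᵍ u +ᵍ b *ᵍ v)
          ≡ a *ᵍ (r *ᵍ x +ᵍ u) +ᵍ b *ᵍ (r *ᵍ y +ᵍ v)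
    lemma = solve-∀ 𝔾-ring
  contract-linear (suc n) φ a b x y (true ∷ π)  =
    trans (cong (-1ᵍ *ᵍ_) (contract-linear n (φ ∘ suc) a b _ _ π)) (lemma a b _ _)
    where
    lemma : ∀ a b u v → -ᵍ 1ᵍ *ᵍ (a *ᵍ u +ᵍ b *ᵍ v) ≡ a *ᵍ (-ᵍ 1ᵍ *ᵍ u) +ᵍ b *ᵍ (-ᵍ 1ᵍ *ᵍ v)
    lemma = solve-∀ 𝔾-ring

  contract-zero : ∀ n φ {x : Λ n} → (∀ σ → x σ ≡ 0ᵍ) → ∀ π → contract n φ x π ≡ 0ᵍ
  contract-zero zero    φ h π           = refl
  contract-zero (suc n) φ h (false ∷ π) =
    trans (cong₂ (λ a b → φ 0 *ᵍ a +ᵍ b) (h (true ∷ π)) (contract-zero n (φ ∘ suc) (λ σ → h (false ∷ σ)) π)) (lemma (φ 0))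
    where
    lemma : ∀ a → a *ᵍ 0ᵍ +ᵍ 0ᵍ ≡ 0ᵍ
    lemma = solve-∀ 𝔾-ring
  contract-zero (suc n) φ h (true ∷ π)  = cong (-1ᵍ *ᵍ_) (contract-zero n (φ ∘ suc) (λ σ → h (true ∷ σ)) π)

  contract-one : ∀ n φ π → contract n φ one π ≡ 0ᵍ
  contract-one zero    φ π           = refl
  contract-one (suc n) φ (false ∷ π) = trans (cong (φ 0 *ᵍ 0ᵍ +ᵍ_) (contract-one n (φ ∘ suc) π)) (lemma (φ 0))
    where
    lemma : ∀ a → a *ᵍ 0ᵍ +ᵍ 0ᵍ ≡ 0ᵍ
    lemma = solve-∀ 𝔾-ring
  contract-one (suc n) φ (true ∷ π)  = cong (-1ᵍ *ᵍ_) (contract-zero n (φ ∘ suc) (λ _ → refl) π)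

  pairing : ℕ → (ℕ → 𝔾) → (ℕ → 𝔾) → 𝔾
  pairing n φ r = sumᵍ n (λ i → φ i *ᵍ r i)

  contract-wedge : ∀ n φ r (x : Λ n) π →
    contract n φ (wedge n r x) π ≡ pairing n φ r *ᵍ x π +ᵍ -1ᵍ *ᵍ wedge n r (contract n φ x) π
  contract-wedge zero    φ r x π           = lemma (x π)
    where
    lemma : ∀ a → 0ᵍ ≡ 0ᵍ *ᵍ a +ᵍ -ᵍ 1ᵍ *ᵍ 0ᵍ
    lemma = solve-∀ 𝔾-ring
  contract-wedge (suc n) φ r x (false ∷ π) =
    trans (cong (φ 0 *ᵍ (r 0 *ᵍ x₀ π +ᵍ -1ᵍ *ᵍ R x₁ π) +ᵍ_) (contract-wedge n (φ ∘ suc) (r ∘ suc) x₀ π))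
      (trans (lemma (φ 0) (r 0) (x₀ π) (R x₁ π) (pairing n (φ ∘ suc) (r ∘ suc)) (R (C x₀) π))
        (cong (λ t → pairing (suc n) φ r *ᵍ x₀ π +ᵍ -1ᵍ *ᵍ t)
          (sym (trans (wedge-cong n (λ _ → refl) (λ σ → cong (φ 0 *ᵍ x₁ σ +ᵍ_) (one* (C x₀ σ))) π)
                      (wedge-linearʳ n (r ∘ suc) (φ 0) 1ᵍ x₁ (C x₀) π)))))
    where
    R C : Λ n → Λ n
    R = wedge n (r ∘ suc)
    C = contract n (φ ∘ suc)
    x₀ x₁ : Λ n
    x₀ σ = x (false ∷ σ)
    x₁ σ = x (true ∷ σ)
    lemma : ∀ f r a b s c → f *ᵍ (r *ᵍ a +ᵍ -ᵍ 1ᵍ *ᵍ b) +ᵍ (s *ᵍ a +ᵍ -ᵍ 1ᵍ *ᵍ c)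
          ≡ (f *ᵍ r +ᵍ s) *ᵍ a +ᵍ -ᵍ 1ᵍ *ᵍ (f *ᵍ b +ᵍ 1ᵍ *ᵍ c)
    lemma = solve-∀ 𝔾-ring
  contract-wedge (suc n) φ r x (true ∷ π)  =
    trans (cong (-1ᵍ *ᵍ_) (trans (contract-linear n (φ ∘ suc) (r 0) -1ᵍ x₀ (R x₁) π)
            (cong (λ t → r 0 *ᵍ C x₀ π +ᵍ -1ᵍ *ᵍ t) (contract-wedge n (φ ∘ suc) (r ∘ suc) x₁ π))))
      (trans (lemma (φ 0) (r 0) (x₁ π) (C x₀ π) (pairing n (φ ∘ suc) (r ∘ suc)) (R (C x₁) π))
        (cong (λ t → pairing (suc n) φ r *ᵍ x₁ π +ᵍ -1ᵍ *ᵍ (r 0 *ᵍ (φ 0 *ᵍ x₁ π +ᵍ C x₀ π) +ᵍ -1ᵍ *ᵍ t))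
          (sym (trans (wedge-cong n (λ _ → refl) (λ σ → pad (C x₁ σ)) π)
                      (wedge-linearʳ n (r ∘ suc) -1ᵍ 0ᵍ (C x₁) (C x₁) π)))))
    where
    R C : Λ n → Λ n
    R = wedge n (r ∘ suc)
    C = contract n (φ ∘ suc)
    x₀ x₁ : Λ n
    x₀ σ = x (false ∷ σ)
    x₁ σ = x (true ∷ σ)
    pad : ∀ a → -ᵍ 1ᵍ *ᵍ a ≡ -ᵍ 1ᵍ *ᵍ a +ᵍ 0ᵍ *ᵍ a
    pad = solve-∀ 𝔾-ring
    lemma : ∀ f r a b s c → -ᵍ 1ᵍ *ᵍ (r *ᵍ b +ᵍ -ᵍ 1ᵍ *ᵍ (s *ᵍ a +ᵍ -ᵍ 1ᵍ *ᵍ c))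
          ≡ (f *ᵍ r +ᵍ s) *ᵍ a +ᵍ -ᵍ 1ᵍ *ᵍ (r *ᵍ (f *ᵍ a +ᵍ b) +ᵍ -ᵍ 1ᵍ *ᵍ (-ᵍ 1ᵍ *ᵍ c +ᵍ 0ᵍ *ᵍ c))
    lemma = solve-∀ 𝔾-ring

  count : ∀ {n} → Vec Bool n → ℕ
  count []          = 0
  count (false ∷ π) = count π
  count (true ∷ π)  = suc (count π)

  count≤n : ∀ {n} (π : Vec Bool n) → count π ℕ.≤ n
  count≤n []          = z≤n
  count≤n (false ∷ π) = ℕ.m≤n⇒m≤1+n (count≤n π)
  count≤n (true ∷ π)  = s≤s (count≤n π)

  wedge-degree : ∀ n k r (x : Λ n) → (∀ π → count π ℕ.< k → x π ≡ 0ᵍ) →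
    ∀ π → count π ℕ.< suc k → wedge n r x π ≡ 0ᵍ
  wedge-degree zero    k       r x h π           _         = refl
  wedge-degree (suc n) k       r x h (false ∷ π) c         =
    wedge-degree n k (r ∘ suc) _ (λ σ → h (false ∷ σ)) π c
  wedge-degree (suc n) (suc k) r x h (true ∷ π)  (s≤s c)   =
    trans (cong₂ (λ a b → r 0 *ᵍ a +ᵍ -1ᵍ *ᵍ b) (h (false ∷ π) c)
                 (wedge-degree n k (r ∘ suc) _ (λ σ c′ → h (true ∷ σ) (s≤s c′)) π c)) (lemma (r 0))
    where
    lemma : ∀ a → a *ᵍ 0ᵍ +ᵍ -ᵍ 1ᵍ *ᵍ 0ᵍ ≡ 0ᵍ
    lemma = solve-∀ 𝔾-ring
  wedge-degree (suc n) zero    r x h (true ∷ π)  (s≤s ())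

  wedges-degree : ∀ n k rows π → count π ℕ.< k → wedges n k rows π ≡ 0ᵍ
  wedges-degree n (suc k) rows π c = wedge-degree n k (rows 0) _ (wedges-degree n k (rows ∘ suc)) π c

  -- The column operation is the map r ↦ r + φ(r) e on rows; on the exterior
  -- algebra it acts as x ↦ x + e ∧ (contraction of x with φ).

  unit : ℕ → ℕ → 𝔾
  unit p = update (λ _ → 0ᵍ) p 1ᵍ

  update-unit : ∀ (r : ℕ → 𝔾) p v i → update r p v i ≡ 1ᵍ *ᵍ r i +ᵍ (v -ᵍ r p) *ᵍ unit p i
  update-unit r zero    v zero    = lemma (r 0) v
    where
    lemma : ∀ a b → b ≡ 1ᵍ *ᵍ a +ᵍ (b -ᵍ a) *ᵍ 1ᵍ
    lemma = solve-∀ 𝔾-ring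
  update-unit r zero    v (suc i) = lemma (r (suc i)) (v -ᵍ r 0)
    where
    lemma : ∀ a b → a ≡ 1ᵍ *ᵍ a +ᵍ b *ᵍ 0ᵍ
    lemma = solve-∀ 𝔾-ring
  update-unit r (suc p) v zero    = lemma (r 0) (v -ᵍ r (suc p))
    where
    lemma : ∀ a b → a ≡ 1ᵍ *ᵍ a +ᵍ b *ᵍ 0ᵍ
    lemma = solve-∀ 𝔾-ring
  update-unit r (suc p) v (suc i) = update-unit (r ∘ suc) p v i

  private
    zero*ʳ : ∀ a → a *ᵍ 0ᵍ ≡ 0ᵍ
    zero*ʳ = solve-∀ 𝔾-ring

  pairing-unit : ∀ n φ p → p ℕ.< n → pairing n φ (unit p) ≡ φ p
  pairing-unit (suc n) φ zero    _         =
    trans (cong (φ 0 *ᵍ 1ᵍ +ᵍ_) (sumᵍ-zero n λ i _ → zero*ʳ (φ (suc i)))) (lemma (φ 0))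
    where
    lemma : ∀ a → a *ᵍ 1ᵍ +ᵍ 0ᵍ ≡ a
    lemma = solve-∀ 𝔾-ring
  pairing-unit (suc n) φ (suc p) (s≤s p<n) =
    trans (cong (φ 0 *ᵍ 0ᵍ +ᵍ_) (pairing-unit n (φ ∘ suc) p p<n)) (lemma (φ 0) (φ (suc p)))
    where
    lemma : ∀ a b → a *ᵍ 0ᵍ +ᵍ b ≡ b
    lemma = solve-∀ 𝔾-ring

  pairing-comm : ∀ n φ r → pairing n φ r ≡ pairing n r φ
  pairing-comm n φ r = sumᵍ-cong n λ i _ → comm (φ i) (r i)
    where
    comm : ∀ a b → a *ᵍ b ≡ b *ᵍ a
    comm = solve-∀ 𝔾-ring

  module ColumnOperation (n : ℕ) (c : ℕ → 𝔾) (p : ℕ) (p<n : p ℕ.< n) where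

    -- The functional `c` minus the `p`-th coordinate: adding `pairing n φ r` to entry `p` of `r`
    -- turns that entry into `pairing n c r`.
    φ : ℕ → 𝔾
    φ i = 1ᵍ *ᵍ c i +ᵍ -1ᵍ *ᵍ unit p i

    shear : (ℕ → 𝔾) → ℕ → 𝔾
    shear r = update r p (pairing n c r)

    pairing-φ : ∀ r → pairing n φ r ≡ pairing n c r -ᵍ r p
    pairing-φ r = begin
      pairing n φ r
        ≡⟨ sumᵍ-cong n (λ i _ → expand (c i) (unit p i) (r i)) ⟩
      sumᵍ n (λ i → 1ᵍ *ᵍ (c i *ᵍ r i) +ᵍ -1ᵍ *ᵍ (unit p i *ᵍ r i))
        ≡⟨ sumᵍ-linear n 1ᵍ -1ᵍ (λ i → c i *ᵍ r i) (λ i → unit p i *ᵍ r i) ⟩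
      1ᵍ *ᵍ pairing n c r +ᵍ -1ᵍ *ᵍ pairing n (unit p) r
        ≡⟨ cong (λ t → 1ᵍ *ᵍ pairing n c r +ᵍ -1ᵍ *ᵍ t) (trans (pairing-comm n (unit p) r) (pairing-unit n r p p<n)) ⟩
      1ᵍ *ᵍ pairing n c r +ᵍ -1ᵍ *ᵍ r p
        ≡⟨ tidy (pairing n c r) (r p) ⟩
      pairing n c r -ᵍ r p ∎
      where
      open ≡-Reasoning
      expand : ∀ a b r → (1ᵍ *ᵍ a +ᵍ -ᵍ 1ᵍ *ᵍ b) *ᵍ r ≡ 1ᵍ *ᵍ (a *ᵍ r) +ᵍ -ᵍ 1ᵍ *ᵍ (b *ᵍ r)
      expand = solve-∀ 𝔾-ring
      tidy : ∀ a b → 1ᵍ *ᵍ a +ᵍ -ᵍ 1ᵍ *ᵍ b ≡ a -ᵍ b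
      tidy = solve-∀ 𝔾-ring

    shear-row : ∀ r i → shear r i ≡ 1ᵍ *ᵍ r i +ᵍ pairing n φ r *ᵍ unit p i
    shear-row r i = trans (update-unit r p (pairing n c r) i)
      (cong (λ t → 1ᵍ *ᵍ r i +ᵍ t *ᵍ unit p i) (sym (pairing-φ r)))

    e∧ : Λ n → Λ n
    e∧ = wedge n (unit p)

    -- No terms of second order in `φ` appear, because they would contain `unit p` twice; this is
    -- what lets the induction close.
    shear-wedges : ∀ k rows π → wedges n k (λ j → shear (rows j)) π
      ≡ 1ᵍ *ᵍ wedges n k rows π +ᵍ 1ᵍ *ᵍ e∧ (contract n φ (wedges n k rows)) π
    shear-wedges zero    rows π = trans (pad (one π))
      (cong (λ t → 1ᵍ *ᵍ one π +ᵍ 1ᵍ *ᵍ t) (sym (wedge-zeroʳ n (unit p) (contract-one n φ) π)))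
      where
      pad : ∀ a → a ≡ 1ᵍ *ᵍ a +ᵍ 1ᵍ *ᵍ 0ᵍ
      pad = solve-∀ 𝔾-ring
    shear-wedges (suc k) rows π = begin
      wedge n (shear r) (wedges n k (λ j → shear (rows (suc j)))) π
        ≡⟨ wedge-cong n (shear-row r) (shear-wedges k (rows ∘ suc)) π ⟩
      wedge n (λ i → 1ᵍ *ᵍ r i +ᵍ s *ᵍ unit p i) (λ σ → 1ᵍ *ᵍ X σ +ᵍ 1ᵍ *ᵍ e∧ Y σ) π
        ≡⟨ wedge-linearˡ n 1ᵍ s r (unit p) _ π ⟩
      1ᵍ *ᵍ wedge n r (λ σ → 1ᵍ *ᵍ X σ +ᵍ 1ᵍ *ᵍ e∧ Y σ) π +ᵍ s *ᵍ e∧ (λ σ → 1ᵍ *ᵍ X σ +ᵍ 1ᵍ *ᵍ e∧ Y σ) π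
        ≡⟨ cong₂ (λ a b → 1ᵍ *ᵍ a +ᵍ s *ᵍ b)
             (trans (wedge-linearʳ n r 1ᵍ 1ᵍ X (e∧ Y) π)
                    (cong (λ t → 1ᵍ *ᵍ wedge n r X π +ᵍ 1ᵍ *ᵍ t) (wedge-anticomm n r (unit p) Y π)))
             (trans (wedge-linearʳ n (unit p) 1ᵍ 1ᵍ X (e∧ Y) π)
                    (cong (λ t → 1ᵍ *ᵍ e∧ X π +ᵍ 1ᵍ *ᵍ t) (wedge-square n (unit p) Y π))) ⟩
      1ᵍ *ᵍ (1ᵍ *ᵍ wedge n r X π +ᵍ 1ᵍ *ᵍ (-1ᵍ *ᵍ e∧ (wedge n r Y) π)) +ᵍ s *ᵍ (1ᵍ *ᵍ e∧ X π +ᵍ 1ᵍ *ᵍ 0ᵍ)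
        ≡⟨ lemma s (wedge n r X π) (e∧ (wedge n r Y) π) (e∧ X π) ⟩
      1ᵍ *ᵍ wedge n r X π +ᵍ 1ᵍ *ᵍ (s *ᵍ e∧ X π +ᵍ -1ᵍ *ᵍ e∧ (wedge n r Y) π)
        ≡⟨ cong (λ t → 1ᵍ *ᵍ wedge n r X π +ᵍ 1ᵍ *ᵍ t)
             (sym (trans (wedge-cong n (λ _ → refl) (contract-wedge n φ r X) π)
                         (wedge-linearʳ n (unit p) s -1ᵍ X (wedge n r Y) π))) ⟩
      1ᵍ *ᵍ wedge n r X π +ᵍ 1ᵍ *ᵍ e∧ (contract n φ (wedge n r X)) π ∎
      where
      open ≡-Reasoning
      r = rows 0
      s = pairing n φ r
      X Y : Λ n
      X = wedges n k (rows ∘ suc)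
      Y = contract n φ X
      lemma : ∀ s a b c → 1ᵍ *ᵍ (1ᵍ *ᵍ a +ᵍ 1ᵍ *ᵍ (-ᵍ 1ᵍ *ᵍ b)) +ᵍ s *ᵍ (1ᵍ *ᵍ c +ᵍ 1ᵍ *ᵍ 0ᵍ)
            ≡ 1ᵍ *ᵍ a +ᵍ 1ᵍ *ᵍ (s *ᵍ c +ᵍ -ᵍ 1ᵍ *ᵍ b)
      lemma = solve-∀ 𝔾-ring

    -- The element `e∧ X` has degree `n + 1` and vanishes. Contracting it with `φ`, the Leibniz rule
    -- evaluates the correction term as `φ(e)` times `X`, and `φ(e) = c p − 1`.
    column-operation : ∀ rows π → wedges n n (λ j → shear (rows j)) π ≡ c p *ᵍ wedges n n rows π
    column-operation rows π = trans (shear-wedges n rows π)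
      (trans (cong (λ t → 1ᵍ *ᵍ X π +ᵍ 1ᵍ *ᵍ t) top) (lemma (c p) (X π)))
      where
      X : Λ n
      X = wedges n n rows
      e∧X≡0 : ∀ π → e∧ X π ≡ 0ᵍ
      e∧X≡0 π = wedge-degree n n (unit p) X (wedges-degree n n rows) π (s≤s (count≤n π))
      unit-pp : ∀ p → unit p p ≡ 1ᵍ
      unit-pp zero    = refl
      unit-pp (suc p) = unit-pp p
      φ-unit : pairing n φ (unit p) ≡ 1ᵍ *ᵍ c p +ᵍ -1ᵍ *ᵍ 1ᵍ
      φ-unit = trans (pairing-unit n φ p p<n) (cong (λ t → 1ᵍ *ᵍ c p +ᵍ -1ᵍ *ᵍ t) (unit-pp p))
      subtract-zero : ∀ a → a -ᵍ 0ᵍ ≡ a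
      subtract-zero = solve-∀ 𝔾-ring
      solve-for : ∀ a x w → 0ᵍ ≡ a *ᵍ x +ᵍ -1ᵍ *ᵍ w → w ≡ a *ᵍ x
      solve-for a x w e = trans (rearranged a x w)
        (trans (cong (λ t → a *ᵍ x -ᵍ t) (sym e)) (subtract-zero (a *ᵍ x)))
        where
        rearranged : ∀ a x w → w ≡ a *ᵍ x -ᵍ (a *ᵍ x +ᵍ -ᵍ 1ᵍ *ᵍ w)
        rearranged = solve-∀ 𝔾-ring
      top : e∧ (contract n φ X) π ≡ (1ᵍ *ᵍ c p +ᵍ -1ᵍ *ᵍ 1ᵍ) *ᵍ X π
      top = trans (solve-for (pairing n φ (unit p)) (X π) _
              (trans (sym (contract-zero n φ e∧X≡0 π)) (contract-wedge n φ (unit p) X π)))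
            (cong (_*ᵍ X π) φ-unit)
      lemma : ∀ c x → 1ᵍ *ᵍ x +ᵍ 1ᵍ *ᵍ ((1ᵍ *ᵍ c +ᵍ -ᵍ 1ᵍ *ᵍ 1ᵍ) *ᵍ x) ≡ c *ᵍ x
      lemma = solve-∀ 𝔾-ring

  sumℚ prodℚ : ℕ → (ℕ → ℚ) → ℚ
  sumℚ zero    f = 0ℚ
  sumℚ (suc n) f = f 0 + sumℚ n (f ∘ suc)
  prodℚ zero    f = 1ℚ
  prodℚ (suc n) f = f 0 * prodℚ n (f ∘ suc)

  sumℚ-nonNeg : ∀ n {f : ℕ → ℚ} → (∀ i → 0ℚ ≤ f i) → 0ℚ ≤ sumℚ n f
  sumℚ-nonNeg zero    h = ℚ.≤-refl
  sumℚ-nonNeg (suc n) h = +-nonNeg (h 0) (sumℚ-nonNeg n (h ∘ suc))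

  prodℚ-nonNeg : ∀ n {f : ℕ → ℚ} → (∀ i → 0ℚ ≤ f i) → 0ℚ ≤ prodℚ n f
  prodℚ-nonNeg zero    h = 0≤1
  prodℚ-nonNeg (suc n) h = *-nonNeg (h 0) (prodℚ-nonNeg n (h ∘ suc))

  -- A weighted ℓ¹ norm, in which generator `i` has weight `κ i`. Multiplication by a vector
  -- increases it at most by the factor `rowNorm`, so that determinants are estimated by products of
  -- row norms without a sum over permutations.
  norm : ∀ n → (ℕ → ℚ) → Λ n → ℚ
  norm zero    κ x = ‖ x [] ‖
  norm (suc n) κ x = norm n (κ ∘ suc) (λ σ → x (false ∷ σ)) + κ 0 * norm n (κ ∘ suc) (λ σ → x (true ∷ σ))

  rowNorm : ℕ → (ℕ → ℚ) → (ℕ → 𝔾) → ℚ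
  rowNorm n κ r = sumℚ n (λ i → κ i * ‖ r i ‖)

  norm-nonNeg : ∀ n κ → (∀ i → 0ℚ ≤ κ i) → ∀ x → 0ℚ ≤ norm n κ x
  norm-nonNeg zero    κ κ≥0 x = ‖‖-nonNeg (x [])
  norm-nonNeg (suc n) κ κ≥0 x =
    +-nonNeg (norm-nonNeg n (κ ∘ suc) (κ≥0 ∘ suc) _) (*-nonNeg (κ≥0 0) (norm-nonNeg n (κ ∘ suc) (κ≥0 ∘ suc) _))

  rowNorm-nonNeg : ∀ n κ → (∀ i → 0ℚ ≤ κ i) → ∀ r → 0ℚ ≤ rowNorm n κ r
  rowNorm-nonNeg n κ κ≥0 r = sumℚ-nonNeg n λ i → *-nonNeg (κ≥0 i) (‖‖-nonNeg (r i))

  norm-linear : ∀ n κ → (∀ i → 0ℚ ≤ κ i) → ∀ a (x y : Λ n) →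
    norm n κ (λ σ → a *ᵍ x σ +ᵍ -1ᵍ *ᵍ y σ) ≤ ‖ a ‖ * norm n κ x + norm n κ y
  norm-linear zero    κ κ≥0 a x y = ℚ.≤-trans (‖+‖ (a *ᵍ x []) (-1ᵍ *ᵍ y []))
    (ℚ.+-mono-≤ (‖*‖ a (x [])) (ℚ.≤-reflexive (trans (cong ‖_‖ (minus (y []))) (‖neg‖ (y [])))))
    where
    minus : ∀ b → -ᵍ 1ᵍ *ᵍ b ≡ -ᵍ b
    minus = solve-∀ 𝔾-ring
  norm-linear (suc n) κ κ≥0 a x y = ℚ.≤-trans
    (ℚ.+-mono-≤ (norm-linear n (κ ∘ suc) (κ≥0 ∘ suc) a _ _)
                (*-monoʳ (κ≥0 0) (norm-linear n (κ ∘ suc) (κ≥0 ∘ suc) a _ _)))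
    (ℚ.≤-reflexive (lemma (‖ a ‖) (κ 0) _ _ _ _))
    where
    lemma : ∀ a k x y u v → a * x + y + k * (a * u + v) ≡ a * (x + k * u) + (y + k * v)
    lemma = solve-∀ ℚ-ring

  norm-wedge : ∀ n κ → (∀ i → 0ℚ ≤ κ i) → ∀ r x → norm n κ (wedge n r x) ≤ rowNorm n κ r * norm n κ x
  norm-wedge zero    κ κ≥0 r x = ℚ.≤-reflexive (trans ‖0‖ (sym (ℚ.*-zeroˡ (‖ x [] ‖))))
  norm-wedge (suc n) κ κ≥0 r x = begin
    norm n κ′ (wedge n r′ x₀) + κ 0 * norm n κ′ (λ σ → r 0 *ᵍ x₀ σ +ᵍ -1ᵍ *ᵍ wedge n r′ x₁ σ)
      ≤⟨ ℚ.+-mono-≤ (norm-wedge n κ′ κ′≥0 r′ x₀) (*-monoʳ (κ≥0 0) (ℚ.≤-trans (norm-linear n κ′ κ′≥0 (r 0) x₀ (wedge n r′ x₁))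
           (ℚ.+-monoʳ-≤ (‖ r 0 ‖ * N x₀) (norm-wedge n κ′ κ′≥0 r′ x₁)))) ⟩
    R * N x₀ + κ 0 * (‖ r 0 ‖ * N x₀ + R * N x₁)
      -- The added term completes the product of the two norms; it stands for the contribution that
      -- `e₀ ∧ e₀ = 0` removes.
      ≤⟨ ≤-+ʳ (*-nonNeg (*-nonNeg (κ≥0 0) (κ≥0 0)) (*-nonNeg (‖‖-nonNeg (r 0)) (norm-nonNeg n κ′ κ′≥0 x₁))) ⟩
    R * N x₀ + κ 0 * (‖ r 0 ‖ * N x₀ + R * N x₁) + κ 0 * κ 0 * (‖ r 0 ‖ * N x₁)
      ≡⟨ lemma R (κ 0) (‖ r 0 ‖) (N x₀) (N x₁) ⟩
    (κ 0 * ‖ r 0 ‖ + R) * (N x₀ + κ 0 * N x₁) ∎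
    where
    open ℚ.≤-Reasoning
    κ′ = κ ∘ suc
    r′ = r ∘ suc
    κ′≥0 = κ≥0 ∘ suc
    R = rowNorm n κ′ r′
    x₀ x₁ : Λ n
    x₀ σ = x (false ∷ σ)
    x₁ σ = x (true ∷ σ)
    N : Λ n → ℚ
    N = norm n κ′
    lemma : ∀ R k a x y → R * x + k * (a * x + R * y) + k * k * (a * y) ≡ (k * a + R) * (x + k * y)
    lemma = solve-∀ ℚ-ring

  norm-zero : ∀ n κ → norm n κ (λ _ → 0ᵍ) ≡ 0ℚ
  norm-zero zero    κ = ‖0‖
  norm-zero (suc n) κ = trans (cong₂ (λ a b → a + κ 0 * b) (norm-zero n (κ ∘ suc)) (norm-zero n (κ ∘ suc))) (lemma (κ 0))
    where
    lemma : ∀ k → 0ℚ + k * 0ℚ ≡ 0ℚ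
    lemma = solve-∀ ℚ-ring

  norm-one : ∀ n κ → norm n κ one ≡ 1ℚ
  norm-one zero    κ = ‖1‖
  norm-one (suc n) κ = trans (cong₂ (λ a b → a + κ 0 * b) (norm-one n (κ ∘ suc)) (norm-zero n (κ ∘ suc))) (lemma (κ 0))
    where
    lemma : ∀ k → 1ℚ + k * 0ℚ ≡ 1ℚ
    lemma = solve-∀ ℚ-ring

  norm-top : ∀ n κ → (∀ i → 0ℚ ≤ κ i) → ∀ x → prodℚ n κ * ‖ x (replicate n true) ‖ ≤ norm n κ x
  norm-top zero    κ κ≥0 x = ℚ.≤-reflexive (ℚ.*-identityˡ _)
  norm-top (suc n) κ κ≥0 x = ℚ.≤-trans
    (ℚ.≤-reflexive (ℚ.*-assoc (κ 0) _ _))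
    (ℚ.≤-trans (*-monoʳ (κ≥0 0) (norm-top n (κ ∘ suc) (κ≥0 ∘ suc) (λ σ → x (true ∷ σ))))
               (≤-+ˡ (norm-nonNeg n (κ ∘ suc) (κ≥0 ∘ suc) _)))

  norm-wedges : ∀ n κ → (∀ i → 0ℚ ≤ κ i) → ∀ k rows →
    norm n κ (wedges n k rows) ≤ prodℚ k (λ j → rowNorm n κ (rows j))
  norm-wedges n κ κ≥0 zero    rows = ℚ.≤-reflexive (norm-one n κ)
  norm-wedges n κ κ≥0 (suc k) rows = ℚ.≤-trans (norm-wedge n κ κ≥0 (rows 0) _)
    (*-monoʳ (rowNorm-nonNeg n κ κ≥0 (rows 0)) (norm-wedges n κ κ≥0 k (rows ∘ suc)))

  det-bound : ∀ n κ → (∀ i → 0ℚ ≤ κ i) → ∀ rows →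
    prodℚ n κ * ‖ det n rows ‖ ≤ prodℚ n (λ j → rowNorm n κ (rows j))
  det-bound n κ κ≥0 rows = ℚ.≤-trans (norm-top n κ κ≥0 (wedges n n rows)) (norm-wedges n κ κ≥0 n rows)

  prodℚ-* : ∀ n f g → prodℚ n f * prodℚ n g ≡ prodℚ n (λ i → f i * g i)
  prodℚ-* zero    f g = refl
  prodℚ-* (suc n) f g = trans (lemma (f 0) _ (g 0) _) (cong (f 0 * g 0 *_) (prodℚ-* n (f ∘ suc) (g ∘ suc)))
    where
    lemma : ∀ a b c d → a * b * (c * d) ≡ a * c * (b * d)
    lemma = solve-∀ ℚ-ring

  prodℚ-bound : ∀ n {f B} → (∀ i → 0ℚ ≤ f i) → (∀ i → i ℕ.< n → f i ≤ B) → prodℚ n f ≤ B ^ n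
  prodℚ-bound zero    f≥0 f≤B = ℚ.≤-refl
  prodℚ-bound (suc n) f≥0 f≤B = *-mono (prodℚ-nonNeg n (f≥0 ∘ suc)) (ℚ.≤-trans (f≥0 0) (f≤B 0 (s≤s z≤n)))
    (f≤B 0 (s≤s z≤n)) (prodℚ-bound n (f≥0 ∘ suc) λ i i<n → f≤B (suc i) (s≤s i<n))

  prodℚ-one : ∀ n → prodℚ n (λ _ → 1ℚ) ≡ 1ℚ
  prodℚ-one zero    = refl
  prodℚ-one (suc n) = trans (ℚ.*-identityˡ _) (prodℚ-one n)

  prodℚ-spike : ∀ n p a → p ℕ.< n → prodℚ n (update (λ _ → 1ℚ) p a) ≡ a
  prodℚ-spike (suc n) zero    a _         = trans (cong (a *_) (prodℚ-one n)) (ℚ.*-identityʳ a)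
  prodℚ-spike (suc n) (suc p) a (s≤s p<n) = trans (ℚ.*-identityˡ _) (prodℚ-spike n p a p<n)

  -- The weights rescale rows (`μ`) and columns (`κ`), so that matrices whose entries have very
  -- different sizes can be brought to one common bound before the determinant is estimated.
  det-weighted : ∀ n κ μ B → (∀ i → 0ℚ ≤ κ i) → (∀ i → 0ℚ ≤ μ i) → ∀ rows →
    (∀ j → j ℕ.< n → μ j * rowNorm n κ (rows j) ≤ B) →
    prodℚ n μ * prodℚ n κ * ‖ det n rows ‖ ≤ B ^ n
  det-weighted n κ μ B κ≥0 μ≥0 rows h = begin
    prodℚ n μ * prodℚ n κ * ‖ det n rows ‖  ≡⟨ ℚ.*-assoc (prodℚ n μ) (prodℚ n κ) _ ⟩
    prodℚ n μ * (prodℚ n κ * ‖ det n rows ‖)  ≤⟨ *-monoʳ (prodℚ-nonNeg n μ≥0) (det-bound n κ κ≥0 rows) ⟩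
    prodℚ n μ * prodℚ n (λ j → rowNorm n κ (rows j))  ≡⟨ prodℚ-* n μ _ ⟩
    prodℚ n (λ j → μ j * rowNorm n κ (rows j))  ≤⟨ prodℚ-bound n (λ j → *-nonNeg (μ≥0 j) (rowNorm-nonNeg n κ κ≥0 (rows j))) h ⟩
    B ^ n  ∎
    where open ℚ.≤-Reasoning

  IsInteger : 𝔾 → Set
  IsInteger z = ∃ λ a → z ≡ real (fromℤ a)

  int-+ : ∀ {x y} → IsInteger x → IsInteger y → IsInteger (x +ᵍ y)
  int-+ (a , refl) (b , refl) = a ℤ.+ b , cong real (sym (fromℤ-+ a b))

  int-* : ∀ {x y} → IsInteger x → IsInteger y → IsInteger (x *ᵍ y)
  int-* (a , refl) (b , refl) = a ℤ.* b , trans (sym (real-* (fromℤ a) (fromℤ b))) (cong real (sym (fromℤ-* a b)))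

  wedge-int : ∀ n r (x : Λ n) → (∀ i → IsInteger (r i)) → (∀ σ → IsInteger (x σ)) → ∀ π → IsInteger (wedge n r x π)
  wedge-int zero    r x hr hx π           = ℤ.+ 0 , refl
  wedge-int (suc n) r x hr hx (false ∷ π) = wedge-int n (r ∘ suc) _ (hr ∘ suc) (λ σ → hx (false ∷ σ)) π
  wedge-int (suc n) r x hr hx (true ∷ π)  = int-+ (int-* (hr 0) (hx (false ∷ π)))
    (int-* (ℤ.-[1+ 0 ] , refl) (wedge-int n (r ∘ suc) _ (hr ∘ suc) (λ σ → hx (true ∷ σ)) π))

  wedges-int : ∀ n k rows → (∀ j i → IsInteger (rows j i)) → ∀ π → IsInteger (wedges n k rows π)
  wedges-int n zero    rows h π = one-int π
    where
    one-int : ∀ {n} (π : Vec Bool n) → IsInteger (one π)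
    one-int []          = ℤ.+ 1 , refl
    one-int (false ∷ π) = one-int π
    one-int (true ∷ π)  = ℤ.+ 0 , refl
  wedges-int n (suc k) rows h π = wedge-int n (rows 0) _ (h 0) (wedges-int n k (rows ∘ suc) (h ∘ suc)) π

  det-int : ∀ n rows → (∀ j i → IsInteger (rows j i)) → IsInteger (det n rows)
  det-int n rows h = wedges-int n n rows h (replicate n true)

-- Coefficient sequences, divided differences and Bezoutians

module Polynomials where
  open import Data.Rational.Base using (_+_; _*_; _≤_; _<_)
  open import Tactic.RingSolver using (solve-∀)
  open Rationals
  open Gaussian
  open ExteriorAlgebra

  -- A polynomial is its coefficient sequence; the length is given separately.

  eval : ℕ → (ℕ → 𝔾) → 𝔾 → 𝔾
  eval zero    p z = 0ᵍ
  eval (suc n) p z = p 0 +ᵍ z *ᵍ eval n (p ∘ suc) z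

  Below : {A : Set} → A → ℕ → (ℕ → A) → Set
  Below o n p = ∀ i → n ℕ.≤ i → p i ≡ o

  below-tail : {A : Set} {o : A} → ∀ n {p} → Below o (suc n) p → Below o n (p ∘ suc)
  below-tail n h i n≤i = h (suc i) (s≤s n≤i)

  eval-cong : ∀ n {p q : ℕ → 𝔾} → (∀ i → i ℕ.< n → p i ≡ q i) → ∀ z → eval n p z ≡ eval n q z
  eval-cong zero    e z = refl
  eval-cong (suc n) e z = cong₂ (λ a b → a +ᵍ z *ᵍ b) (e 0 (s≤s z≤n)) (eval-cong n (λ i i<n → e (suc i) (s≤s i<n)) z)

  private
    lin0 : ∀ a b → 0ᵍ ≡ a *ᵍ 0ᵍ +ᵍ b *ᵍ 0ᵍ
    lin0 = solve-∀ 𝔾-ring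
    linE : ∀ a b z p q u v → a *ᵍ p +ᵍ b *ᵍ q +ᵍ z *ᵍ (a *ᵍ u +ᵍ b *ᵍ v)
         ≡ a *ᵍ (p +ᵍ z *ᵍ u) +ᵍ b *ᵍ (q +ᵍ z *ᵍ v)
    linE = solve-∀ 𝔾-ring

  eval-linear : ∀ n a b (p q : ℕ → 𝔾) z →
    eval n (λ i → a *ᵍ p i +ᵍ b *ᵍ q i) z ≡ a *ᵍ eval n p z +ᵍ b *ᵍ eval n q z
  eval-linear zero    a b p q z = lin0 a b
  eval-linear (suc n) a b p q z =
    trans (cong (λ t → a *ᵍ p 0 +ᵍ b *ᵍ q 0 +ᵍ z *ᵍ t) (eval-linear n a b (p ∘ suc) (q ∘ suc) z))
          (linE a b z (p 0) (q 0) _ _)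

  eval-zero : ∀ n {p : ℕ → 𝔾} → (∀ i → i ℕ.< n → p i ≡ 0ᵍ) → ∀ z → eval n p z ≡ 0ᵍ
  eval-zero zero    h z = refl
  eval-zero (suc n) h z = trans (cong₂ (λ a b → a +ᵍ z *ᵍ b) (h 0 (s≤s z≤n)) (eval-zero n (λ i i<n → h (suc i) (s≤s i<n)) z)) (lemma z)
    where
    lemma : ∀ z → 0ᵍ +ᵍ z *ᵍ 0ᵍ ≡ 0ᵍ
    lemma = solve-∀ 𝔾-ring

  eval-extend : ∀ {n m} → n ℕ.≤ m → ∀ {p} → Below 0ᵍ n p → ∀ z → eval m p z ≡ eval n p z
  eval-extend {m = m} z≤n h z = eval-zero m (λ i _ → h i z≤n) z
  eval-extend (s≤s n≤m) {p} h z = cong (λ t → p 0 +ᵍ z *ᵍ t) (eval-extend n≤m (below-tail _ h) z)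

  eval-as-sum : ∀ n p z → eval n p z ≡ sumᵍ n (λ i → z ^ᵍ i *ᵍ p i)
  eval-as-sum zero    p z = refl
  eval-as-sum (suc n) p z = cong₂ _+ᵍ_ (one* (p 0)) (begin
    z *ᵍ eval n (p ∘ suc) z  ≡⟨ cong (z *ᵍ_) (eval-as-sum n (p ∘ suc) z) ⟩
    z *ᵍ sumᵍ n (λ i → z ^ᵍ i *ᵍ p (suc i))  ≡⟨ pad z _ ⟩
    z *ᵍ S +ᵍ 0ᵍ *ᵍ S  ≡⟨ sym (sumᵍ-linear n z 0ᵍ f f) ⟩
    sumᵍ n (λ i → z *ᵍ f i +ᵍ 0ᵍ *ᵍ f i)  ≡⟨ sumᵍ-cong n (λ i _ → assoc z (z ^ᵍ i) (p (suc i))) ⟩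
    sumᵍ n (λ i → z *ᵍ z ^ᵍ i *ᵍ p (suc i))  ∎)
    where
    open ≡-Reasoning
    f : ℕ → 𝔾
    f i = z ^ᵍ i *ᵍ p (suc i)
    S = sumᵍ n f
    one* : ∀ t → t ≡ 1ᵍ *ᵍ t
    one* = solve-∀ 𝔾-ring
    pad : ∀ a b → a *ᵍ b ≡ a *ᵍ b +ᵍ 0ᵍ *ᵍ b
    pad = solve-∀ 𝔾-ring
    assoc : ∀ a b c → a *ᵍ (b *ᵍ c) +ᵍ 0ᵍ *ᵍ (b *ᵍ c) ≡ a *ᵍ b *ᵍ c
    assoc = solve-∀ 𝔾-ring

  shift : {A : Set} → ℕ → (ℕ → A) → ℕ → A
  shift j p i = p (j ℕ.+ i)

  eval-split : ∀ j n p z → eval (j ℕ.+ n) p z ≡ eval j p z +ᵍ z ^ᵍ j *ᵍ eval n (shift j p) z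
  eval-split zero    n p z = lemma _
    where
    lemma : ∀ a → a ≡ 0ᵍ +ᵍ 1ᵍ *ᵍ a
    lemma = solve-∀ 𝔾-ring
  eval-split (suc j) n p z = trans (cong (λ t → p 0 +ᵍ z *ᵍ t) (eval-split j n (p ∘ suc) z)) (lemma (p 0) z _ _ _)
    where
    lemma : ∀ p z a b c → p +ᵍ z *ᵍ (a +ᵍ b *ᵍ c) ≡ p +ᵍ z *ᵍ a +ᵍ z *ᵍ b *ᵍ c
    lemma = solve-∀ 𝔾-ring

  module Convolution {R : Set} (_⊹ᵣ_ _*ᵣ_ : R → R → R) where
    conv : (ℕ → R) → (ℕ → R) → ℕ → R
    conv p q zero    = p 0 *ᵣ q 0
    conv p q (suc k) = (p 0 *ᵣ q (suc k)) ⊹ᵣ conv (p ∘ suc) q k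

  open Convolution _+_ _*_ public using () renaming (conv to convℚ)
  open Convolution _+ᵍ_ _*ᵍ_ public using () renaming (conv to convᵍ)

  real-conv : ∀ p q k → real (convℚ p q k) ≡ convᵍ (real ∘ p) (real ∘ q) k
  real-conv p q zero    = real-* (p 0) (q 0)
  real-conv p q (suc k) = cong₂ _+ᵍ_ (real-* (p 0) (q (suc k))) (real-conv (p ∘ suc) q k)

  convᵍ-zero : ∀ {p q : ℕ → 𝔾} → (∀ i → p i ≡ 0ᵍ) → ∀ k → convᵍ p q k ≡ 0ᵍ
  convᵍ-zero {q = q} h zero    = trans (cong (_*ᵍ q 0) (h 0)) (zero* _)
    where
    zero* : ∀ t → 0ᵍ *ᵍ t ≡ 0ᵍ
    zero* = solve-∀ 𝔾-ring
  convᵍ-zero {q = q} h (suc k) = trans (cong₂ (λ a b → a *ᵍ q (suc k) +ᵍ b) (h 0) (convᵍ-zero (h ∘ suc) k)) (lemma _)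
    where
    lemma : ∀ t → 0ᵍ *ᵍ t +ᵍ 0ᵍ ≡ 0ᵍ
    lemma = solve-∀ 𝔾-ring

  eval-conv : ∀ a b p q → Below 0ᵍ a p → Below 0ᵍ b q → ∀ z →
    eval (a ℕ.+ b) (convᵍ p q) z ≡ eval a p z *ᵍ eval b q z
  eval-conv zero    b p q hp hq z = trans (eval-zero b (λ i _ → convᵍ-zero {q = q} (λ i → hp i z≤n) i) z) (lemma _)
    where
    lemma : ∀ t → 0ᵍ ≡ 0ᵍ *ᵍ t
    lemma = solve-∀ 𝔾-ring
  eval-conv (suc a) b p q hp hq z = begin
    p 0 *ᵍ q 0 +ᵍ z *ᵍ eval (a ℕ.+ b) (λ k → p 0 *ᵍ q (suc k) +ᵍ convᵍ (p ∘ suc) q k) z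
      ≡⟨ cong (λ t → p 0 *ᵍ q 0 +ᵍ z *ᵍ t) (trans (eval-cong (a ℕ.+ b) (λ i _ → cong (p 0 *ᵍ q (suc i) +ᵍ_) (one* _)) z)
           (trans (eval-linear (a ℕ.+ b) (p 0) 1ᵍ (q ∘ suc) (convᵍ (p ∘ suc) q) z)
             (cong (λ t → p 0 *ᵍ eval (a ℕ.+ b) (q ∘ suc) z +ᵍ 1ᵍ *ᵍ t) (eval-conv a b (p ∘ suc) q (below-tail a hp) hq z)))) ⟩
    p 0 *ᵍ q 0 +ᵍ z *ᵍ (p 0 *ᵍ eval (a ℕ.+ b) (q ∘ suc) z +ᵍ 1ᵍ *ᵍ (P *ᵍ eval b q z))
      ≡⟨ lemma (p 0) (q 0) z _ P (eval b q z) ⟩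
    p 0 *ᵍ eval (suc (a ℕ.+ b)) q z +ᵍ z *ᵍ P *ᵍ eval b q z
      ≡⟨ cong (λ t → p 0 *ᵍ t +ᵍ z *ᵍ P *ᵍ eval b q z) (eval-extend (ℕ.m≤n+m b (suc a)) hq z) ⟩
    p 0 *ᵍ eval b q z +ᵍ z *ᵍ P *ᵍ eval b q z
      ≡⟨ collect (p 0) (z *ᵍ P) (eval b q z) ⟩
    (p 0 +ᵍ z *ᵍ P) *ᵍ eval b q z ∎
    where
    open ≡-Reasoning
    P = eval a (p ∘ suc) z
    one* : ∀ t → t ≡ 1ᵍ *ᵍ t
    one* = solve-∀ 𝔾-ring
    lemma : ∀ p q z s P e → p *ᵍ q +ᵍ z *ᵍ (p *ᵍ s +ᵍ 1ᵍ *ᵍ (P *ᵍ e)) ≡ p *ᵍ (q +ᵍ z *ᵍ s) +ᵍ z *ᵍ P *ᵍ e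
    lemma = solve-∀ 𝔾-ring
    collect : ∀ a b e → a *ᵍ e +ᵍ b *ᵍ e ≡ (a +ᵍ b) *ᵍ e
    collect = solve-∀ 𝔾-ring

  -- divided differences: divided is p[x,y] and divided₂ is p[x,x,y]

  divided divided₂ : ℕ → (ℕ → 𝔾) → 𝔾 → 𝔾 → 𝔾
  divided zero    p x y = 0ᵍ
  divided (suc n) p x y = eval n (p ∘ suc) y +ᵍ x *ᵍ divided n (p ∘ suc) x y
  divided₂ zero    p x y = 0ᵍ
  divided₂ (suc n) p x y = divided n (p ∘ suc) x y +ᵍ x *ᵍ divided₂ n (p ∘ suc) x y

  eval-difference : ∀ n p x y → eval n p y -ᵍ eval n p x ≡ (y -ᵍ x) *ᵍ divided n p x y
  eval-difference zero    p x y = lemma x y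
    where
    lemma : ∀ x y → 0ᵍ -ᵍ 0ᵍ ≡ (y -ᵍ x) *ᵍ 0ᵍ
    lemma = solve-∀ 𝔾-ring
  eval-difference (suc n) p x y = trans (lemma (p 0) x y _ _)
    (trans (cong (λ t → (y -ᵍ x) *ᵍ eval n (p ∘ suc) y +ᵍ x *ᵍ t) (eval-difference n (p ∘ suc) x y)) (collect x y _ _))
    where
    lemma : ∀ p x y a b → p +ᵍ y *ᵍ a -ᵍ (p +ᵍ x *ᵍ b) ≡ (y -ᵍ x) *ᵍ a +ᵍ x *ᵍ (a -ᵍ b)
    lemma = solve-∀ 𝔾-ring
    collect : ∀ x y a d → (y -ᵍ x) *ᵍ a +ᵍ x *ᵍ ((y -ᵍ x) *ᵍ d) ≡ (y -ᵍ x) *ᵍ (a +ᵍ x *ᵍ d)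
    collect = solve-∀ 𝔾-ring

  divided-difference : ∀ n p x y → divided n p x y -ᵍ divided n p x x ≡ (y -ᵍ x) *ᵍ divided₂ n p x y
  divided-difference zero    p x y = lemma x y
    where
    lemma : ∀ x y → 0ᵍ -ᵍ 0ᵍ ≡ (y -ᵍ x) *ᵍ 0ᵍ
    lemma = solve-∀ 𝔾-ring
  divided-difference (suc n) p x y = trans (lemma x (eval n (p ∘ suc) y) (eval n (p ∘ suc) x) _ _)
    (trans (cong₂ (λ s t → s +ᵍ x *ᵍ t) (eval-difference n (p ∘ suc) x y) (divided-difference n (p ∘ suc) x y)) (collect x y _ _))
    where
    lemma : ∀ x a b c d → a +ᵍ x *ᵍ c -ᵍ (b +ᵍ x *ᵍ d) ≡ a -ᵍ b +ᵍ x *ᵍ (c -ᵍ d)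
    lemma = solve-∀ 𝔾-ring
    collect : ∀ x y a d → (y -ᵍ x) *ᵍ a +ᵍ x *ᵍ ((y -ᵍ x) *ᵍ d) ≡ (y -ᵍ x) *ᵍ (a +ᵍ x *ᵍ d)
    collect = solve-∀ 𝔾-ring

  derivative : (ℕ → 𝔾) → ℕ → 𝔾
  derivative p i = real (fromℕ (suc i)) *ᵍ p (suc i)

  eval-derivative : ∀ n p x → eval n (derivative p) x ≡ divided (suc n) p x x
  eval-derivative zero    p x = lemma x
    where
    lemma : ∀ x → 0ᵍ ≡ 0ᵍ +ᵍ x *ᵍ 0ᵍ
    lemma = solve-∀ 𝔾-ring
  eval-derivative (suc n) p x = begin
    derivative p 0 +ᵍ x *ᵍ eval n (derivative p ∘ suc) x
      ≡⟨ cong (λ t → derivative p 0 +ᵍ x *ᵍ t) (trans (eval-cong n (λ i _ → split i) x)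
           (eval-linear n 1ᵍ 1ᵍ (p ∘ suc ∘ suc) (derivative (p ∘ suc)) x)) ⟩
    1ᵍ *ᵍ p 1 +ᵍ x *ᵍ (1ᵍ *ᵍ eval n (p ∘ suc ∘ suc) x +ᵍ 1ᵍ *ᵍ eval n (derivative (p ∘ suc)) x)
      ≡⟨ lemma (p 1) x _ _ ⟩
    p 1 +ᵍ x *ᵍ eval n (p ∘ suc ∘ suc) x +ᵍ x *ᵍ eval n (derivative (p ∘ suc)) x
      ≡⟨ cong (λ t → p 1 +ᵍ x *ᵍ eval n (p ∘ suc ∘ suc) x +ᵍ x *ᵍ t) (eval-derivative n (p ∘ suc) x) ⟩
    p 1 +ᵍ x *ᵍ eval n (p ∘ suc ∘ suc) x +ᵍ x *ᵍ divided (suc n) (p ∘ suc) x x ∎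
    where
    open ≡-Reasoning
    lemma : ∀ p x a b → 1ᵍ *ᵍ p +ᵍ x *ᵍ (1ᵍ *ᵍ a +ᵍ 1ᵍ *ᵍ b) ≡ p +ᵍ x *ᵍ a +ᵍ x *ᵍ b
    lemma = solve-∀ 𝔾-ring
    distribute : ∀ a b c → (a +ᵍ b) *ᵍ c ≡ a *ᵍ c +ᵍ 1ᵍ *ᵍ (b *ᵍ c)
    distribute = solve-∀ 𝔾-ring
    split : ∀ i → derivative p (suc i) ≡ 1ᵍ *ᵍ p (suc (suc i)) +ᵍ 1ᵍ *ᵍ derivative (p ∘ suc) i
    split i = trans (cong (_*ᵍ p (suc (suc i))) (cong real (fromℕ-+ 1 (suc i)))) (distribute 1ᵍ (real (fromℕ (suc i))) (p (suc (suc i))))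

  -- The inner values are the coefficients of `(p(X) − p(x)) / (X − x)`, and the value of this
  -- quotient at `X = x` is the derivative.
  divided-shifts : ∀ n p x → Below 0ᵍ (suc n) p → eval n (λ i → eval n (shift (suc i) p) x) x ≡ divided (suc n) p x x
  divided-shifts zero    p x h = lemma x
    where
    lemma : ∀ x → 0ᵍ ≡ 0ᵍ +ᵍ x *ᵍ 0ᵍ
    lemma = solve-∀ 𝔾-ring
  divided-shifts (suc n) p x h = cong (λ t → eval (suc n) (p ∘ suc) x +ᵍ x *ᵍ t)
    (trans (eval-cong n (λ i _ → eval-extend (ℕ.n≤1+n n) (λ k n≤k → h (suc (suc (i ℕ.+ k))) (s≤s (s≤s (ℕ.m≤n⇒m≤o+n i n≤k)))) x) x)
           (divided-shifts n (p ∘ suc) x (below-tail (suc n) h)))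

  -- the Bezoutian (f(y) g(x) − f(x) g(y)) / (y − x)

  half : (ℕ → 𝔾) → (ℕ → 𝔾) → ℕ → ℕ → 𝔾
  half g f zero    i       = g 0 *ᵍ f (suc i)
  half g f (suc j) zero    = g 0 *ᵍ f (suc (suc j))
  half g f (suc j) (suc i) = g 0 *ᵍ f (suc (suc (suc (j ℕ.+ i)))) +ᵍ half (g ∘ suc) (f ∘ suc) j i

  -- Entry `(j , i)` is the sum of `g l *ᵍ f (j + i + 1 − l)` over `l ≤ min j i`, which is symmetric
  -- in `j` and `i`.
  half-sym : ∀ g f j i → half g f j i ≡ half g f i j
  half-sym g f zero    zero    = refl
  half-sym g f zero    (suc i) = refl
  half-sym g f (suc j) zero    = refl
  half-sym g f (suc j) (suc i) = cong₂ _+ᵍ_ (cong (λ k → g 0 *ᵍ f (suc (suc (suc k)))) (ℕ.+-comm j i)) (half-sym (g ∘ suc) (f ∘ suc) j i)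

  eval-half : ∀ N j g f → Below 0ᵍ (suc N) f → ∀ z →
    eval N (half g f j) z ≡ eval (suc j) g z *ᵍ eval N (shift (suc j) f) z
  eval-half N zero g f h z = trans (eval-cong N (λ i _ → pad (g 0) (f (suc i))) z)
    (trans (eval-linear N (g 0) 0ᵍ (f ∘ suc) (f ∘ suc) z) (lemma (g 0) z _))
    where
    pad : ∀ a b → a *ᵍ b ≡ a *ᵍ b +ᵍ 0ᵍ *ᵍ b
    pad = solve-∀ 𝔾-ring
    lemma : ∀ g z e → g *ᵍ e +ᵍ 0ᵍ *ᵍ e ≡ (g +ᵍ z *ᵍ 0ᵍ) *ᵍ e
    lemma = solve-∀ 𝔾-ring
  eval-half zero (suc j) g f h z = lemma (eval (suc (suc j)) g z)
    where
    lemma : ∀ a → 0ᵍ ≡ a *ᵍ 0ᵍ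
    lemma = solve-∀ 𝔾-ring
  eval-half (suc N) (suc j) g f h z = begin
    g 0 *ᵍ f (suc (suc j)) +ᵍ z *ᵍ eval N (λ i → g 0 *ᵍ f (suc (suc (suc (j ℕ.+ i)))) +ᵍ half (g ∘ suc) (f ∘ suc) j i) z
      ≡⟨ cong (λ t → g 0 *ᵍ f (suc (suc j)) +ᵍ z *ᵍ t) (trans (eval-cong N (λ i _ → cong (g 0 *ᵍ f (suc (suc (suc (j ℕ.+ i)))) +ᵍ_) (one* _)) z)
           (trans (eval-linear N (g 0) 1ᵍ (λ i → f (suc (suc (suc (j ℕ.+ i))))) _ z)
             (cong₂ (λ a b → g 0 *ᵍ a +ᵍ 1ᵍ *ᵍ b)
               (eval-cong N (λ i _ → cong (f ∘ suc ∘ suc) (sym (ℕ.+-suc j i))) z)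
               (eval-half N j (g ∘ suc) (f ∘ suc) (below-tail (suc N) h) z)))) ⟩
    g 0 *ᵍ f (suc (suc j)) +ᵍ z *ᵍ (g 0 *ᵍ T +ᵍ 1ᵍ *ᵍ (G *ᵍ eval N (shift (suc j) (f ∘ suc)) z))
      ≡⟨ cong (λ s → g 0 *ᵍ f (suc (suc j)) +ᵍ z *ᵍ (g 0 *ᵍ T +ᵍ 1ᵍ *ᵍ (G *ᵍ s)))
           (sym (eval-extend (ℕ.n≤1+n N) (λ k N≤k → h (suc (suc (j ℕ.+ k))) (s≤s (s≤s (ℕ.m≤n⇒m≤o+n j N≤k)))) z)) ⟩
    g 0 *ᵍ f (suc (suc j)) +ᵍ z *ᵍ (g 0 *ᵍ T +ᵍ 1ᵍ *ᵍ (G *ᵍ (f (suc (suc (j ℕ.+ 0))) +ᵍ z *ᵍ T)))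
      ≡⟨ cong (λ k → g 0 *ᵍ f (suc (suc k)) +ᵍ z *ᵍ (g 0 *ᵍ T +ᵍ 1ᵍ *ᵍ (G *ᵍ (f (suc (suc (j ℕ.+ 0))) +ᵍ z *ᵍ T)))) (sym (ℕ.+-identityʳ j)) ⟩
    g 0 *ᵍ F +ᵍ z *ᵍ (g 0 *ᵍ T +ᵍ 1ᵍ *ᵍ (G *ᵍ (F +ᵍ z *ᵍ T)))
      ≡⟨ lemma (g 0) F z T G ⟩
    (g 0 +ᵍ z *ᵍ G) *ᵍ (F +ᵍ z *ᵍ T) ∎
    where
    open ≡-Reasoning
    F = f (suc (suc (j ℕ.+ 0)))
    T = eval N (λ i → f (suc (suc (j ℕ.+ suc i)))) z
    G = eval (suc j) (g ∘ suc) z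
    one* : ∀ t → t ≡ 1ᵍ *ᵍ t
    one* = solve-∀ 𝔾-ring
    lemma : ∀ g F z T G → g *ᵍ F +ᵍ z *ᵍ (g *ᵍ T +ᵍ 1ᵍ *ᵍ (G *ᵍ (F +ᵍ z *ᵍ T))) ≡ (g +ᵍ z *ᵍ G) *ᵍ (F +ᵍ z *ᵍ T)
    lemma = solve-∀ 𝔾-ring

  bezoutian : (ℕ → 𝔾) → (ℕ → 𝔾) → ℕ → ℕ → 𝔾
  bezoutian g f j i = 1ᵍ *ᵍ half g f j i +ᵍ -1ᵍ *ᵍ half f g j i

  half-cong : ∀ {g g′ f f′ : ℕ → 𝔾} → (∀ i → g i ≡ g′ i) → (∀ i → f i ≡ f′ i) → ∀ j i → half g f j i ≡ half g′ f′ j i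
  half-cong e h zero    i       = cong₂ _*ᵍ_ (e 0) (h (suc i))
  half-cong e h (suc j) zero    = cong₂ _*ᵍ_ (e 0) (h (suc (suc j)))
  half-cong e h (suc j) (suc i) = cong₂ _+ᵍ_ (cong₂ _*ᵍ_ (e 0) (h (suc (suc (suc (j ℕ.+ i)))))) (half-cong (e ∘ suc) (h ∘ suc) j i)

  bezoutian-congˡ : ∀ {g g′ : ℕ → 𝔾} f → (∀ i → g i ≡ g′ i) → ∀ j i → bezoutian g f j i ≡ bezoutian g′ f j i
  bezoutian-congˡ {g} {g′} f e j i = cong₂ (λ a b → 1ᵍ *ᵍ a +ᵍ -1ᵍ *ᵍ b)
    (half-cong {g} {g′} {f} {f} e (λ _ → refl) j i) (half-cong {f} {f} {g} {g′} (λ _ → refl) e j i)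

  bezoutian-sym : ∀ g f j i → bezoutian g f j i ≡ bezoutian g f i j
  bezoutian-sym g f j i = cong₂ (λ a b → 1ᵍ *ᵍ a +ᵍ -1ᵍ *ᵍ b) (half-sym g f j i) (half-sym f g j i)

  -- Both polynomials are split at degree `j + 1`, and the products of their upper parts cancel. At
  -- a root of `f` the row collapses to `g(z)` times a coefficient of `f(x) / (x − z)`, and `g(z)`
  -- is small if `g` has a root nearby.
  eval-bezoutian : ∀ N j g f → Below 0ᵍ (suc N) g → Below 0ᵍ (suc N) f → ∀ z →
    eval N (bezoutian g f j) z ≡
      eval (suc N) g z *ᵍ eval N (shift (suc j) f) z -ᵍ eval (suc N) f z *ᵍ eval N (shift (suc j) g) z
  eval-bezoutian N j g f hg hf z = begin
    eval N (bezoutian g f j) z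
      ≡⟨ eval-linear N 1ᵍ -1ᵍ (half g f j) (half f g j) z ⟩
    1ᵍ *ᵍ eval N (half g f j) z +ᵍ -1ᵍ *ᵍ eval N (half f g j) z
      ≡⟨ cong₂ (λ a b → 1ᵍ *ᵍ a +ᵍ -1ᵍ *ᵍ b) (eval-half N j g f hf z) (eval-half N j f g hg z) ⟩
    1ᵍ *ᵍ (eval (suc j) g z *ᵍ w) +ᵍ -1ᵍ *ᵍ (eval (suc j) f z *ᵍ v)
      ≡⟨ lemma (eval (suc j) g z) (eval (suc j) f z) w v (z ^ᵍ suc j) ⟩
    (eval (suc j) g z +ᵍ z ^ᵍ suc j *ᵍ v) *ᵍ w -ᵍ (eval (suc j) f z +ᵍ z ^ᵍ suc j *ᵍ w) *ᵍ v
      ≡⟨ sym (cong₂ (λ a b → a *ᵍ w -ᵍ b *ᵍ v) (whole g hg) (whole f hf)) ⟩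
    eval (suc N) g z *ᵍ w -ᵍ eval (suc N) f z *ᵍ v ∎
    where
    open ≡-Reasoning
    w = eval N (shift (suc j) f) z
    v = eval N (shift (suc j) g) z
    lemma : ∀ g f w v s → 1ᵍ *ᵍ (g *ᵍ w) +ᵍ -ᵍ 1ᵍ *ᵍ (f *ᵍ v) ≡ (g +ᵍ s *ᵍ v) *ᵍ w -ᵍ (f +ᵍ s *ᵍ w) *ᵍ v
    lemma = solve-∀ 𝔾-ring
    whole : ∀ p → Below 0ᵍ (suc N) p → eval (suc N) p z ≡ eval (suc j) p z +ᵍ z ^ᵍ suc j *ᵍ eval N (shift (suc j) p) z
    whole p h = trans (sym (eval-extend (s≤s (ℕ.m≤n+m N j)) h z)) (eval-split (suc j) N p z)

-- Size estimates for values, divided differences and Bezoutians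

module Bounds where
  import Data.Nat.Solver as ℕ
  open import Data.Rational.Base using (_+_; _*_; _≤_; _<_)
  open import Tactic.RingSolver using (solve-∀)
  open Rationals
  open Gaussian
  open ExteriorAlgebra
  open Polynomials

  private
    factor : ∀ X c B Y → X * (c * (B * Y)) ≡ c * (B * (X * Y))
    factor = solve-∀ ℚ-ring

  horner-step : ∀ m {u v x c d e B X} → 0ℚ ≤ B → 1ℚ ≤ X → 0ℚ ≤ d → c + d ≤ e →
    ‖ u ‖ ≤ c * (B * X ^ suc m) → ‖ v ‖ ≤ d * (B * X ^ m) → ‖ x ‖ ≤ X → ‖ u +ᵍ x *ᵍ v ‖ ≤ e * (B * X ^ suc m)
  horner-step m {u} {v} {x} {c} {d} {e} {B} {X} 0≤B 1≤X 0≤d c+d≤e hu hv hx = begin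
    ‖ u +ᵍ x *ᵍ v ‖  ≤⟨ ‖+‖ u (x *ᵍ v) ⟩
    ‖ u ‖ + ‖ x *ᵍ v ‖  ≤⟨ ℚ.+-mono-≤ hu (ℚ.≤-trans (‖*‖ x v) (*-mono (‖‖-nonNeg v) 0≤X hx hv)) ⟩
    c * (B * X ^ suc m) + X * (d * (B * X ^ m))  ≡⟨ cong (c * (B * X ^ suc m) +_) (factor X d B (X ^ m)) ⟩
    c * (B * X ^ suc m) + d * (B * X ^ suc m)  ≡⟨ sym (ℚ.*-distribʳ-+ (B * X ^ suc m) c d) ⟩
    (c + d) * (B * X ^ suc m)  ≤⟨ *-monoˡ (*-nonNeg 0≤B (^-nonNeg (suc m) 0≤X)) c+d≤e ⟩
    e * (B * X ^ suc m)  ∎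
    where
    open ℚ.≤-Reasoning
    0≤X = ℚ.≤-trans 0≤1 1≤X

  0≤cBX : ∀ n m {B X} → 0ℚ ≤ B → 1ℚ ≤ X → 0ℚ ≤ fromℕ n * (B * X ^ m)
  0≤cBX n m 0≤B 1≤X = *-nonNeg (fromℕ-nonNeg n) (*-nonNeg 0≤B (^-nonNeg m (ℚ.≤-trans 0≤1 1≤X)))

  ≤-zero : ∀ {z r} → z ≡ 0ᵍ → 0ℚ ≤ r → ‖ z ‖ ≤ r
  ≤-zero refl h = ℚ.≤-trans (ℚ.≤-reflexive ‖0‖) h

  private
    collapse : ∀ x → 0ᵍ +ᵍ x *ᵍ 0ᵍ ≡ 0ᵍ
    collapse = solve-∀ 𝔾-ring
    collapse₂ : ∀ x → 0ᵍ +ᵍ x *ᵍ 0ᵍ +ᵍ x *ᵍ (0ᵍ +ᵍ x *ᵍ 0ᵍ) ≡ 0ᵍ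
    collapse₂ = solve-∀ 𝔾-ring

  eval-bound : ∀ n m {p B X z} → n ℕ.≤ suc m → 0ℚ ≤ B → 1ℚ ≤ X → (∀ i → ‖ p i ‖ ≤ B) → ‖ z ‖ ≤ X →
    ‖ eval n p z ‖ ≤ fromℕ n * (B * X ^ m)
  eval-bound zero m _ 0≤B 1≤X hp hz = ≤-zero refl (0≤cBX 0 m 0≤B 1≤X)
  eval-bound (suc zero) zero {p} {B} {X} {z} _ 0≤B 1≤X hp hz = begin
    ‖ p 0 +ᵍ z *ᵍ 0ᵍ ‖  ≡⟨ cong ‖_‖ (lemma (p 0) z) ⟩
    ‖ p 0 ‖  ≤⟨ hp 0 ⟩
    B  ≡⟨ sym (trans (ℚ.*-identityˡ (B * 1ℚ)) (ℚ.*-identityʳ B)) ⟩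
    1ℚ * (B * 1ℚ)  ∎
    where
    open ℚ.≤-Reasoning
    lemma : ∀ p z → p +ᵍ z *ᵍ 0ᵍ ≡ p
    lemma = solve-∀ 𝔾-ring
  eval-bound (suc (suc n)) zero (s≤s ())
  eval-bound (suc n) (suc m) {p} {B} {X} (s≤s n≤m) 0≤B 1≤X hp hz =
    horner-step m {c = 1ℚ} 0≤B 1≤X (fromℕ-nonNeg n) (ℚ.≤-reflexive (sym (fromℕ-+ 1 n)))
      (ℚ.≤-trans (hp 0) (ℚ.≤-trans (≤-*ʳ 0≤B (1≤^ (suc m) 1≤X)) (ℚ.≤-reflexive (sym (ℚ.*-identityˡ (B * X ^ suc m))))))
      (eval-bound n m n≤m 0≤B 1≤X (hp ∘ suc) hz) hz

  square-step : ∀ n → fromℕ n + fromℕ (n ℕ.* n) ≤ fromℕ (suc n ℕ.* suc n)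
  square-step n = ℚ.≤-trans (ℚ.≤-reflexive (sym (fromℕ-+ n (n ℕ.* n))))
    (fromℕ-mono (ℕ.≤-trans (ℕ.*-monoʳ-≤ (suc n) (ℕ.n≤1+n n)) ℕ.≤-refl))

  cube-step : ∀ n → fromℕ (n ℕ.* n) + fromℕ (n ℕ.* n ℕ.* n) ≤ fromℕ (suc n ℕ.* suc n ℕ.* suc n)
  cube-step n = ℚ.≤-trans (ℚ.≤-reflexive (trans (sym (fromℕ-+ (n ℕ.* n) (n ℕ.* n ℕ.* n)))
      (cong fromℕ (trans (cong (ℕ._+ n ℕ.* n ℕ.* n) (sym (ℕ.*-identityʳ (n ℕ.* n))))
        (trans (sym (ℕ.*-distribˡ-+ (n ℕ.* n) 1 n)) refl)))))
    (fromℕ-mono (ℕ.*-monoˡ-≤ (suc n) (ℕ.*-mono-≤ (ℕ.n≤1+n n) (ℕ.n≤1+n n))))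

  divided-bound : ∀ n m {p B X x y} → n ℕ.≤ suc (suc m) → 0ℚ ≤ B → 1ℚ ≤ X → (∀ i → ‖ p i ‖ ≤ B) →
    ‖ x ‖ ≤ X → ‖ y ‖ ≤ X → ‖ divided n p x y ‖ ≤ fromℕ (n ℕ.* n) * (B * X ^ m)
  divided-bound zero m _ 0≤B 1≤X hp hx hy = ≤-zero refl (0≤cBX 0 m 0≤B 1≤X)
  divided-bound (suc zero) m {x = x} _ 0≤B 1≤X hp hx hy = ≤-zero (collapse x) (0≤cBX 1 m 0≤B 1≤X)
  divided-bound (suc (suc zero)) zero {p} {B} {X} {x} {y} _ 0≤B 1≤X hp hx hy = begin
    ‖ p 1 +ᵍ y *ᵍ 0ᵍ +ᵍ x *ᵍ (0ᵍ +ᵍ x *ᵍ 0ᵍ) ‖  ≡⟨ cong ‖_‖ (lemma (p 1) x y) ⟩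
    ‖ p 1 ‖  ≤⟨ hp 1 ⟩
    B  ≤⟨ ≤-*ˡ 0≤B (1≤fromℕ {4} (s≤s z≤n)) ⟩
    fromℕ 4 * B  ≡⟨ cong (fromℕ 4 *_) (sym (ℚ.*-identityʳ B)) ⟩
    fromℕ 4 * (B * 1ℚ)  ∎
    where
    open ℚ.≤-Reasoning
    lemma : ∀ p x y → p +ᵍ y *ᵍ 0ᵍ +ᵍ x *ᵍ (0ᵍ +ᵍ x *ᵍ 0ᵍ) ≡ p
    lemma = solve-∀ 𝔾-ring
  divided-bound (suc (suc (suc n))) zero (s≤s (s≤s ()))
  divided-bound (suc n) (suc m) (s≤s n≤m) 0≤B 1≤X hp hx hy =
    horner-step m {c = fromℕ n} 0≤B 1≤X (fromℕ-nonNeg (n ℕ.* n)) (square-step n)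
      (eval-bound n (suc m) n≤m 0≤B 1≤X (hp ∘ suc) hy)
      (divided-bound n m n≤m 0≤B 1≤X (hp ∘ suc) hx hy) hx

  divided₂-bound : ∀ n m {p B X x y} → n ℕ.≤ suc (suc (suc m)) → 0ℚ ≤ B → 1ℚ ≤ X → (∀ i → ‖ p i ‖ ≤ B) →
    ‖ x ‖ ≤ X → ‖ y ‖ ≤ X → ‖ divided₂ n p x y ‖ ≤ fromℕ (n ℕ.* n ℕ.* n) * (B * X ^ m)
  divided₂-bound zero m _ 0≤B 1≤X hp hx hy = ≤-zero refl (0≤cBX 0 m 0≤B 1≤X)
  divided₂-bound (suc zero) m {x = x} _ 0≤B 1≤X hp hx hy = ≤-zero (collapse x) (0≤cBX 1 m 0≤B 1≤X)
  divided₂-bound (suc (suc zero)) m {x = x} _ 0≤B 1≤X hp hx hy = ≤-zero (collapse₂ x) (0≤cBX 8 m 0≤B 1≤X)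
  divided₂-bound (suc (suc (suc zero))) zero {p} {B} {X} {x} {y} _ 0≤B 1≤X hp hx hy = begin
    ‖ p 2 +ᵍ y *ᵍ 0ᵍ +ᵍ x *ᵍ (0ᵍ +ᵍ x *ᵍ 0ᵍ) +ᵍ x *ᵍ (0ᵍ +ᵍ x *ᵍ 0ᵍ +ᵍ x *ᵍ (0ᵍ +ᵍ x *ᵍ 0ᵍ)) ‖
                                                ≡⟨ cong ‖_‖ (lemma (p 2) x y) ⟩
    ‖ p 2 ‖  ≤⟨ hp 2 ⟩
    B  ≤⟨ ≤-*ˡ 0≤B (1≤fromℕ {27} (s≤s z≤n)) ⟩
    fromℕ 27 * B  ≡⟨ cong (fromℕ 27 *_) (sym (ℚ.*-identityʳ B)) ⟩
    fromℕ 27 * (B * 1ℚ)  ∎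
    where
    open ℚ.≤-Reasoning
    lemma : ∀ p x y → p +ᵍ y *ᵍ 0ᵍ +ᵍ x *ᵍ (0ᵍ +ᵍ x *ᵍ 0ᵍ) +ᵍ x *ᵍ (0ᵍ +ᵍ x *ᵍ 0ᵍ +ᵍ x *ᵍ (0ᵍ +ᵍ x *ᵍ 0ᵍ)) ≡ p
    lemma = solve-∀ 𝔾-ring
  divided₂-bound (suc (suc (suc (suc n)))) zero (s≤s (s≤s (s≤s ())))
  divided₂-bound (suc n) (suc m) (s≤s n≤m) 0≤B 1≤X hp hx hy =
    horner-step m {c = fromℕ (n ℕ.* n)} 0≤B 1≤X (fromℕ-nonNeg (n ℕ.* n ℕ.* n)) (cube-step n)
      (divided-bound n (suc m) n≤m 0≤B 1≤X (hp ∘ suc) hx hy)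
      (divided₂-bound n m n≤m 0≤B 1≤X (hp ∘ suc) hx hy) hx

  half-bound : ∀ j i {g f G F} → 0ℚ ≤ G → 0ℚ ≤ F → (∀ i → ‖ g i ‖ ≤ G) → (∀ i → ‖ f i ‖ ≤ F) →
    ‖ half g f j i ‖ ≤ fromℕ (suc j) * (G * F)
  half-bound j i {g} {f} {G} {F} 0≤G 0≤F hg hf = go j i hg hf
    where
    term : ∀ {g f : ℕ → 𝔾} → (∀ i → ‖ g i ‖ ≤ G) → (∀ i → ‖ f i ‖ ≤ F) → ∀ k → ‖ g 0 *ᵍ f k ‖ ≤ G * F
    term {g} {f} hg hf k = ℚ.≤-trans (‖*‖ (g 0) (f k)) (*-mono (‖‖-nonNeg (f k)) 0≤G (hg 0) (hf k))
    first : ∀ j → G * F ≤ fromℕ (suc j) * (G * F)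
    first j = ≤-*ˡ (*-nonNeg 0≤G 0≤F) (1≤fromℕ {suc j} (s≤s z≤n))
    go : ∀ j i {g f : ℕ → 𝔾} → (∀ i → ‖ g i ‖ ≤ G) → (∀ i → ‖ f i ‖ ≤ F) → ‖ half g f j i ‖ ≤ fromℕ (suc j) * (G * F)
    go zero    i {g} {f} hg hf       = ℚ.≤-trans (term {g} {f} hg hf (suc i)) (first 0)
    go (suc j) zero {g} {f} hg hf    = ℚ.≤-trans (term {g} {f} hg hf (suc (suc j))) (first (suc j))
    go (suc j) (suc i) {g} {f} hg hf = ℚ.≤-trans (‖+‖ (g 0 *ᵍ f (suc (suc (suc (j ℕ.+ i))))) _)
      (ℚ.≤-trans (ℚ.+-mono-≤ (term {g} {f} hg hf (suc (suc (suc (j ℕ.+ i))))) (go j i (hg ∘ suc) (hf ∘ suc)))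
        (ℚ.≤-reflexive (trans (lemma (G * F) (fromℕ (suc j))) (cong (_* (G * F)) (sym (fromℕ-+ 1 (suc j)))))))
      where
      lemma : ∀ a b → a + b * a ≡ (1ℚ + b) * a
      lemma = solve-∀ ℚ-ring

  bezoutian-bound : ∀ j i {g f G F} → 0ℚ ≤ G → 0ℚ ≤ F → (∀ i → ‖ g i ‖ ≤ G) → (∀ i → ‖ f i ‖ ≤ F) →
    ‖ bezoutian g f j i ‖ ≤ 2ℚ * fromℕ (suc j) * (G * F)
  bezoutian-bound j i {g} {f} {G} {F} 0≤G 0≤F hg hf = begin
    ‖ 1ᵍ *ᵍ half g f j i +ᵍ -1ᵍ *ᵍ half f g j i ‖  ≡⟨ cong ‖_‖ (minus (half g f j i) (half f g j i)) ⟩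
    ‖ half g f j i -ᵍ half f g j i ‖  ≤⟨ ‖-‖ (half g f j i) (half f g j i) ⟩
    ‖ half g f j i ‖ + ‖ half f g j i ‖  ≤⟨ ℚ.+-mono-≤ (half-bound j i 0≤G 0≤F hg hf) (half-bound j i 0≤F 0≤G hf hg) ⟩
    c * (G * F) + c * (F * G)  ≡⟨ lemma c G F ⟩
    2ℚ * c * (G * F)  ∎
    where
    open ℚ.≤-Reasoning
    c = fromℕ (suc j)
    minus : ∀ a b → 1ᵍ *ᵍ a +ᵍ -ᵍ 1ᵍ *ᵍ b ≡ a -ᵍ b
    minus = solve-∀ 𝔾-ring
    lemma : ∀ c G F → c * (G * F) + c * (F * G) ≡ (1ℚ + 1ℚ) * c * (G * F)
    lemma = solve-∀ ℚ-ring

  -- If ‖z‖ ≤ 1 then X = 2 and p = 0 do, otherwise X = 2‖z‖ and p = t.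
  scale : ∀ z t → ∃ λ X → ∃ λ p → 1ℚ ≤ X × ‖ z ‖ + 1ℚ ≤ X × X ≤ 2ℚ * (‖ z ‖ + 1ℚ) × p ℕ.≤ t ×
    X ^ t ≤ (2ℚ * 2ℚ) ^ t * ‖ z ^ᵍ p ‖
  scale z t with ℚ.≤-total ‖ z ‖ 1ℚ
  ... | inj₁ z≤1 = 2ℚ , 0 , 1≤2 , ℚ.+-monoˡ-≤ 1ℚ z≤1 , ≤-*ʳ {2ℚ} {‖ z ‖ + 1ℚ} (ℚ.<⇒≤ 0<2) (≤-+ˡ (‖‖-nonNeg z)) , z≤n ,
    ℚ.≤-trans (^-mono {2ℚ} {2ℚ * 2ℚ} t (ℚ.<⇒≤ 0<2) (≤-*ʳ {2ℚ} {2ℚ} (ℚ.<⇒≤ 0<2) 1≤2)) (ℚ.≤-reflexive (sym (trans (cong ((2ℚ * 2ℚ) ^ t *_) ‖1‖) (ℚ.*-identityʳ ((2ℚ * 2ℚ) ^ t)))))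
  ... | inj₂ 1≤z = 2ℚ * ‖ z ‖ , t ,
    ℚ.≤-trans 1≤z (≤-*ˡ {‖ z ‖} {2ℚ} (‖‖-nonNeg z) 1≤2) ,
    ℚ.≤-trans (ℚ.+-monoʳ-≤ ‖ z ‖ 1≤z) (ℚ.≤-reflexive (double (‖ z ‖))) ,
    *-monoʳ {‖ z ‖} {‖ z ‖ + 1ℚ} {2ℚ} (ℚ.<⇒≤ 0<2) (≤-+ʳ 0≤1) , ℕ.≤-refl , (begin
      (2ℚ * ‖ z ‖) ^ t  ≡⟨ ^-distrib-* 2ℚ (‖ z ‖) t ⟩
      2ℚ ^ t * ‖ z ‖ ^ t  ≤⟨ *-monoʳ (^-nonNeg t (ℚ.<⇒≤ 0<2)) (‖^‖-lower z t) ⟩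
      2ℚ ^ t * (2ℚ ^ t * ‖ z ^ᵍ t ‖)  ≡⟨ sym (ℚ.*-assoc (2ℚ ^ t) (2ℚ ^ t) (‖ z ^ᵍ t ‖)) ⟩
      2ℚ ^ t * 2ℚ ^ t * ‖ z ^ᵍ t ‖  ≡⟨ cong (_* ‖ z ^ᵍ t ‖) (sym (^-distrib-* 2ℚ 2ℚ t)) ⟩
      (2ℚ * 2ℚ) ^ t * ‖ z ^ᵍ t ‖  ∎)
    where
    open ℚ.≤-Reasoning
    double : ∀ a → a + a ≡ (1ℚ + 1ℚ) * a
    double = solve-∀ ℚ-ring

  quotientConstant : ℕ → ℚ
  quotientConstant m = 2ℚ ^ suc m * fromℕ (suc m)

  -- The coefficients of f(x)/(x − z) are O(H), uniformly in z: for ‖z‖ ≥ 1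
  -- they are read off from the other end of f.
  quotient-bound : ∀ m i {f H z} → i ℕ.< m → 1ℚ ≤ H → (∀ i → ‖ f i ‖ ≤ H) → Below 0ᵍ (suc m) f →
    ‖ eval (suc m) f z ‖ ≤ 1ℚ → ‖ eval m (shift (suc i) f) z ‖ ≤ quotientConstant m * H
  quotient-bound m i {f} {H} {z} i<m 1≤H hf below fz≤1 with ℚ.≤-total ‖ z ‖ 1ℚ
  ... | inj₁ z≤1 = begin
    ‖ eval m (shift (suc i) f) z ‖  ≤⟨ eval-bound m m (ℕ.n≤1+n m) (ℚ.≤-trans 0≤1 1≤H) ℚ.≤-refl (λ k → hf (suc i ℕ.+ k)) z≤1 ⟩
    fromℕ m * (H * 1ℚ ^ m)  ≡⟨ cong (λ t → fromℕ m * (H * t)) (1^n≡1 m) ⟩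
    fromℕ m * (H * 1ℚ)  ≡⟨ cong (fromℕ m *_) (ℚ.*-identityʳ H) ⟩
    fromℕ m * H  ≤⟨ *-monoˡ (ℚ.≤-trans 0≤1 1≤H) (ℚ.≤-trans (fromℕ-mono (ℕ.n≤1+n m)) (≤-*ˡ (fromℕ-nonNeg (suc m)) (1≤^ (suc m) 1≤2))) ⟩
    quotientConstant m * H  ∎
    where open ℚ.≤-Reasoning
  ... | inj₂ 1≤z = *-cancel≤ʳ (^-pos (suc i) 0<z) (begin
    ‖ z ‖ ^ suc i * ‖ w ‖
      ≤⟨ *-monoˡ (‖‖-nonNeg w) (‖^‖-lower z (suc i)) ⟩
    2ℚ ^ suc i * ‖ z ^ᵍ suc i ‖ * ‖ w ‖
      ≡⟨ ℚ.*-assoc (2ℚ ^ suc i) _ _ ⟩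
    2ℚ ^ suc i * (‖ z ^ᵍ suc i ‖ * ‖ w ‖)
      ≤⟨ *-monoʳ (^-nonNeg (suc i) (ℚ.<⇒≤ 0<2)) (‖*‖-lower (z ^ᵍ suc i) w) ⟩
    2ℚ ^ suc i * (2ℚ * ‖ z ^ᵍ suc i *ᵍ w ‖)
      ≤⟨ *-monoʳ (^-nonNeg (suc i) (ℚ.<⇒≤ 0<2)) (*-monoʳ (ℚ.<⇒≤ 0<2) product-bounded) ⟩
    2ℚ ^ suc i * (2ℚ * (fromℕ (suc (suc i)) * (H * ‖ z ‖ ^ i)))
      ≡⟨ regroup (2ℚ ^ suc i) 2ℚ (fromℕ (suc (suc i))) H (‖ z ‖ ^ i) ⟩
    2ℚ * 2ℚ ^ suc i * fromℕ (suc (suc i)) * H * ‖ z ‖ ^ i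
      ≤⟨ *-mono (^-nonNeg i 0≤z) (*-nonNeg constant-nonNeg 0≤H)
           (*-monoˡ 0≤H (*-mono (fromℕ-nonNeg (suc (suc i))) (^-nonNeg (suc m) (ℚ.<⇒≤ 0<2)) (^-monoʳ 1≤2 (s≤s i<m)) (fromℕ-mono (s≤s i<m))))
           (^-monoʳ 1≤z (ℕ.n≤1+n i)) ⟩
    quotientConstant m * H * ‖ z ‖ ^ suc i
      ≡⟨ ℚ.*-comm (quotientConstant m * H) (‖ z ‖ ^ suc i) ⟩
    ‖ z ‖ ^ suc i * (quotientConstant m * H) ∎)
    where
    open ℚ.≤-Reasoning
    w = eval m (shift (suc i) f) z
    0<z = ℚ.<-≤-trans 0<1 1≤z
    0≤z = ℚ.<⇒≤ 0<z
    0≤H = ℚ.≤-trans 0≤1 1≤H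
    constant-nonNeg : 0ℚ ≤ quotientConstant m
    constant-nonNeg = *-nonNeg (^-nonNeg (suc m) (ℚ.<⇒≤ 0<2)) (fromℕ-nonNeg (suc m))
    regroup : ∀ a b c d e → a * (b * (c * (d * e))) ≡ b * a * c * d * e
    regroup = solve-∀ ℚ-ring
    split : z ^ᵍ suc i *ᵍ w ≡ eval (suc m) f z -ᵍ eval (suc i) f z
    split = trans (isolate (eval (suc i) f z) (z ^ᵍ suc i *ᵍ w))
      (cong (_-ᵍ eval (suc i) f z) (trans (sym (eval-split (suc i) m f z)) (eval-extend (s≤s (ℕ.m≤n+m m i)) below z)))
      where
      isolate : ∀ a b → b ≡ a +ᵍ b -ᵍ a
      isolate = solve-∀ 𝔾-ring
    product-bounded : ‖ z ^ᵍ suc i *ᵍ w ‖ ≤ fromℕ (suc (suc i)) * (H * ‖ z ‖ ^ i)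
    product-bounded = begin
      ‖ z ^ᵍ suc i *ᵍ w ‖  ≡⟨ cong ‖_‖ split ⟩
      ‖ eval (suc m) f z -ᵍ eval (suc i) f z ‖  ≤⟨ ‖-‖ (eval (suc m) f z) (eval (suc i) f z) ⟩
      ‖ eval (suc m) f z ‖ + ‖ eval (suc i) f z ‖  ≤⟨ ℚ.+-mono-≤ (ℚ.≤-trans fz≤1 (ℚ.≤-trans 1≤H (≤-*ʳ 0≤H (1≤^ i 1≤z))))
                                                               (eval-bound (suc i) i ℕ.≤-refl 0≤H 1≤z hf ℚ.≤-refl) ⟩
      H * ‖ z ‖ ^ i + fromℕ (suc i) * (H * ‖ z ‖ ^ i)  ≡⟨ trans (lemma (H * ‖ z ‖ ^ i) (fromℕ (suc i))) (cong (_* (H * ‖ z ‖ ^ i)) (sym (fromℕ-+ 1 (suc i)))) ⟩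
      fromℕ (suc (suc i)) * (H * ‖ z ‖ ^ i)  ∎
      where
      lemma : ∀ a b → a + b * a ≡ (1ℚ + b) * a
      lemma = solve-∀ ℚ-ring

-- Division by a monic polynomial

module Division where
  open import Data.Rational.Base using (_+_; _*_; _-_; -_)
  open import Tactic.RingSolver using (solve-∀)
  open Rationals
  open Polynomials

  prepend : {A : Set} → A → (ℕ → A) → ℕ → A
  prepend a r zero    = a
  prepend a r (suc i) = r i

  module Divide (m : ℕ) (f : ℕ → ℚ) (monic : f (suc m) ≡ 1ℚ) (below : Below 0ℚ (suc (suc m)) f) where

    -- If the tail of `p` is `q f + r`, then `p = (r_m + x q) f + (p 0 + x r − r_m f)`. The
    -- subtraction cancels degree `m + 1`, because `f` is monic of that degree.
    quo rem : ℕ → (ℕ → ℚ) → ℕ → ℚ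
    quo zero    p i       = 0ℚ
    quo (suc n) p zero    = rem n (p ∘ suc) m
    quo (suc n) p (suc i) = quo n (p ∘ suc) i
    rem zero    p i = 0ℚ
    rem (suc n) p i = prepend (p 0) (rem n (p ∘ suc)) i - rem n (p ∘ suc) m * f i

    convℚ-zero : ∀ {q} (r : ℕ → ℚ) → (∀ i → q i ≡ 0ℚ) → ∀ k → convℚ q r k ≡ 0ℚ
    convℚ-zero r h zero    = trans (cong (_* r 0) (h 0)) (ℚ.*-zeroˡ (r 0))
    convℚ-zero r h (suc k) = trans (cong₂ (λ a b → a * r (suc k) + b) (h 0) (convℚ-zero r (h ∘ suc) k))
      (trans (ℚ.+-identityʳ _) (ℚ.*-zeroˡ (r (suc k))))

    division : ∀ n p → Below 0ℚ n p → ∀ k → p k ≡ convℚ (quo n p) f k + rem n p k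
    division zero    p h k       = trans (h k z≤n) (sym (trans (ℚ.+-identityʳ _) (convℚ-zero f (λ _ → refl) k)))
    division (suc n) p h zero    = lemma (p 0) (rem n (p ∘ suc) m * f 0)
      where
      lemma : ∀ a b → a ≡ b + (a - b)
      lemma = solve-∀ ℚ-ring
    division (suc n) p h (suc k) = trans (division n (p ∘ suc) (below-tail n h) k)
      (lemma (convℚ (quo n (p ∘ suc)) f k) (rem n (p ∘ suc) k) (rem n (p ∘ suc) m * f (suc k)))
      where
      lemma : ∀ c r t → c + r ≡ t + c + (r - t)
      lemma = solve-∀ ℚ-ring

    rem-below : ∀ n p → Below 0ℚ (suc m) (rem n p)
    rem-below zero    p i       h       = refl
    rem-below (suc n) p (suc i) (s≤s m≤i) = step (ℕ.m≤n⇒m<n∨m≡n m≤i)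
      where
      open import Data.Sum using (_⊎_; inj₁; inj₂)
      r = rem n (p ∘ suc)
      cancel : ∀ a → a - a * 1ℚ ≡ 0ℚ
      cancel = solve-∀ ℚ-ring
      zero-out : ∀ a → 0ℚ - a * 0ℚ ≡ 0ℚ
      zero-out = solve-∀ ℚ-ring
      step : m ℕ.< i ⊎ m ≡ i → r i - r m * f (suc i) ≡ 0ℚ
      step (inj₁ m<i)  = trans (cong₂ (λ a b → a - r m * b) (rem-below n (p ∘ suc) i m<i) (below (suc i) (s≤s m<i))) (zero-out (r m))
      step (inj₂ refl) = trans (cong (λ b → r m - r m * b) monic) (cancel (r m))

    rem-small : ∀ n p → n ℕ.≤ suc m → Below 0ℚ n p → ∀ i → rem n p i ≡ p i
    rem-small zero    p n≤m h i = sym (h i z≤n)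
    rem-small (suc n) p (s≤s n≤m) h i = trans (cong (λ t → prepend (p 0) (rem n (p ∘ suc)) i - t * f i) r-top)
      (trans (lemma (prepend (p 0) (rem n (p ∘ suc)) i) (f i)) (tail i))
      where
      r≡ = rem-small n (p ∘ suc) (ℕ.m≤n⇒m≤1+n n≤m) (below-tail n h)
      r-top : rem n (p ∘ suc) m ≡ 0ℚ
      r-top = trans (r≡ m) (h (suc m) (s≤s n≤m))
      lemma : ∀ a b → a - 0ℚ * b ≡ a
      lemma = solve-∀ ℚ-ring
      tail : ∀ i → prepend (p 0) (rem n (p ∘ suc)) i ≡ p i
      tail zero    = refl
      tail (suc i) = r≡ i

    quo-below : ∀ n p → Below 0ℚ n p → ∀ i → n ℕ.≤ i ℕ.+ suc m → quo n p i ≡ 0ℚ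
    quo-below zero    p h i       n≤ = refl
    quo-below (suc n) p h zero    (s≤s n≤m) = trans (rem-small n (p ∘ suc) (ℕ.m≤n⇒m≤1+n n≤m) (below-tail n h) m) (h (suc m) (s≤s n≤m))
    quo-below (suc n) p h (suc i) (s≤s n≤) = quo-below n (p ∘ suc) (below-tail n h) i n≤

    quo-top : ∀ e p → Below 0ℚ (suc (e ℕ.+ suc m)) p → quo (suc (e ℕ.+ suc m)) p e ≡ p (e ℕ.+ suc m)
    quo-top zero    p h = rem-small (suc m) (p ∘ suc) ℕ.≤-refl (below-tail (suc m) h) m
    quo-top (suc e) p h = quo-top e (p ∘ suc) (below-tail _ h)

-- Vanishing at a complex point and minimal polynomials

module Places where
  open import Data.Nat.Induction using (<-rec)
  open import Data.Rational.Base using (_+_; _*_; _-_; -_; _≤_; _<_)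
  open import Tactic.RingSolver using (solve-∀)
  open Rationals
  open Gaussian
  open Polynomials
  open Bounds
  open Division

  infixl 1 _∩_
  _∩_ : ∀ {P Q : ℕ → Set} → Eventually P → Eventually Q → Eventually (λ k → P k × Q k)
  (M , p) ∩ (N , q) = M ℕ.⊔ N , λ n h → p n (ℕ.m⊔n≤o⇒m≤o M N h) , q n (ℕ.m⊔n≤o⇒n≤o M N h)

  eventually-map : ∀ {P Q : ℕ → Set} → (∀ k → P k → Q k) → Eventually P → Eventually Q
  eventually-map f (N , p) = N , λ n h → f n (p n h)

  Null : (ℕ → 𝔾) → Set
  Null u = ∀ ε → 0ℚ < ε → Eventually λ k → ‖ u k ‖ < ε

  CauchyG : (ℕ → 𝔾) → Set
  CauchyG u = ∀ ε → 0ℚ < ε → ∃ λ N → ∀ m n → N ℕ.≤ m → N ℕ.≤ n → ‖ u m -ᵍ u n ‖ < ε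

  BoundedG : (ℕ → 𝔾) → Set
  BoundedG u = ∃ λ X → 1ℚ ≤ X × Eventually λ k → ‖ u k ‖ ≤ X

  null-cong : ∀ {u v : ℕ → 𝔾} → (∀ k → u k ≡ v k) → Null u → Null v
  null-cong e h ε 0<ε = eventually-map (λ k → subst (λ t → ‖ t ‖ < ε) (e k)) (h ε 0<ε)

  null-+ : ∀ {u v : ℕ → 𝔾} → Null u → Null v → Null (λ k → u k +ᵍ v k)
  null-+ {u} {v} hu hv ε 0<ε = eventually-map (λ k h → ℚ.≤-<-trans (‖+‖ (u k) (v k))
      (ℚ.<-≤-trans (ℚ.+-mono-< (proj₁ h) (proj₂ h)) (ℚ.≤-reflexive (half+half ε))))
    (hu (½ * ε) (half>0 ε 0<ε) ∩ hv (½ * ε) (half>0 ε 0<ε))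

  null-*-bounded : ∀ {u v : ℕ → 𝔾} → BoundedG u → Null v → Null (λ k → u k *ᵍ v k)
  null-*-bounded {u} {v} (X , 1≤X , bound) hv ε 0<ε =
    let η , 0<η , Xη≤ε = shrink X ε 0<ε
    in eventually-map (λ k h → ℚ.≤-<-trans (‖*‖ (u k) (v k)) (ℚ.≤-<-trans (*-monoˡ (‖‖-nonNeg (v k)) (proj₁ h))
         (ℚ.<-≤-trans (*-mono<ʳ (ℚ.<-≤-trans 0<1 1≤X) (proj₂ h)) Xη≤ε))) (bound ∩ hv η 0<η)

  ≤-triangle : ∀ u v → ‖ u ‖ ≤ ‖ v ‖ + ‖ u -ᵍ v ‖
  ≤-triangle u v = ℚ.≤-trans (ℚ.≤-reflexive (cong ‖_‖ (lemma u v))) (‖+‖ v (u -ᵍ v))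
    where
    lemma : ∀ u v → u ≡ v +ᵍ (u -ᵍ v)
    lemma = solve-∀ 𝔾-ring

  cauchyG-bounded : ∀ {u} → CauchyG u → BoundedG u
  cauchyG-bounded {u} c = let N , h = c 1ℚ 0<1 in
    ‖ u N ‖ + 1ℚ , ≤-+ˡ (‖‖-nonNeg (u N)) , N ,
    λ k N≤k → ℚ.≤-trans (≤-triangle (u k) (u N)) (ℚ.+-monoʳ-≤ (‖ u N ‖) (ℚ.<⇒≤ (h k N N≤k ℕ.≤-refl)))

  Apart : (ℕ → 𝔾) → Set
  Apart u = ∃ λ ε → 0ℚ < ε × Eventually λ k → ε ≤ ‖ u k ‖

  private
    quarter+half : ∀ ε → ½ * ε + ½ * (½ * ε) + ½ * (½ * ε) ≡ ε
    quarter+half = solve-∀ ℚ-ring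
    half-split : ∀ ε → ½ * ε ≡ ½ * (½ * ε) + ½ * (½ * ε)
    half-split = solve-∀ ℚ-ring

  -- For each single `ε` one late rational value decides: either the sequence eventually stays below
  -- `ε` or it is bounded away from 0. Only the passage from all `ε` to one of them needs the double
  -- negation.
  not-null⇒apart : ∀ {u} → CauchyG u → ¬ Null u → ¬ ¬ Apart u
  not-null⇒apart {u} c ¬null ¬apart = ¬null null
    where
    null : Null u
    null ε 0<ε = decide (‖ u N ‖ ℚ.<? ½ * ε)
      where
      0<¼ε = half>0 (½ * ε) (half>0 ε 0<ε)
      N = proj₁ (c (½ * (½ * ε)) 0<¼ε)
      h = proj₂ (c (½ * (½ * ε)) 0<¼ε)
      decide : Dec (‖ u N ‖ < ½ * ε) → Eventually λ k → ‖ u k ‖ < ε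
      decide (yes small) = N , λ k N≤k → ℚ.≤-<-trans (≤-triangle (u k) (u N))
        (ℚ.<-≤-trans (ℚ.+-mono-< small (h k N N≤k ℕ.≤-refl))
          (ℚ.≤-trans (≤-+ʳ (ℚ.<⇒≤ 0<¼ε)) (ℚ.≤-reflexive (quarter+half ε))))
      decide (no large) = ⊥-elim (¬apart (½ * (½ * ε) , 0<¼ε , N , λ k N≤k →
        ℚ.≮⇒≥ λ uk< → large (ℚ.≤-<-trans (≤-triangle (u N) (u k))
          (ℚ.<-≤-trans (ℚ.+-mono-< uk< (h N k ℕ.≤-refl N≤k)) (ℚ.≤-reflexive (sym (half-split ε)))))))

  apart-product : ∀ {u v : ℕ → 𝔾} → Apart u → Null (λ k → u k *ᵍ v k) → Null v
  apart-product {u} {v} (δ , 0<δ , large) h ε 0<ε =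
    let η , 0<η , 2η≤ = shrink 2ℚ (δ * ε) (*-pos 0<δ 0<ε)
    in eventually-map (λ k hk → *-cancel<ʳ (ℚ.<⇒≤ 0<δ) (ℚ.≤-<-trans (*-monoˡ (‖‖-nonNeg (v k)) (proj₁ hk))
         (ℚ.≤-<-trans (‖*‖-lower (u k) (v k)) (ℚ.<-≤-trans (*-mono<ʳ 0<2 (proj₂ hk)) 2η≤)))) (large ∩ h η 0<η)

  -- If the first factor is not null, it is bounded away from 0 and can be cancelled. Which factor
  -- vanishes cannot be decided, hence the double negation.
  null-product : ∀ {u v : ℕ → 𝔾} → CauchyG u → Null (λ k → u k *ᵍ v k) → ¬ ¬ (Null u ⊎ Null v)
  null-product c h k = not-null⇒apart c (k ∘ inj₁) λ apart → k (inj₂ (apart-product apart h))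

  coefficients-bounded : ∀ n p → Below 0ᵍ n p → ∃ λ B → 0ℚ ≤ B × ∀ i → ‖ p i ‖ ≤ B
  coefficients-bounded zero    p h = 0ℚ , ℚ.≤-refl , λ i → ℚ.≤-reflexive (trans (cong ‖_‖ (h i z≤n)) ‖0‖)
  coefficients-bounded (suc n) p h = let B , 0≤B , hB = coefficients-bounded n (p ∘ suc) (below-tail n h) in
    ‖ p 0 ‖ + B , +-nonNeg (‖‖-nonNeg (p 0)) 0≤B , λ
      { zero    → ≤-+ʳ 0≤B
      ; (suc i) → ℚ.≤-trans (hB i) (≤-+ˡ (‖‖-nonNeg (p 0))) }

  eval-bounded : ∀ n p → Below 0ᵍ n p → ∀ {z} → BoundedG z → BoundedG (λ k → eval n p (z k))
  eval-bounded n p h {z} (X , 1≤X , bound) = let B , 0≤B , hB = coefficients-bounded n p h in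
    1ℚ + fromℕ n * (B * X ^ n) , ≤-+ʳ (0≤cBX n n 0≤B 1≤X) ,
    eventually-map (λ k hk → ℚ.≤-trans (eval-bound n n (ℕ.n≤1+n n) 0≤B 1≤X hB hk) (≤-+ˡ 0≤1)) bound

  eval-cauchy : ∀ n p → Below 0ᵍ n p → ∀ {z} → CauchyG z → CauchyG (λ k → eval n p (z k))
  eval-cauchy n p h {z} c ε 0<ε = N′ ℕ.⊔ N , λ i j hi hj →
      let i≥M = ℕ.m⊔n≤o⇒m≤o N′ N hi ; j≥M = ℕ.m⊔n≤o⇒m≤o N′ N hj in
      ℚ.≤-<-trans (ℚ.≤-reflexive (cong ‖_‖ (eval-difference n p (z j) (z i))))
        (ℚ.≤-<-trans (‖*‖ (z i -ᵍ z j) _)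
          (ℚ.≤-<-trans (*-monoʳ (‖‖-nonNeg (z i -ᵍ z j)) (ℚ.≤-trans (divided-bound n n (ℕ.m≤n⇒m≤1+n (ℕ.n≤1+n n)) 0≤B 1≤X hB (bounded j j≥M) (bounded i i≥M)) (≤-+ˡ 0≤1)))
            (ℚ.<-≤-trans (*-mono<ˡ 0<K (close i j (ℕ.m⊔n≤o⇒n≤o N′ N hi) (ℕ.m⊔n≤o⇒n≤o N′ N hj))) (ℚ.≤-trans (ℚ.≤-reflexive (ℚ.*-comm η K)) Kη≤ε))))
    where
    coeffs = coefficients-bounded n p h
    B = proj₁ coeffs
    0≤B = proj₁ (proj₂ coeffs)
    hB = proj₂ (proj₂ coeffs)
    bz = cauchyG-bounded c
    X = proj₁ bz
    1≤X = proj₁ (proj₂ bz)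
    N′ = proj₁ (proj₂ (proj₂ bz))
    bounded = proj₂ (proj₂ (proj₂ bz))
    K = 1ℚ + fromℕ (n ℕ.* n) * (B * X ^ n)
    0<K : 0ℚ < K
    0<K = +-pos-nonNeg 0<1 (0≤cBX (n ℕ.* n) n 0≤B 1≤X)
    shrunk = shrink K ε 0<ε
    η = proj₁ shrunk
    Kη≤ε = proj₂ (proj₂ shrunk)
    N = proj₁ (c η (proj₁ (proj₂ shrunk)))
    close = proj₂ (c η (proj₁ (proj₂ shrunk)))

  real-below : ∀ {n p} → Below 0ℚ n p → Below 0ᵍ n (real ∘ p)
  real-below h i n≤i = cong real (h i n≤i)

  module Place (z : ℕ → 𝔾) (cauchy-z : CauchyG z) where

    -- Vanishing of `p` at the limit of `z`, expressed through values at the rational approximations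
    -- only.
    V : ℕ → (ℕ → ℚ) → Set
    V n p = Null (λ k → eval n (real ∘ p) (z k))

    V-extend : ∀ {n m p} → n ℕ.≤ m → Below 0ℚ n p → V n p → V m p
    V-extend n≤m h = null-cong λ k → sym (eval-extend n≤m (real-below h) (z k))

    V-restrict : ∀ {n m p} → n ℕ.≤ m → Below 0ℚ n p → V m p → V n p
    V-restrict n≤m h = null-cong λ k → eval-extend n≤m (real-below h) (z k)

    V-resize : ∀ {n m p} → Below 0ℚ n p → Below 0ℚ m p → V n p → V m p
    V-resize {n} {m} {p} hn hm h = V-restrict (ℕ.m≤n⊔m n m) hm (V-extend (ℕ.m≤m⊔n n m) hn h)

    V-cong : ∀ {n p q} → (∀ i → p i ≡ q i) → V n p → V n q
    V-cong {n} e = null-cong λ k → eval-cong n (λ i _ → cong real (e i)) (z k)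

    V-conv : ∀ a b p q → Below 0ℚ a p → Below 0ℚ b q → V (a ℕ.+ b) (convℚ p q) → ¬ ¬ (V a p ⊎ V b q)
    V-conv a b p q hp hq h = null-product (eval-cauchy a (real ∘ p) (real-below hp) cauchy-z) (null-cong (λ k →
      trans (eval-cong (a ℕ.+ b) (λ i _ → real-conv p q i) (z k)) (eval-conv a b (real ∘ p) (real ∘ q) (real-below hp) (real-below hq) (z k))) h)

    V-conv⁺ : ∀ a b p q → Below 0ℚ a p → Below 0ℚ b q → V b q → V (a ℕ.+ b) (convℚ p q)
    V-conv⁺ a b p q hp hq h = null-cong (λ k →
        sym (trans (eval-cong (a ℕ.+ b) (λ i _ → real-conv p q i) (z k)) (eval-conv a b (real ∘ p) (real ∘ q) (real-below hp) (real-below hq) (z k))))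
      (null-*-bounded (eval-bounded a (real ∘ p) (real-below hp) (cauchyG-bounded cauchy-z)) h)

    V-linear : ∀ n a b p q → V n p → V n q → V n (λ i → a * p i + b * q i)
    V-linear n a b p q hp hq = null-cong (λ k → sym (trans (eval-cong n (λ i _ → cong₂ _+ᵍ_ (real-* a (p i)) (real-* b (q i))) (z k))
        (eval-linear n (real a) (real b) (real ∘ p) (real ∘ q) (z k))))
      (null-+ (null-*-bounded (constant a) hp) (null-*-bounded (constant b) hq))
      where
      constant : ∀ a → BoundedG (λ _ → real a)
      constant a = 1ℚ + ‖ real a ‖ , ≤-+ʳ (‖‖-nonNeg (real a)) , 0 , λ _ _ → ≤-+ˡ 0≤1

    V-one : ∀ {p} → p 0 ≡ 1ℚ → ¬ V 1 p
    V-one {p} e h = let N , hN = h 1ℚ 0<1 in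
      ℚ.<-irrefl refl (subst (_< 1ℚ) (trans (cong ‖_‖ (trans (lemma (real (p 0)) (z N)) (cong real e))) ‖1‖) (hN N ℕ.≤-refl))
      where
      lemma : ∀ a z → a +ᵍ z *ᵍ 0ᵍ ≡ a
      lemma = solve-∀ 𝔾-ring

    -- The minimal polynomial of the limit point, characterised by its degree instead of
    -- irreducibility; this is the property that divisions and Bezoutians use.
    record Minimal (m : ℕ) (f : ℕ → ℚ) : Set where
      field
        monic    : f m ≡ 1ℚ
        below    : Below 0ℚ (suc m) f
        vanishes : V (suc m) f
        least    : ∀ p → Below 0ℚ m p → V m p → ∀ i → p i ≡ 0ℚ

    leading : ∀ n p i → Below 0ℚ n p → p i ≢ 0ℚ → ∃ λ t → t ℕ.< n × p t ≢ 0ℚ × Below 0ℚ (suc t) p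
    leading zero    p i h pi≢0 = ⊥-elim (pi≢0 (h i z≤n))
    leading (suc n) p i h pi≢0 = decide (p n ℚ.≟ 0ℚ)
      where
      decide : Dec (p n ≡ 0ℚ) → ∃ λ t → t ℕ.< suc n × p t ≢ 0ℚ × Below 0ℚ (suc t) p
      decide (no pn≢0)  = n , ℕ.≤-refl , pn≢0 , h
      decide (yes pn≡0) = let t , t<n , rest = leading n p i lower pi≢0 in t , ℕ.m≤n⇒m≤1+n t<n , rest
        where
        lower : Below 0ℚ n p
        lower j n≤j = split (ℕ.m≤n⇒m<n∨m≡n n≤j)
          where
          split : n ℕ.< j ⊎ n ≡ j → p j ≡ 0ℚ
          split (inj₁ n<j)  = h j n<j
          split (inj₂ refl) = pn≡0

    inverse≢ : ∀ a → a ≢ 0ℚ → ∃ λ b → b * a ≡ 1ℚ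
    inverse≢ a a≢0 = ℚ.1/_ a {{ℚ.≢-nonZero a≢0}} , ℚ.*-inverseˡ a {{ℚ.≢-nonZero a≢0}}
      where import Data.Rational.Base as ℚ

    normalise : ∀ n p i → Below 0ℚ n p → p i ≢ 0ℚ → V n p → ∃ λ t → ∃ λ f → t ℕ.< n × f t ≡ 1ℚ × Below 0ℚ (suc t) f × V (suc t) f
    normalise n p i h pi≢0 hV =
      let t , t<n , pt≢0 , ht = leading n p i h pi≢0
          b , bp≡1 = inverse≢ (p t) pt≢0
      in t , (λ j → b * p j + 0ℚ * p j) , t<n , trans (drop b (p t)) bp≡1 ,
         (λ j t<j → trans (cong (λ x → b * x + 0ℚ * x) (ht j t<j)) (zeros b)) ,
         V-linear (suc t) b 0ℚ p p (V-restrict t<n ht hV) (V-restrict t<n ht hV)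
      where
      drop : ∀ b x → b * x + 0ℚ * x ≡ b * x
      drop = solve-∀ ℚ-ring
      zeros : ∀ b → b * 0ℚ + 0ℚ * 0ℚ ≡ 0ℚ
      zeros = solve-∀ ℚ-ring

    -- Descent on the degree. Under the assumption that nothing is minimal, a nonzero polynomial of
    -- smaller degree vanishing at the point would be normalised and refuted by induction; as
    -- equality of rationals is decidable, this proves `least` for `P` itself.
    minimal-exists : ∀ d P → P d ≡ 1ℚ → Below 0ℚ (suc d) P → V (suc d) P →
      ¬ (∀ m f → m ℕ.≤ d → ¬ Minimal m f)
    minimal-exists = <-rec Goal step
      where
      Goal : ℕ → Set
      Goal d = ∀ P → P d ≡ 1ℚ → Below 0ℚ (suc d) P → V (suc d) P → ¬ (∀ m f → m ℕ.≤ d → ¬ Minimal m f)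
      step : ∀ d → (∀ {e} → e ℕ.< d → Goal e) → Goal d
      step d rec P top h hV none = none d P ℕ.≤-refl record { monic = top ; below = h ; vanishes = hV ; least = least }
        where
        least : ∀ p → Below 0ℚ d p → V d p → ∀ i → p i ≡ 0ℚ
        least p hp hVp i = decide (p i ℚ.≟ 0ℚ)
          where
          decide : Dec (p i ≡ 0ℚ) → p i ≡ 0ℚ
          decide (yes e) = e
          decide (no pi≢0) = let t , f , t<d , ft , hf , hVf = normalise d p i hp pi≢0 hVp in
            ⊥-elim (rec t<d f ft hf hVf λ m g m≤t → none m g (ℕ.≤-trans m≤t (ℕ.<⇒≤ t<d)))

    minimal-degree : ∀ {f} → ¬ Minimal 0 f
    minimal-degree {f} min = V-one {f} (Minimal.monic min) (Minimal.vanishes min)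

    minimal-divides : ∀ m f (min : Minimal (suc m) f) n P → Below 0ℚ n P → V n P →
      ∀ k → P k ≡ convℚ (Divide.quo m f (Minimal.monic min) (Minimal.below min) n P) f k
    minimal-divides m f min n P h hV k = trans (D.division n P h k)
      (trans (cong (convℚ (D.quo n P) f k +_) (least (D.rem n P) (D.rem-below n P) V-rem k)) (ℚ.+-identityʳ _))
      where
      open Minimal min
      module D = Divide m f monic below
      q-below : Below 0ℚ n (D.quo n P)
      q-below i n≤i = D.quo-below n P h i (ℕ.m≤n⇒m≤n+o (suc m) n≤i)
      N = n ℕ.+ suc (suc m)
      V-product : V N (convℚ (D.quo n P) f)
      V-product = V-conv⁺ n (suc (suc m)) (D.quo n P) f q-below below vanishes
      V-rem : V (suc m) (D.rem n P)
      V-rem = V-restrict (ℕ.≤-trans (ℕ.n≤1+n (suc m)) (ℕ.m≤n+m (suc (suc m)) n)) (D.rem-below n P)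
        (V-cong {N} (λ i → trans (cong (λ t → 1ℚ * t + - 1ℚ * convℚ (D.quo n P) f i) (D.division n P h i)) (lemma (convℚ (D.quo n P) f i) (D.rem n P i)))
          (V-linear N 1ℚ (- 1ℚ) P (convℚ (D.quo n P) f) (V-extend (ℕ.m≤m+n n (suc (suc m))) h hV) V-product))
        where
        lemma : ∀ c r → 1ℚ * (c + r) + - 1ℚ * c ≡ r
        lemma = solve-∀ ℚ-ring

-- Complex numbers as sequences of Gaussian rationals

module Complex where
  open import Data.Integer.Base as ℤ using (ℤ; +_)
  open import Data.List.Base using ([]; _∷_; map; length)
  open import Data.Rational.Base using (_+_; _*_; _-_; -_; ∣_∣; _≤_)
  open import Tactic.RingSolver using (solve-∀)
  open Rationals
  open Gaussian
  open Polynomials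
  open Places

  at : ℂ → ℕ → 𝔾
  at z k = seq (re z) k ⊹ seq (im z) k

  at-cauchy : ∀ z → CauchyG (at z)
  at-cauchy z ε 0<ε =
    let M , hM = cauchy (re z) (½ * ε) (half>0 ε 0<ε)
        N , hN = cauchy (im z) (½ * ε) (half>0 ε 0<ε)
    in M ℕ.⊔ N , λ m n hm hn → ℚ.≤-<-trans (ℚ.≤-reflexive (‖⊹‖ _ _))
         (ℚ.<-≤-trans (ℚ.+-mono-< (hM m n (ℕ.m⊔n≤o⇒m≤o M N hm) (ℕ.m⊔n≤o⇒m≤o M N hn)) (hN m n (ℕ.m⊔n≤o⇒n≤o M N hm) (ℕ.m⊔n≤o⇒n≤o M N hn)))
           (ℚ.≤-reflexive (half+half ε)))

  ≈⇒null : ∀ {z w} → z ≈ᶜ w → Null (λ k → at z k -ᵍ at w k)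
  ≈⇒null (hr , hi) ε 0<ε = eventually-map (λ k h → ℚ.≤-<-trans (ℚ.≤-reflexive (‖⊹‖ _ _))
      (ℚ.<-≤-trans (ℚ.+-mono-< (proj₁ h) (proj₂ h)) (ℚ.≤-reflexive (half+half ε))))
    (hr (½ * ε) (half>0 ε 0<ε) ∩ hi (½ * ε) (half>0 ε 0<ε))

  null⇒≈ : ∀ {z w} → Null (λ k → at z k -ᵍ at w k) → z ≈ᶜ w
  null⇒≈ {z} {w} h = (λ ε 0<ε → eventually-map (λ k hk → ℚ.≤-<-trans (ℚ.≤-trans (≤-+ʳ (ℚ.0≤∣p∣ _)) (ℚ.≤-reflexive (sym (‖⊹‖ _ _)))) hk) (h ε 0<ε))
                   , (λ ε 0<ε → eventually-map (λ k hk → ℚ.≤-<-trans (ℚ.≤-trans (≤-+ˡ (ℚ.0≤∣p∣ (seq (re z) k - seq (re w) k))) (ℚ.≤-reflexive (sym (‖⊹‖ _ _)))) hk) (h ε 0<ε))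

  coeffℚ : ℤ[X].Poly → ℕ → ℚ
  coeffℚ P k = fromℤ (ℤ[X].coeff P k)

  -- This is an equation and not an approximation, because the arithmetic of Cauchy sequences acts
  -- termwise.
  at-eval : ∀ P α k → at (ℂ[X].eval (map fromℤᶜ P) α) k ≡ eval (length P) (real ∘ coeffℚ P) (at α k)
  at-eval []      α k = refl
  at-eval (a ∷ P) α k = cong (λ t → real (fromℤ a) +ᵍ at α k *ᵍ t) (at-eval P α k)

  coeff-beyond : ∀ P k → length P ℕ.≤ k → ℤ[X].coeff P k ≡ + 0
  coeff-beyond []      k       _       = refl
  coeff-beyond (a ∷ P) (suc k) (s≤s h) = coeff-beyond P k h

  coeffℚ-below : ∀ P → Below 0ℚ (length P) (coeffℚ P)
  coeffℚ-below P k h = cong fromℤ (coeff-beyond P k h)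

  private
    minus-zero : ∀ z → z -ᵍ 0ᵍ ≡ z
    minus-zero = solve-∀ 𝔾-ring

  root⇒null : ∀ P α → Root P α → Null (λ k → eval (length P) (real ∘ coeffℚ P) (at α k))
  root⇒null P α h = null-cong (λ k → trans (minus-zero _) (at-eval P α k)) (≈⇒null {ℂ[X].eval (map fromℤᶜ P) α} {fromℤᶜ (+ 0)} h)

  null⇒root : ∀ P α → Null (λ k → eval (length P) (real ∘ coeffℚ P) (at α k)) → Root P α
  null⇒root P α h = null⇒≈ {ℂ[X].eval (map fromℤᶜ P) α} {fromℤᶜ (+ 0)} (null-cong (λ k → sym (trans (minus-zero _) (at-eval P α k))) h)

  difference-cauchy : ∀ z w → CauchyG (λ k → at z k -ᵍ at w k)
  difference-cauchy z w = at-cauchy (z -ᶜ w)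

  seq-^ : ∀ x n k → seq (x ^ᴿ n) k ≡ seq x k ^ n
  seq-^ x zero    k = refl
  seq-^ x (suc n) k = cong (seq x k *_) (seq-^ x n k)

  coeff-height : ∀ P k → ℤ.∣ ℤ[X].coeff P k ∣ ℕ.≤ height P
  coeff-height []      k       = z≤n
  coeff-height (a ∷ P) zero    = ℕ.m≤m⊔n ℤ.∣ a ∣ (height P)
  coeff-height (a ∷ P) (suc k) = ℕ.≤-trans (coeff-height P k) (ℕ.m≤n⊔m ℤ.∣ a ∣ (height P))

  coeffℚ-height : ∀ P k → ‖ real (coeffℚ P k) ‖ ≤ fromℕ (height P)
  coeffℚ-height P k = ℚ.≤-trans (ℚ.≤-reflexive (trans (‖real‖ _) (∣fromℤ∣ (ℤ[X].coeff P k)))) (fromℕ-mono (coeff-height P k))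

  coeff-⊕ : ∀ p q k → ℚ[X].coeff (p ℚ[X].⊕ q) k ≡ ℚ[X].coeff p k + ℚ[X].coeff q k
  coeff-⊕ []      q       k       = sym (ℚ.+-identityˡ _)
  coeff-⊕ (a ∷ p) []      k       = sym (ℚ.+-identityʳ _)
  coeff-⊕ (a ∷ p) (b ∷ q) zero    = refl
  coeff-⊕ (a ∷ p) (b ∷ q) (suc k) = coeff-⊕ p q k

  coeff-map* : ∀ a q k → ℚ[X].coeff (map (a *_) q) k ≡ a * ℚ[X].coeff q k
  coeff-map* a []      k       = sym (ℚ.*-zeroʳ a)
  coeff-map* a (b ∷ q) zero    = refl
  coeff-map* a (b ∷ q) (suc k) = coeff-map* a q k

  coeff-⊛ : ∀ p q k → ℚ[X].coeff (p ℚ[X].⊛ q) k ≡ convℚ (ℚ[X].coeff p) (ℚ[X].coeff q) k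
  coeff-⊛ [] q k = sym (zeros (ℚ[X].coeff q) k)
    where
    zeros : ∀ q k → convℚ (λ _ → 0ℚ) q k ≡ 0ℚ
    zeros q zero    = ℚ.*-zeroˡ (q 0)
    zeros q (suc k) = cong₂ _+_ (ℚ.*-zeroˡ (q (suc k))) (zeros q k)
  coeff-⊛ (a ∷ p) q zero    = trans (coeff-⊕ (map (a *_) q) (0ℚ ∷ p ℚ[X].⊛ q) 0)
    (trans (ℚ.+-identityʳ _) (coeff-map* a q 0))
  coeff-⊛ (a ∷ p) q (suc k) = trans (coeff-⊕ (map (a *_) q) (0ℚ ∷ p ℚ[X].⊛ q) (suc k))
    (cong₂ _+_ (coeff-map* a q (suc k)) (coeff-⊛ p q k))

  coeff-map/1 : ∀ P k → ℚ[X].coeff (map fromℤ P) k ≡ coeffℚ P k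
  coeff-map/1 []      k       = refl
  coeff-map/1 (a ∷ P) zero    = refl
  coeff-map/1 (a ∷ P) (suc k) = coeff-map/1 P k

-- Grids and inequalities for Cauchy sequences

module Reals where
  open import Data.Integer.Base as ℤ using (ℤ; +_)
  import Data.Integer.Properties as ℤ
  open import Data.Rational.Base using (_+_; _*_; _-_; -_; _≤_; _<_; _/_; toℚᵘ)
  import Data.Rational.Unnormalised.Base as ℚᵘ
  import Data.Rational.Unnormalised.Properties as ℚᵘ
  open import Tactic.RingSolver using (solve-∀)
  open Rationals

  divide-cancel : ∀ a n .{{_ : ℕ.NonZero n}} → (a / n) * fromℕ n ≡ fromℤ a
  divide-cancel a (suc n) = ℚ.toℚᵘ-injective (begin
    toℚᵘ ((a / suc n) * fromℕ (suc n))                      ≈⟨ ℚ.toℚᵘ-homo-* (a / suc n) (fromℕ (suc n)) ⟩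
    toℚᵘ (a / suc n) ℚᵘ.* toℚᵘ (fromℕ (suc n))            ≈⟨ ℚᵘ.*-cong (ℚ.toℚᵘ-fromℚᵘ (ℚᵘ.mkℚᵘ a n)) (toℚᵘ-fromℤ (+ suc n)) ⟩
    ℚᵘ.mkℚᵘ a n ℚᵘ.* ℚᵘ.mkℚᵘ (+ suc n) 0                      ≈⟨ ℚᵘ.*≡* (trans (ℤ.*-identityʳ (a ℤ.* + suc n)) (cong (λ k → a ℤ.* (+ suc k)) (sym (ℕ.*-identityʳ n)))) ⟩
    ℚᵘ.mkℚᵘ a 0                                               ≈⟨ ℚᵘ.≃-sym (toℚᵘ-fromℤ a) ⟩
    toℚᵘ (fromℤ a)  ∎)
    where
    open ℚᵘ.≃-Reasoning

  -- The mesh of the grid on which the `n`-th approximation of a root, a square root or a logarithm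
  -- is searched.
  step : ℕ → ℚ
  step n = + 1 / suc n

  step-cancel : ∀ n → step n * fromℕ (suc n) ≡ 1ℚ
  step-cancel n = divide-cancel (+ 1) (suc n)

  0<step : ∀ n → 0ℚ < step n
  0<step n = *-cancel<ʳ {0ℚ} {step n} {fromℕ (suc n)} (fromℕ-nonNeg (suc n))
    (subst₂ _<_ (sym (ℚ.*-zeroʳ (fromℕ (suc n)))) (trans (sym (step-cancel n)) (ℚ.*-comm (step n) (fromℕ (suc n)))) 0<1)

  step-small : ∀ ε → 0ℚ < ε → Eventually λ n → step n < ε
  step-small ε 0<ε = N , λ n N≤n → *-cancel<ʳ {step n} {ε} {fromℕ (suc n)} (fromℕ-nonNeg (suc n))
      (subst₂ _<_ (trans εr≡1 (trans (sym (step-cancel n)) (ℚ.*-comm (step n) (fromℕ (suc n))))) (ℚ.*-comm ε (fromℕ (suc n)))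
        (*-mono<ʳ 0<ε (ℚ.≤-<-trans r≤N (fromℕ-mono< (s≤s N≤n)))))
    where
    r = proj₁ (inverse 0<ε)
    εr≡1 : ε * r ≡ 1ℚ
    εr≡1 = proj₂ (proj₂ (inverse 0<ε))
    N = proj₁ (archimedean r)
    r≤N : r ≤ fromℕ N
    r≤N = proj₂ (archimedean r)

  cut : (Q : ℕ → Set) → (∀ p → Dec (Q p)) → ∀ B → Q 0 → ¬ Q B → ∃ λ p → Q p × ¬ Q (suc p)
  cut Q Q? zero    q ¬q = ⊥-elim (¬q q)
  cut Q Q? (suc B) q ¬q = decide (Q? B)
    where
    decide : Dec (Q B) → _
    decide (yes qB) = B , qB , ¬q
    decide (no ¬qB) = cut Q Q? B q ¬qB

  -- Exchanging `m` and `n` bounds the absolute value. Half of `ε` is used, because the strict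
  -- inequality is weakened on the way.
  one-sided-cauchy : ∀ (x : ℕ → ℚ) → (∀ ε → 0ℚ < ε → ∃ λ N → ∀ m n → N ℕ.≤ m → N ℕ.≤ n → x m < x n + ε) → Cauchy x
  one-sided-cauchy x h ε 0<ε = N , λ m n hm hn → ℚ.≤-<-trans
      (∣p∣≤ {x m - x n} {½ * ε} (bound m n hm hn) (subst (_≤ ½ * ε) (swap (x n) (x m)) (bound n m hn hm))) half<
    where
    N = proj₁ (h (½ * ε) (half>0 ε 0<ε))
    swap : ∀ a b → a - b ≡ - (b - a)
    swap = solve-∀ ℚ-ring
    cancel : ∀ a b → a + b - a ≡ b
    cancel = solve-∀ ℚ-ring
    bound : ∀ m n → N ℕ.≤ m → N ℕ.≤ n → x m - x n ≤ ½ * ε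
    bound m n hm hn = subst (x m - x n ≤_) (cancel (x n) (½ * ε)) (ℚ.+-monoˡ-≤ (- x n) (ℚ.<⇒≤ (proj₂ (h (½ * ε) (half>0 ε 0<ε)) m n hm hn)))
    half< : ½ * ε < ε
    half< = subst₂ _<_ (ℚ.+-identityʳ (½ * ε)) (half+half ε) (ℚ.+-monoʳ-< (½ * ε) (half>0 ε 0<ε))

  +-cancelʳ-≤ : ∀ c {a b} → a + c ≤ b + c → a ≤ b
  +-cancelʳ-≤ c {a} {b} h = subst₂ _≤_ (cancel a c) (cancel b c) (ℚ.+-monoˡ-≤ (- c) h)
    where
    cancel : ∀ a c → a + c - c ≡ a
    cancel = solve-∀ ℚ-ring

  -- Uses the Cauchy property to turn the negative statement x ≤ y into a positive one.
  ≤ᴿ⇒eventually : ∀ x y → x ≤ᴿ y → ∀ ε → 0ℚ < ε → Eventually λ k → seq x k < seq y k + ε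
  ≤ᴿ⇒eventually x y x≤y ε 0<ε = decide (seq x N ℚ.<? seq y N + ½ * ε)
    where
    η = ½ * (½ * (½ * ε))
    0<η : 0ℚ < η
    0<η = half>0 _ (half>0 _ (half>0 ε 0<ε))
    cx = cauchy x η 0<η
    cy = cauchy y η 0<η
    N = proj₁ cx ℕ.⊔ proj₁ cy
    x-near : ∀ m n → N ℕ.≤ m → N ℕ.≤ n → seq x m < seq x n + η
    x-near m n hm hn = subst (_< seq x n + η) (recover (seq x n) (seq x m)) (ℚ.+-monoʳ-< (seq x n) (ℚ.≤-<-trans (p≤∣p∣ (seq x m - seq x n))
      (proj₂ cx m n (ℕ.m⊔n≤o⇒m≤o (proj₁ cx) (proj₁ cy) hm) (ℕ.m⊔n≤o⇒m≤o (proj₁ cx) (proj₁ cy) hn))))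
    y-near : ∀ m n → N ℕ.≤ m → N ℕ.≤ n → seq y m < seq y n + η
    y-near m n hm hn = subst (_< seq y n + η) (recover (seq y n) (seq y m)) (ℚ.+-monoʳ-< (seq y n) (ℚ.≤-<-trans (p≤∣p∣ (seq y m - seq y n))
      (proj₂ cy m n (ℕ.m⊔n≤o⇒n≤o (proj₁ cx) (proj₁ cy) hm) (ℕ.m⊔n≤o⇒n≤o (proj₁ cx) (proj₁ cy) hn))))
    decide : Dec (seq x N < seq y N + ½ * ε) → Eventually λ k → seq x k < seq y k + ε
    decide (yes h) = N , λ k hk → ℚ.<-trans (x-near k N hk ℕ.≤-refl) (ℚ.<-trans (ℚ.+-monoˡ-< η h)
        (ℚ.<-≤-trans (ℚ.+-monoˡ-< η (ℚ.+-monoˡ-< (½ * ε) (y-near N k ℕ.≤-refl hk))) (subst (_≤ seq y k + ε) (sum (seq y k) ε) (ℚ.+-monoʳ-≤ (seq y k) (three-quarters)))))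
      where
      sum : ∀ y ε → y + (½ * ε + ½ * (½ * ε)) ≡ y + ½ * (½ * (½ * ε)) + ½ * ε + ½ * (½ * (½ * ε))
      sum = solve-∀ ℚ-ring
      all : ∀ ε → ½ * ε + ½ * (½ * ε) + ½ * (½ * ε) ≡ ε
      all = solve-∀ ℚ-ring
      three-quarters : ½ * ε + ½ * (½ * ε) ≤ ε
      three-quarters = subst (½ * ε + ½ * (½ * ε) ≤_) (all ε) (≤-+ʳ (ℚ.<⇒≤ (half>0 _ (half>0 ε 0<ε))))
    decide (no h) = ⊥-elim (x≤y (½ * (½ * ε) , half>0 _ (half>0 ε 0<ε) , N , λ k hk → ℚ.<-≤-trans (ℚ.+-monoˡ-< (½ * (½ * ε)) (y-near k N hk ℕ.≤-refl))
        (+-cancelʳ-≤ η (ℚ.≤-trans (ℚ.≤-reflexive (sum (seq y N) ε)) (ℚ.≤-trans (ℚ.≮⇒≥ h) (ℚ.<⇒≤ (x-near N k ℕ.≤-refl hk)))))))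
      where
      sum : ∀ y ε → y + ½ * (½ * (½ * ε)) + ½ * (½ * ε) + ½ * (½ * (½ * ε)) ≡ y + ½ * ε
      sum = solve-∀ ℚ-ring

-- Roots of increasing functions and square roots

module Cuts where
  open import Data.Rational.Base using (_+_; _*_; _-_; -_; ∣_∣; _≤_; _<_)
  open import Tactic.RingSolver using (solve-∀)
  open Rationals
  open Gaussian using (2ℚ; 0<2)
  open Places using (_∩_; eventually-map)
  open Reals

  <⇒≱ : ∀ {a b} → a < b → ¬ (b ≤ a)
  <⇒≱ a<b b≤a = ℚ.<-irrefl refl (ℚ.<-≤-trans a<b b≤a)

  grid-next : ∀ n p → fromℕ (suc p) * step n ≡ fromℕ p * step n + step n
  grid-next n p = trans (cong (_* step n) (fromℕ-+ 1 p)) (lemma (fromℕ p) (step n))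
    where
    lemma : ∀ p h → (1ℚ + p) * h ≡ p * h + h
    lemma = solve-∀ ℚ-ring

  grid-nonNeg : ∀ n p → 0ℚ ≤ fromℕ p * step n
  grid-nonNeg n p = *-nonNeg (fromℕ-nonNeg p) (ℚ.<⇒≤ (0<step n))

  step≤1 : ∀ n → step n ≤ 1ℚ
  step≤1 n = ℚ.≤-trans (≤-*ʳ (ℚ.<⇒≤ (0<step n)) (1≤fromℕ {suc n} (s≤s z≤n))) (ℚ.≤-reflexive (step-cancel n))

  -- The `n`-th approximation is a grid point at which the sign of `f` changes. By `growth` the
  -- function is strictly increasing, so approximations from different grids agree up to a mesh; by
  -- `lipschitz` the values of `f` at them tend to 0. The interval up to 2 leaves room for the next
  -- grid point.
  module MonotoneRoot (f : ℚ → ℚ) (L : ℚ) (f0≤0 : f 0ℚ ≤ 0ℚ) (0<f1 : 0ℚ < f 1ℚ)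
    (growth : ∀ a b → 0ℚ ≤ a → a ≤ b → b - a ≤ f b - f a)
    (lipschitz : ∀ a b → 0ℚ ≤ a → a ≤ b → b ≤ 2ℚ → f b - f a ≤ L * (b - a)) where

    private
      Below′ : ℕ → ℕ → Set
      Below′ n p = f (fromℕ p * step n) ≤ 0ℚ

      found : ∀ n → ∃ λ p → Below′ n p × ¬ Below′ n (suc p)
      found n = cut (Below′ n) (λ p → f (fromℕ p * step n) ℚ.≤? 0ℚ) (suc n)
        (subst (λ t → f t ≤ 0ℚ) (sym (ℚ.*-zeroˡ (step n))) f0≤0)
        (λ h → <⇒≱ 0<f1 (subst (λ t → f t ≤ 0ℚ) (trans (ℚ.*-comm (fromℕ (suc n)) (step n)) (step-cancel n)) h))

      opaque
        -- Kept opaque so that comparing real numbers does not run the search.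
        grid : ∃ λ (t : ℕ → ℚ) → ∀ n → 0ℚ ≤ t n × f (t n) ≤ 0ℚ × 0ℚ < f (t n + step n)
        grid = (λ n → fromℕ (proj₁ (found n)) * step n) , λ n → grid-nonNeg n (proj₁ (found n)) , proj₁ (proj₂ (found n)) ,
          subst (λ x → 0ℚ < f x) (grid-next n (proj₁ (found n))) (ℚ.≰⇒> (proj₂ (proj₂ (found n))))

      t : ℕ → ℚ
      t = proj₁ grid

      f-next : ∀ n → 0ℚ < f (t n + step n)
      f-next n = proj₂ (proj₂ (proj₂ grid n))

      increasing : ∀ {a b} → 0ℚ ≤ a → f b < f a → b < a
      increasing {a} {b} 0≤a h = decide (b ℚ.<? a)
        where
        decide : Dec (b < a) → b < a
        decide (yes b<a) = b<a
        decide (no b≮a)  = ⊥-elim (<⇒≱ h (≤-by-difference (ℚ.≤-trans (difference-nonNeg (ℚ.≮⇒≥ b≮a)) (growth a b 0≤a (ℚ.≮⇒≥ b≮a)))))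

    t-nonNeg : ∀ n → 0ℚ ≤ t n
    t-nonNeg n = proj₁ (proj₂ grid n)

    f≤0 : ∀ n → f (t n) ≤ 0ℚ
    f≤0 n = proj₁ (proj₂ (proj₂ grid n))

    t≤1 : ∀ n → t n ≤ 1ℚ
    t≤1 n = ℚ.<⇒≤ (increasing 0≤1 (ℚ.≤-<-trans (f≤0 n) 0<f1))

    t-cauchy : Cauchy t
    t-cauchy = one-sided-cauchy t λ ε 0<ε → let N , small = step-small ε 0<ε in
      N , λ m n hm hn → ℚ.<-trans (increasing (+-nonNeg (t-nonNeg n) (ℚ.<⇒≤ (0<step n))) (ℚ.≤-<-trans (f≤0 m) (f-next n)))
        (ℚ.+-monoʳ-< (t n) (small n hn))

    root : ℝ
    root = mkℝ t t-cauchy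

    f-small : ∀ n → ∣ f (t n) ∣ ≤ L * step n
    f-small n = ∣p∣≤ {f (t n)} (ℚ.≤-trans (f≤0 n) (ℚ.≤-trans (ℚ.≤-trans (ℚ.<⇒≤ (f-next n)) (≤-+ʳ (ℚ.neg-antimono-≤ (f≤0 n)))) rise)) (ℚ.≤-trans (≤-+ˡ (ℚ.<⇒≤ (f-next n))) rise)
      where
      next : ∀ t h → t + h - t ≡ h
      next = solve-∀ ℚ-ring
      rise : f (t n + step n) - f (t n) ≤ L * step n
      rise = subst (λ x → f (t n + step n) - f (t n) ≤ L * x) (next (t n) (step n))
        (lipschitz (t n) (t n + step n) (t-nonNeg n) (≤-+ʳ (ℚ.<⇒≤ (0<step n))) (ℚ.+-mono-≤ (t≤1 n) (step≤1 n)))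

    f-null : ∀ ε → 0ℚ < ε → Eventually λ n → ∣ f (t n) ∣ < ε
    f-null ε 0<ε = let η , 0<η , Lη≤ε = shrink (∣ L ∣ + 1ℚ) ε 0<ε in
      eventually-map (λ n h → ℚ.≤-<-trans (f-small n) (ℚ.≤-<-trans (*-monoˡ (ℚ.<⇒≤ (0<step n)) (ℚ.≤-trans (p≤∣p∣ L) (≤-+ʳ 0≤1)))
        (ℚ.<-≤-trans (*-mono<ʳ (ℚ.+-mono-≤-< (ℚ.0≤∣p∣ L) 0<1) h) Lη≤ε))) (step-small η 0<η)

  module SquareRoot (y : ℝ) (y-nonNeg : ∀ n → 0ℚ ≤ seq y n) where

    private
      Below′ : ℕ → ℕ → Set
      Below′ n p = fromℕ p * step n * (fromℕ p * step n) ≤ seq y n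

      too-large : ∀ n → ¬ Below′ n (suc (proj₁ (archimedean (seq y n))) ℕ.* suc n)
      too-large n h = ℚ.<-irrefl refl (ℚ.<-≤-trans
        (ℚ.≤-<-trans (proj₂ (archimedean (seq y n))) (ℚ.<-≤-trans (fromℕ-mono< {N} (ℕ.≤-refl)) (≤-*ʳ (fromℕ-nonNeg (suc N)) (1≤fromℕ {suc N} (s≤s z≤n)))))
        (subst (λ x → x * x ≤ seq y n) simplify h))
        where
        N = proj₁ (archimedean (seq y n))
        simplify : fromℕ (suc N ℕ.* suc n) * step n ≡ fromℕ (suc N)
        simplify = trans (cong (_* step n) (fromℕ-* (suc N) (suc n))) (trans (ℚ.*-assoc (fromℕ (suc N)) (fromℕ (suc n)) (step n))
          (trans (cong (fromℕ (suc N) *_) (trans (ℚ.*-comm (fromℕ (suc n)) (step n)) (step-cancel n))) (ℚ.*-identityʳ _)))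

      found : ∀ n → ∃ λ p → Below′ n p × ¬ Below′ n (suc p)
      found n = cut (Below′ n) (λ p → fromℕ p * step n * (fromℕ p * step n) ℚ.≤? seq y n) (suc (proj₁ (archimedean (seq y n))) ℕ.* suc n)
        (subst (λ t → t * t ≤ seq y n) (sym (ℚ.*-zeroˡ (step n))) (y-nonNeg n)) (too-large n)

      opaque
        grid : ∃ λ (s : ℕ → ℚ) → ∀ n → 0ℚ ≤ s n × s n * s n ≤ seq y n × seq y n < (s n + step n) * (s n + step n)
        grid = (λ n → fromℕ (proj₁ (found n)) * step n) , λ n → grid-nonNeg n (proj₁ (found n)) , proj₁ (proj₂ (found n)) ,
          subst (λ x → seq y n < x * x) (grid-next n (proj₁ (found n))) (ℚ.≰⇒> (proj₂ (proj₂ (found n))))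

      s : ℕ → ℚ
      s = proj₁ grid

    s-nonNeg : ∀ n → 0ℚ ≤ s n
    s-nonNeg n = proj₁ (proj₂ grid n)

    s²≤y : ∀ n → s n * s n ≤ seq y n
    s²≤y n = proj₁ (proj₂ (proj₂ grid n))

    private
      w : ℕ → ℚ
      w n = s n + step n

      w-nonNeg : ∀ n → 0ℚ ≤ w n
      w-nonNeg n = +-nonNeg (s-nonNeg n) (ℚ.<⇒≤ (0<step n))

      y<w² : ∀ n → seq y n < w n * w n
      y<w² n = proj₂ (proj₂ (proj₂ grid n))

      -- From `s m ² ≤ y m ≤ y n + η² < (w n)² + η² ≤ (w n + η)²`. Comparing squares avoids a
      -- division by `s`, which might tend to 0.
      s-cauchy : Cauchy s
      s-cauchy = one-sided-cauchy s λ ε 0<ε →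
        let η = ½ * ε ; 0<η = half>0 ε 0<ε
            M , close = cauchy y (η * η) (*-pos 0<η 0<η)
            N , small = step-small η 0<η
        in M ℕ.⊔ N , λ m n hm hn →
          let m≥M = ℕ.m⊔n≤o⇒m≤o M N hm ; n≥M = ℕ.m⊔n≤o⇒m≤o M N hn ; n≥N = ℕ.m⊔n≤o⇒n≤o M N hn
          in ℚ.<-trans {s m} (square-cancel-< {s m} {w n + η} (+-nonNeg (w-nonNeg n) (ℚ.<⇒≤ 0<η))
              (ℚ.≤-<-trans (s²≤y m) (ℚ.≤-<-trans (ℚ.≤-trans (ℚ.≤-reflexive (sym (recover (seq y n) (seq y m)))) (ℚ.+-monoʳ-≤ (seq y n) (ℚ.≤-trans (p≤∣p∣ (seq y m - seq y n)) (ℚ.<⇒≤ (close m n m≥M n≥M)))))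
                (ℚ.<-≤-trans (ℚ.+-monoˡ-< (η * η) (y<w² n)) (subst (w n * w n + η * η ≤_) (expand (w n) η) (≤-+ʳ (*-nonNeg {2ℚ} (ℚ.<⇒≤ 0<2) (*-nonNeg (w-nonNeg n) (ℚ.<⇒≤ 0<η)))))))))
            (subst (w n + η <_) (collect (s n) ε) (ℚ.+-monoˡ-< η (ℚ.+-monoʳ-< (s n) (small n n≥N))))
        where
        expand : ∀ w η → w * w + η * η + (1ℚ + 1ℚ) * (w * η) ≡ (w + η) * (w + η)
        expand = solve-∀ ℚ-ring
        collect : ∀ s ε → s + ½ * ε + ½ * ε ≡ s + ε
        collect = solve-∀ ℚ-ring

    sqrt : ℝ
    sqrt = mkℝ s s-cauchy

    s²-close : ∀ ε → 0ℚ < ε → Eventually λ n → seq y n - s n * s n < ε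
    s²-close ε 0<ε = close (eventually-bounded s s-cauchy)
      where
      close : (∃ λ B → _ × Eventually λ n → ∣ s n ∣ ≤ B) → Eventually λ n → seq y n - s n * s n < ε
      close (B , _ , s≤B) = let η , 0<η , Kη≤ε = shrink (2ℚ * ∣ B ∣ + 1ℚ) ε 0<ε in
        eventually-map (λ n (sn≤B , hn) → bound n η sn≤B hn Kη≤ε) (s≤B ∩ step-small η 0<η)
        where
        bound : ∀ n η → ∣ s n ∣ ≤ B → step n < η → (2ℚ * ∣ B ∣ + 1ℚ) * η ≤ ε → seq y n - s n * s n < ε
        bound n η sn≤B hn Kη≤ε = begin-strict
          seq y n - s n * s n  <⟨ ℚ.+-monoˡ-< (- (s n * s n)) (y<w² n) ⟩
          w n * w n - s n * s n  ≡⟨ expand (s n) (step n) ⟩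
          ((1ℚ + 1ℚ) * s n + step n) * step n  ≤⟨ *-monoˡ (ℚ.<⇒≤ (0<step n)) (ℚ.+-mono-≤ (*-monoʳ {c = 2ℚ} (ℚ.<⇒≤ 0<2) (ℚ.≤-trans (p≤∣p∣ (s n)) (ℚ.≤-trans sn≤B (p≤∣p∣ B)))) (step≤1 n)) ⟩
          (2ℚ * ∣ B ∣ + 1ℚ) * step n  ≤⟨ *-monoʳ (+-nonNeg (*-nonNeg {2ℚ} (ℚ.<⇒≤ 0<2) (ℚ.0≤∣p∣ B)) 0≤1) (ℚ.<⇒≤ hn) ⟩
          (2ℚ * ∣ B ∣ + 1ℚ) * η  ≤⟨ Kη≤ε ⟩
          ε  ∎
          where
          open ℚ.≤-Reasoning
          expand : ∀ s h → (s + h) * (s + h) - s * s ≡ ((1ℚ + 1ℚ) * s + h) * h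
          expand = solve-∀ ℚ-ring

    sqrt² : sqrt *ᴿ sqrt ≈ᴿ y
    sqrt² ε 0<ε = eventually-map (λ n h → ℚ.≤-<-trans (ℚ.≤-reflexive (trans (∣p-q∣≡∣q-p∣ (s n * s n) (seq y n)) (ℚ.0≤p⇒∣p∣≡p (difference-nonNeg (s²≤y n))))) h) (s²-close ε 0<ε)

-- Real logarithms to an integer base

module Logarithms where
  open import Data.Integer.Base as ℤ using (ℤ; +_; -[1+_])
  open import Data.Nat.Base using (NonTrivial)
  open import Data.Rational.Base using (_+_; _*_; _-_; -_; ∣_∣; _≤_; _<_; ↥_; ↧ₙ_; mkℚ)
  open import Tactic.RingSolver using (solve-∀)
  open Rationals
  open Gaussian using (2ℚ; 1≤2)
  open Places using (_∩_; eventually-map)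
  open Complex using (seq-^)
  open Reals
  open Cuts using (grid-next; <⇒≱)

  ^ℤ-neg : ∀ b .{{nt : NonTrivial b}} n → (b ^ℤ -[1+ n ]) * fromℕ b ^ suc n ≡ 1ℚ
  ^ℤ-neg b {{nt}} n = trans (cong ((b ^ℤ -[1+ n ]) *_) (sym (fromℕ-^ b (suc n))))
    (divide-cancel (+ 1) (b ℕ.^ suc n) {{ℕ.m^n≢0 b (suc n) {{ℕ.nonTrivial⇒nonZero b}}}})

  root≤1 : ∀ n {x} → 0ℚ ≤ x → x ^ suc n ≤ 1ℚ → x ≤ 1ℚ
  root≤1 n {x} 0≤x h = ℚ.≮⇒≥ λ 1<x → <⇒≱ (subst (_< x ^ suc n) (1^n≡1 (suc n)) (^-mono< n 0≤1 1<x)) h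

  powers-regroup : ∀ (s β : ℚ) K P V → (s ^ K * β ^ P) ^ V ≡ s ^ (K ℕ.* V) * β ^ (P ℕ.* V)
  powers-regroup s β K P V = trans (^-distrib-* (s ^ K) (β ^ P) V) (cong₂ _*_ (sym (^-* s K V)) (sym (^-* β P V)))

  -- The hypothesis `1ℚ < s ^ K * β ^ P` says that `−log s / log β` lies below `P / K`. Raising it
  -- to the power `suc V` and extracting a `K`-th root compares with another fraction, in integer
  -- exponents throughout; `powers-below` is the counterpart for the other side.
  powers-above : ∀ (s β : ℚ) K P V W j → 0ℚ < s → 1ℚ ≤ β → 1ℚ < s ^ K * β ^ P → P ℕ.* suc V ℕ.+ j ℕ.* K ℕ.≤ W ℕ.* K →
    β ^ j < s ^ suc V * β ^ W
  powers-above s β K P V W j 0<s 1≤β h le = ^-cancel< K (*-nonNeg (^-nonNeg (suc V) (ℚ.<⇒≤ 0<s)) (^-nonNeg W 0≤β)) (begin-strict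
    (β ^ j) ^ K  ≡⟨ trans (sym (^-* β j K)) (sym (ℚ.*-identityˡ _)) ⟩
    1ℚ * β ^ (j ℕ.* K)  ≡⟨ cong (_* β ^ (j ℕ.* K)) (sym (1^n≡1 (suc V))) ⟩
    1ℚ ^ suc V * β ^ (j ℕ.* K)  <⟨ *-mono<ˡ (^-pos (j ℕ.* K) (ℚ.<-≤-trans 0<1 1≤β)) (^-mono< V 0≤1 h) ⟩
    (s ^ K * β ^ P) ^ suc V * β ^ (j ℕ.* K)  ≡⟨ cong (_* β ^ (j ℕ.* K)) (powers-regroup s β K P (suc V)) ⟩
    s ^ (K ℕ.* suc V) * β ^ (P ℕ.* suc V) * β ^ (j ℕ.* K)  ≡⟨ ℚ.*-assoc (s ^ (K ℕ.* suc V)) (β ^ (P ℕ.* suc V)) (β ^ (j ℕ.* K)) ⟩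
    s ^ (K ℕ.* suc V) * (β ^ (P ℕ.* suc V) * β ^ (j ℕ.* K)) ≡⟨ cong₂ (λ x y → s ^ x * y) (ℕ.*-comm K (suc V)) (sym (^-+ β (P ℕ.* suc V) (j ℕ.* K))) ⟩
    s ^ (suc V ℕ.* K) * β ^ (P ℕ.* suc V ℕ.+ j ℕ.* K)  ≤⟨ *-monoʳ (^-nonNeg (suc V ℕ.* K) (ℚ.<⇒≤ 0<s)) (^-monoʳ 1≤β le) ⟩
    s ^ (suc V ℕ.* K) * β ^ (W ℕ.* K)  ≡⟨ sym (powers-regroup s β (suc V) W K) ⟩
    (s ^ suc V * β ^ W) ^ K  ∎)
    where
    open ℚ.≤-Reasoning
    0≤β = ℚ.≤-trans 0≤1 1≤β

  powers-below : ∀ (s β : ℚ) K p V W j → 0ℚ ≤ s → 1ℚ ≤ β → s ^ suc K * β ^ p ≤ 1ℚ → W ℕ.* suc K ℕ.+ j ℕ.* suc K ℕ.≤ p ℕ.* V →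
    s ^ V * β ^ W * β ^ j ≤ 1ℚ
  powers-below s β K p V W j 0≤s 1≤β h le = root≤1 K (*-nonNeg (*-nonNeg (^-nonNeg V 0≤s) (^-nonNeg W 0≤β)) (^-nonNeg j 0≤β)) (begin
    (s ^ V * β ^ W * β ^ j) ^ suc K  ≡⟨ cong (_^ suc K) (trans (ℚ.*-assoc (s ^ V) (β ^ W) (β ^ j)) (cong (s ^ V *_) (sym (^-+ β W j)))) ⟩
    (s ^ V * β ^ (W ℕ.+ j)) ^ suc K  ≡⟨ powers-regroup s β V (W ℕ.+ j) (suc K) ⟩
    s ^ (V ℕ.* suc K) * β ^ ((W ℕ.+ j) ℕ.* suc K)  ≤⟨ *-monoʳ (^-nonNeg (V ℕ.* suc K) 0≤s) (^-monoʳ 1≤β (subst (ℕ._≤ p ℕ.* V) (sym (ℕ.*-distribʳ-+ (suc K) W j)) le)) ⟩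
    s ^ (V ℕ.* suc K) * β ^ (p ℕ.* V)  ≡⟨ cong (λ x → s ^ x * β ^ (p ℕ.* V)) (ℕ.*-comm V (suc K)) ⟩
    s ^ (suc K ℕ.* V) * β ^ (p ℕ.* V)  ≡⟨ sym (powers-regroup s β (suc K) p V) ⟩
    (s ^ suc K * β ^ p) ^ V  ≤⟨ ^-mono V (*-nonNeg (^-nonNeg (suc K) 0≤s) (^-nonNeg p 0≤β)) h ⟩
    1ℚ ^ V  ≡⟨ 1^n≡1 V ⟩
    1ℚ  ∎)
    where
    open ℚ.≤-Reasoning
    0≤β = ℚ.≤-trans 0≤1 1≤β

  3ℚ : ℚ
  3ℚ = 1ℚ + 1ℚ + 1ℚ

  1≤3 : 1ℚ ≤ 3ℚ
  1≤3 = ≤-+ˡ {1ℚ} (+-nonNeg 0≤1 0≤1)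

  [1+μ]^n : ∀ n μ → 0ℚ ≤ μ → μ ≤ 1ℚ → (1ℚ + μ) ^ n ≤ 1ℚ + 3ℚ ^ n * μ
  [1+μ]^n zero    μ 0≤μ μ≤1 = ≤-+ʳ (*-nonNeg 0≤1 0≤μ)
  [1+μ]^n (suc n) μ 0≤μ μ≤1 = ℚ.≤-trans (*-monoʳ (+-nonNeg 0≤1 0≤μ) ([1+μ]^n n μ 0≤μ μ≤1))
    (≤-by-difference (subst (0ℚ ≤_) (lemma (3ℚ ^ n) μ) (+-nonNeg (*-nonNeg 0≤μ (difference-nonNeg (1≤^ n 1≤3)))
      (*-nonNeg (^-nonNeg n (ℚ.≤-trans 0≤1 1≤3)) (*-nonNeg 0≤μ (difference-nonNeg μ≤1))))))
    where
    lemma : ∀ t μ → μ * (t - 1ℚ) + t * (μ * (1ℚ - μ)) ≡ 1ℚ + (1ℚ + 1ℚ + 1ℚ) * t * μ - (1ℚ + μ) * (1ℚ + t * μ)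
    lemma = solve-∀ ℚ-ring

  -- Here `μ = 3⁻ⁿ`. It turns a factor 2 gained on an `n`-th power into the factor `1 + μ` on the
  -- base, and thus into the positive gap that `<ᴿ` requires.
  root-of-2 : ∀ n → ∃ λ μ → 0ℚ < μ × (1ℚ + μ) ^ n ≤ 2ℚ
  root-of-2 n = μ , 0<μ , ℚ.≤-trans ([1+μ]^n n μ (ℚ.<⇒≤ 0<μ) μ≤1) (ℚ.≤-reflexive (cong (λ x → 1ℚ + x) 3μ≡1))
    where
    i = inverse (^-pos n (ℚ.<-≤-trans 0<1 1≤3))
    μ = proj₁ i
    0<μ = proj₁ (proj₂ i)
    3μ≡1 : 3ℚ ^ n * μ ≡ 1ℚ
    3μ≡1 = proj₂ (proj₂ i)
    μ≤1 : μ ≤ 1ℚ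
    μ≤1 = ℚ.≤-trans (≤-*ˡ (ℚ.<⇒≤ 0<μ) (1≤^ n 1≤3)) (ℚ.≤-reflexive 3μ≡1)

  fromℕ-cancel≤ : ∀ {m n} → fromℕ m ≤ fromℕ n → m ℕ.≤ n
  fromℕ-cancel≤ h = ℕ.≮⇒≥ λ n<m → <⇒≱ (fromℕ-mono< n<m) h

  clear-above : ∀ p k D w v q → q * fromℕ v ≡ fromℕ w → fromℕ p * step k + step k + step D ≤ q →
    suc p ℕ.* (v ℕ.* suc D) ℕ.+ v ℕ.* suc k ℕ.≤ w ℕ.* suc D ℕ.* suc k
  clear-above p k D w v q qv≡w h = fromℕ-cancel≤ (subst₂ _≤_ left right (*-monoˡ (*-nonNeg (fromℕ-nonNeg (suc k)) (*-nonNeg (fromℕ-nonNeg v) (fromℕ-nonNeg (suc D)))) h))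
    where
    K = fromℕ (suc k)
    E = fromℕ (suc D)
    regroup : ∀ p h g K v D → (p * h + h + g) * (K * (v * D)) ≡ (1ℚ + p) * (v * D) * (h * K) + v * K * (g * D)
    regroup = solve-∀ ℚ-ring
    left : (fromℕ p * step k + step k + step D) * (K * (fromℕ v * E)) ≡ fromℕ (suc p ℕ.* (v ℕ.* suc D) ℕ.+ v ℕ.* suc k)
    left = trans (regroup (fromℕ p) (step k) (step D) K (fromℕ v) E)
      (trans (cong₂ (λ x y → (1ℚ + fromℕ p) * (fromℕ v * E) * x + fromℕ v * K * y) (step-cancel k) (step-cancel D))
      (trans (cong₂ _+_ (trans (ℚ.*-identityʳ _) (trans (cong₂ _*_ (sym (fromℕ-+ 1 p)) (sym (fromℕ-* v (suc D)))) (sym (fromℕ-* (suc p) (v ℕ.* suc D)))))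
        (trans (ℚ.*-identityʳ _) (sym (fromℕ-* v (suc k))))) (sym (fromℕ-+ (suc p ℕ.* (v ℕ.* suc D)) (v ℕ.* suc k)))))
    regroup′ : ∀ q K v D → q * (K * (v * D)) ≡ q * v * D * K
    regroup′ = solve-∀ ℚ-ring
    right : q * (K * (fromℕ v * E)) ≡ fromℕ (w ℕ.* suc D ℕ.* suc k)
    right = trans (regroup′ q K (fromℕ v) E) (trans (cong (λ x → x * E * K) qv≡w) (trans (cong (_* K) (sym (fromℕ-* w (suc D)))) (sym (fromℕ-* (w ℕ.* suc D) (suc k)))))

  clear-below : ∀ p k D w v q → q * fromℕ v ≡ fromℕ w → q + step D ≤ fromℕ p * step k →
    w ℕ.* suc D ℕ.* suc k ℕ.+ v ℕ.* suc k ℕ.≤ p ℕ.* (v ℕ.* suc D)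
  clear-below p k D w v q qv≡w h = fromℕ-cancel≤ (subst₂ _≤_ left right (*-monoˡ (*-nonNeg (fromℕ-nonNeg (suc k)) (*-nonNeg (fromℕ-nonNeg v) (fromℕ-nonNeg (suc D)))) h))
    where
    K = fromℕ (suc k)
    E = fromℕ (suc D)
    regroup : ∀ q g K v D → (q + g) * (K * (v * D)) ≡ q * v * D * K + v * K * (g * D)
    regroup = solve-∀ ℚ-ring
    left : (q + step D) * (K * (fromℕ v * E)) ≡ fromℕ (w ℕ.* suc D ℕ.* suc k ℕ.+ v ℕ.* suc k)
    left = trans (regroup q (step D) K (fromℕ v) E)
      (trans (cong₂ (λ x y → x * E * K + fromℕ v * K * y) qv≡w (step-cancel D))
      (trans (cong₂ _+_ (trans (cong (_* K) (sym (fromℕ-* w (suc D)))) (sym (fromℕ-* (w ℕ.* suc D) (suc k)))) (trans (ℚ.*-identityʳ _) (sym (fromℕ-* v (suc k)))))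
        (sym (fromℕ-+ (w ℕ.* suc D ℕ.* suc k) (v ℕ.* suc k)))))
    regroup′ : ∀ p h K v D → p * h * (K * (v * D)) ≡ p * (v * D) * (h * K)
    regroup′ = solve-∀ ℚ-ring
    right : fromℕ p * step k * (K * (fromℕ v * E)) ≡ fromℕ (p ℕ.* (v ℕ.* suc D))
    right = trans (regroup′ (fromℕ p) (step k) K (fromℕ v) E) (trans (cong (fromℕ p * (fromℕ v * E) *_) (step-cancel k))
      (trans (ℚ.*-identityʳ _) (trans (cong (fromℕ p *_) (sym (fromℕ-* v (suc D)))) (sym (fromℕ-* p (v ℕ.* suc D))))))

  n<b^n : ∀ b n → 2 ℕ.≤ b → n ℕ.< b ℕ.^ n
  n<b^n b zero    2≤b = s≤s z≤n
  n<b^n b (suc n) 2≤b = ℕ.≤-trans (ℕ.≤-trans (s≤s (n<b^n b n 2≤b)) (ℕ.+-monoˡ-≤ (b ℕ.^ n) (ℕ.≤-trans (s≤s z≤n) (n<b^n b n 2≤b))))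
    (ℕ.≤-trans (ℕ.≤-reflexive (cong (b ℕ.^ n ℕ.+_) (sym (ℕ.+-identityʳ (b ℕ.^ n))))) (ℕ.*-monoˡ-≤ (b ℕ.^ n) 2≤b))

  -- The real e with s = b⁻ᵉ, for 0 < s < 1: its n-th approximation is the largest
  -- multiple p/(n+1) of 1/(n+1) with s^(n+1) ≤ b⁻ᵖ.
  module Logarithm (b : ℕ) .{{nt : NonTrivial b}} (s : ℝ) (σ : ℚ) (0<σ : 0ℚ < σ) (N₀ : ℕ)
    (bounds : ∀ k → N₀ ℕ.≤ k → σ ≤ seq s k × seq s k + σ ≤ 1ℚ) where

    β : ℚ
    β = fromℕ b

    2≤b : 2 ℕ.≤ b
    2≤b = ℕ.nonTrivial⇒n>1 b
    2≤β : 2ℚ ≤ β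
    2≤β = fromℕ-mono {2} {b} 2≤b
    1≤β : 1ℚ ≤ β
    1≤β = ℚ.≤-trans 1≤2 2≤β
    0≤β = ℚ.≤-trans 0≤1 1≤β
    0<β = ℚ.<-≤-trans 0<1 1≤β

    private
      y : ℕ → ℚ
      -- With the first `N₀` indices skipped, the bounds hold at every index, so that the search for
      -- `p` always succeeds.
      y k = seq s (k ℕ.⊔ N₀)
      σ≤y : ∀ k → σ ≤ y k
      σ≤y k = proj₁ (bounds (k ℕ.⊔ N₀) (ℕ.m≤n⊔m k N₀))
      0<y : ∀ k → 0ℚ < y k
      0<y k = ℚ.<-≤-trans 0<σ (σ≤y k)
      y≤1 : ∀ k → y k ≤ 1ℚ
      y≤1 k = ℚ.≤-trans (≤-+ʳ (ℚ.<⇒≤ 0<σ)) (proj₂ (bounds (k ℕ.⊔ N₀) (ℕ.m≤n⊔m k N₀)))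
      y≡s : ∀ k → N₀ ℕ.≤ k → y k ≡ seq s k
      y≡s k h = cong (seq s) (ℕ.m≥n⇒m⊔n≡m h)

      Below′ : ℕ → ℕ → Set
      Below′ k p = y k ^ suc k * β ^ p ≤ 1ℚ

      start : ∀ k → Below′ k 0
      start k = ℚ.≤-trans (ℚ.≤-reflexive (ℚ.*-identityʳ _)) (subst (y k ^ suc k ≤_) (1^n≡1 (suc k)) (^-mono (suc k) (ℚ.<⇒≤ (0<y k)) (y≤1 k)))

      stop : ∀ k → ∃ λ B → ¬ Below′ k B
      stop k = N , <⇒≱ (ℚ.≤-<-trans (ℚ.≤-reflexive (sym yr≡1)) (*-mono<ʳ (^-pos (suc k) (0<y k))
          (ℚ.≤-<-trans (proj₂ (archimedean r)) (subst (fromℕ N <_) (fromℕ-^ b N) (fromℕ-mono< (n<b^n b N 2≤b))))))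
        where
        i = inverse (^-pos (suc k) (0<y k))
        r = proj₁ i
        yr≡1 : y k ^ suc k * r ≡ 1ℚ
        yr≡1 = proj₂ (proj₂ i)
        N = proj₁ (archimedean r)

      found : ∀ k → ∃ λ p → Below′ k p × ¬ Below′ k (suc p)
      found k = cut (Below′ k) (λ p → y k ^ suc k * β ^ p ℚ.≤? 1ℚ) (proj₁ (stop k)) (start k) (proj₂ (stop k))

      p : ℕ → ℕ
      p k = proj₁ (found k)
      below : ∀ k → y k ^ suc k * β ^ p k ≤ 1ℚ
      below k = proj₁ (proj₂ (found k))
      above : ∀ k → 1ℚ < y k ^ suc k * β ^ suc (p k)
      above k = ℚ.≰⇒> (proj₂ (proj₂ (found k)))

      e : ℕ → ℚ
      e k = fromℕ (p k) * step k

      -- If `e m` exceeded `e n` by `step n + step D` or more, then `y n ^ suc D` would exceed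
      -- `y m ^ suc D` by a factor `β ≥ 2`. But for late indices these powers differ by less than
      -- `σ ^ suc D`, which is at most `y m ^ suc D`.
      e-cauchy : Cauchy e
      e-cauchy = one-sided-cauchy e λ ε 0<ε →
        let D₀ , small-D = step-small (½ * ε) (half>0 ε 0<ε)
            N , small = step-small (½ * ε) (half>0 ε 0<ε)
            M , close = cauchy (s ^ᴿ suc D₀) (σ ^ suc D₀) (^-pos (suc D₀) 0<σ)
        in N ℕ.⊔ (M ℕ.⊔ N₀) , λ m n hm hn → ℚ.≰⇒> λ h →
          let m≥ = ℕ.m⊔n≤o⇒n≤o N (M ℕ.⊔ N₀) hm ; n≥ = ℕ.m⊔n≤o⇒n≤o N (M ℕ.⊔ N₀) hn
              n≥N = ℕ.m⊔n≤o⇒m≤o N (M ℕ.⊔ N₀) hn in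
          impossible m n D₀ (ℕ.m⊔n≤o⇒n≤o M N₀ m≥) (ℕ.m⊔n≤o⇒n≤o M N₀ n≥)
            (subst₂ (λ u v → ∣ u - v ∣ < σ ^ suc D₀) (seq-^ s (suc D₀) n) (seq-^ s (suc D₀) m) (close n m (ℕ.m⊔n≤o⇒m≤o M N₀ n≥) (ℕ.m⊔n≤o⇒m≤o M N₀ m≥)))
            (ℚ.≤-trans (ℚ.+-mono-≤ {e n + step n} (ℚ.+-monoʳ-≤ (e n) (ℚ.<⇒≤ (small n n≥N))) (ℚ.<⇒≤ (small-D D₀ ℕ.≤-refl))) (ℚ.≤-trans (ℚ.≤-reflexive (halves (e n) ε)) h))
        where
        halves : ∀ a ε → a + ½ * ε + ½ * ε ≡ a + ε
        halves = solve-∀ ℚ-ring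
        impossible : ∀ m n D → N₀ ℕ.≤ m → N₀ ℕ.≤ n → ∣ seq s n ^ suc D - seq s m ^ suc D ∣ < σ ^ suc D → e n + step n + step D ≤ e m → ⊥
        impossible m n D hm hn close h = <⇒≱ ratio (ℚ.≤-trans (ℚ.<⇒≤ near) (*-monoʳ (^-nonNeg (suc D) (ℚ.<⇒≤ (0<y m))) 2≤β))
          where
          ym^ = y m ^ suc D
          near : y n ^ suc D < ym^ * 2ℚ
          near = ℚ.<-≤-trans (subst (_< ym^ + σ ^ suc D) (recover (ym^) (y n ^ suc D)) (ℚ.+-monoʳ-< (ym^) (ℚ.≤-<-trans (p≤∣p∣ (y n ^ suc D - ym^))
              (subst₂ (λ u v → ∣ u ^ suc D - v ^ suc D ∣ < σ ^ suc D) (sym (y≡s n hn)) (sym (y≡s m hm)) close))))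
            (ℚ.≤-trans (ℚ.+-monoʳ-≤ (ym^) (^-mono (suc D) (ℚ.<⇒≤ 0<σ) (σ≤y m))) (ℚ.≤-reflexive (double (ym^))))
            where
            double : ∀ x → x + x ≡ x * (1ℚ + 1ℚ)
            double = solve-∀ ℚ-ring
          P = suc (p n)
          inequality : P ℕ.* suc D ℕ.* suc m ℕ.+ suc n ℕ.* suc m ℕ.≤ p m ℕ.* (suc n ℕ.* suc D)
          inequality = clear-below (p m) m D P (suc n) (fromℕ P * step n)
            (trans (ℚ.*-assoc (fromℕ P) (step n) (fromℕ (suc n))) (trans (cong (fromℕ P *_) (step-cancel n)) (ℚ.*-identityʳ _)))
            (subst (λ x → x + step D ≤ e m) (sym (grid-next n (p n))) h)
          upper : y m ^ (suc n ℕ.* suc D) * β ^ (P ℕ.* suc D) * β ^ suc n ≤ 1ℚ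
          upper = powers-below (y m) β m (p m) (suc n ℕ.* suc D) (P ℕ.* suc D) (suc n) (ℚ.<⇒≤ (0<y m)) 1≤β (below m) inequality
          lower : 1ℚ < y n ^ (suc n ℕ.* suc D) * β ^ (P ℕ.* suc D)
          lower = subst₂ _<_ (1^n≡1 (suc D)) (powers-regroup (y n) β (suc n) P (suc D)) (^-mono< D 0≤1 (above n))
          ratio : ym^ * β < y n ^ suc D
          ratio = ^-cancel< (suc n) (^-nonNeg (suc D) (ℚ.<⇒≤ (0<y n))) (*-cancel<ʳ (^-nonNeg (P ℕ.* suc D) 0≤β) (subst₂ _<_ left right (ℚ.≤-<-trans upper lower)))
            where
            exponent : ∀ x → x ^ (suc n ℕ.* suc D) ≡ (x ^ suc D) ^ suc n
            exponent x = trans (cong (x ^_) (ℕ.*-comm (suc n) (suc D))) (^-* x (suc D) (suc n))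
            swap : ∀ a b c → a * b * c ≡ b * (a * c)
            swap = solve-∀ ℚ-ring
            left : y m ^ (suc n ℕ.* suc D) * β ^ (P ℕ.* suc D) * β ^ suc n ≡ β ^ (P ℕ.* suc D) * (ym^ * β) ^ suc n
            left = trans (swap (y m ^ (suc n ℕ.* suc D)) (β ^ (P ℕ.* suc D)) (β ^ suc n))
              (cong (β ^ (P ℕ.* suc D) *_) (trans (cong (_* β ^ suc n) (exponent (y m))) (sym (^-distrib-* ym^ β (suc n)))))
            right : y n ^ (suc n ℕ.* suc D) * β ^ (P ℕ.* suc D) ≡ β ^ (P ℕ.* suc D) * (y n ^ suc D) ^ suc n
            right = trans (ℚ.*-comm (y n ^ (suc n ℕ.* suc D)) (β ^ (P ℕ.* suc D))) (cong (β ^ (P ℕ.* suc D) *_) (exponent (y n)))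

    exponent : ℝ
    exponent = mkℝ e e-cauchy

    private
      eventually : ∀ {Q : ℕ → Set} → Eventually Q → Eventually λ k → Q k × y k ≡ seq s k
      eventually h = eventually-map (λ k (q , le) → q , y≡s k le) (h ∩ (N₀ , λ k le → le))

      grouped : ∀ x v w D → x ^ (suc v ℕ.* D) * β ^ (w ℕ.* D) ≡ (x ^ suc v * β ^ w) ^ D
      grouped x v w D = sym (powers-regroup x β (suc v) w D)

    exponent-nonNeg : ∀ k → 0ℚ ≤ seq exponent k
    exponent-nonNeg k = *-nonNeg (fromℕ-nonNeg (p k)) (ℚ.<⇒≤ (0<step k))

    exponent-lower : ∀ w v → (Eventually λ k → seq s k ^ suc v * β ^ w ≤ 1ℚ) → Eventually λ k → fromℕ w < (seq exponent k + step k) * fromℕ (suc v)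
    exponent-lower w v small = eventually-map (λ k (h , y≡) → ℚ.≰⇒> λ le →
        <⇒≱ (powers-above (y k) β (suc k) (suc (p k)) v w 0 (0<y k) 1≤β (above k)
               (subst (ℕ._≤ w ℕ.* suc k) (sym (ℕ.+-identityʳ (suc (p k) ℕ.* suc v))) (fromℕ-cancel≤ {suc (p k) ℕ.* suc v} {w ℕ.* suc k} (cleared k le))))
            (subst (λ x → x ^ suc v * β ^ w ≤ 1ℚ) (sym y≡) h))
      (eventually small)
      where
      regroup : ∀ x h v K → (x * h) * v * K ≡ x * v * (h * K)
      regroup = solve-∀ ℚ-ring
      cleared : ∀ k → (e k + step k) * fromℕ (suc v) ≤ fromℕ w → fromℕ (suc (p k) ℕ.* suc v) ≤ fromℕ (w ℕ.* suc k)
      cleared k le = subst₂ _≤_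
        (trans (cong (λ x → x * fromℕ (suc v) * fromℕ (suc k)) (sym (grid-next k (p k)))) (trans (regroup (fromℕ (suc (p k))) (step k) (fromℕ (suc v)) (fromℕ (suc k)))
          (trans (cong (fromℕ (suc (p k)) * fromℕ (suc v) *_) (step-cancel k)) (trans (ℚ.*-identityʳ _) (sym (fromℕ-* (suc (p k)) (suc v)))))))
        (sym (fromℕ-* w (suc k)))
        (*-monoˡ {c = fromℕ (suc k)} (fromℕ-nonNeg (suc k)) le)

    private
      power-above : ∀ r → fromℚ r <ᴿ (-ᴿ exponent) → fromℚ (b ^ℤ (↥ r)) <ᴿ s ^ᴿ (↧ₙ r)
      -- The exponent is nonnegative, so that no nonnegative `r` lies below its negative.
      power-above (mkℚ (+ n) v c) (ε , 0<ε , N , h) = ⊥-elim (<⇒≱ (h N ℕ.≤-refl)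
        (ℚ.≤-trans (ℚ.neg-antimono-≤ (exponent-nonNeg N)) (+-nonNeg (ℚ.nonNegative⁻¹ (mkℚ (+ n) v c)) (ℚ.<⇒≤ 0<ε))))
      power-above (mkℚ -[1+ n ] v c) (ε , 0<ε , h) = t * μ , *-pos 0<t 0<μ ,
          eventually-map (λ k ((small , h) , y≡) → subst (t + t * μ <_) (trans (cong (_^ suc v) y≡) (sym (seq-^ s (suc v) k))) (bound k small h))
            (eventually (step-small (½ * ε) (half>0 ε 0<ε) ∩ h))
        where
        w = suc n
        q = mkℚ (+ suc n) v c
        t = b ^ℤ -[1+ n ]
        D = proj₁ (step-small (½ * ε) (half>0 ε 0<ε))
        step-D = proj₂ (step-small (½ * ε) (half>0 ε 0<ε)) D ℕ.≤-refl
        μ = proj₁ (root-of-2 (suc D))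
        0<μ = proj₁ (proj₂ (root-of-2 (suc D)))
        tβ≡1 : t * β ^ w ≡ 1ℚ
        tβ≡1 = ^ℤ-neg b n
        0<t : 0ℚ < t
        0<t = *-cancel<ʳ {0ℚ} {t} {β ^ w} (^-nonNeg w 0≤β) (subst₂ _<_ (sym (ℚ.*-zeroʳ (β ^ w))) (trans (sym tβ≡1) (ℚ.*-comm t (β ^ w))) 0<1)
        bound : ∀ k → step k < ½ * ε → - q + ε < - e k → t + t * μ < y k ^ suc v
        bound k small h = *-cancel<ʳ {t + t * μ} {y k ^ suc v} {β ^ w} (^-nonNeg w 0≤β)
            (subst₂ _<_ (trans (cong (_* (1ℚ + μ)) (sym tβ≡1)) (regroup t (β ^ w) μ)) (ℚ.*-comm (y k ^ suc v) (β ^ w)) (subst (_< y k ^ suc v * β ^ w) (sym (ℚ.*-identityˡ (1ℚ + μ))) 1+μ<X))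
          where
          regroup : ∀ t b μ → t * b * (1ℚ + μ) ≡ b * (t + t * μ)
          regroup = solve-∀ ℚ-ring
          room : e k + step k + step D ≤ q
          room = ℚ.<⇒≤ (ℚ.<-≤-trans (ℚ.+-mono-< (ℚ.+-monoʳ-< (e k) small) step-D) (≤-by-difference (subst (0ℚ ≤_) (lemma (e k) q ε) (ℚ.<⇒≤ (difference-pos h)))))
            where
            lemma : ∀ e q ε → - e - (- q + ε) ≡ q - (e + ½ * ε + ½ * ε)
            lemma = solve-∀ ℚ-ring
          1+μ<X : 1ℚ + μ < y k ^ suc v * β ^ w
          -- The slack `step D` in the exponent is worth a factor `β ^ suc v ≥ 2` on the power
          -- `suc D`, hence `1 + μ` on the base.
          1+μ<X = ^-cancel< (suc D) (*-nonNeg (^-nonNeg (suc v) (ℚ.<⇒≤ (0<y k))) (^-nonNeg w 0≤β))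
            (ℚ.≤-<-trans (proj₂ (proj₂ (root-of-2 (suc D)))) (ℚ.≤-<-trans (ℚ.≤-trans 2≤β (≤-*ʳ 0≤β (1≤^ v 1≤β)))
              (subst (β ^ suc v <_) (grouped (y k) v w (suc D))
                (powers-above (y k) β (suc k) (suc (p k)) (D ℕ.+ v ℕ.* suc D) (w ℕ.* suc D) (suc v) (0<y k) 1≤β (above k)
                  (clear-above (p k) k D w (suc v) q (numerator/denominator q) room)))))

      power-below : ∀ r → (-ᴿ exponent) <ᴿ fromℚ r → s ^ᴿ (↧ₙ r) <ᴿ fromℚ (b ^ℤ (↥ r))
      -- Here `s ^ suc v ≤ s ≤ 1 − σ`, while a nonnegative power of `b` is at least 1; half of `σ`
      -- remains as the gap.
      power-below (mkℚ (+ n) v c) _ = ½ * σ , half>0 σ 0<σ , N₀ , λ k hk →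
        subst (λ x → x + ½ * σ < b ^ℤ (+ n)) (sym (seq-^ s (suc v) k)) (bound k (bounds k hk))
        where
        bound : ∀ k → σ ≤ seq s k × seq s k + σ ≤ 1ℚ → seq s k ^ suc v + ½ * σ < b ^ℤ (+ n)
        bound k (lo , hi) = ℚ.<-≤-trans (ℚ.+-mono-≤-< power≤ half<) (ℚ.≤-trans hi (ℚ.≤-trans (1≤^ n 1≤β) (ℚ.≤-reflexive (sym (fromℕ-^ b n)))))
          where
          0≤s = ℚ.≤-trans (ℚ.<⇒≤ 0<σ) lo
          power≤ : seq s k ^ suc v ≤ seq s k
          power≤ = ℚ.≤-trans (*-monoʳ 0≤s (subst (seq s k ^ v ≤_) (1^n≡1 v) (^-mono v 0≤s (ℚ.≤-trans (≤-+ʳ (ℚ.<⇒≤ 0<σ)) hi)))) (ℚ.≤-reflexive (ℚ.*-identityʳ _))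
          half< : ½ * σ < σ
          half< = subst₂ _<_ (ℚ.+-identityʳ (½ * σ)) (half+half σ) (ℚ.+-monoʳ-< (½ * σ) (half>0 σ 0<σ))
      power-below (mkℚ -[1+ n ] v c) (ε , 0<ε , h) = ½ * (σ ^ suc v * μ) , half>0 _ 0<σμ ,
          eventually-map (λ k (h , y≡) → subst (λ x → x + ½ * (σ ^ suc v * μ) < t) (trans (cong (_^ suc v) y≡) (sym (seq-^ s (suc v) k))) (bound k h))
            (eventually h)
        where
        w = suc n
        q = mkℚ (+ suc n) v c
        t = b ^ℤ -[1+ n ]
        D = proj₁ (step-small ε 0<ε)
        step-D = proj₂ (step-small ε 0<ε) D ℕ.≤-refl
        μ = proj₁ (root-of-2 (suc D))
        0<μ = proj₁ (proj₂ (root-of-2 (suc D)))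
        0<σμ = *-pos (^-pos (suc v) 0<σ) 0<μ
        tβ≡1 : t * β ^ w ≡ 1ℚ
        tβ≡1 = ^ℤ-neg b n
        bound : ∀ k → - e k + ε < - q → y k ^ suc v + ½ * (σ ^ suc v * μ) < t
        bound k h = ℚ.<-≤-trans (ℚ.+-monoʳ-< (y k ^ suc v) (ℚ.<-≤-trans half< (*-monoˡ (ℚ.<⇒≤ 0<μ) (^-mono (suc v) (ℚ.<⇒≤ 0<σ) (σ≤y k)))))
            (*-cancel≤ʳ {c = β ^ w} (^-pos w 0<β) (subst₂ _≤_ (regroup (y k ^ suc v) (β ^ w) μ) (trans (sym tβ≡1) (ℚ.*-comm t (β ^ w))) X[1+μ]≤1))
          where
          half< : ½ * (σ ^ suc v * μ) < σ ^ suc v * μ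
          half< = subst₂ _<_ (ℚ.+-identityʳ _) (half+half (σ ^ suc v * μ)) (ℚ.+-monoʳ-< (½ * (σ ^ suc v * μ)) (half>0 _ 0<σμ))
          regroup : ∀ s b μ → s * b * (1ℚ + μ) ≡ b * (s + s * μ)
          regroup = solve-∀ ℚ-ring
          room : q + step D ≤ e k
          room = ℚ.<⇒≤ (ℚ.<-≤-trans (ℚ.+-monoʳ-< q step-D) (≤-by-difference (subst (0ℚ ≤_) (lemma (e k) q ε) (ℚ.<⇒≤ (difference-pos h)))))
            where
            lemma : ∀ e q ε → - q - (- e + ε) ≡ e - (q + ε)
            lemma = solve-∀ ℚ-ring
          X = y k ^ suc v * β ^ w
          0≤X : 0ℚ ≤ X
          0≤X = *-nonNeg (^-nonNeg (suc v) (ℚ.<⇒≤ (0<y k))) (^-nonNeg w 0≤β)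
          X^β≤1 : X ^ suc D * β ^ suc v ≤ 1ℚ
          X^β≤1 = subst (λ x → x * β ^ suc v ≤ 1ℚ) (grouped (y k) v w (suc D))
            (powers-below (y k) β k (p k) (suc v ℕ.* suc D) (w ℕ.* suc D) (suc v) (ℚ.<⇒≤ (0<y k)) 1≤β (below k)
              (clear-below (p k) k D w (suc v) q (numerator/denominator q) room))
          X[1+μ]≤1 : X * (1ℚ + μ) ≤ 1ℚ
          X[1+μ]≤1 = root≤1 D (*-nonNeg 0≤X (+-nonNeg 0≤1 (ℚ.<⇒≤ 0<μ))) (ℚ.≤-trans (ℚ.≤-reflexive (^-distrib-* X (1ℚ + μ) (suc D)))
            (ℚ.≤-trans (*-monoʳ (^-nonNeg (suc D) 0≤X) (ℚ.≤-trans (proj₂ (proj₂ (root-of-2 (suc D)))) (ℚ.≤-trans 2≤β (≤-*ʳ 0≤β (1≤^ v 1≤β))))) X^β≤1))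

    isPower : IsPower b (-ᴿ exponent) s
    isPower = (½ * σ , half>0 σ 0<σ , N₀ , λ k hk → subst (_< seq s k) (sym (ℚ.+-identityˡ (½ * σ))) (ℚ.<-≤-trans half< (proj₁ (bounds k hk)))) , power-above , power-below
      where
      half< : ½ * σ < σ
      half< = subst₂ _<_ (ℚ.+-identityʳ (½ * σ)) (half+half σ) (ℚ.+-monoʳ-< (½ * σ) (half>0 σ 0<σ))

-- The Bezoutian evaluated at a point

module Resultants where
  open import Data.Integer.Base as ℤ using (ℤ)
  import Data.Integer.Properties as ℤ
  open import Data.Rational.Base using (_+_; _*_; ∣_∣; _≤_; _<_)
  open import Tactic.RingSolver using (solve-∀)
  open Rationals
  open Gaussian
  open ExteriorAlgebra
  open Polynomials

  update-at : {A : Set} (f : ℕ → A) → ∀ p v → update f p v p ≡ v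
  update-at f zero    v = refl
  update-at f (suc p) v = update-at (f ∘ suc) p v

  update-other : {A : Set} (f : ℕ → A) → ∀ p v i → i ≢ p → update f p v i ≡ f i
  update-other f zero    v zero    h = ⊥-elim (h refl)
  update-other f zero    v (suc i) h = refl
  update-other f (suc p) v zero    h = refl
  update-other f (suc p) v (suc i) h = update-other (f ∘ suc) p v i (h ∘ cong suc)

  update-nonNeg : ∀ {f : ℕ → ℚ} p {v} → (∀ i → 0ℚ ≤ f i) → 0ℚ ≤ v → ∀ i → 0ℚ ≤ update f p v i
  update-nonNeg zero    hf hv zero    = hv
  update-nonNeg zero    hf hv (suc i) = hf (suc i)
  update-nonNeg (suc p) hf hv zero    = hf 0
  update-nonNeg (suc p) hf hv (suc i) = update-nonNeg p (hf ∘ suc) hv i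

  prodℚ-update : ∀ n f p v → p ℕ.< n → f p ≡ 1ℚ → prodℚ n (update f p v) ≡ v * prodℚ n f
  prodℚ-update (suc n) f zero    v _         e = cong (v *_) (sym (trans (cong (_* prodℚ n (f ∘ suc)) e) (ℚ.*-identityˡ _)))
  prodℚ-update (suc n) f (suc p) v (s≤s p<n) e = trans (cong (f 0 *_) (prodℚ-update n (f ∘ suc) p v p<n e)) (swap (f 0) v _)
    where
    swap : ∀ a b c → a * (b * c) ≡ b * (a * c)
    swap = solve-∀ ℚ-ring

  sumℚ-bound : ∀ n {f b} → (∀ i → i ℕ.< n → f i ≤ b) → sumℚ n f ≤ fromℕ n * b
  sumℚ-bound zero {b = b} h = ℚ.≤-reflexive (sym (ℚ.*-zeroˡ b))
  sumℚ-bound (suc n) {f} {b} h = ℚ.≤-trans (ℚ.+-mono-≤ (h 0 (s≤s z≤n)) (sumℚ-bound n λ i i<n → h (suc i) (s≤s i<n)))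
    (ℚ.≤-reflexive (trans (lemma b (fromℕ n)) (cong (_* b) (sym (fromℕ-+ 1 n)))))
    where
    lemma : ∀ b n → b + n * b ≡ (1ℚ + n) * b
    lemma = solve-∀ ℚ-ring

  sumℚ-scale : ∀ n a f → a * sumℚ n f ≡ sumℚ n (λ i → a * f i)
  sumℚ-scale zero    a f = ℚ.*-zeroʳ a
  sumℚ-scale (suc n) a f = trans (ℚ.*-distribˡ-+ a (f 0) _) (cong (a * f 0 +_) (sumℚ-scale n a (f ∘ suc)))

  rowNorm-bound : ∀ n κ a r {b} → (∀ i → i ℕ.< n → a * κ i * ‖ r i ‖ ≤ b) → a * rowNorm n κ r ≤ fromℕ n * b
  rowNorm-bound n κ a r h = ℚ.≤-trans (ℚ.≤-reflexive (sumℚ-scale n a _))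
    (sumℚ-bound n λ i i<n → ℚ.≤-trans (ℚ.≤-reflexive (sym (ℚ.*-assoc a (κ i) (‖ r i ‖)))) (h i i<n))

  integer≥1 : ∀ {z} → IsInteger z → z ≢ 0ᵍ → ∃ λ q → z ≡ real q × 1ℚ ≤ ∣ q ∣
  integer≥1 (a , refl) z≢0 = fromℤ a , refl ,
    subst (1ℚ ≤_) (sym (∣fromℤ∣ a)) (1≤fromℕ {ℤ.∣ a ∣} (ℕ.n≢0⇒n>0 λ e → z≢0 (cong (λ t → real (fromℤ t)) {a} {ℤ.+ 0} (ℤ.∣i∣≡0⇒i≡0 e))))

  *-integer≥1 : ∀ {d} z → IsInteger d → d ≢ 0ᵍ → ‖ z ‖ ≤ ‖ z *ᵍ d ‖
  *-integer≥1 {d} z int d≢0 with integer≥1 int d≢0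
  ... | q , refl , 1≤q = begin
    ‖ z ‖  ≤⟨ ≤-*ˡ (‖‖-nonNeg z) 1≤q ⟩
    ∣ q ∣ * ‖ z ‖  ≡⟨ sym (‖real*‖ q z) ⟩
    ‖ real q *ᵍ z ‖  ≡⟨ cong ‖_‖ (comm (real q) z) ⟩
    ‖ z *ᵍ real q ‖  ∎
    where
    open ℚ.≤-Reasoning
    comm : ∀ a b → a *ᵍ b ≡ b *ᵍ a
    comm = solve-∀ 𝔾-ring

  half-int : ∀ {g f : ℕ → 𝔾} → (∀ i → IsInteger (g i)) → (∀ i → IsInteger (f i)) → ∀ j i → IsInteger (half g f j i)
  half-int hg hf zero    i       = int-* (hg 0) (hf (suc i))
  half-int hg hf (suc j) zero    = int-* (hg 0) (hf (suc (suc j)))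
  half-int hg hf (suc j) (suc i) = int-+ (int-* (hg 0) (hf _)) (half-int (hg ∘ suc) (hf ∘ suc) j i)

  bezoutian-int : ∀ {g f : ℕ → 𝔾} → (∀ i → IsInteger (g i)) → (∀ i → IsInteger (f i)) → ∀ j i → IsInteger (bezoutian g f j i)
  bezoutian-int hg hf j i = int-+ (int-* (ℤ.+ 1 , refl) (half-int hg hf j i)) (int-* (ℤ.-[1+ 0 ] , refl) (half-int hf hg j i))

  module BezoutianAt (m : ℕ) (g f : ℕ → 𝔾) (hg : Below 0ᵍ (suc m) g) (hf : Below 0ᵍ (suc m) f) (z : 𝔾) where

    -- The combination of the rows with the powers of `z` as coefficients. It is small when `z`
    -- almost annihilates `f` and lies near a root of `g`.
    ρ : ℕ → 𝔾
    ρ i = eval (suc m) g z *ᵍ eval m (shift (suc i) f) z -ᵍ eval (suc m) f z *ᵍ eval m (shift (suc i) g) z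

    powers : ℕ → 𝔾
    powers j = z ^ᵍ j

    pairing-row : ∀ i → pairing m powers (bezoutian g f i) ≡ ρ i
    pairing-row i = trans (sym (eval-as-sum m (bezoutian g f i) z)) (eval-bezoutian m i g f hg hf z)

    reduced : ℕ → ℕ → ℕ → 𝔾
    reduced p = update (bezoutian g f) p ρ

    -- The freedom in `p` matters: it decides which power of `z` multiplies the determinant, and is
    -- used to compensate the growth of `ρ` for large `z`.
    det-reduced : ∀ p → p ℕ.< m → det m (reduced p) ≡ z ^ᵍ p *ᵍ det m (bezoutian g f)
    det-reduced p p<m = trans
      (wedges-update-cong m m (bezoutian g f) p (λ i → trans (sym (pairing-row i))
        (sumᵍ-cong m λ j _ → cong (z ^ᵍ j *ᵍ_) (bezoutian-sym g f i j))) _)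
      (row-operation m m (bezoutian g f) powers p p<m _)

    ρ-evaluated : 𝔾
    ρ-evaluated = eval (suc m) g z *ᵍ divided (suc m) f z z -ᵍ eval (suc m) f z *ᵍ eval m (λ i → eval m (shift (suc i) g) z) z

    pairing-ρ : pairing m powers ρ ≡ ρ-evaluated
    pairing-ρ = begin
      pairing m powers ρ
        ≡⟨ sym (eval-as-sum m ρ z) ⟩
      eval m ρ z
        ≡⟨ eval-cong m (λ i _ → rewritten G (w i) F (v i)) z ⟩
      eval m (λ i → G *ᵍ w i +ᵍ (-ᵍ F) *ᵍ v i) z
        ≡⟨ eval-linear m G (-ᵍ F) w v z ⟩
      G *ᵍ eval m w z +ᵍ (-ᵍ F) *ᵍ eval m v z
        ≡⟨ sym (rewritten G (eval m w z) F (eval m v z)) ⟩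
      G *ᵍ eval m w z -ᵍ F *ᵍ eval m v z
        ≡⟨ cong (λ t → G *ᵍ t -ᵍ F *ᵍ eval m v z) (divided-shifts m f z hf) ⟩
      ρ-evaluated ∎
      where
      open ≡-Reasoning
      G = eval (suc m) g z
      F = eval (suc m) f z
      w v : ℕ → 𝔾
      w i = eval m (shift (suc i) f) z
      v i = eval m (shift (suc i) g) z
      rewritten : ∀ G w F v → G *ᵍ w -ᵍ F *ᵍ v ≡ G *ᵍ w +ᵍ (-ᵍ F) *ᵍ v
      rewritten = solve-∀ 𝔾-ring

    doubly-reduced : ℕ → ℕ → ℕ → 𝔾
    doubly-reduced p j = update (reduced p j) p (pairing m powers (reduced p j))

    -- Since the Bezoutian is symmetric, row and column `p` can both be replaced. For `g` the
    -- derivative of `f` both become of first order in `f′(z)` and their common entry of second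
    -- order, so the determinant is quadratically small.
    det-doubly-reduced : ∀ p → p ℕ.< m → det m (doubly-reduced p) ≡ z ^ᵍ p *ᵍ (z ^ᵍ p *ᵍ det m (bezoutian g f))
    det-doubly-reduced p p<m = trans (ColumnOperation.column-operation m powers p p<m (reduced p) _)
      (cong (z ^ᵍ p *ᵍ_) (det-reduced p p<m))

    doubly-reduced-other : ∀ p j i → j ≢ p → i ≢ p → doubly-reduced p j i ≡ bezoutian g f j i
    doubly-reduced-other p j i j≢p i≢p = trans (update-other (reduced p j) p _ i i≢p)
      (cong (λ r → r i) (update-other (bezoutian g f) p ρ j j≢p))

    doubly-reduced-column : ∀ p j → j ≢ p → doubly-reduced p j p ≡ ρ j
    doubly-reduced-column p j j≢p = trans (update-at (reduced p j) p _)
      (trans (cong (pairing m powers) (update-other (bezoutian g f) p ρ j j≢p)) (pairing-row j))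

    doubly-reduced-row : ∀ p i → i ≢ p → doubly-reduced p p i ≡ ρ i
    doubly-reduced-row p i i≢p = trans (update-other (reduced p p) p _ i i≢p)
      (cong (λ r → r i) (update-at (bezoutian g f) p ρ))

    doubly-reduced-corner : ∀ p → doubly-reduced p p p ≡ ρ-evaluated
    doubly-reduced-corner p = trans (update-at (reduced p p) p _)
      (trans (cong (pairing m powers) (update-at (bezoutian g f) p ρ)) pairing-ρ)

  half-top : ∀ {g f : ℕ → 𝔾} j i → j ℕ.≤ i → f (suc i) ≡ 1ᵍ → Below 0ᵍ (suc (suc i)) f → half g f j i ≡ g j
  half-top {g} {f} zero i _ top below = trans (cong (g 0 *ᵍ_) top) (*one (g 0))
    where
    *one : ∀ a → a *ᵍ 1ᵍ ≡ a
    *one = solve-∀ 𝔾-ring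
  half-top {g} {f} (suc j) (suc i) (s≤s j≤i) top below =
    trans (cong₂ (λ a b → g 0 *ᵍ a +ᵍ b) (below _ (s≤s (s≤s (s≤s (ℕ.m≤n+m i j))))) (half-top j i j≤i top (below-tail _ below)))
          (lemma (g 0) (g (suc j)))
    where
    lemma : ∀ a b → a *ᵍ 0ᵍ +ᵍ b ≡ b
    lemma = solve-∀ 𝔾-ring

  half-low : ∀ {f g : ℕ → 𝔾} j i → j ℕ.≤ i → Below 0ᵍ (suc i) g → half f g j i ≡ 0ᵍ
  half-low {f} {g} zero i _ below = trans (cong (f 0 *ᵍ_) (below (suc i) ℕ.≤-refl)) (*zero (f 0))
    where
    *zero : ∀ a → a *ᵍ 0ᵍ ≡ 0ᵍ
    *zero = solve-∀ 𝔾-ring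
  half-low {f} {g} (suc j) (suc i) (s≤s j≤i) below =
    trans (cong₂ (λ a b → f 0 *ᵍ a +ᵍ b) (below _ (s≤s (s≤s (ℕ.m≤n⇒m≤1+n (ℕ.m≤n+m i j))))) (half-low j i j≤i (below-tail _ below)))
          (lemma (f 0))
    where
    lemma : ∀ a → a *ᵍ 0ᵍ +ᵍ 0ᵍ ≡ 0ᵍ
    lemma = solve-∀ 𝔾-ring

  -- The last column of the Bezoutian is `g` itself, because `f` is monic. It is linear instead of
  -- quadratic in the coefficients, which saves a factor `F²` in the discriminant.
  bezoutian-top : ∀ {g f : ℕ → 𝔾} j i → j ℕ.≤ i → f (suc i) ≡ 1ᵍ → Below 0ᵍ (suc (suc i)) f → Below 0ᵍ (suc i) g →
    bezoutian g f j i ≡ g j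
  bezoutian-top {g} j i j≤i top hf hg = trans (cong₂ (λ a b → 1ᵍ *ᵍ a +ᵍ -1ᵍ *ᵍ b) (half-top j i j≤i top hf) (half-low j i j≤i hg)) (lemma (g j))
    where
    lemma : ∀ a → 1ᵍ *ᵍ a +ᵍ -ᵍ 1ᵍ *ᵍ 0ᵍ ≡ a
    lemma = solve-∀ 𝔾-ring

-- Distance between roots of different minimal polynomials

module Coprime where
  open import Data.Rational.Base using (_+_; _*_; _≤_; _<_)
  open import Tactic.RingSolver using (solve-∀)
  open Rationals
  open Gaussian
  open ExteriorAlgebra
  open Polynomials
  open Bounds
  open Resultants

  -- δ approximates the distance of a root z of f and a root y of g; η is the
  -- error with which they are roots.
  record Close (e : ℕ) (z y : 𝔾) (δ η : ℚ) : Set where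
    field
      0<δ   : 0ℚ < δ
      δ≤1   : δ ≤ 1ℚ
      near  : ‖ y -ᵍ z ‖ ≤ δ
      0≤η   : 0ℚ ≤ η
      small : η * (2ℚ * (‖ z ‖ + 1ℚ)) ^ (e ℕ.+ e) ≤ δ * δ

  module CloseProperties {e z y δ η} (c : Close e z y δ η) where
    open Close c public
    open ℚ.≤-Reasoning

    0≤δ : 0ℚ ≤ δ
    0≤δ = ℚ.<⇒≤ 0<δ

    δδ≤δ : δ * δ ≤ δ
    δδ≤δ = ℚ.≤-trans (*-monoʳ 0≤δ δ≤1) (ℚ.≤-reflexive (ℚ.*-identityʳ δ))

    error : ∀ {X k} → 1ℚ ≤ X → X ≤ 2ℚ * (‖ z ‖ + 1ℚ) → k ℕ.≤ e ℕ.+ e → η * X ^ k ≤ δ * δ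
    error {X} {k} 1≤X X≤ k≤ = begin
      η * X ^ k  ≤⟨ *-monoʳ 0≤η (^-monoʳ 1≤X k≤) ⟩
      η * X ^ (e ℕ.+ e)  ≤⟨ *-monoʳ 0≤η (^-mono (e ℕ.+ e) (ℚ.≤-trans 0≤1 1≤X) X≤) ⟩
      η * (2ℚ * (‖ z ‖ + 1ℚ)) ^ (e ℕ.+ e)  ≤⟨ small ⟩
      δ * δ  ∎

    η≤δδ : ∀ {X} → 1ℚ ≤ X → X ≤ 2ℚ * (‖ z ‖ + 1ℚ) → η ≤ δ * δ
    η≤δδ 1≤X X≤ = ℚ.≤-trans (ℚ.≤-reflexive (sym (ℚ.*-identityʳ η))) (error {k = 0} 1≤X X≤ z≤n)

    y≤ : ‖ y ‖ ≤ ‖ z ‖ + 1ℚ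
    y≤ = begin
      ‖ y ‖  ≡⟨ cong ‖_‖ (recentreᵍ z y) ⟩
      ‖ z +ᵍ (y -ᵍ z) ‖  ≤⟨ ‖+‖ z (y -ᵍ z) ⟩
      ‖ z ‖ + ‖ y -ᵍ z ‖  ≤⟨ ℚ.+-monoʳ-≤ (‖ z ‖) (ℚ.≤-trans near δ≤1) ⟩
      ‖ z ‖ + 1ℚ  ∎
      where
      recentreᵍ : ∀ z y → y ≡ z +ᵍ (y -ᵍ z)
      recentreᵍ = solve-∀ 𝔾-ring

  -- The sum of the constants for an ordinary row and for the replaced row, so that one bound `B`
  -- covers both.
  coprimeRow : ℕ → ℕ → ℚ
  coprimeRow a b = fromℕ a * (2ℚ * fromℕ a) + fromℕ a * ((1ℚ + fromℕ (suc (suc b) ℕ.* suc (suc b))) * quotientConstant a + fromℕ a)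

  coprimeConstant : ℕ → ℕ → ℚ
  coprimeConstant a b = (2ℚ * 2ℚ) ^ b * coprimeRow a b ^ a

  -- Between `y` and `z` the value of `g` changes by `O(δ X^b G)`. The replaced row is therefore
  -- `O(δ X^b F G)` and the other rows are `O(F G)`, so that `‖ z^p ‖ ≤ δ X^b B^a` as the
  -- determinant is a nonzero integer. By the choice of `p` in `scale`, `X^b = O(‖ z^p ‖)`, and
  -- `X^b` cancels.
  coprime-separation : ∀ a b (f g : ℕ → 𝔾) F G z y δ η → suc b ℕ.≤ a →
    (∀ i → IsInteger (f i)) → (∀ i → IsInteger (g i)) →
    Below 0ᵍ (suc a) f → Below 0ᵍ (suc (suc b)) g →
    (∀ i → ‖ f i ‖ ≤ F) → (∀ i → ‖ g i ‖ ≤ G) → 1ℚ ≤ F → 1ℚ ≤ G →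
    det a (bezoutian g f) ≢ 0ᵍ → Close a z y δ η →
    ‖ eval (suc a) f z ‖ ≤ η → ‖ eval (suc (suc b)) g y ‖ ≤ η →
    1ℚ ≤ coprimeConstant a b * (δ * (F * G) ^ a)
  coprime-separation a b f g F G z y δ η b<a fℤ gℤ hf hg f≤F g≤G 1≤F 1≤G det≢0 close fz gy = *-cancel≤ʳ 0<Xᵇ (begin
      X ^ b * 1ℚ
        ≡⟨ ℚ.*-identityʳ (X ^ b) ⟩
      X ^ b
        ≤⟨ Xᵇ≤ ⟩
      (2ℚ * 2ℚ) ^ b * ‖ z ^ᵍ p ‖
        ≤⟨ *-monoʳ (^-nonNeg b (*-nonNeg {2ℚ} {2ℚ} (ℚ.<⇒≤ 0<2) (ℚ.<⇒≤ 0<2))) zᵖ≤ ⟩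
      (2ℚ * 2ℚ) ^ b * (δ * X ^ b * B ^ a)
        ≡⟨ cong (λ t → (2ℚ * 2ℚ) ^ b * (δ * X ^ b * t)) (^-distrib-* c (F * G) a) ⟩
      (2ℚ * 2ℚ) ^ b * (δ * X ^ b * (c ^ a * (F * G) ^ a))
        ≡⟨ regroup ((2ℚ * 2ℚ) ^ b) δ (X ^ b) (c ^ a) ((F * G) ^ a) ⟩
      X ^ b * (coprimeConstant a b * (δ * (F * G) ^ a)) ∎)
    where
    open ℚ.≤-Reasoning
    open CloseProperties close
    scaled = scale z b
    X = proj₁ scaled
    p = proj₁ (proj₂ scaled)
    1≤X = proj₁ (proj₂ (proj₂ scaled))
    z+1≤X = proj₁ (proj₂ (proj₂ (proj₂ scaled)))
    X≤ = proj₁ (proj₂ (proj₂ (proj₂ (proj₂ scaled))))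
    p≤b = proj₁ (proj₂ (proj₂ (proj₂ (proj₂ (proj₂ scaled)))))
    Xᵇ≤ = proj₂ (proj₂ (proj₂ (proj₂ (proj₂ (proj₂ scaled)))))
    inverted = inverse {δ * X ^ b} (*-pos (Close.0<δ close) (^-pos b (ℚ.<-≤-trans 0<1 1≤X)))
    r = proj₁ inverted
    0<r = proj₁ (proj₂ inverted)
    rδX≡1 = proj₂ (proj₂ inverted)
    regroup : ∀ s d X c G → s * (d * X * (c * G)) ≡ X * (s * c * (d * G))
    regroup = solve-∀ ℚ-ring
    0<Xᵇ = ^-pos b (ℚ.<-≤-trans 0<1 1≤X)
    0≤Xᵇ = ℚ.<⇒≤ 0<Xᵇ
    0≤X = ℚ.≤-trans 0≤1 1≤X
    0≤F = ℚ.≤-trans 0≤1 1≤F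
    0≤G = ℚ.≤-trans 0≤1 1≤G
    z≤X : ‖ z ‖ ≤ X
    z≤X = ℚ.≤-trans (≤-+ʳ 0≤1) z+1≤X
    y≤X : ‖ y ‖ ≤ X
    y≤X = ℚ.≤-trans y≤ z+1≤X
    p<a : p ℕ.< a
    p<a = ℕ.≤-trans (s≤s p≤b) b<a
    hg′ : Below 0ᵍ (suc a) g
    hg′ i h = hg i (ℕ.≤-trans (s≤s b<a) h)
    open BezoutianAt a g f hg′ hf z
    q = quotientConstant a
    s = fromℕ (suc (suc b) ℕ.* suc (suc b))
    c = coprimeRow a b
    B = c * (F * G)
    D = δ * X ^ b
    0≤D : 0ℚ ≤ D
    0≤D = *-nonNeg 0≤δ 0≤Xᵇ
    0≤s : 0ℚ ≤ s
    0≤s = fromℕ-nonNeg (suc (suc b) ℕ.* suc (suc b))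
    0≤q : 0ℚ ≤ q
    0≤q = *-nonNeg (^-nonNeg (suc a) (ℚ.<⇒≤ 0<2)) (fromℕ-nonNeg (suc a))
    0≤a : 0ℚ ≤ fromℕ a
    0≤a = fromℕ-nonNeg a
    0≤FG = *-nonNeg 0≤F 0≤G
    δ≤D : δ ≤ D
    δ≤D = ≤-*ʳ 0≤δ (1≤^ b 1≤X)
    η≤D : η ≤ D
    η≤D = ℚ.≤-trans (η≤δδ 1≤X X≤) (ℚ.≤-trans δδ≤δ δ≤D)
    gz≤ : ‖ eval (suc a) g z ‖ ≤ (1ℚ + s) * (D * G)
    gz≤ = begin
      ‖ eval (suc a) g z ‖
        ≡⟨ cong ‖_‖ (trans (eval-extend (s≤s b<a) hg z) (telescope (eval (suc (suc b)) g y) (eval (suc (suc b)) g z))) ⟩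
      ‖ eval (suc (suc b)) g y -ᵍ (eval (suc (suc b)) g y -ᵍ eval (suc (suc b)) g z) ‖
        ≤⟨ ‖-‖ _ _ ⟩
      ‖ eval (suc (suc b)) g y ‖ + ‖ eval (suc (suc b)) g y -ᵍ eval (suc (suc b)) g z ‖
        ≤⟨ ℚ.+-mono-≤ (ℚ.≤-trans gy (ℚ.≤-trans η≤D (≤-*ʳ 0≤D 1≤G))) (ℚ.≤-trans (ℚ.≤-reflexive (cong ‖_‖ (eval-difference (suc (suc b)) g z y)))
             (ℚ.≤-trans (‖*‖ (y -ᵍ z) _) (*-mono (‖‖-nonNeg (divided (suc (suc b)) g z y)) 0≤δ near
               (divided-bound (suc (suc b)) b ℕ.≤-refl 0≤G 1≤X g≤G z≤X y≤X)))) ⟩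
      D * G + δ * (s * (G * X ^ b))
        ≡⟨ lemma δ (X ^ b) G s ⟩
      (1ℚ + s) * (D * G) ∎
      where
      telescope : ∀ u v → v ≡ u -ᵍ (u -ᵍ v)
      telescope = solve-∀ 𝔾-ring
      lemma : ∀ d X G s → d * X * G + d * (s * (G * X)) ≡ (1ℚ + s) * (d * X * G)
      lemma = solve-∀ ℚ-ring
    fz≤1 : ‖ eval (suc a) f z ‖ ≤ 1ℚ
    fz≤1 = ℚ.≤-trans fz (ℚ.≤-trans (η≤δδ 1≤X X≤) (ℚ.≤-trans δδ≤δ δ≤1))
    ρ≤ : ∀ i → i ℕ.< a → ‖ ρ i ‖ ≤ ((1ℚ + s) * q + fromℕ a) * (D * (F * G))
    ρ≤ i i<a = begin
      ‖ ρ i ‖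
        ≤⟨ ℚ.≤-trans (‖-‖ _ _) (ℚ.+-mono-≤ (‖*‖ (eval (suc a) g z) _) (‖*‖ (eval (suc a) f z) _)) ⟩
      ‖ eval (suc a) g z ‖ * ‖ eval a (shift (suc i) f) z ‖ + ‖ eval (suc a) f z ‖ * ‖ eval a (shift (suc i) g) z ‖
        ≤⟨ ℚ.+-mono-≤
             (*-mono (‖‖-nonNeg (eval a (shift (suc i) f) z)) (*-nonNeg (+-nonNeg 0≤1 0≤s) (*-nonNeg 0≤D 0≤G)) gz≤ (quotient-bound a i i<a 1≤F f≤F hf fz≤1))
             (*-mono (‖‖-nonNeg (eval a (shift (suc i) g) z)) 0≤η fz (eval-bound a a (ℕ.n≤1+n a) 0≤G 1≤X (λ k → g≤G (suc i ℕ.+ k)) z≤X)) ⟩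
      (1ℚ + s) * (D * G) * (q * F) + η * (fromℕ a * (G * X ^ a))
        ≡⟨ lemma (1ℚ + s) D G q F η (fromℕ a) (X ^ a) ⟩
      (1ℚ + s) * q * (D * (F * G)) + fromℕ a * (G * (η * X ^ a))
        -- The tolerance `η` outweighs the factor `X ^ a`, so that the term with `f(z)` is no larger
        -- in order than the main term.
        ≤⟨ ℚ.+-monoʳ-≤ ((1ℚ + s) * q * (D * (F * G))) (*-monoʳ 0≤a (*-monoʳ 0≤G (ℚ.≤-trans (error 1≤X X≤ (ℕ.m≤m+n a a)) (ℚ.≤-trans δδ≤δ (ℚ.≤-trans δ≤D (≤-*ʳ 0≤D 1≤F)))))) ⟩
      (1ℚ + s) * q * (D * (F * G)) + fromℕ a * (G * (D * F))
        ≡⟨ lemma₂ ((1ℚ + s) * q) (fromℕ a) D F G ⟩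
      ((1ℚ + s) * q + fromℕ a) * (D * (F * G)) ∎
      where
      lemma : ∀ s D G q F e a X → s * (D * G) * (q * F) + e * (a * (G * X)) ≡ s * q * (D * (F * G)) + a * (G * (e * X))
      lemma = solve-∀ ℚ-ring
      lemma₂ : ∀ s a D F G → s * (D * (F * G)) + a * (G * (D * F)) ≡ (s + a) * (D * (F * G))
      lemma₂ = solve-∀ ℚ-ring
    -- Row `p` is multiplied by `r`, the inverse of its small factor `D = δ X^b`; after this all
    -- rows have the same order.
    μ : ℕ → ℚ
    μ = update (λ _ → 1ℚ) p r
    0≤row : 0ℚ ≤ (1ℚ + s) * q + fromℕ a
    0≤row = +-nonNeg (*-nonNeg (+-nonNeg 0≤1 0≤s) 0≤q) 0≤a
    rows≤ : ∀ j → j ℕ.< a → μ j * rowNorm a (λ _ → 1ℚ) (reduced p j) ≤ B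
    rows≤ j j<a = split (j ℕ.≟ p)
      where
      split : Dec (j ≡ p) → μ j * rowNorm a (λ _ → 1ℚ) (reduced p j) ≤ B
      split (yes refl) = subst₂ (λ u v → u * rowNorm a (λ _ → 1ℚ) v ≤ B) (sym (update-at (λ _ → 1ℚ) p r)) (sym (update-at (bezoutian g f) p ρ))
        (ℚ.≤-trans (rowNorm-bound a (λ _ → 1ℚ) r ρ {((1ℚ + s) * q + fromℕ a) * (F * G)} λ i i<a → begin
            r * 1ℚ * ‖ ρ i ‖  ≡⟨ cong (_* ‖ ρ i ‖) (ℚ.*-identityʳ r) ⟩
            r * ‖ ρ i ‖  ≤⟨ *-monoʳ (ℚ.<⇒≤ 0<r) (ρ≤ i i<a) ⟩
            r * (((1ℚ + s) * q + fromℕ a) * (D * (F * G)))  ≡⟨ lemma r ((1ℚ + s) * q + fromℕ a) D (F * G) ⟩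
            D * r * (((1ℚ + s) * q + fromℕ a) * (F * G))  ≡⟨ cong (_* (((1ℚ + s) * q + fromℕ a) * (F * G))) rδX≡1 ⟩
            1ℚ * (((1ℚ + s) * q + fromℕ a) * (F * G))  ≡⟨ ℚ.*-identityˡ _ ⟩
            ((1ℚ + s) * q + fromℕ a) * (F * G)  ∎)
          (begin
            fromℕ a * (((1ℚ + s) * q + fromℕ a) * (F * G))  ≡⟨ sym (ℚ.*-assoc (fromℕ a) _ (F * G)) ⟩
            fromℕ a * ((1ℚ + s) * q + fromℕ a) * (F * G)  ≤⟨ *-monoˡ 0≤FG (≤-+ˡ (*-nonNeg 0≤a (*-nonNeg (ℚ.<⇒≤ 0<2) 0≤a))) ⟩
            B  ∎))
        where
        lemma : ∀ r c D G → r * (c * (D * G)) ≡ D * r * (c * G)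
        lemma = solve-∀ ℚ-ring
      split (no j≢p) = subst₂ (λ u v → u * rowNorm a (λ _ → 1ℚ) v ≤ B) (sym (update-other (λ _ → 1ℚ) p r j j≢p)) (sym (update-other (bezoutian g f) p ρ j j≢p))
        (ℚ.≤-trans (rowNorm-bound a (λ _ → 1ℚ) 1ℚ (bezoutian g f j) {2ℚ * fromℕ a * (G * F)} λ i i<a → begin
            1ℚ * 1ℚ * ‖ bezoutian g f j i ‖  ≡⟨ ℚ.*-identityˡ _ ⟩
            ‖ bezoutian g f j i ‖  ≤⟨ bezoutian-bound j i 0≤G 0≤F g≤G f≤F ⟩
            2ℚ * fromℕ (suc j) * (G * F)  ≤⟨ *-monoˡ (*-nonNeg 0≤G 0≤F) (*-monoʳ {c = 2ℚ} (ℚ.<⇒≤ 0<2) (fromℕ-mono {suc j} {a} j<a)) ⟩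
            2ℚ * fromℕ a * (G * F)  ∎)
          (begin
            fromℕ a * (2ℚ * fromℕ a * (G * F))  ≡⟨ lemma (fromℕ a) 2ℚ G F ⟩
            fromℕ a * (2ℚ * fromℕ a) * (F * G)  ≤⟨ *-monoˡ 0≤FG (≤-+ʳ {fromℕ a * (2ℚ * fromℕ a)} (*-nonNeg 0≤a 0≤row)) ⟩
            B  ∎))
        where
        lemma : ∀ a t G F → a * (t * a * (G * F)) ≡ a * (t * a) * (F * G)
        lemma = solve-∀ ℚ-ring
    zᵖ≤ : ‖ z ^ᵍ p ‖ ≤ D * B ^ a
    zᵖ≤ = begin
      ‖ z ^ᵍ p ‖  ≤⟨ *-integer≥1 (z ^ᵍ p) (det-int a (bezoutian g f) (bezoutian-int gℤ fℤ)) det≢0 ⟩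
      ‖ z ^ᵍ p *ᵍ det a (bezoutian g f) ‖  ≡⟨ cong ‖_‖ (sym (det-reduced p p<a)) ⟩
      ‖ det a (reduced p) ‖  ≡⟨ sym (trans (cong (_* ‖ det a (reduced p) ‖) rδX≡1) (ℚ.*-identityˡ _)) ⟩
      D * r * ‖ det a (reduced p) ‖  ≡⟨ trans (ℚ.*-assoc D r _) (cong (λ t → D * (t * ‖ det a (reduced p) ‖)) (sym weights)) ⟩
      D * (prodℚ a μ * prodℚ a (λ _ → 1ℚ) * ‖ det a (reduced p) ‖)
        ≤⟨ *-monoʳ 0≤D (det-weighted a (λ _ → 1ℚ) μ B (λ _ → 0≤1) (update-nonNeg p (λ _ → 0≤1) (ℚ.<⇒≤ 0<r)) (reduced p) rows≤) ⟩
      D * B ^ a  ∎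
      where
      weights : prodℚ a μ * prodℚ a (λ _ → 1ℚ) ≡ r
      weights = trans (cong₂ _*_ (prodℚ-spike a p r p<a) (prodℚ-one a)) (ℚ.*-identityʳ r)

-- Distance between two roots of the same minimal polynomial

module Discriminant where
  import Data.Integer.Base as ℤ
  open import Data.Rational.Base using (_+_; _*_; _≤_; _<_)
  open import Tactic.RingSolver using (solve-∀)
  open Rationals
  open Gaussian
  open ExteriorAlgebra hiding (Λ)
  open Polynomials
  open Bounds
  open Resultants
  open Coprime

  derivative-below : ∀ m {f : ℕ → 𝔾} → Below 0ᵍ (suc m) f → Below 0ᵍ m (derivative f)
  derivative-below m h i m≤i = trans (cong (real (fromℕ (suc i)) *ᵍ_) (h (suc i) (s≤s m≤i))) (*zero (real (fromℕ (suc i))))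
    where
    *zero : ∀ a → a *ᵍ 0ᵍ ≡ 0ᵍ
    *zero = solve-∀ 𝔾-ring

  derivative-int : ∀ {f : ℕ → 𝔾} → (∀ i → IsInteger (f i)) → ∀ i → IsInteger (derivative f i)
  derivative-int h i = int-* (ℤ.+ suc i , refl) (h (suc i))

  derivative-norm : ∀ f i → ‖ derivative f i ‖ ≡ fromℕ (suc i) * ‖ f (suc i) ‖
  derivative-norm f i = trans (‖real*‖ (fromℕ (suc i)) (f (suc i))) (cong (_* ‖ f (suc i) ‖) (ℚ.0≤p⇒∣p∣≡p (fromℕ-nonNeg (suc i))))

  derivative-bound : ∀ m {f F} → Below 0ᵍ (suc m) f → 0ℚ ≤ F → (∀ i → ‖ f i ‖ ≤ F) → ∀ i → ‖ derivative f i ‖ ≤ fromℕ m * F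
  derivative-bound m {f} {F} below 0≤F hf i with ℕ.<-≤-connex i m
  ... | inj₁ i<m = ℚ.≤-trans (ℚ.≤-reflexive (derivative-norm f i))
          (*-mono (‖‖-nonNeg (f (suc i))) (fromℕ-nonNeg m) (fromℕ-mono {suc i} {m} i<m) (hf (suc i)))
  ... | inj₂ m≤i = ≤-zero (derivative-below m below i m≤i) (*-nonNeg (fromℕ-nonNeg m) 0≤F)

  -- In `slopeConstant` the outer 2 comes from `‖*‖-lower`, the inner 2 from the errors `f(y)` and
  -- `f(z)`, and the cube from `divided₂-bound`. The three summands of `entryConstant` belong to
  -- ordinary entries, to the replaced row and column, and to their common entry.
  slopeConstant entryConstant discriminantConstant : ℕ → ℚ
  slopeConstant m = 2ℚ * (2ℚ + fromℕ (suc m ℕ.* suc m ℕ.* suc m))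
  entryConstant m = 2ℚ * fromℕ m * fromℕ m + (quotientConstant m + fromℕ m * fromℕ m) + (1ℚ + fromℕ m * fromℕ m * fromℕ m)
  discriminantConstant k = 2ℚ * ((2ℚ * 2ℚ) ^ k * (2ℚ * 2ℚ) ^ k) * (slopeConstant m * slopeConstant m) * (fromℕ m * entryConstant m) ^ m
    where m = suc (suc k)

  module Repeated (k : ℕ) (f : ℕ → 𝔾) (F : ℚ) (z y : 𝔾) (η : ℚ)
    (fℤ : ∀ i → IsInteger (f i)) (below : Below 0ᵍ (suc (suc (suc k))) f) (monic : f (suc (suc k)) ≡ 1ᵍ)
    (f≤F : ∀ i → ‖ f i ‖ ≤ F) (1≤F : 1ℚ ≤ F) (close : Close (suc (suc k)) z y (‖ y -ᵍ z ‖) η)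
    (fz : ‖ eval (suc (suc (suc k))) f z ‖ ≤ η) (fy : ‖ eval (suc (suc (suc k))) f y ‖ ≤ η)
    (X : ℚ) (p : ℕ) (1≤X : 1ℚ ≤ X) (z+1≤X : ‖ z ‖ + 1ℚ ≤ X) (X≤ : X ≤ 2ℚ * (‖ z ‖ + 1ℚ)) (p≤k : p ℕ.≤ k)
    where
    open ℚ.≤-Reasoning
    open CloseProperties close
    m = suc (suc k)
    δ = ‖ y -ᵍ z ‖
    g = derivative f
    hg : Below 0ᵍ m g
    hg = derivative-below m below
    hg′ : Below 0ᵍ (suc m) g
    hg′ i h = hg i (ℕ.≤-trans (ℕ.n≤1+n m) h)
    p<m : p ℕ.< m
    p<m = s≤s (ℕ.m≤n⇒m≤1+n p≤k)
    open BezoutianAt m g f hg′ below z public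
    M = fromℕ m
    0≤M : 0ℚ ≤ M
    0≤M = fromℕ-nonNeg m
    0≤F = ℚ.≤-trans 0≤1 1≤F
    0≤X = ℚ.≤-trans 0≤1 1≤X
    0≤FF = *-nonNeg 0≤F 0≤F
    G = M * F
    0≤G = *-nonNeg 0≤M 0≤F
    g≤G : ∀ i → ‖ g i ‖ ≤ G
    g≤G = derivative-bound m below 0≤F f≤F
    z≤X : ‖ z ‖ ≤ X
    z≤X = ℚ.≤-trans (≤-+ʳ 0≤1) z+1≤X
    y≤X : ‖ y ‖ ≤ X
    y≤X = ℚ.≤-trans y≤ z+1≤X
    s = fromℕ (suc m ℕ.* suc m ℕ.* suc m)
    0≤s : 0ℚ ≤ s
    0≤s = fromℕ-nonNeg (suc m ℕ.* suc m ℕ.* suc m)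
    cλ = slopeConstant m
    1≤Xᵏ = 1≤^ k 1≤X
    0≤Xᵏ = ℚ.≤-trans 0≤1 1≤Xᵏ
    1≤FX : 1ℚ ≤ F * X ^ k
    1≤FX = ℚ.≤-trans 1≤F (≤-*ʳ 0≤F 1≤Xᵏ)
    Λ = cλ * (δ * (F * X ^ k))
    1≤2+s : 1ℚ ≤ 2ℚ + s
    1≤2+s = ℚ.≤-trans 1≤2 (≤-+ʳ {2ℚ} {s} 0≤s)
    1≤cλ : 1ℚ ≤ cλ
    1≤cλ = ℚ.≤-trans 1≤2+s (≤-*ˡ {2ℚ + s} {2ℚ} (ℚ.≤-trans 0≤1 1≤2+s) 1≤2)
    0≤cλ = ℚ.≤-trans 0≤1 1≤cλ
    δF≤Λ : δ * F ≤ Λ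
    δF≤Λ = ℚ.≤-trans (*-monoʳ 0≤δ (≤-*ʳ 0≤F 1≤Xᵏ)) (≤-*ˡ (*-nonNeg 0≤δ (*-nonNeg 0≤F 0≤Xᵏ)) 1≤cλ)
    δ≤Λ : δ ≤ Λ
    δ≤Λ = ℚ.≤-trans (≤-*ʳ 0≤δ 1≤F) δF≤Λ
    0<Λ : 0ℚ < Λ
    0<Λ = ℚ.<-≤-trans 0<δ δ≤Λ
    0≤Λ = ℚ.<⇒≤ 0<Λ
    slope = eval (suc m) g z

    slope≡divided : slope ≡ divided (suc m) f z z
    slope≡divided = trans (eval-extend (ℕ.n≤1+n m) hg z) (eval-derivative m f z)

    -- By divided differences `f′(z) = f[z,y] − (y − z) f[z,z,y]`. The values `f(y)` and `f(z)` are
    -- at most `δ²`, so `f[z,y]` is `O(δ)`, and the last term is `O(δ F X^k)`. Everything is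
    -- multiplied by `y − z` instead of dividing by it.
    slope≤Λ : ‖ slope ‖ ≤ Λ
    slope≤Λ = *-cancel≤ʳ 0<δ (begin
      δ * ‖ slope ‖
        ≤⟨ ‖*‖-lower (y -ᵍ z) slope ⟩
      2ℚ * ‖ (y -ᵍ z) *ᵍ slope ‖
        ≡⟨ cong (λ t → 2ℚ * ‖ t ‖) expansion ⟩
      2ℚ * ‖ eval (suc m) f y -ᵍ eval (suc m) f z -ᵍ (y -ᵍ z) *ᵍ ((y -ᵍ z) *ᵍ d₂) ‖
        ≤⟨ *-monoʳ {c = 2ℚ} (ℚ.<⇒≤ 0<2) (ℚ.≤-trans (‖-‖ _ _) (ℚ.+-mono-≤
             (ℚ.≤-trans (‖-‖ _ _) (ℚ.+-mono-≤ (ℚ.≤-trans fy (η≤δδ 1≤X X≤)) (ℚ.≤-trans fz (η≤δδ 1≤X X≤))))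
             (ℚ.≤-trans (‖*‖ (y -ᵍ z) _) (*-monoʳ 0≤δ (ℚ.≤-trans (‖*‖ (y -ᵍ z) d₂) (*-monoʳ 0≤δ
               (divided₂-bound (suc m) k ℕ.≤-refl 0≤F 1≤X f≤F z≤X y≤X))))))) ⟩
      2ℚ * (δ * δ + δ * δ + δ * (δ * (s * (F * X ^ k))))
        ≤⟨ *-monoʳ {c = 2ℚ} (ℚ.<⇒≤ 0<2) (ℚ.+-monoˡ-≤ (δ * (δ * (s * (F * X ^ k))))
             (≤-*ʳ (+-nonNeg (*-nonNeg 0≤δ 0≤δ) (*-nonNeg 0≤δ 0≤δ)) 1≤FX)) ⟩
      2ℚ * ((δ * δ + δ * δ) * (F * X ^ k) + δ * (δ * (s * (F * X ^ k))))
        ≡⟨ lemma δ (F * X ^ k) s ⟩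
      δ * Λ ∎)
      where
      d₂ = divided₂ (suc m) f z y
      expansion : (y -ᵍ z) *ᵍ slope ≡ eval (suc m) f y -ᵍ eval (suc m) f z -ᵍ (y -ᵍ z) *ᵍ ((y -ᵍ z) *ᵍ d₂)
      expansion = trans (cong ((y -ᵍ z) *ᵍ_) slope≡divided) (trans (rewritten (y -ᵍ z) (divided (suc m) f z y) (divided (suc m) f z z))
        (cong₂ (λ u v → u -ᵍ (y -ᵍ z) *ᵍ v) (sym (eval-difference (suc m) f z y)) (divided-difference (suc m) f z y)))
        where
        rewritten : ∀ h a b → h *ᵍ b ≡ h *ᵍ a -ᵍ h *ᵍ (a -ᵍ b)
        rewritten = solve-∀ 𝔾-ring
      lemma : ∀ d Y s → (1ℚ + 1ℚ) * ((d * d + d * d) * Y + d * (d * (s * Y))) ≡ d * ((1ℚ + 1ℚ) * ((1ℚ + 1ℚ) + s) * (d * Y))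
      lemma = solve-∀ ℚ-ring

    q = quotientConstant m
    0≤q : 0ℚ ≤ q
    0≤q = *-nonNeg (^-nonNeg (suc m) (ℚ.<⇒≤ 0<2)) (fromℕ-nonNeg (suc m))
    c = entryConstant m
    c₁ c₂ c₃ : ℚ
    c₁ = 2ℚ * M * M
    c₂ = q + M * M
    c₃ = 1ℚ + M * M * M
    0≤MM = *-nonNeg 0≤M 0≤M
    0≤c₁ : 0ℚ ≤ c₁
    0≤c₁ = *-nonNeg (*-nonNeg {2ℚ} (ℚ.<⇒≤ 0<2) 0≤M) 0≤M
    0≤c₂ : 0ℚ ≤ c₂
    0≤c₂ = +-nonNeg 0≤q 0≤MM
    0≤c₃ : 0ℚ ≤ c₃
    0≤c₃ = +-nonNeg 0≤1 (*-nonNeg 0≤MM 0≤M)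
    c₁≤c : c₁ ≤ c
    c₁≤c = ℚ.≤-trans (≤-+ʳ {c₁} {c₂} 0≤c₂) (≤-+ʳ {c₁ + c₂} {c₃} 0≤c₃)
    c₂≤c : c₂ ≤ c
    c₂≤c = ℚ.≤-trans (≤-+ˡ {c₂} {c₁} 0≤c₁) (≤-+ʳ {c₁ + c₂} {c₃} 0≤c₃)
    c₃≤c : c₃ ≤ c
    c₃≤c = ≤-+ˡ {c₃} {c₁ + c₂} (+-nonNeg {c₁} {c₂} 0≤c₁ 0≤c₂)

    -- An entry lacks a factor `F` for each of its two indices that is the last one, because `f` is
    -- monic; the weight `F` at that index evens this out.
    h : ℕ → ℚ
    h = update (λ _ → 1ℚ) (suc k) F

    v : ℕ → 𝔾
    v i = eval m (shift (suc i) g) z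

    v≤ : ∀ i → ‖ v i ‖ ≤ M * (G * X ^ m)
    v≤ i = eval-bound m m (ℕ.n≤1+n m) 0≤G 1≤X (λ j → g≤G (suc i ℕ.+ j)) z≤X

    fz≤1 : ‖ eval (suc m) f z ‖ ≤ 1ℚ
    fz≤1 = ℚ.≤-trans fz (ℚ.≤-trans (η≤δδ 1≤X X≤) (ℚ.≤-trans δδ≤δ δ≤1))

    ρ≤ : ∀ i → i ℕ.< m → ‖ ρ i ‖ ≤ c₂ * (F * Λ)
    ρ≤ i i<m = begin
      ‖ ρ i ‖
        ≤⟨ ℚ.≤-trans (‖-‖ _ _) (ℚ.+-mono-≤ (‖*‖ slope _) (‖*‖ (eval (suc m) f z) _)) ⟩
      ‖ slope ‖ * ‖ eval m (shift (suc i) f) z ‖ + ‖ eval (suc m) f z ‖ * ‖ v i ‖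
        ≤⟨ ℚ.+-mono-≤ (*-mono (‖‖-nonNeg (eval m (shift (suc i) f) z)) 0≤Λ slope≤Λ (quotient-bound m i i<m 1≤F f≤F below fz≤1))
                      (*-mono (‖‖-nonNeg (v i)) 0≤η fz (v≤ i)) ⟩
      Λ * (q * F) + η * (M * (M * F * X ^ m))
        ≡⟨ cong (Λ * (q * F) +_) (lemma η M F (X ^ m)) ⟩
      Λ * (q * F) + M * M * (F * (η * X ^ m))
        ≤⟨ ℚ.+-monoʳ-≤ (Λ * (q * F)) (*-monoʳ 0≤MM (*-monoʳ 0≤F (ℚ.≤-trans (error 1≤X X≤ (ℕ.m≤m+n m m)) (ℚ.≤-trans δδ≤δ δ≤Λ)))) ⟩
      Λ * (q * F) + M * M * (F * Λ)
        ≡⟨ lemma₂ Λ q F (M * M) ⟩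
      c₂ * (F * Λ) ∎
      where
      lemma : ∀ e M F X → e * (M * (M * F * X)) ≡ M * M * (F * (e * X))
      lemma = solve-∀ ℚ-ring
      lemma₂ : ∀ L q F n → L * (q * F) + n * (F * L) ≡ (q + n) * (F * L)
      lemma₂ = solve-∀ ℚ-ring

    ρ-top : ρ (suc k) ≡ slope
    ρ-top = trans (cong₂ (λ a b → slope *ᵍ a -ᵍ eval (suc m) f z *ᵍ b) w-top v-top) (lemma slope (eval (suc m) f z))
      where
      w-top : eval m (shift m f) z ≡ 1ᵍ
      w-top = trans (eval-extend {1} {m} (s≤s z≤n) {shift m f} (λ i 1≤i → below (m ℕ.+ i) (subst (ℕ._≤ m ℕ.+ i) (ℕ.+-comm m 1) (ℕ.+-monoʳ-≤ m 1≤i))) z)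
        (trans (cong (λ t → f t +ᵍ z *ᵍ 0ᵍ) (ℕ.+-identityʳ m)) (trans (cong (λ t → t +ᵍ z *ᵍ 0ᵍ) monic) (lemma₁ z)))
        where
        lemma₁ : ∀ z → 1ᵍ +ᵍ z *ᵍ 0ᵍ ≡ 1ᵍ
        lemma₁ = solve-∀ 𝔾-ring
      v-top : v (suc k) ≡ 0ᵍ
      v-top = eval-zero m (λ i _ → hg (m ℕ.+ i) (ℕ.m≤m+n m i)) z
      lemma : ∀ s e → s *ᵍ 1ᵍ -ᵍ e *ᵍ 0ᵍ ≡ s
      lemma = solve-∀ 𝔾-ring

    hρ≤ : ∀ i → i ℕ.< m → h i * ‖ ρ i ‖ ≤ c * (F * Λ)
    hρ≤ i i<m = split (i ℕ.≟ suc k)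
      where
      split : Dec (i ≡ suc k) → h i * ‖ ρ i ‖ ≤ c * (F * Λ)
      split (yes refl) = ℚ.≤-trans (*-mono (‖‖-nonNeg (ρ (suc k))) 0≤F (ℚ.≤-reflexive (update-at (λ _ → 1ℚ) (suc k) F))
            (ℚ.≤-trans (ℚ.≤-reflexive (cong ‖_‖ ρ-top)) slope≤Λ))
            (≤-*ˡ (*-nonNeg 0≤F 0≤Λ) (ℚ.≤-trans (≤-+ʳ {1ℚ} {M * M * M} (*-nonNeg 0≤MM 0≤M)) c₃≤c))
      split (no i≢) = ℚ.≤-trans (ℚ.≤-reflexive (trans (cong (_* ‖ ρ i ‖) (update-other (λ _ → 1ℚ) (suc k) F i i≢)) (ℚ.*-identityˡ _)))
            (ℚ.≤-trans (ρ≤ i i<m) (*-monoˡ (*-nonNeg 0≤F 0≤Λ) c₂≤c))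

    -- The number `f′(z)` occurs twice here, as the value of `g` and as `f[z,z]`, which makes the
    -- main term quadratic in `Λ`.
    corner≤ : ‖ ρ-evaluated ‖ ≤ c * (Λ * Λ)
    corner≤ = begin
      ‖ ρ-evaluated ‖
        ≤⟨ ℚ.≤-trans (‖-‖ _ _) (ℚ.+-mono-≤ (‖*‖ slope _) (‖*‖ (eval (suc m) f z) _)) ⟩
      ‖ slope ‖ * ‖ divided (suc m) f z z ‖ + ‖ eval (suc m) f z ‖ * ‖ eval m v z ‖
        ≤⟨ ℚ.+-mono-≤ (*-mono (‖‖-nonNeg (divided (suc m) f z z)) 0≤Λ slope≤Λ (ℚ.≤-trans (ℚ.≤-reflexive (cong ‖_‖ (sym slope≡divided))) slope≤Λ))
                      (*-mono (‖‖-nonNeg (eval m v z)) 0≤η fz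
                        (eval-bound m m (ℕ.n≤1+n m) (*-nonNeg 0≤M (*-nonNeg 0≤G (^-nonNeg m 0≤X))) 1≤X v≤ z≤X)) ⟩
      Λ * Λ + η * (M * (M * (M * F * X ^ m) * X ^ m))
        ≡⟨ cong (Λ * Λ +_) (trans (lemma η M F (X ^ m)) (cong (λ t → M * M * M * (η * t * F)) (sym (^-+ X m m)))) ⟩
      Λ * Λ + M * M * M * (η * X ^ (m ℕ.+ m) * F)
        -- The error term has been evaluated at `z` twice; its factor `X ^ (m ℕ.+ m)` accounts for
        -- the exponent `e ℕ.+ e` in `Close`.
        ≤⟨ ℚ.+-monoʳ-≤ (Λ * Λ) (*-monoʳ (*-nonNeg 0≤MM 0≤M) (*-monoˡ 0≤F (error 1≤X X≤ ℕ.≤-refl))) ⟩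
      Λ * Λ + M * M * M * (δ * δ * F)
        ≤⟨ ℚ.+-monoʳ-≤ (Λ * Λ) (*-monoʳ (*-nonNeg 0≤MM 0≤M) (ℚ.≤-trans (ℚ.≤-reflexive (ℚ.*-assoc δ δ F)) (*-mono (*-nonNeg 0≤δ 0≤F) 0≤Λ δ≤Λ δF≤Λ))) ⟩
      Λ * Λ + M * M * M * (Λ * Λ)
        ≡⟨ lemma₂ (M * M * M) (Λ * Λ) ⟩
      c₃ * (Λ * Λ)
        ≤⟨ *-monoˡ (*-nonNeg 0≤Λ 0≤Λ) c₃≤c ⟩
      c * (Λ * Λ) ∎
      where
      lemma : ∀ e M F X → e * (M * (M * (M * F * X) * X)) ≡ M * M * M * (e * (X * X) * F)
      lemma = solve-∀ ℚ-ring
      lemma₂ : ∀ a b → b + a * b ≡ (1ℚ + a) * b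
      lemma₂ = solve-∀ ℚ-ring

    h-cases : ∀ i → (i ≡ suc k × h i ≡ F) ⊎ (h i ≡ 1ℚ)
    h-cases i = split (i ℕ.≟ suc k)
      where
      split : Dec (i ≡ suc k) → (i ≡ suc k × h i ≡ F) ⊎ (h i ≡ 1ℚ)
      split (yes refl) = inj₁ (refl , update-at (λ _ → 1ℚ) (suc k) F)
      split (no i≢)    = inj₂ (update-other (λ _ → 1ℚ) (suc k) F i i≢)

    M≤c : M ≤ c
    M≤c = ℚ.≤-trans (≤-*ˡ 0≤M 1≤M) (ℚ.≤-trans (≤-+ˡ {M * M} {q} 0≤q) c₂≤c)
      where
      1≤M : 1ℚ ≤ M
      1≤M = 1≤fromℕ {m} (s≤s z≤n)

    top-entry : ∀ j → j ℕ.< m → bezoutian g f j (suc k) ≡ g j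
    top-entry j (s≤s j≤) = bezoutian-top j (suc k) j≤ monic below hg

    g-top : ‖ g (suc k) ‖ ≤ M
    g-top = ℚ.≤-reflexive (trans (derivative-norm f (suc k)) (trans (cong (λ t → M * ‖ t ‖) monic) (trans (cong (M *_) ‖1‖) (ℚ.*-identityʳ M))))

    entry≤ : ∀ j i → j ℕ.< m → i ℕ.< m → h j * h i * ‖ bezoutian g f j i ‖ ≤ c * (F * F)
    entry≤ j i j<m i<m = split (h-cases j) (h-cases i)
      where
      lemma : ∀ F c → F * (c * F) ≡ c * (F * F)
      lemma = solve-∀ ℚ-ring
      lemma₂ : ∀ t M F → t * M * (M * F * F) ≡ t * M * M * (F * F)
      lemma₂ = solve-∀ ℚ-ring
      split : (j ≡ suc k × h j ≡ F) ⊎ (h j ≡ 1ℚ) → (i ≡ suc k × h i ≡ F) ⊎ (h i ≡ 1ℚ) → h j * h i * ‖ bezoutian g f j i ‖ ≤ c * (F * F)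
      split (inj₁ (refl , hj)) (inj₁ (refl , hi)) = begin
        h j * h i * ‖ bezoutian g f j i ‖  ≡⟨ cong₂ (λ a b → a * ‖ b ‖) (cong₂ _*_ hj hi) (top-entry j j<m) ⟩
        F * F * ‖ g j ‖  ≤⟨ *-monoʳ 0≤FF (ℚ.≤-trans g-top M≤c) ⟩
        F * F * c  ≡⟨ ℚ.*-comm (F * F) c ⟩
        c * (F * F)  ∎
      split (inj₁ (refl , hj)) (inj₂ hi) = begin
        h j * h i * ‖ bezoutian g f j i ‖  ≡⟨ cong₂ (λ a b → a * ‖ b ‖) (trans (cong₂ _*_ hj hi) (ℚ.*-identityʳ F)) (trans (bezoutian-sym g f j i) (top-entry i i<m)) ⟩
        F * ‖ g i ‖  ≤⟨ *-monoʳ 0≤F (ℚ.≤-trans (g≤G i) (*-monoˡ 0≤F M≤c)) ⟩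
        F * (c * F)  ≡⟨ lemma F c ⟩
        c * (F * F)  ∎
      split (inj₂ hj) (inj₁ (refl , hi)) = begin
        h j * h i * ‖ bezoutian g f j i ‖  ≡⟨ cong₂ (λ a b → a * ‖ b ‖) (trans (cong₂ _*_ hj hi) (ℚ.*-identityˡ F)) (top-entry j j<m) ⟩
        F * ‖ g j ‖  ≤⟨ *-monoʳ 0≤F (ℚ.≤-trans (g≤G j) (*-monoˡ 0≤F M≤c)) ⟩
        F * (c * F)  ≡⟨ lemma F c ⟩
        c * (F * F)  ∎
      split (inj₂ hj) (inj₂ hi) = begin
        h j * h i * ‖ bezoutian g f j i ‖  ≡⟨ trans (cong (_* ‖ bezoutian g f j i ‖) (cong₂ _*_ hj hi)) (ℚ.*-identityˡ _) ⟩
        ‖ bezoutian g f j i ‖  ≤⟨ bezoutian-bound j i 0≤G 0≤F g≤G f≤F ⟩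
        2ℚ * fromℕ (suc j) * (M * F * F)  ≤⟨ *-monoˡ (*-nonNeg 0≤G 0≤F) (*-monoʳ {c = 2ℚ} (ℚ.<⇒≤ 0<2) (fromℕ-mono {suc j} {m} j<m)) ⟩
        2ℚ * M * (M * F * F)  ≡⟨ lemma₂ 2ℚ M F ⟩
        c₁ * (F * F)  ≤⟨ *-monoˡ 0≤FF c₁≤c ⟩
        c * (F * F)  ∎

    p≢ : p ≢ suc k
    p≢ e = ℕ.<-irrefl e (s≤s p≤k)

    h-p : h p ≡ 1ℚ
    h-p = update-other (λ _ → 1ℚ) (suc k) F p p≢

    h-nonNeg : ∀ i → 0ℚ ≤ h i
    h-nonNeg = update-nonNeg (suc k) (λ _ → 0≤1) 0≤F

    -- The weight `a = F / Λ` raises row and column `p`, of size `F Λ` after weighting by `h`, and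
    -- their common entry, of size `Λ²`, to the size `F²` of all other weighted entries.
    module Weighted (a : ℚ) (0≤a : 0ℚ ≤ a) (aΛ≡F : a * Λ ≡ F) where

      κ : ℕ → ℚ
      κ = update h p a

      κ-nonNeg : ∀ i → 0ℚ ≤ κ i
      κ-nonNeg = update-nonNeg p h-nonNeg 0≤a

      κ-p : κ p ≡ a
      κ-p = update-at h p a

      κ-other : ∀ i → i ≢ p → κ i ≡ h i
      κ-other = update-other h p a

      border : ∀ i → i ℕ.< m → a * (h i * ‖ ρ i ‖) ≤ c * (F * F)
      border i i<m = begin
        a * (h i * ‖ ρ i ‖)  ≤⟨ *-monoʳ 0≤a (hρ≤ i i<m) ⟩
        a * (c * (F * Λ))  ≡⟨ lemma a c F Λ ⟩
        c * (F * (a * Λ))  ≡⟨ cong (λ t → c * (F * t)) aΛ≡F ⟩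
        c * (F * F)  ∎
        where
        lemma : ∀ a c F L → a * (c * (F * L)) ≡ c * (F * (a * L))
        lemma = solve-∀ ℚ-ring

      weighted-entry : ∀ j i → j ℕ.< m → i ℕ.< m → κ j * κ i * ‖ doubly-reduced p j i ‖ ≤ c * (F * F)
      weighted-entry j i j<m i<m = split (j ℕ.≟ p) (i ℕ.≟ p)
        where
        lemma : ∀ h a n → h * a * n ≡ a * (h * n)
        lemma = solve-∀ ℚ-ring
        lemma₂ : ∀ a c L → a * a * (c * (L * L)) ≡ c * (a * L * (a * L))
        lemma₂ = solve-∀ ℚ-ring
        split : Dec (j ≡ p) → Dec (i ≡ p) → κ j * κ i * ‖ doubly-reduced p j i ‖ ≤ c * (F * F)
        split (no j≢p) (no i≢p) = ℚ.≤-trans (ℚ.≤-reflexive (cong₂ (λ s t → s * ‖ t ‖) (cong₂ _*_ (κ-other j j≢p) (κ-other i i≢p)) (doubly-reduced-other p j i j≢p i≢p)))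
                (entry≤ j i j<m i<m)
        split (no j≢p) (yes refl) = ℚ.≤-trans (ℚ.≤-reflexive (trans (cong₂ (λ s t → s * ‖ t ‖) (cong₂ _*_ (κ-other j j≢p) κ-p) (doubly-reduced-column p j j≢p)) (lemma (h j) a _)))
                (border j j<m)
        split (yes refl) (no i≢p) = ℚ.≤-trans (ℚ.≤-reflexive (trans (cong₂ (λ s t → s * ‖ t ‖) (cong₂ _*_ κ-p (κ-other i i≢p)) (doubly-reduced-row p i i≢p)) (ℚ.*-assoc a (h i) _)))
                (border i i<m)
        split (yes refl) (yes refl) = begin
          κ p * κ p * ‖ doubly-reduced p p p ‖  ≡⟨ cong₂ (λ s t → s * ‖ t ‖) (cong₂ _*_ κ-p κ-p) (doubly-reduced-corner p) ⟩
          a * a * ‖ ρ-evaluated ‖  ≤⟨ *-monoʳ (*-nonNeg 0≤a 0≤a) corner≤ ⟩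
          a * a * (c * (Λ * Λ))  ≡⟨ lemma₂ a c Λ ⟩
          c * (a * Λ * (a * Λ))  ≡⟨ cong (λ t → c * (t * t)) aΛ≡F ⟩
          c * (F * F)  ∎

      weights : prodℚ m κ ≡ a * F
      weights = trans (prodℚ-update m h p a p<m h-p) (cong (a *_) (prodℚ-spike m (suc k) F ℕ.≤-refl))

      determinant≤ : a * F * (a * F) * ‖ det m (doubly-reduced p) ‖ ≤ (M * (c * (F * F))) ^ m
      determinant≤ = subst (λ w → w * w * ‖ det m (doubly-reduced p) ‖ ≤ (M * (c * (F * F))) ^ m) weights
        (det-weighted m κ κ (M * (c * (F * F))) κ-nonNeg κ-nonNeg (doubly-reduced p)
          λ j j<m → rowNorm-bound m κ (κ j) (doubly-reduced p j) λ i i<m → weighted-entry j i j<m i<m)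

  -- The weighted determinant gives `F⁴ ‖ z^p ‖² = O(Λ² F^(2m))` with `m = k + 2`, and
  -- `Λ = O(δ F X^k)`. Hence `‖ z^p ‖² = O(δ² X^(2k) F^(2m−2))`, and the powers of `X` cancel by the
  -- choice of `p`.
  discriminant-separation : ∀ k f F z y η → (∀ i → IsInteger (f i)) → Below 0ᵍ (suc (suc (suc k))) f → f (suc (suc k)) ≡ 1ᵍ →
    (∀ i → ‖ f i ‖ ≤ F) → 1ℚ ≤ F → det (suc (suc k)) (bezoutian (derivative f) f) ≢ 0ᵍ →
    Close (suc (suc k)) z y (‖ y -ᵍ z ‖) η →
    ‖ eval (suc (suc (suc k))) f z ‖ ≤ η → ‖ eval (suc (suc (suc k))) f y ‖ ≤ η →
    1ℚ ≤ discriminantConstant k * (‖ y -ᵍ z ‖ * F ^ suc k * (‖ y -ᵍ z ‖ * F ^ suc k))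
  discriminant-separation k f F z y η fℤ below monic f≤F 1≤F det≢0 close fz fy = *-cancel≤ʳ 0<X²F⁴ (begin
      X ^ k * X ^ k * (F * F * (F * F)) * 1ℚ
        ≡⟨ ℚ.*-identityʳ _ ⟩
      X ^ k * X ^ k * (F * F * (F * F))
        ≤⟨ *-monoˡ (*-nonNeg 0≤FF 0≤FF) (*-mono 0≤Xᵏ (*-nonNeg 0≤4ᵏ (‖‖-nonNeg zᵖ)) Xᵏ≤ Xᵏ≤) ⟩
      4ᵏ * ‖ zᵖ ‖ * (4ᵏ * ‖ zᵖ ‖) * (F * F * (F * F))
        ≡⟨ lemma₁ 4ᵏ (‖ zᵖ ‖) F ⟩
      4ᵏ * 4ᵏ * (F * F * F * F * (‖ zᵖ ‖ * ‖ zᵖ ‖))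
        ≤⟨ *-monoʳ (*-nonNeg 0≤4ᵏ 0≤4ᵏ) key ⟩
      4ᵏ * 4ᵏ * (2ℚ * (Λ * Λ) * (M * (c * (F * F))) ^ m)
        ≡⟨ cong (λ t → 4ᵏ * 4ᵏ * (2ℚ * (Λ * Λ) * t)) powers-of-F ⟩
      4ᵏ * 4ᵏ * (2ℚ * (Λ * Λ) * ((M * c) ^ m * (F * F ^ suc k * (F * F ^ suc k))))
        ≡⟨ lemma₂ 4ᵏ 2ℚ cλ δ F (X ^ k) ((M * c) ^ m) (F ^ suc k) ⟩
      X ^ k * X ^ k * (F * F * (F * F)) * (discriminantConstant k * (δ * F ^ suc k * (δ * F ^ suc k))) ∎)
    where
    open ℚ.≤-Reasoning
    scaled = scale z k
    X = proj₁ scaled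
    p = proj₁ (proj₂ scaled)
    1≤X = proj₁ (proj₂ (proj₂ scaled))
    z+1≤X = proj₁ (proj₂ (proj₂ (proj₂ scaled)))
    X≤ = proj₁ (proj₂ (proj₂ (proj₂ (proj₂ scaled))))
    p≤k = proj₁ (proj₂ (proj₂ (proj₂ (proj₂ (proj₂ scaled)))))
    Xᵏ≤ = proj₂ (proj₂ (proj₂ (proj₂ (proj₂ (proj₂ scaled)))))
    module R = Repeated k f F z y η fℤ below monic f≤F 1≤F close fz fy X p 1≤X z+1≤X X≤ p≤k
    open R using (m; δ; M; c; cλ; Λ; 0<Λ; 0≤Λ; 0≤F; 0≤FF; 0≤Xᵏ; p<m)
    zᵖ = z ^ᵍ p
    4ᵏ : ℚ
    4ᵏ = (2ℚ * 2ℚ) ^ k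
    0≤4ᵏ : 0ℚ ≤ 4ᵏ
    0≤4ᵏ = ^-nonNeg k (*-nonNeg {2ℚ} {2ℚ} (ℚ.<⇒≤ 0<2) (ℚ.<⇒≤ 0<2))
    0<F = ℚ.<-≤-trans 0<1 1≤F
    0<Xᵏ = ^-pos k (ℚ.<-≤-trans 0<1 1≤X)
    0<X²F⁴ = *-pos (*-pos 0<Xᵏ 0<Xᵏ) (*-pos (*-pos 0<F 0<F) (*-pos 0<F 0<F))
    r = proj₁ (inverse 0<Λ)
    a = F * r
    aΛ≡F : a * Λ ≡ F
    aΛ≡F = trans (lemma F r Λ) (trans (cong (F *_) (proj₂ (proj₂ (inverse 0<Λ)))) (ℚ.*-identityʳ F))
      where
      lemma : ∀ F r L → F * r * L ≡ F * (L * r)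
      lemma = solve-∀ ℚ-ring
    0≤a = *-nonNeg 0≤F (ℚ.<⇒≤ (proj₁ (proj₂ (inverse 0<Λ))))
    zᵖ²≤ : ‖ zᵖ ‖ * ‖ zᵖ ‖ ≤ 2ℚ * ‖ det m (R.doubly-reduced p) ‖
    zᵖ²≤ = begin
      ‖ zᵖ ‖ * ‖ zᵖ ‖  ≤⟨ *-monoʳ (‖‖-nonNeg zᵖ) (*-integer≥1 zᵖ (det-int m (bezoutian (derivative f) f) (bezoutian-int (derivative-int fℤ) fℤ)) det≢0) ⟩
      ‖ zᵖ ‖ * ‖ zᵖ *ᵍ det m (bezoutian (derivative f) f) ‖  ≤⟨ ‖*‖-lower zᵖ _ ⟩
      2ℚ * ‖ zᵖ *ᵍ (zᵖ *ᵍ det m (bezoutian (derivative f) f)) ‖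
                                                             ≡⟨ cong (λ t → 2ℚ * ‖ t ‖) (sym (R.det-doubly-reduced p p<m)) ⟩
      2ℚ * ‖ det m (R.doubly-reduced p) ‖  ∎
    key : F * F * F * F * (‖ zᵖ ‖ * ‖ zᵖ ‖) ≤ 2ℚ * (Λ * Λ) * (M * (c * (F * F))) ^ m
    key = begin
      F * F * F * F * (‖ zᵖ ‖ * ‖ zᵖ ‖)
        ≤⟨ *-monoʳ (*-nonNeg (*-nonNeg 0≤FF 0≤F) 0≤F) zᵖ²≤ ⟩
      F * F * F * F * (2ℚ * D)
        ≡⟨ cong (λ t → t * t * F * F * (2ℚ * D)) (sym aΛ≡F) ⟩
      a * Λ * (a * Λ) * F * F * (2ℚ * D)
        ≡⟨ lemma a Λ F 2ℚ D ⟩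
      2ℚ * (Λ * Λ) * (a * F * (a * F) * D)
        ≤⟨ *-monoʳ (*-nonNeg {2ℚ} (ℚ.<⇒≤ 0<2) (*-nonNeg 0≤Λ 0≤Λ)) (R.Weighted.determinant≤ a 0≤a aΛ≡F) ⟩
      2ℚ * (Λ * Λ) * (M * (c * (F * F))) ^ m ∎
      where
      D = ‖ det m (R.doubly-reduced p) ‖
      lemma : ∀ a L F t D → a * L * (a * L) * F * F * (t * D) ≡ t * (L * L) * (a * F * (a * F) * D)
      lemma = solve-∀ ℚ-ring
    powers-of-F : (M * (c * (F * F))) ^ m ≡ (M * c) ^ m * (F * F ^ suc k * (F * F ^ suc k))
    powers-of-F = trans (cong (_^ m) (sym (ℚ.*-assoc M c (F * F)))) (trans (^-distrib-* (M * c) (F * F) m) (cong ((M * c) ^ m *_) (^-distrib-* F F m)))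
    lemma₁ : ∀ w n F → w * n * (w * n) * (F * F * (F * F)) ≡ w * w * (F * F * F * F * (n * n))
    lemma₁ = solve-∀ ℚ-ring
    lemma₂ : ∀ w t l d F X B P → w * w * (t * (l * (d * (F * X)) * (l * (d * (F * X)))) * (B * (F * P * (F * P))))
           ≡ X * X * (F * F * (F * F)) * (t * (w * w) * (l * l) * B * (d * P * (d * P)))
    lemma₂ = solve-∀ ℚ-ring

-- Gauss' lemma for monic factors

module GaussLemma where
  open import Data.Integer.Base as ℤ using (ℤ; +_; -[1+_]; _+_; _*_)
  import Data.Integer.Properties as ℤ
  open import Data.Integer.Divisibility.Signed using (_∣_; divides; ∣ᵤ⇒∣; ∣⇒∣ᵤ; ∣m∣n⇒∣m+n; ∣n⇒∣m*n; ∣m⇒∣m*n; _∣?_)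
  open import Data.Integer.Tactic.RingSolver using (solve-∀)
  open import Data.List.Base using ([]; _∷_)
  open import Data.Nat.ListAction using (product)
  open import Data.List.Relation.Unary.All using (All; []; _∷_)
  import Data.Nat.Divisibility as ℕ
  open import Data.Nat.Primality using (Prime; euclidsLemma; prime⇒nonTrivial; prime⇒nonZero)
  open import Data.Nat.Primality.Factorisation using (PrimeFactorisation; factorise)
  open import Data.Rational.Base using (↥_; ↧ₙ_)
  import Data.Rational.Base as ℚ
  import Tactic.RingSolver as Ring
  open Rationals
  open Polynomials using (Below; below-tail; convℚ; module Convolution)

  open Convolution _+_ _*_ public using () renaming (conv to convℤ)

  convℤ-suc : ∀ F G k → convℤ F G (suc k) ≡ convℤ F (G ∘ suc) k + F (suc k) * G 0
  convℤ-suc F G zero    = refl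
  convℤ-suc F G (suc k) = trans (cong (λ t → F 0 * G (suc (suc k)) + t) (convℤ-suc (F ∘ suc) G k))
    (sym (ℤ.+-assoc (F 0 * G (suc (suc k))) (convℤ (F ∘ suc) (G ∘ suc) k) (F (suc (suc k)) * G 0)))

  private
    scaleˡ₀ : ∀ a b p → a * p * b ≡ a * b * p
    scaleˡ₀ = solve-∀
    scaleˡ₁ : ∀ a b c p → a * p * b + c * p ≡ (a * b + c) * p
    scaleˡ₁ = solve-∀
    scaleʳ₀ : ∀ a b p → a * (b * p) ≡ a * b * p
    scaleʳ₀ = solve-∀
    scaleʳ₁ : ∀ a b c p → a * (b * p) + c * p ≡ (a * b + c) * p
    scaleʳ₁ = solve-∀

  convℤ-scaleˡ : ∀ F G p k → convℤ (λ i → F i * p) G k ≡ convℤ F G k * p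
  convℤ-scaleˡ F G p zero    = scaleˡ₀ (F 0) (G 0) p
  convℤ-scaleˡ F G p (suc k) = trans (cong (λ t → F 0 * p * G (suc k) + t) (convℤ-scaleˡ (F ∘ suc) G p k)) (scaleˡ₁ (F 0) (G (suc k)) _ p)

  convℤ-scaleʳ : ∀ F G p k → convℤ F (λ i → G i * p) k ≡ convℤ F G k * p
  convℤ-scaleʳ F G p zero    = scaleʳ₀ (F 0) (G 0) p
  convℤ-scaleʳ F G p (suc k) = trans (cong (λ t → F 0 * (G (suc k) * p) + t) (convℤ-scaleʳ (F ∘ suc) G p k)) (scaleʳ₁ (F 0) (G (suc k)) _ p)

  convℤ-cong : ∀ {F F′ G G′ : ℕ → ℤ} → (∀ i → F i ≡ F′ i) → (∀ i → G i ≡ G′ i) → ∀ k → convℤ F G k ≡ convℤ F′ G′ k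
  convℤ-cong e h zero    = cong₂ _*_ (e 0) (h 0)
  convℤ-cong e h (suc k) = cong₂ _+_ (cong₂ _*_ (e 0) (h (suc k))) (convℤ-cong (e ∘ suc) h k)

  ∣-cancel+ : ∀ {p} a b → p ∣ a + b → p ∣ b → p ∣ a
  ∣-cancel+ {p} a b h hb = subst (p ∣_) (lemma a b) (∣m∣n⇒∣m+n h (subst (p ∣_) (ℤ.*-comm b -[1+ 0 ]) (∣m⇒∣m*n -[1+ 0 ] hb)))
    where
    lemma : ∀ a b → a + b + -[1+ 0 ] * b ≡ a
    lemma = solve-∀

  euclidℤ : ∀ {p} → Prime p → ∀ a b → + p ∣ a * b → + p ∣ a ⊎ + p ∣ b
  euclidℤ {p} prm a b h with euclidsLemma ℤ.∣ a ∣ ℤ.∣ b ∣ prm (subst (p ℕ.∣_) (ℤ.abs-* a b) (∣⇒∣ᵤ h))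
  ... | inj₁ pa = inj₁ (∣ᵤ⇒∣ pa)
  ... | inj₂ pb = inj₂ (∣ᵤ⇒∣ pb)

  -- Polynomials modulo `p` have no zero divisors. A constant term divisible by `p` is stripped off
  -- one of the factors; if neither constant term is divisible, their product contradicts the
  -- hypothesis at `k = 0`.
  prime-divides-conv : ∀ {p} → Prime p → ∀ a b (F G : ℕ → ℤ) → Below (+ 0) a F → Below (+ 0) b G →
    (∀ k → + p ∣ convℤ F G k) → (∀ k → + p ∣ F k) ⊎ (∀ k → + p ∣ G k)
  prime-divides-conv prm zero b F G hF hG h = inj₁ λ k → divides (+ 0) (hF k z≤n)
  prime-divides-conv prm (suc a) zero F G hF hG h = inj₂ λ k → divides (+ 0) (hG k z≤n)
  prime-divides-conv {p} prm (suc a) (suc b) F G hF hG h with + p ∣? F 0 | + p ∣? G 0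
  ... | no ¬pF | no ¬pG with euclidℤ prm (F 0) (G 0) (h 0)
  ...   | inj₁ pF = ⊥-elim (¬pF pF)
  ...   | inj₂ pG = ⊥-elim (¬pG pG)
  prime-divides-conv {p} prm (suc a) (suc b) F G hF hG h | yes pF | _
    with prime-divides-conv prm a (suc b) (F ∘ suc) G (below-tail a hF) hG
           (λ k → ∣-cancel+ _ (F 0 * G (suc k)) (subst (+ p ∣_) (ℤ.+-comm (F 0 * G (suc k)) _) (h (suc k))) (∣m⇒∣m*n (G (suc k)) pF))
  ... | inj₁ r = inj₁ λ { zero → pF ; (suc k) → r k }
  ... | inj₂ r = inj₂ r
  prime-divides-conv {p} prm (suc a) (suc b) F G hF hG h | no _ | yes pG
    with prime-divides-conv prm (suc a) b F (G ∘ suc) hF (below-tail b hG)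
           (λ k → ∣-cancel+ _ (F (suc k) * G 0) (subst (+ p ∣_) (convℤ-suc F G k) (h (suc k))) (∣n⇒∣m*n (F (suc k)) pG))
  ... | inj₁ r = inj₁ r
  ... | inj₂ r = inj₂ λ { zero → pG ; (suc k) → r k }

  primeDivisor : ∀ n → 2 ℕ.≤ n → ∃ λ p → Prime p × p ℕ.∣ n
  primeDivisor n 2≤n = go (PrimeFactorisation.factors fac) (PrimeFactorisation.isFactorisation fac) (PrimeFactorisation.factorsPrime fac)
    where
    fac = factorise n {{ℕ.>-nonZero (ℕ.≤-trans (s≤s z≤n) 2≤n)}}
    go : ∀ ps → n ≡ product ps → All Prime ps → ∃ λ p → Prime p × p ℕ.∣ n
    go []       e _        = ⊥-elim (ℕ.<-irrefl (sym e) 2≤n)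
    go (p ∷ ps) e (h ∷ _)  = p , h , ℕ.divides (product ps) (trans e (ℕ.*-comm p (product ps)))

  -- The leading coefficients `D` and `E` can be divided out of all coefficients, leaving monic
  -- integer polynomials.
  Integral : ℕ → ℕ → ℕ → ℕ → (ℕ → ℤ) → (ℕ → ℤ) → Set
  Integral a b D E F G = Σ (ℕ → ℤ) λ F′ → Σ (ℕ → ℤ) λ G′ →
    (F′ a ≡ + 1 × G′ b ≡ + 1) × (∀ k → F k ≡ + D * F′ k) × (∀ k → G k ≡ + E * G′ k)

  private
    move : ∀ q d p → d * q * p ≡ d * p * q
    move = solve-∀

  -- By Euclid, a prime factor of D E divides all of F or all of G, and can be cancelled.
  gauss : ∀ fuel a b D E (F G P : ℕ → ℤ) → 1 ℕ.≤ D → 1 ℕ.≤ E → D ℕ.* E ℕ.≤ fuel → F a ≡ + D → G b ≡ + E →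
    Below (+ 0) (suc a) F → Below (+ 0) (suc b) G → (∀ k → convℤ F G k ≡ + (D ℕ.* E) * P k) → Integral a b D E F G
  gauss zero a b (suc D) (suc E) F G P _ _ () Fa Gb hF hG e
  gauss (suc fuel) a b D E F G P 1≤D 1≤E DE≤ Fa Gb hF hG e with D ℕ.* E ℕ.≟ 1
  ... | yes DE≡1 = F , G , (trans Fa (cong (λ t → + t) D≡1) , trans Gb (cong (λ t → + t) E≡1)) ,
          (λ k → sym (trans (cong (λ d → + d * F k) D≡1) (ℤ.*-identityˡ (F k)))) ,
          (λ k → sym (trans (cong (λ d → + d * G k) E≡1) (ℤ.*-identityˡ (G k))))
    where
    D≡1 = ℕ.m*n≡1⇒m≡1 D E DE≡1
    E≡1 = ℕ.m*n≡1⇒n≡1 D E DE≡1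
  ... | no DE≢1 with primeDivisor (D ℕ.* E) (ℕ.≤∧≢⇒< (ℕ.*-mono-≤ 1≤D 1≤E) (DE≢1 ∘ sym))
  ...   | p , prm , p∣DE with prime-divides-conv prm (suc a) (suc b) F G hF hG
            (λ k → subst (+ p ∣_) (sym (e k)) (∣m⇒∣m*n (P k) (∣ᵤ⇒∣ {+ p} {+ (D ℕ.* E)} p∣DE)))
  ...     | inj₁ pF = finish (∣⇒∣ᵤ (subst (+ p ∣_) Fa (pF a)))
    where
    instance
      p≢0 = prime⇒nonZero prm
    2≤p : 2 ℕ.≤ p
    2≤p = ℕ.nonTrivial⇒n>1 p {{prime⇒nonTrivial prm}}
    Q : ℕ → ℤ
    Q k = _∣_.quotient (pF k)
    FQ : ∀ k → F k ≡ Q k * + p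
    FQ k = _∣_.equality (pF k)
    finish : p ℕ.∣ D → Integral a b D E F G
    finish (ℕ.divides D₁ refl) = let F′ , G′ , tops , eF , eG = recurse in
        F′ , G′ , tops , (λ k → trans (FQ k) (trans (cong (_* + p) (eF k)) (trans (move (F′ k) (+ D₁) (+ p)) (cong (_* F′ k) (sym (ℤ.pos-* D₁ p)))))) , eG
      where
      1≤D₁ : 1 ℕ.≤ D₁
      1≤D₁ = ℕ.n≢0⇒n>0 λ D₁≡0 → ℕ.<-irrefl (sym (cong (ℕ._* p) D₁≡0)) 1≤D
      recurse : Integral a b D₁ E Q G
      recurse = gauss fuel a b D₁ E Q G P 1≤D₁ 1≤E
        (ℕ.≤-pred (ℕ.<-≤-trans (ℕ.*-monoˡ-< E {{ℕ.>-nonZero 1≤E}} (subst (ℕ._< D₁ ℕ.* p) (ℕ.*-identityʳ D₁) (ℕ.*-monoʳ-< D₁ {{ℕ.>-nonZero 1≤D₁}} 2≤p))) DE≤))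
        (ℤ.*-cancelʳ-≡ (Q a) (+ D₁) (+ p) (trans (sym (FQ a)) (trans Fa (ℤ.pos-* D₁ p)))) Gb
        (λ i h → ℤ.*-cancelʳ-≡ (Q i) (+ 0) (+ p) (trans (sym (FQ i)) (hF i h))) hG
        (λ k → ℤ.*-cancelʳ-≡ _ _ (+ p) (trans (sym (convℤ-scaleˡ Q G (+ p) k)) (trans (sym (convℤ-cong FQ (λ _ → refl) k)) (trans (e k)
          (trans (cong (_* P k) (trans (ℤ.pos-* (D₁ ℕ.* p) E) (cong (_* + E) (ℤ.pos-* D₁ p))))
            (trans (regroup (+ D₁) (+ p) (+ E) (P k)) (cong (λ t → t * P k * + p) (sym (ℤ.pos-* D₁ E)))))))))
        where
        regroup : ∀ d p e x → d * p * e * x ≡ d * e * x * p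
        regroup = solve-∀
  ...     | inj₂ pG = finish (∣⇒∣ᵤ (subst (+ p ∣_) Gb (pG b)))
    where
    instance
      p≢0 = prime⇒nonZero prm
    2≤p : 2 ℕ.≤ p
    2≤p = ℕ.nonTrivial⇒n>1 p {{prime⇒nonTrivial prm}}
    Q : ℕ → ℤ
    Q k = _∣_.quotient (pG k)
    GQ : ∀ k → G k ≡ Q k * + p
    GQ k = _∣_.equality (pG k)
    finish : p ℕ.∣ E → Integral a b D E F G
    finish (ℕ.divides E₁ refl) = let F′ , G′ , tops , eF , eG = recurse in
        F′ , G′ , tops , eF , (λ k → trans (GQ k) (trans (cong (_* + p) (eG k)) (trans (move (G′ k) (+ E₁) (+ p)) (cong (_* G′ k) (sym (ℤ.pos-* E₁ p))))))
      where
      1≤E₁ : 1 ℕ.≤ E₁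
      1≤E₁ = ℕ.n≢0⇒n>0 λ E₁≡0 → ℕ.<-irrefl (sym (cong (ℕ._* p) E₁≡0)) 1≤E
      recurse : Integral a b D E₁ F Q
      recurse = gauss fuel a b D E₁ F Q P 1≤D 1≤E₁
        (ℕ.≤-pred (ℕ.<-≤-trans (ℕ.*-monoʳ-< D {{ℕ.>-nonZero 1≤D}} (subst (ℕ._< E₁ ℕ.* p) (ℕ.*-identityʳ E₁) (ℕ.*-monoʳ-< E₁ {{ℕ.>-nonZero 1≤E₁}} 2≤p))) DE≤))
        Fa (ℤ.*-cancelʳ-≡ (Q b) (+ E₁) (+ p) (trans (sym (GQ b)) (trans Gb (ℤ.pos-* E₁ p))))
        hF (λ i h → ℤ.*-cancelʳ-≡ (Q i) (+ 0) (+ p) (trans (sym (GQ i)) (hG i h)))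
        (λ k → ℤ.*-cancelʳ-≡ _ _ (+ p) (trans (sym (convℤ-scaleʳ F Q (+ p) k)) (trans (sym (convℤ-cong {G = G} (λ _ → refl) GQ k)) (trans (e k)
          (trans (cong (_* P k) (trans (ℤ.pos-* D (E₁ ℕ.* p)) (cong (+ D *_) (ℤ.pos-* E₁ p))))
            (trans (regroup (+ D) (+ p) (+ E₁) (P k)) (cong (λ t → t * P k * + p) (sym (ℤ.pos-* D E₁)))))))))
        where
        regroup : ∀ d p e x → d * (e * p) * x ≡ d * e * x * p
        regroup = solve-∀

  fromℤ-conv : ∀ F G k → fromℤ (convℤ F G k) ≡ convℚ (fromℤ ∘ F) (fromℤ ∘ G) k
  fromℤ-conv F G zero    = fromℤ-* (F 0) (G 0)
  fromℤ-conv F G (suc k) = trans (fromℤ-+ (F 0 * G (suc k)) _) (cong₂ ℚ._+_ (fromℤ-* (F 0) (G (suc k))) (fromℤ-conv (F ∘ suc) G k))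

  clear-denominators : ∀ n f → Below 0ℚ n f → ∃ λ D → 1 ℕ.≤ D × ∀ k → ∃ λ z → fromℤ z ≡ fromℕ D ℚ.* f k
  clear-denominators zero f h = 1 , s≤s z≤n , λ k → + 0 , trans (sym (ℚ.*-zeroʳ 1ℚ)) (cong (1ℚ ℚ.*_) (sym (h k z≤n)))
  clear-denominators (suc n) f h = let D , 1≤D , zs = clear-denominators n (f ∘ suc) (below-tail n h) in
      ↧ₙ f 0 ℕ.* D , ℕ.*-mono-≤ (1≤denominator (f 0)) 1≤D , λ
        { zero    → ↥ f 0 * + D , trans (fromℤ-* (↥ f 0) (+ D)) (trans (cong (ℚ._* fromℕ D) (sym (numerator/denominator (f 0))))
                      (trans (lemma (f 0) (fromℕ (↧ₙ f 0)) (fromℕ D)) (cong (ℚ._* f 0) (sym (fromℕ-* (↧ₙ f 0) D)))))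
        ; (suc k) → + ↧ₙ f 0 * proj₁ (zs k) , trans (fromℤ-* (+ ↧ₙ f 0) (proj₁ (zs k))) (trans (cong (fromℕ (↧ₙ f 0) ℚ.*_) (proj₂ (zs k)))
                      (trans (sym (ℚ.*-assoc (fromℕ (↧ₙ f 0)) (fromℕ D) (f (suc k)))) (cong (ℚ._* f (suc k)) (sym (fromℕ-* (↧ₙ f 0) D))))) }
    where
    lemma : ∀ a b c → a ℚ.* b ℚ.* c ≡ b ℚ.* c ℚ.* a
    lemma = Ring.solve-∀ ℚ-ring

  convℚ-scale : ∀ a b f h k → convℚ (λ i → a ℚ.* f i) (λ i → b ℚ.* h i) k ≡ a ℚ.* b ℚ.* convℚ f h k
  convℚ-scale a b f h zero    = lemma a b (f 0) (h 0)
    where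
    lemma : ∀ a b c d → a ℚ.* c ℚ.* (b ℚ.* d) ≡ a ℚ.* b ℚ.* (c ℚ.* d)
    lemma = Ring.solve-∀ ℚ-ring
  convℚ-scale a b f h (suc k) = trans (cong (a ℚ.* f 0 ℚ.* (b ℚ.* h (suc k)) ℚ.+_) (convℚ-scale a b (f ∘ suc) h k)) (lemma a b (f 0) (h (suc k)) _)
    where
    lemma : ∀ a b c d e → a ℚ.* c ℚ.* (b ℚ.* d) ℚ.+ a ℚ.* b ℚ.* e ≡ a ℚ.* b ℚ.* (c ℚ.* d ℚ.+ e)
    lemma = Ring.solve-∀ ℚ-ring

  convℚ-cong : ∀ {F F′ G G′ : ℕ → ℚ} → (∀ i → F i ≡ F′ i) → (∀ i → G i ≡ G′ i) → ∀ k → convℚ F G k ≡ convℚ F′ G′ k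
  convℚ-cong e h zero    = cong₂ ℚ._*_ (e 0) (h 0)
  convℚ-cong e h (suc k) = cong₂ ℚ._+_ (cong₂ ℚ._*_ (e 0) (h (suc k))) (convℚ-cong (e ∘ suc) h k)

  monic-factors-integral : ∀ a b f h (P : ℕ → ℤ) → f a ≡ 1ℚ → h b ≡ 1ℚ → Below 0ℚ (suc a) f → Below 0ℚ (suc b) h →
    (∀ k → fromℤ (P k) ≡ convℚ f h k) →
    Σ (ℕ → ℤ) λ F → Σ (ℕ → ℤ) λ G → (∀ k → f k ≡ fromℤ (F k)) × (∀ k → h k ≡ fromℤ (G k))
  monic-factors-integral a b f h P fa hb hf hh e =
    let F′ , G′ , _ , eF , eG = gauss (D ℕ.* E) a b D E F G P 1≤D 1≤E ℕ.≤-refl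
          (top {D} fa (F-eq a)) (top {E} hb (G-eq b)) (below {D = D} hf F-eq) (below {D = E} hh G-eq) product-eq
    in F′ , G′ , (λ k → recover-f D 1≤D (F k) (F′ k) (f k) (F-eq k) (eF k)) , (λ k → recover-f E 1≤E (G k) (G′ k) (h k) (G-eq k) (eG k))
    where
    cf = clear-denominators (suc a) f hf
    ch = clear-denominators (suc b) h hh
    D = proj₁ cf
    E = proj₁ ch
    1≤D = proj₁ (proj₂ cf)
    1≤E = proj₁ (proj₂ ch)
    F G : ℕ → ℤ
    F k = proj₁ (proj₂ (proj₂ cf) k)
    G k = proj₁ (proj₂ (proj₂ ch) k)
    F-eq : ∀ k → fromℤ (F k) ≡ fromℕ D ℚ.* f k
    F-eq k = proj₂ (proj₂ (proj₂ cf) k)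
    G-eq : ∀ k → fromℤ (G k) ≡ fromℕ E ℚ.* h k
    G-eq k = proj₂ (proj₂ (proj₂ ch) k)
    top : ∀ {D z q} → q ≡ 1ℚ → fromℤ z ≡ fromℕ D ℚ.* q → z ≡ + D
    top {D} {z} refl e = fromℤ-injective {z} {+ D} (trans e (ℚ.*-identityʳ (fromℕ D)))
    below : ∀ {n D f} {F : ℕ → ℤ} → Below 0ℚ n f → (∀ k → fromℤ (F k) ≡ fromℕ D ℚ.* f k) → Below (+ 0) n F
    below {D = D} {F = F} h e i n≤i = fromℤ-injective {F i} {+ 0} (trans (e i) (trans (cong (fromℕ D ℚ.*_) (h i n≤i)) (ℚ.*-zeroʳ (fromℕ D))))
    recover-f : ∀ D → 1 ℕ.≤ D → ∀ z z′ q → fromℤ z ≡ fromℕ D ℚ.* q → z ≡ + D * z′ → q ≡ fromℤ z′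
    recover-f D 1≤D z z′ q e e′ = cancel (fromℕ D) q (fromℤ z′) (fromℕ-mono< {0} {D} 1≤D) (trans (sym e) (trans (cong fromℤ e′) (fromℤ-* (+ D) z′)))
      where
      cancel : ∀ d x y → 0ℚ ℚ.< d → d ℚ.* x ≡ d ℚ.* y → x ≡ y
      cancel d x y 0<d e = ℚ.≤-antisym (*-cancel≤ʳ 0<d (ℚ.≤-reflexive e)) (*-cancel≤ʳ 0<d (ℚ.≤-reflexive (sym e)))
    product-eq : ∀ k → convℤ F G k ≡ + (D ℕ.* E) * P k
    product-eq k = fromℤ-injective {convℤ F G k} {+ (D ℕ.* E) * P k} (begin
      fromℤ (convℤ F G k)  ≡⟨ fromℤ-conv F G k ⟩
      convℚ (fromℤ ∘ F) (fromℤ ∘ G) k  ≡⟨ convℚ-cong F-eq G-eq k ⟩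
      convℚ (λ i → fromℕ D ℚ.* f i) (λ i → fromℕ E ℚ.* h i) k  ≡⟨ convℚ-scale (fromℕ D) (fromℕ E) f h k ⟩
      fromℕ D ℚ.* fromℕ E ℚ.* convℚ f h k  ≡⟨ cong₂ ℚ._*_ (sym (fromℕ-* D E)) (sym (e k)) ⟩
      fromℕ (D ℕ.* E) ℚ.* fromℤ (P k)  ≡⟨ sym (fromℤ-* (+ (D ℕ.* E)) (P k)) ⟩
      fromℤ (+ (D ℕ.* E) * P k)  ∎)
      where open ≡-Reasoning

-- Gelfond's inequality for the heights of factors

module Gelfond where
  open import Data.List.Base using ([]; _∷_; filter; length; upTo)
  open import Data.List.Properties using (length-upTo)
  open import Data.List.Relation.Unary.All as All using (All; []; _∷_)
  import Data.List.Relation.Unary.All.Properties as All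
  open import Data.List.Relation.Unary.AllPairs using ([]; _∷_)
  open import Data.List.Relation.Unary.Unique.Propositional using (Unique)
  import Data.List.Relation.Unary.Unique.Propositional.Properties as Unique
  import Data.Integer.Base as ℤ
  import Data.Integer.Properties as ℤ
  open import Data.Rational.Base using (_+_; _*_; _-_; -_; ∣_∣; _≤_; _<_)
  open import Relation.Nullary.Decidable using (¬?)
  open import Relation.Unary using (Decidable)
  open import Tactic.RingSolver using (solve-∀)
  open Rationals
  open Gaussian
  open Polynomials
  open Bounds

  -- coefficients of (p(x) − p(c)) / (x − c)
  quotient : ℕ → (ℕ → 𝔾) → 𝔾 → ℕ → 𝔾
  quotient zero    p c i       = 0ᵍ
  quotient (suc n) p c zero    = eval n (p ∘ suc) c
  quotient (suc n) p c (suc i) = quotient n (p ∘ suc) c i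

  eval-quotient : ∀ n p c x → eval (suc n) p x -ᵍ eval (suc n) p c ≡ (x -ᵍ c) *ᵍ eval n (quotient (suc n) p c) x
  eval-quotient zero p c x = lemma (p 0) c x
    where
    lemma : ∀ p c x → p +ᵍ x *ᵍ 0ᵍ -ᵍ (p +ᵍ c *ᵍ 0ᵍ) ≡ (x -ᵍ c) *ᵍ 0ᵍ
    lemma = solve-∀ 𝔾-ring
  eval-quotient (suc n) p c x = trans (lemma (p 0) c x _ _)
    (trans (cong (λ t → (x -ᵍ c) *ᵍ eval (suc n) (p ∘ suc) c +ᵍ x *ᵍ t) (eval-quotient n (p ∘ suc) c x)) (lemma₂ c x _ _))
    where
    lemma : ∀ p c x u v → p +ᵍ x *ᵍ u -ᵍ (p +ᵍ c *ᵍ v) ≡ (x -ᵍ c) *ᵍ v +ᵍ x *ᵍ (u -ᵍ v)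
    lemma = solve-∀ 𝔾-ring
    lemma₂ : ∀ c x v w → (x -ᵍ c) *ᵍ v +ᵍ x *ᵍ ((x -ᵍ c) *ᵍ w) ≡ (x -ᵍ c) *ᵍ (v +ᵍ x *ᵍ w)
    lemma₂ = solve-∀ 𝔾-ring

  quotient-head : ∀ n p c → p 0 ≡ eval (suc n) p c -ᵍ c *ᵍ quotient (suc n) p c 0
  quotient-head n p c = lemma (p 0) c _
    where
    lemma : ∀ p c v → p ≡ p +ᵍ c *ᵍ v -ᵍ c *ᵍ v
    lemma = solve-∀ 𝔾-ring

  quotient-step : ∀ n p c i → i ℕ.< n → p (suc i) ≡ quotient (suc n) p c i -ᵍ c *ᵍ quotient (suc n) p c (suc i)
  quotient-step (suc n) p c zero    _         = quotient-head n (p ∘ suc) c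
  quotient-step (suc n) p c (suc i) (s≤s i<n) = quotient-step n (p ∘ suc) c i i<n

  quotient-top : ∀ n p c → quotient (suc n) p c n ≡ 0ᵍ
  quotient-top zero    p c = refl
  quotient-top (suc n) p c = quotient-top n (p ∘ suc) c

  point : ℕ → 𝔾
  point x = real (fromℕ x)

  point-norm : ∀ x → ‖ point x ‖ ≡ fromℕ x
  point-norm x = trans (‖real‖ (fromℕ x)) (ℚ.0≤p⇒∣p∣≡p (fromℕ-nonNeg x))

  distinct-points : ∀ x c w → c ≢ x → ‖ w ‖ ≤ ‖ (point x -ᵍ point c) *ᵍ w ‖
  distinct-points x c w c≢x = begin
    ‖ w ‖  ≤⟨ ≤-*ˡ (‖‖-nonNeg w) (1≤fromℕ {ℤ.∣ z ∣} (ℕ.n≢0⇒n>0 λ e → c≢x (ℤ.+-injective (sym (ℤ.i-j≡0⇒i≡j (ℤ.+ x) (ℤ.+ c) (ℤ.∣i∣≡0⇒i≡0 {z} e)))))) ⟩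
    fromℕ ℤ.∣ z ∣ * ‖ w ‖  ≡⟨ cong (_* ‖ w ‖) (sym (∣fromℤ∣ z)) ⟩
    ∣ fromℤ z ∣ * ‖ w ‖  ≡⟨ sym (‖real*‖ (fromℤ z) w) ⟩
    ‖ real (fromℤ z) *ᵍ w ‖  ≡⟨ cong (λ t → ‖ real t *ᵍ w ‖) (trans (fromℤ-+ (ℤ.+ x) (ℤ.- ℤ.+ c)) (cong (fromℕ x +_) (fromℤ-neg (ℤ.+ c)))) ⟩
    ‖ (point x -ᵍ point c) *ᵍ w ‖  ∎
    where
    open ℚ.≤-Reasoning
    z = ℤ.+ x ℤ.- ℤ.+ c

  interpolationConstant : ℕ → ℕ → ℚ
  interpolationConstant zero    d = 0ℚ
  interpolationConstant (suc n) d = 1ℚ + (1ℚ + fromℕ d) * (interpolationConstant n d * 2ℚ)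

  interpolationConstant-nonNeg : ∀ n d → 0ℚ ≤ interpolationConstant n d
  interpolationConstant-nonNeg zero    d = ℚ.≤-refl
  interpolationConstant-nonNeg (suc n) d = +-nonNeg 0≤1 (*-nonNeg (+-nonNeg 0≤1 (fromℕ-nonNeg d))
    (*-nonNeg {interpolationConstant n d} {2ℚ} (interpolationConstant-nonNeg n d) (ℚ.<⇒≤ 0<2)))

  -- Induction through the quotient `q` by `x − c`. At the remaining points `q` is at most `2 M`,
  -- because distinct integers differ by at least 1; then `p = p(c) + (x − c) q` gives back the
  -- coefficients, with `c ≤ d`.
  interpolation : ∀ n p xs d M → 0ℚ ≤ M → Unique xs → All (ℕ._≤ d) xs → n ℕ.≤ length xs →
    All (λ x → ‖ eval n p (point x) ‖ ≤ M) xs → ∀ i → i ℕ.< n → ‖ p i ‖ ≤ interpolationConstant n d * M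
  interpolation (suc n) p (c ∷ xs) d M 0≤M (c∉xs ∷ unique) (c≤d ∷ xs≤d) (s≤s n≤) (pc≤M ∷ pxs≤M) = bound
    where
    open ℚ.≤-Reasoning
    q = quotient (suc n) p (point c)
    K = interpolationConstant n d
    D = fromℕ d
    0≤D : 0ℚ ≤ D
    0≤D = fromℕ-nonNeg d
    0≤K = interpolationConstant-nonNeg n d
    0≤2M : 0ℚ ≤ 2ℚ * M
    0≤2M = *-nonNeg {2ℚ} (ℚ.<⇒≤ 0<2) 0≤M
    0≤K2M = *-nonNeg 0≤K 0≤2M
    q-values : ∀ {xs} → All (c ≢_) xs → All (λ x → ‖ eval (suc n) p (point x) ‖ ≤ M) xs → All (λ x → ‖ eval n q (point x) ‖ ≤ 2ℚ * M) xs
    q-values [] [] = []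
    q-values (_∷_ {x} c≢x cs) (px≤M ∷ ps) = (begin
      ‖ eval n q (point x) ‖  ≤⟨ distinct-points x c _ c≢x ⟩
      ‖ (point x -ᵍ point c) *ᵍ eval n q (point x) ‖  ≡⟨ cong ‖_‖ (sym (eval-quotient n p (point c) (point x))) ⟩
      ‖ eval (suc n) p (point x) -ᵍ eval (suc n) p (point c) ‖  ≤⟨ ‖-‖ _ _ ⟩
      ‖ eval (suc n) p (point x) ‖ + ‖ eval (suc n) p (point c) ‖  ≤⟨ ℚ.+-mono-≤ px≤M pc≤M ⟩
      M + M  ≡⟨ double M ⟩
      2ℚ * M  ∎) ∷ q-values cs ps
      where
      double : ∀ a → a + a ≡ (1ℚ + 1ℚ) * a
      double = solve-∀ ℚ-ring
    q≤ : ∀ i → i ℕ.≤ n → ‖ q i ‖ ≤ K * (2ℚ * M)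
    q≤ i i≤n with ℕ.m≤n⇒m<n∨m≡n i≤n
    ... | inj₁ i<n  = interpolation n q xs d (2ℚ * M) 0≤2M unique xs≤d n≤ (q-values c∉xs pxs≤M) i i<n
    ... | inj₂ refl = ≤-zero (quotient-top i p (point c)) 0≤K2M
    cq≤ : ∀ i → i ℕ.≤ n → ‖ point c *ᵍ q i ‖ ≤ D * (K * (2ℚ * M))
    cq≤ i i≤n = ℚ.≤-trans (‖*‖ (point c) (q i)) (*-mono (‖‖-nonNeg (q i)) 0≤D (ℚ.≤-trans (ℚ.≤-reflexive (point-norm c)) (fromℕ-mono c≤d)) (q≤ i i≤n))
    lemma : ∀ D K M → M + (1ℚ + D) * (K * ((1ℚ + 1ℚ) * M)) ≡ (1ℚ + (1ℚ + D) * (K * (1ℚ + 1ℚ))) * M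
    lemma = solve-∀ ℚ-ring
    one+ : ∀ D t → t + D * t ≡ (1ℚ + D) * t
    one+ = solve-∀ ℚ-ring
    bound : ∀ i → i ℕ.< suc n → ‖ p i ‖ ≤ interpolationConstant (suc n) d * M
    bound zero _ = begin
      ‖ p 0 ‖  ≡⟨ cong ‖_‖ (quotient-head n p (point c)) ⟩
      ‖ eval (suc n) p (point c) -ᵍ point c *ᵍ q 0 ‖  ≤⟨ ℚ.≤-trans (‖-‖ _ _) (ℚ.+-mono-≤ pc≤M (cq≤ 0 z≤n)) ⟩
      M + D * (K * (2ℚ * M))  ≤⟨ ℚ.+-monoʳ-≤ M (*-monoˡ 0≤K2M (≤-+ˡ {D} {1ℚ} 0≤1)) ⟩
      M + (1ℚ + D) * (K * (2ℚ * M))  ≡⟨ lemma D K M ⟩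
      interpolationConstant (suc n) d * M  ∎
    bound (suc i) (s≤s i<n) = begin
      ‖ p (suc i) ‖  ≡⟨ cong ‖_‖ (quotient-step n p (point c) i i<n) ⟩
      ‖ q i -ᵍ point c *ᵍ q (suc i) ‖  ≤⟨ ℚ.≤-trans (‖-‖ _ _) (ℚ.+-mono-≤ (q≤ i (ℕ.<⇒≤ i<n)) (cq≤ (suc i) i<n)) ⟩
      K * (2ℚ * M) + D * (K * (2ℚ * M))  ≡⟨ one+ D (K * (2ℚ * M)) ⟩
      (1ℚ + D) * (K * (2ℚ * M))  ≤⟨ ≤-+ˡ 0≤M ⟩
      M + (1ℚ + D) * (K * (2ℚ * M))  ≡⟨ lemma D K M ⟩
      interpolationConstant (suc n) d * M  ∎

  -- That the maximiser belongs to the list is expressed by its inheriting every property shared by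
  -- all elements.
  argmax : (v : ℕ → ℚ) → ∀ xs → 1 ℕ.≤ length xs → ∃ λ x → (∀ {P : ℕ → Set} → All P xs → P x) × All (λ y → v y ≤ v x) xs
  argmax v (x ∷ []) _ = x , (λ { (px ∷ _) → px }) , ℚ.≤-refl ∷ []
  argmax v (x ∷ xs@(_ ∷ _)) _ with argmax v xs (s≤s z≤n)
  ... | y , member , max with ℚ.≤-total (v x) (v y)
  ...   | inj₁ vx≤vy = y , (λ { (_ ∷ ps) → member ps }) , vx≤vy ∷ max
  ...   | inj₂ vy≤vx = x , (λ { (px ∷ _) → px }) , ℚ.≤-refl ∷ All.map (λ h → ℚ.≤-trans h vy≤vx) max

  large-value : ∀ n p xs d i → i ℕ.< n → Unique xs → All (ℕ._≤ d) xs → n ℕ.≤ length xs →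
    ∃ λ x → (∀ {P : ℕ → Set} → All P xs → P x) × ‖ p i ‖ ≤ interpolationConstant n d * ‖ eval n p (point x) ‖
  large-value n p xs d i i<n unique xs≤d n≤ with argmax (λ x → ‖ eval n p (point x) ‖) xs (ℕ.≤-trans (ℕ.≤-trans (s≤s z≤n) i<n) n≤)
  ... | x , member , max = x , member , interpolation n p xs d _ (‖‖-nonNeg (eval n p (point x))) unique xs≤d n≤ max i i<n

  filter-length : ∀ {P : ℕ → Set} (P? : Decidable P) xs → length (filter P? xs) ℕ.+ length (filter (λ x → ¬? (P? x)) xs) ≡ length xs
  filter-length P? [] = refl
  filter-length P? (x ∷ xs) with P? x
  ... | yes _ = cong suc (filter-length P? xs)
  ... | no  _ = trans (ℕ.+-suc _ _) (cong suc (filter-length P? xs))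

  gelfondConstant : ℕ → ℕ → ℚ
  gelfondConstant a b = interpolationConstant (suc a) (a ℕ.+ b) * interpolationConstant (suc b) (a ℕ.+ b) *
    (2ℚ * (fromℕ (suc a ℕ.+ suc b) * fromℕ (suc (a ℕ.+ b)) ^ (suc a ℕ.+ suc b)))

  -- Pigeonhole on the points `0, …, a + b`. By interpolation `p` cannot be small, relative to
  -- `p i`, at `a + 1` of them; so it is large at `b + 1` points, and at one of these `q` is large
  -- relative to `q j`. There the product of the values is a value of `r`, which is `O(H)`.
  gelfond : ∀ a b (p q r : ℕ → 𝔾) i j H → i ℕ.< suc a → j ℕ.< suc b → 0ℚ ≤ H → (∀ k → ‖ r k ‖ ≤ H) →
    (∀ x → eval (suc a ℕ.+ suc b) r x ≡ eval (suc a) p x *ᵍ eval (suc b) q x) →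
    ‖ p i ‖ * ‖ q j ‖ ≤ gelfondConstant a b * H
  gelfond a b p q r i j H i<a j<b 0≤H r≤H product = conclude (choose (suc a ℕ.≤? length small))
    where
    d = a ℕ.+ b
    Large : ℕ → Set
    Large x = ‖ p i ‖ ≤ interpolationConstant (suc a) d * ‖ eval (suc a) p (point x) ‖
    large? : Decidable Large
    large? x = _ ℚ.≤? _
    points = upTo (suc d)
    unique : Unique points
    unique = Unique.upTo⁺ (suc d)
    points≤d : All (ℕ._≤ d) points
    points≤d = All.map ℕ.≤-pred (All.all-upTo (suc d))
    Both : Set
    Both = ∃ λ x → x ℕ.≤ d × Large x × ‖ q j ‖ ≤ interpolationConstant (suc b) d * ‖ eval (suc b) q (point x) ‖
    small = filter (λ x → ¬? (large? x)) points
    big = filter large? points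
    enough : ¬ suc a ℕ.≤ length small → suc b ℕ.≤ length big
    enough few = ℕ.+-cancelˡ-≤ a (suc b) _ (begin
      a ℕ.+ suc b  ≡⟨ ℕ.+-suc a b ⟩
      suc d  ≡⟨ sym (length-upTo (suc d)) ⟩
      length points  ≡⟨ sym (filter-length large? points) ⟩
      length big ℕ.+ length small  ≤⟨ ℕ.+-monoʳ-≤ (length big) (ℕ.≤-pred (ℕ.≰⇒> few)) ⟩
      length big ℕ.+ a  ≡⟨ ℕ.+-comm _ a ⟩
      a ℕ.+ length big  ∎)
      where open ℕ.≤-Reasoning
    choose : Dec (suc a ℕ.≤ length small) → Both
    choose (yes many) =
      let x , member , large = large-value (suc a) p small d i i<a (Unique.filter⁺ (λ x → ¬? (large? x)) unique)
                                 (All.filter⁺ (λ x → ¬? (large? x)) points≤d) many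
      in ⊥-elim (member (All.all-filter (λ x → ¬? (large? x)) points) large)
    choose (no few) =
      let x , member , large = large-value (suc b) q big d j j<b (Unique.filter⁺ large? unique)
                                 (All.filter⁺ large? points≤d) (enough few)
      in x , member (All.filter⁺ large? points≤d) , member (All.all-filter large? points) , large
    L = suc a ℕ.+ suc b
    A = interpolationConstant (suc a) (a ℕ.+ b)
    B = interpolationConstant (suc b) (a ℕ.+ b)
    0≤A = interpolationConstant-nonNeg (suc a) (a ℕ.+ b)
    0≤B = interpolationConstant-nonNeg (suc b) (a ℕ.+ b)
    lemma : ∀ a p b q → a * p * (b * q) ≡ a * b * (p * q)
    lemma = solve-∀ ℚ-ring
    lemma₂ : ∀ c t l H X → c * (t * (l * (H * X))) ≡ c * (t * (l * X)) * H
    lemma₂ = solve-∀ ℚ-ring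
    conclude : Both → ‖ p i ‖ * ‖ q j ‖ ≤ gelfondConstant a b * H
    conclude (x , x≤d , p-large , q-large) = begin
      ‖ p i ‖ * ‖ q j ‖
        ≤⟨ *-mono (‖‖-nonNeg (q j)) (*-nonNeg 0≤A (‖‖-nonNeg P)) p-large q-large ⟩
      A * ‖ P ‖ * (B * ‖ Q ‖)
        ≡⟨ lemma A (‖ P ‖) B (‖ Q ‖) ⟩
      A * B * (‖ P ‖ * ‖ Q ‖)
        ≤⟨ *-monoʳ (*-nonNeg 0≤A 0≤B) (ℚ.≤-trans (‖*‖-lower P Q) (*-monoʳ {c = 2ℚ} (ℚ.<⇒≤ 0<2) (ℚ.≤-trans (ℚ.≤-reflexive (cong ‖_‖ (sym (product (point x)))))
             (eval-bound L L (ℕ.n≤1+n L) 0≤H (1≤fromℕ {suc (a ℕ.+ b)} (s≤s z≤n)) r≤H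
               (ℚ.≤-trans (ℚ.≤-reflexive (point-norm x)) (fromℕ-mono (ℕ.m≤n⇒m≤1+n x≤d))))))) ⟩
      A * B * (2ℚ * (fromℕ L * (H * fromℕ (suc (a ℕ.+ b)) ^ L)))
        ≡⟨ lemma₂ (A * B) 2ℚ (fromℕ L) H _ ⟩
      gelfondConstant a b * H ∎
      where
      open ℚ.≤-Reasoning
      P = eval (suc a) p (point x)
      Q = eval (suc b) q (point x)

-- A vanishing determinant yields a linear dependence

module LinearDependence where
  open import Data.Bool.Base using (Bool; true; false)
  open import Data.Vec.Base using (Vec; []; _∷_; replicate)
  open import Tactic.RingSolver using (solve-∀)
  open Gaussian
  open ExteriorAlgebra

  Dependent : ℕ → ℕ → (ℕ → ℕ → 𝔾) → Set
  Dependent n k rows = Σ (ℕ → 𝔾) λ u → (∃ λ j → j ℕ.< k × u j ≢ 0ᵍ) ×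
    (∀ i → i ℕ.< n → sumᵍ k (λ j → u j *ᵍ rows j i) ≡ 0ᵍ)

  _≟ᵍ_ : (z w : 𝔾) → Dec (z ≡ w)
  (a ⊹ b) ≟ᵍ (c ⊹ d) with a ℚ.≟ c | b ℚ.≟ d
  ... | yes p | yes q = yes (cong₂ _⊹_ p q)
  ... | no ¬p | _     = no λ e → ¬p (cong Re e)
  ... | _     | no ¬q = no λ e → ¬q (cong Im e)

  1ᵍ≢0ᵍ : 1ᵍ ≢ 0ᵍ
  1ᵍ≢0ᵍ e with cong Re e
  ... | ()

  private
    one* : ∀ t → t ≡ 1ᵍ *ᵍ t
    one* = solve-∀ 𝔾-ring
    swap : ∀ a b x → a *ᵍ b *ᵍ x ≡ b *ᵍ (a *ᵍ x)
    swap = solve-∀ 𝔾-ring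
    *zero : ∀ t → t *ᵍ 0ᵍ ≡ 0ᵍ
    *zero = solve-∀ 𝔾-ring
    cancel : ∀ a x b → a *ᵍ b ≡ 1ᵍ → a *ᵍ x ≡ 0ᵍ → x ≡ 0ᵍ
    cancel a x b ab≡1 e = begin
      x  ≡⟨ one* x ⟩
      1ᵍ *ᵍ x  ≡⟨ cong (_*ᵍ x) (sym ab≡1) ⟩
      a *ᵍ b *ᵍ x  ≡⟨ swap a b x ⟩
      b *ᵍ (a *ᵍ x)  ≡⟨ cong (b *ᵍ_) e ⟩
      b *ᵍ 0ᵍ  ≡⟨ *zero b ⟩
      0ᵍ  ∎
      where open ≡-Reasoning

  cancelˡ : ∀ a x → a ≢ 0ᵍ → a *ᵍ x ≡ 0ᵍ → x ≡ 0ᵍ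
  cancelˡ a x a≢0 = let b , ab≡1 = invᵍ a a≢0 in cancel a x b ab≡1

  findPivot : ∀ k (f : ℕ → 𝔾) → (∀ j → j ℕ.< k → f j ≡ 0ᵍ) ⊎ (∃ λ p → p ℕ.< k × f p ≢ 0ᵍ)
  findPivot zero    f = inj₁ λ _ ()
  findPivot (suc k) f with f 0 ≟ᵍ 0ᵍ | findPivot k (f ∘ suc)
  ... | no f0≢0  | _                    = inj₂ (0 , s≤s z≤n , f0≢0)
  ... | yes _    | inj₂ (p , p<k , fp)  = inj₂ (suc p , s≤s p<k , fp)
  ... | yes f0≡0 | inj₁ h               = inj₁ λ { zero _ → f0≡0 ; (suc j) (s≤s j<k) → h j j<k }

  -- Row `p` is brought to the front as a pivot, the others keeping their order; these are `p`
  -- transpositions, whence the sign `-1ᵍ ^ᵍ p` of the product. The coefficients of a relation are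
  -- carried the other way by `back`.
  front : {A : Set} → ℕ → (ℕ → A) → ℕ → A
  front zero    f j             = f j
  front (suc p) f zero          = front p (f ∘ suc) 0
  front (suc p) f (suc zero)    = f 0
  front (suc p) f (suc (suc j)) = front p (f ∘ suc) (suc j)

  front-0 : {A : Set} → ∀ p (f : ℕ → A) → front p f 0 ≡ f p
  front-0 zero    f = refl
  front-0 (suc p) f = front-0 p (f ∘ suc)

  wedges-front : ∀ n k p rows → p ℕ.< k → (∀ π → wedges n k rows π ≡ 0ᵍ) →
    ∀ π → wedges n k (front p rows) π ≡ 0ᵍ
  wedges-front n k p rows p<k h π = trans (sign n k p rows p<k π) (trans (cong (-1ᵍ ^ᵍ p *ᵍ_) (h π)) (*zero _))
    where
    pad : ∀ a x → a *ᵍ x ≡ a *ᵍ x +ᵍ 0ᵍ *ᵍ x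
    pad = solve-∀ 𝔾-ring
    assoc : ∀ a b c → a *ᵍ (b *ᵍ c) ≡ a *ᵍ b *ᵍ c
    assoc = solve-∀ 𝔾-ring
    sign : ∀ n k p rows → p ℕ.< k → ∀ π → wedges n k (front p rows) π ≡ -1ᵍ ^ᵍ p *ᵍ wedges n k rows π
    sign n k zero rows p<k π = one* _
    sign n (suc (suc k)) (suc p) rows (s≤s p<k) π =
      trans (wedge-anticomm n (front p (rows ∘ suc) 0) (rows 0) _ π)
        (trans (cong (-1ᵍ *ᵍ_)
          (trans (wedge-cong n (λ _ → refl)
                   (λ σ → trans (sign n (suc k) p (rows ∘ suc) p<k σ) (pad (-1ᵍ ^ᵍ p) _)) π)
            (trans (wedge-linearʳ n (rows 0) (-1ᵍ ^ᵍ p) 0ᵍ _ _ π) (sym (pad (-1ᵍ ^ᵍ p) _)))))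
          (assoc -1ᵍ (-1ᵍ ^ᵍ p) _))
    sign n (suc zero) (suc p) rows (s≤s ()) π

  skip : {A : Set} → (ℕ → A) → ℕ → A
  skip u zero    = u 0
  skip u (suc j) = u (suc (suc j))

  back : {A : Set} → ℕ → (ℕ → A) → ℕ → A
  back zero    u j       = u j
  back (suc p) u zero    = u 1
  back (suc p) u (suc j) = back p (skip u) j

  sumᵍ-back : ∀ k p (u f : ℕ → 𝔾) → p ℕ.< k →
    sumᵍ k (λ j → back p u j *ᵍ f j) ≡ sumᵍ k (λ j → u j *ᵍ front p f j)
  sumᵍ-back k zero u f p<k = refl
  sumᵍ-back (suc zero) (suc p) u f (s≤s ())
  sumᵍ-back (suc (suc k)) (suc p) u f (s≤s p<k) =
    trans (cong (u 1 *ᵍ f 0 +ᵍ_) (sumᵍ-back (suc k) p (skip u) (f ∘ suc) p<k)) (lemma _ _ _)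
    where
    lemma : ∀ a b c → a +ᵍ (b +ᵍ c) ≡ b +ᵍ (a +ᵍ c)
    lemma = solve-∀ 𝔾-ring

  back-nonzero : ∀ k p (u : ℕ → 𝔾) → p ℕ.< k → (∃ λ j → j ℕ.< k × u j ≢ 0ᵍ) → ∃ λ j → j ℕ.< k × back p u j ≢ 0ᵍ
  back-nonzero k zero u p<k h = h
  back-nonzero (suc zero) (suc p) u (s≤s ())
  back-nonzero (suc (suc k)) (suc p) u (s≤s p<k) (suc zero , _ , u≢0) = 0 , s≤s z≤n , u≢0
  back-nonzero (suc (suc k)) (suc p) u (s≤s p<k) (zero , _ , u≢0)
    with back-nonzero (suc k) p (skip u) p<k (0 , s≤s z≤n , u≢0)
  ... | j , j<k , b≢0 = suc j , s≤s j<k , b≢0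
  back-nonzero (suc (suc k)) (suc p) u (s≤s p<k) (suc (suc j) , s≤s j<k , u≢0)
    with back-nonzero (suc k) p (skip u) p<k (suc j , j<k , u≢0)
  ... | i , i<k , b≢0 = suc i , s≤s i<k , b≢0

  front-map : ∀ p (rows : ℕ → ℕ → 𝔾) i j → front p rows j i ≡ front p (λ j → rows j i) j
  front-map zero    rows i j             = refl
  front-map (suc p) rows i zero          = front-map p (rows ∘ suc) i 0
  front-map (suc p) rows i (suc zero)    = refl
  front-map (suc p) rows i (suc (suc j)) = front-map p (rows ∘ suc) i (suc j)

  dependent-back : ∀ n k p rows → p ℕ.< k → Dependent n k (front p rows) → Dependent n k rows
  dependent-back n k p rows p<k (u , nz , rel) = back p u , back-nonzero k p u p<k nz ,
    λ i i<n → trans (sumᵍ-back k p u (λ j → rows j i) p<k)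
      (trans (sumᵍ-cong k λ j _ → cong (u j *ᵍ_) (sym (front-map p rows i j))) (rel i i<n))

  wedges-restrict : ∀ n k rows π → wedges (suc n) k rows (false ∷ π) ≡ wedges n k (λ j → rows j ∘ suc) π
  wedges-restrict n zero    rows π = refl
  wedges-restrict n (suc k) rows π = wedge-cong n (λ _ → refl) (wedges-restrict n k (rows ∘ suc)) π

  wedges-zero-column : ∀ n k rows → (∀ j → rows j 0 ≡ 0ᵍ) → ∀ π → wedges (suc n) k rows (true ∷ π) ≡ 0ᵍ
  wedges-zero-column n zero    rows h π = refl
  wedges-zero-column n (suc k) rows h π =
    trans (cong₂ (λ a b → a *ᵍ wedges (suc n) k (rows ∘ suc) (false ∷ π) +ᵍ -1ᵍ *ᵍ b) (h 0)
            (wedge-zeroʳ n (rows 0 ∘ suc) (wedges-zero-column n k (rows ∘ suc) (h ∘ suc)) π)) (lemma _)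
    where
    lemma : ∀ a → 0ᵍ *ᵍ a +ᵍ -ᵍ 1ᵍ *ᵍ 0ᵍ ≡ 0ᵍ
    lemma = solve-∀ 𝔾-ring

  wedge-eliminate : ∀ n k r (c : ℕ → 𝔾) rows π →
    wedge n r (wedges n k (λ j i → 1ᵍ *ᵍ rows j i +ᵍ c j *ᵍ r i)) π ≡ wedge n r (wedges n k rows) π
  wedge-eliminate n zero    r c rows π = refl
  wedge-eliminate n (suc k) r c rows π = begin
    wedge n r (wedge n (λ i → 1ᵍ *ᵍ rows 0 i +ᵍ c 0 *ᵍ r i) Y) π
      ≡⟨ wedge-cong n (λ _ → refl) (λ σ → wedge-linearˡ n 1ᵍ (c 0) (rows 0) r Y σ) π ⟩
    wedge n r (λ σ → 1ᵍ *ᵍ wedge n (rows 0) Y σ +ᵍ c 0 *ᵍ wedge n r Y σ) π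
      ≡⟨ wedge-linearʳ n r 1ᵍ (c 0) (wedge n (rows 0) Y) (wedge n r Y) π ⟩
    1ᵍ *ᵍ wedge n r (wedge n (rows 0) Y) π +ᵍ c 0 *ᵍ wedge n r (wedge n r Y) π
      ≡⟨ cong₂ (λ a b → 1ᵍ *ᵍ a +ᵍ c 0 *ᵍ b) (wedge-anticomm n r (rows 0) Y π) (wedge-square n r Y π) ⟩
    1ᵍ *ᵍ (-1ᵍ *ᵍ wedge n (rows 0) (wedge n r Y) π) +ᵍ c 0 *ᵍ 0ᵍ
      ≡⟨ lemma (c 0) _ ⟩
    -1ᵍ *ᵍ wedge n (rows 0) (wedge n r Y) π
      ≡⟨ cong (-1ᵍ *ᵍ_) (wedge-cong n (λ _ → refl) (wedge-eliminate n k r (c ∘ suc) (rows ∘ suc)) π) ⟩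
    -1ᵍ *ᵍ wedge n (rows 0) (wedge n r (wedges n k (rows ∘ suc))) π
      ≡⟨ sym (wedge-anticomm n r (rows 0) _ π) ⟩
    wedge n r (wedge n (rows 0) (wedges n k (rows ∘ suc))) π ∎
    where
    open ≡-Reasoning
    Y = wedges n k (λ j i → 1ᵍ *ᵍ rows (suc j) i +ᵍ c (suc j) *ᵍ r i)
    lemma : ∀ c a → 1ᵍ *ᵍ (-ᵍ 1ᵍ *ᵍ a) +ᵍ c *ᵍ 0ᵍ ≡ -ᵍ 1ᵍ *ᵍ a
    lemma = solve-∀ 𝔾-ring

  private
    eliminated : ∀ r b a → 1ᵍ *ᵍ r +ᵍ -ᵍ (r *ᵍ b) *ᵍ a ≡ r -ᵍ r *ᵍ (a *ᵍ b)
    eliminated = solve-∀ 𝔾-ring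
    minus-self : ∀ r → r -ᵍ r *ᵍ 1ᵍ ≡ 0ᵍ
    minus-self = solve-∀ 𝔾-ring
    drop-zero : ∀ t → t +ᵍ -ᵍ 1ᵍ *ᵍ 0ᵍ ≡ t
    drop-zero = solve-∀ 𝔾-ring
    flip : ∀ a t b → a *ᵍ t +ᵍ b ≡ t *ᵍ a +ᵍ 1ᵍ *ᵍ b
    flip = solve-∀ 𝔾-ring
    regroup : ∀ t u c r → t *ᵍ (u *ᵍ c) +ᵍ 1ᵍ *ᵍ (u *ᵍ r) ≡ u *ᵍ (1ᵍ *ᵍ r +ᵍ c *ᵍ t)
    regroup = solve-∀ 𝔾-ring

  -- One step of Gaussian elimination. Once the first column is cleared below the pivot, the product
  -- of all rows contains the pivot times the product of the remaining rows, which must therefore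
  -- vanish as well. The argument `recurse` is the induction hypothesis.
  eliminate-first : ∀ n k rows b → rows 0 0 *ᵍ b ≡ 1ᵍ → rows 0 0 ≢ 0ᵍ → (∀ π → wedges (suc n) (suc k) rows π ≡ 0ᵍ) →
    ((∀ π → wedges n k (λ j i → 1ᵍ *ᵍ rows (suc j) (suc i) +ᵍ -ᵍ (rows (suc j) 0 *ᵍ b) *ᵍ rows 0 (suc i)) π ≡ 0ᵍ) →
      Dependent n k (λ j i → 1ᵍ *ᵍ rows (suc j) (suc i) +ᵍ -ᵍ (rows (suc j) 0 *ᵍ b) *ᵍ rows 0 (suc i))) →
    Dependent (suc n) (suc k) rows
  eliminate-first n k rows b ab≡1 a≢0 h recurse = extend (recurse λ π →
      trans (sym (wedges-restrict n k s π)) (cancelˡ a _ a≢0 (trans (sym (expand π)) (zero-top π))))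
    where
    a = rows 0 0
    c : ℕ → 𝔾
    c j = -ᵍ (rows (suc j) 0 *ᵍ b)
    s : ℕ → ℕ → 𝔾
    s j i = 1ᵍ *ᵍ rows (suc j) i +ᵍ c j *ᵍ rows 0 i
    s-column : ∀ j → s j 0 ≡ 0ᵍ
    s-column j = trans (eliminated (rows (suc j) 0) b a) (trans (cong (λ t → rows (suc j) 0 -ᵍ rows (suc j) 0 *ᵍ t) ab≡1) (minus-self _))
    zero-top : ∀ π → wedge (suc n) (rows 0) (wedges (suc n) k s) (true ∷ π) ≡ 0ᵍ
    zero-top π = trans (wedge-eliminate (suc n) k (rows 0) c (rows ∘ suc) (true ∷ π)) (h (true ∷ π))
    expand : ∀ π → wedge (suc n) (rows 0) (wedges (suc n) k s) (true ∷ π) ≡ a *ᵍ wedges (suc n) k s (false ∷ π)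
    expand π = trans (cong (λ t → a *ᵍ wedges (suc n) k s (false ∷ π) +ᵍ -1ᵍ *ᵍ t)
        (wedge-zeroʳ n (rows 0 ∘ suc) (wedges-zero-column n k s s-column) π)) (drop-zero _)
    extend : Dependent n k (λ j → s j ∘ suc) → Dependent (suc n) (suc k) rows
    extend (u , (j , j<k , uj≢0) , rel) = v , (suc j , s≤s j<k , uj≢0) , relation
      where
      v : ℕ → 𝔾
      v zero    = sumᵍ k (λ j → u j *ᵍ c j)
      v (suc j) = u j
      s-relation : ∀ i → i ℕ.< suc n → sumᵍ k (λ j → u j *ᵍ s j i) ≡ 0ᵍ
      s-relation zero    _         = sumᵍ-zero k λ j _ → trans (cong (u j *ᵍ_) (s-column j)) (*zero (u j))
      s-relation (suc i) (s≤s i<n) = rel i i<n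
      relation : ∀ i → i ℕ.< suc n → sumᵍ (suc k) (λ j → v j *ᵍ rows j i) ≡ 0ᵍ
      relation i i<n = trans (begin
        v 0 *ᵍ t +ᵍ sumᵍ k (λ j → u j *ᵍ rows (suc j) i)
          ≡⟨ flip (v 0) t _ ⟩
        t *ᵍ v 0 +ᵍ 1ᵍ *ᵍ sumᵍ k (λ j → u j *ᵍ rows (suc j) i)
          ≡⟨ sym (sumᵍ-linear k t 1ᵍ (λ j → u j *ᵍ c j) (λ j → u j *ᵍ rows (suc j) i)) ⟩
        sumᵍ k (λ j → t *ᵍ (u j *ᵍ c j) +ᵍ 1ᵍ *ᵍ (u j *ᵍ rows (suc j) i))
          ≡⟨ sumᵍ-cong k (λ j _ → regroup t (u j) (c j) (rows (suc j) i)) ⟩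
        sumᵍ k (λ j → u j *ᵍ s j i) ∎) (s-relation i i<n)
        where
        open ≡-Reasoning
        t = rows 0 i

  -- Stated for `k` vectors in dimension `n`, because a zero column lowers `n` but not `k`, so that
  -- the elimination leaves the square matrices.
  wedges-zero⇒dependent : ∀ n k rows → (∀ π → wedges n k rows π ≡ 0ᵍ) → Dependent n k rows
  wedges-zero⇒dependent zero zero rows h = ⊥-elim (1ᵍ≢0ᵍ (h []))
  wedges-zero⇒dependent zero (suc k) rows h = (λ _ → 1ᵍ) , (0 , s≤s z≤n , 1ᵍ≢0ᵍ) , λ _ ()
  wedges-zero⇒dependent (suc n) k rows h with findPivot k (λ j → rows j 0)
  ... | inj₁ column≡0 = extend (wedges-zero⇒dependent n k (λ j → rows j ∘ suc)
          λ π → trans (sym (wedges-restrict n k rows π)) (h (false ∷ π)))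
    where
    extend : Dependent n k (λ j → rows j ∘ suc) → Dependent (suc n) k rows
    extend (u , nz , rel) = u , nz , λ
      { zero _ → sumᵍ-zero k λ j j<k → trans (cong (u j *ᵍ_) (column≡0 j j<k)) (*zero (u j))
      ; (suc i) (s≤s i<n) → rel i i<n }
  ... | inj₂ (p , p<k , pivot≢0) = dependent-back (suc n) k p rows p<k
          (eliminate k p<k (front p rows) (λ e → pivot≢0 (trans (sym (cong (λ r → r 0) (front-0 p rows))) e))
            (wedges-front (suc n) k p rows p<k h))
    where
    eliminate : ∀ k → p ℕ.< k → ∀ rows → rows 0 0 ≢ 0ᵍ → (∀ π → wedges (suc n) k rows π ≡ 0ᵍ) → Dependent (suc n) k rows
    eliminate (suc k) _ rows a≢0 h = let b , ab≡1 = invᵍ (rows 0 0) a≢0 in go b ab≡1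
      where
      go : ∀ b → rows 0 0 *ᵍ b ≡ 1ᵍ → Dependent (suc n) (suc k) rows
      go b ab≡1 = eliminate-first n k rows b ab≡1 a≢0 h (wedges-zero⇒dependent n k _)

  top-or-low : ∀ {n} (π : Vec Bool n) → π ≡ replicate n true ⊎ count π ℕ.< n
  top-or-low []          = inj₁ refl
  top-or-low (false ∷ π) = inj₂ (s≤s (count≤n π))
  top-or-low (true ∷ π) with top-or-low π
  ... | inj₁ refl = inj₁ refl
  ... | inj₂ c    = inj₂ (s≤s c)

  det-zero⇒dependent : ∀ n rows → det n rows ≡ 0ᵍ → Dependent n n rows
  det-zero⇒dependent n rows e = wedges-zero⇒dependent n n rows all-zero
    where
    all-zero : ∀ π → wedges n n rows π ≡ 0ᵍ
    all-zero π with top-or-low π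
    ... | inj₁ refl = e
    ... | inj₂ c    = wedges-degree n n rows π c

-- The determinant of the Bezoutian does not vanish

module Nonvanishing where
  open import Data.Rational.Base using (_+_; _*_; _-_; -_; _<_)
  open import Tactic.RingSolver using (solve-∀)
  open Rationals
  open Gaussian
  open ExteriorAlgebra
  open LinearDependence
  open Polynomials
  open Resultants
  open Places

  real-sum : ∀ n f → real (sumℚ n f) ≡ sumᵍ n (real ∘ f)
  real-sum zero    f = refl
  real-sum (suc n) f = cong (real (f 0) +ᵍ_) (real-sum n (f ∘ suc))

  sumℚ-single : ∀ n f j → j ℕ.< n → (∀ i → i ≢ j → f i ≡ 0ℚ) → sumℚ n f ≡ f j
  sumℚ-single (suc n) f zero    _         h = trans (cong (f 0 +_) (zeros n (f ∘ suc) λ i → h (suc i) λ ())) (ℚ.+-identityʳ (f 0))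
    where
    zeros : ∀ n f → (∀ i → f i ≡ 0ℚ) → sumℚ n f ≡ 0ℚ
    zeros zero    f h = refl
    zeros (suc n) f h = cong₂ _+_ (h 0) (zeros n (f ∘ suc) (h ∘ suc))
  sumℚ-single (suc n) f (suc j) (s≤s j<n) h = trans (cong₂ _+_ (h 0 λ ()) (sumℚ-single n (f ∘ suc) j j<n λ i i≢j → h (suc i) (i≢j ∘ ℕ.suc-injective)))
    (ℚ.+-identityˡ (f (suc j)))

  eval-sum : ∀ n k (c : ℕ → 𝔾) (rows : ℕ → ℕ → 𝔾) x →
    eval n (λ i → sumᵍ k (λ j → c j *ᵍ rows j i)) x ≡ sumᵍ k (λ j → c j *ᵍ eval n (rows j) x)
  eval-sum n zero    c rows x = eval-zero n (λ _ _ → refl) x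
  eval-sum n (suc k) c rows x = trans (eval-cong n (λ i _ → cong (c 0 *ᵍ rows 0 i +ᵍ_) (one* _)) x)
    (trans (eval-linear n (c 0) 1ᵍ (rows 0) _ x)
      (cong (c 0 *ᵍ eval n (rows 0) x +ᵍ_) (trans (sym (one* _)) (eval-sum n k (c ∘ suc) (rows ∘ suc) x))))
    where
    one* : ∀ t → t ≡ 1ᵍ *ᵍ t
    one* = solve-∀ 𝔾-ring

  IsReal : 𝔾 → Set
  IsReal z = ∃ λ q → z ≡ real q

  real-+ʳ : ∀ {x y} → IsReal x → IsReal y → IsReal (x +ᵍ y)
  real-+ʳ (a , refl) (b , refl) = a + b , refl

  real-*ʳ : ∀ {x y} → IsReal x → IsReal y → IsReal (x *ᵍ y)
  real-*ʳ (a , refl) (b , refl) = a * b , sym (real-* a b)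

  half-real : ∀ {g f : ℕ → 𝔾} → (∀ i → IsReal (g i)) → (∀ i → IsReal (f i)) → ∀ j i → IsReal (half g f j i)
  half-real hg hf zero    i       = real-*ʳ (hg 0) (hf (suc i))
  half-real hg hf (suc j) zero    = real-*ʳ (hg 0) (hf (suc (suc j)))
  half-real hg hf (suc j) (suc i) = real-+ʳ (real-*ʳ (hg 0) (hf _)) (half-real (hg ∘ suc) (hf ∘ suc) j i)

  bezoutian-real : ∀ (g f : ℕ → ℚ) j i → IsReal (bezoutian (real ∘ g) (real ∘ f) j i)
  bezoutian-real g f j i = real-+ʳ (real-*ʳ (1ℚ , refl) (half-real (λ i → g i , refl) (λ i → f i , refl) j i))
    (real-*ʳ (- 1ℚ , refl) (half-real (λ i → f i , refl) (λ i → g i , refl) j i))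

  private
    Re-* : ∀ z q → Re (z *ᵍ real q) ≡ Re z * q
    Re-* (a ⊹ b) q = lemma a b q
      where
      lemma : ∀ a b q → a * q - b * 0ℚ ≡ a * q
      lemma = solve-∀ ℚ-ring
    Im-* : ∀ z q → Im (z *ᵍ real q) ≡ Im z * q
    Im-* (a ⊹ b) q = lemma a b q
      where
      lemma : ∀ a b q → a * 0ℚ + b * q ≡ b * q
      lemma = solve-∀ ℚ-ring
    Re-+ : ∀ z w → Re (z +ᵍ w) ≡ Re z + Re w
    Re-+ (a ⊹ b) (c ⊹ d) = refl
    Im-+ : ∀ z w → Im (z +ᵍ w) ≡ Im z + Im w
    Im-+ (a ⊹ b) (c ⊹ d) = refl

  -- As the matrix is real, the real and the imaginary part of a kernel vector are kernel vectors
  -- too. This leads back to rational coefficients, for which minimality is stated.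
  Re-sum : ∀ n (u b : ℕ → 𝔾) → (∀ j → IsReal (b j)) →
    real (Re (sumᵍ n (λ j → u j *ᵍ b j))) ≡ sumᵍ n (λ j → real (Re (u j)) *ᵍ b j)
  Re-sum zero    u b h = refl
  Re-sum (suc n) u b h = trans (cong real (Re-+ (u 0 *ᵍ b 0) _)) (cong₂ _+ᵍ_ (first (h 0)) (Re-sum n (u ∘ suc) (b ∘ suc) (h ∘ suc)))
    where
    first : ∀ {c} → IsReal c → real (Re (u 0 *ᵍ c)) ≡ real (Re (u 0)) *ᵍ c
    first (q , refl) = trans (cong real (Re-* (u 0) q)) (real-* (Re (u 0)) q)

  Im-sum : ∀ n (u b : ℕ → 𝔾) → (∀ j → IsReal (b j)) →
    real (Im (sumᵍ n (λ j → u j *ᵍ b j))) ≡ sumᵍ n (λ j → real (Im (u j)) *ᵍ b j)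
  Im-sum zero    u b h = refl
  Im-sum (suc n) u b h = trans (cong real (Im-+ (u 0 *ᵍ b 0) _)) (cong₂ _+ᵍ_ (first (h 0)) (Im-sum n (u ∘ suc) (b ∘ suc) (h ∘ suc)))
    where
    first : ∀ {c} → IsReal c → real (Im (u 0 *ᵍ c)) ≡ real (Im (u 0)) *ᵍ c
    first (q , refl) = trans (cong real (Im-* (u 0) q)) (real-* (Im (u 0)) q)

  firstNonzero : ∀ n (u : ℕ → ℚ) j → j ℕ.< n → u j ≢ 0ℚ → ∃ λ i → i ℕ.< n × u i ≢ 0ℚ × (∀ k → k ℕ.< i → u k ≡ 0ℚ)
  firstNonzero (suc n) u j j<n uj≢0 = decide (u 0 ℚ.≟ 0ℚ) j j<n uj≢0
    where
    decide : Dec (u 0 ≡ 0ℚ) → ∀ j → j ℕ.< suc n → u j ≢ 0ℚ → ∃ λ i → i ℕ.< suc n × u i ≢ 0ℚ × (∀ k → k ℕ.< i → u k ≡ 0ℚ)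
    decide (no u0≢0)  j       _         _    = 0 , s≤s z≤n , u0≢0 , λ _ ()
    decide (yes u0≡0) zero    _         u≢0  = ⊥-elim (u≢0 u0≡0)
    decide (yes u0≡0) (suc j) (s≤s j<n) uj≢0 =
      let i , i<n , ui≢0 , zeros = firstNonzero n (u ∘ suc) j j<n uj≢0
      in suc i , s≤s i<n , ui≢0 , λ { zero _ → u0≡0 ; (suc k) (s≤s k<i) → zeros k k<i }

  module _ (z : ℕ → 𝔾) (cauchy-z : CauchyG z) where
    open Place z cauchy-z

    -- A left kernel vector u of the Bezoutian gives g W = f Z with W = Σ uⱼ wⱼ
    -- of degree below that of f, where wⱼ is f with its j + 1 lowest terms removed.
    no-rational-kernel : ∀ m f g → Minimal m f → Below 0ℚ (suc m) g → ¬ V (suc m) g →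
      ∀ (u : ℕ → ℚ) j → j ℕ.< m → u j ≢ 0ℚ →
      ¬ (∀ i → i ℕ.< m → sumᵍ m (λ j → real (u j) *ᵍ bezoutian (real ∘ g) (real ∘ f) j i) ≡ 0ᵍ)
    no-rational-kernel m f g min hg ¬Vg u j j<m uj≢0 rel =
      null-product (eval-cauchy (suc m) G (real-below hg) cauchy-z) gW-null λ
        { (inj₁ Vg) → ¬Vg Vg
        ; (inj₂ VW) → W-nonzero (least W W-below VW) }
      where
      open Minimal min
      F G : ℕ → 𝔾
      F = real ∘ f
      G = real ∘ g
      hF = real-below below
      hG = real-below hg
      W Z : ℕ → ℚ
      W t = sumℚ m (λ j → u j * f (suc j ℕ.+ t))
      Z t = sumℚ m (λ j → u j * g (suc j ℕ.+ t))
      vanish-sum : ∀ p → Below 0ℚ (suc m) p → Below 0ℚ m (λ t → sumℚ m (λ j → u j * p (suc j ℕ.+ t)))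
      vanish-sum p hp t m≤t = zeros m u λ j → hp (suc j ℕ.+ t) (s≤s (ℕ.≤-trans m≤t (ℕ.m≤n+m t j)))
        where
        zeros : ∀ n (u : ℕ → ℚ) {p : ℕ → ℚ} → (∀ j → p j ≡ 0ℚ) → sumℚ n (λ j → u j * p j) ≡ 0ℚ
        zeros zero    u h = refl
        zeros (suc n) u h = cong₂ _+_ (trans (cong (u 0 *_) (h 0)) (ℚ.*-zeroʳ (u 0))) (zeros n (u ∘ suc) (h ∘ suc))
      W-below = vanish-sum f below
      Z-below = vanish-sum g hg
      eval-comb : ∀ p x → eval m (λ t → real (sumℚ m (λ j → u j * p (suc j ℕ.+ t)))) x ≡ sumᵍ m (λ j → real (u j) *ᵍ eval m (shift (suc j) (real ∘ p)) x)
      eval-comb p x = trans (eval-cong m (λ t _ → trans (real-sum m _) (sumᵍ-cong m λ j _ → real-* (u j) (p (suc j ℕ.+ t)))) x)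
        (eval-sum m m (real ∘ u) (λ j → shift (suc j) (real ∘ p)) x)
      identity : ∀ x → eval (suc m) G x *ᵍ eval m (real ∘ W) x ≡ eval m (real ∘ Z) x *ᵍ eval (suc m) F x
      identity x = difference _ _ (begin
        eval (suc m) G x *ᵍ eval m (real ∘ W) x -ᵍ eval m (real ∘ Z) x *ᵍ eval (suc m) F x
          ≡⟨ cong₂ (λ a b → eval (suc m) G x *ᵍ a -ᵍ b *ᵍ eval (suc m) F x) (eval-comb f x) (eval-comb g x) ⟩
        eval (suc m) G x *ᵍ sumᵍ m (λ j → real (u j) *ᵍ w j) -ᵍ sumᵍ m (λ j → real (u j) *ᵍ v j) *ᵍ eval (suc m) F x
          ≡⟨ rewritten (eval (suc m) G x) _ _ (eval (suc m) F x) ⟩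
        eval (suc m) G x *ᵍ sumᵍ m (λ j → real (u j) *ᵍ w j) +ᵍ (-ᵍ eval (suc m) F x) *ᵍ sumᵍ m (λ j → real (u j) *ᵍ v j)
          ≡⟨ sym (sumᵍ-linear m (eval (suc m) G x) (-ᵍ eval (suc m) F x) (λ j → real (u j) *ᵍ w j) (λ j → real (u j) *ᵍ v j)) ⟩
        sumᵍ m (λ j → eval (suc m) G x *ᵍ (real (u j) *ᵍ w j) +ᵍ (-ᵍ eval (suc m) F x) *ᵍ (real (u j) *ᵍ v j))
          ≡⟨ sumᵍ-cong m (λ j _ → trans (regroup (eval (suc m) G x) (real (u j)) (w j) (eval (suc m) F x) (v j))
               (cong (real (u j) *ᵍ_) (sym (eval-bezoutian m j G F hG hF x)))) ⟩
        sumᵍ m (λ j → real (u j) *ᵍ eval m (bezoutian G F j) x)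
          ≡⟨ sym (eval-sum m m (real ∘ u) (bezoutian G F) x) ⟩
        eval m (λ i → sumᵍ m (λ j → real (u j) *ᵍ bezoutian G F j i)) x
          ≡⟨ eval-zero m rel x ⟩
        0ᵍ ∎)
        where
        open ≡-Reasoning
        w v : ℕ → 𝔾
        w j = eval m (shift (suc j) F) x
        v j = eval m (shift (suc j) G) x
        difference : ∀ a b → a -ᵍ b ≡ 0ᵍ → a ≡ b
        difference a b e = trans (restore a b) (trans (cong (_+ᵍ b) e) (zero+ b))
          where
          restore : ∀ a b → a ≡ a -ᵍ b +ᵍ b
          restore = solve-∀ 𝔾-ring
          zero+ : ∀ b → 0ᵍ +ᵍ b ≡ b
          zero+ = solve-∀ 𝔾-ring
        rewritten : ∀ g w v f → g *ᵍ w -ᵍ v *ᵍ f ≡ g *ᵍ w +ᵍ (-ᵍ f) *ᵍ v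
        rewritten = solve-∀ 𝔾-ring
        regroup : ∀ g u w f v → g *ᵍ (u *ᵍ w) +ᵍ (-ᵍ f) *ᵍ (u *ᵍ v) ≡ u *ᵍ (g *ᵍ w -ᵍ f *ᵍ v)
        regroup = solve-∀ 𝔾-ring
      gW-null : Null (λ k → eval (suc m) G (z k) *ᵍ eval m (real ∘ W) (z k))
      gW-null = null-cong (λ k → sym (identity (z k)))
        (null-*-bounded (eval-bounded m (real ∘ Z) (real-below Z-below) (cauchyG-bounded cauchy-z)) vanishes)
      first = firstNonzero m u j j<m uj≢0
      -- Each `wⱼ` is monic of degree `m − j − 1`, so that the first nonzero `uⱼ` is the leading
      -- coefficient of `W`.
      W-nonzero : ¬ (∀ t → W t ≡ 0ℚ)
      W-nonzero zero-W = let i , i<m , ui≢0 , zeros = first in contradict i i<m ui≢0 zeros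
        where
        contradict : ∀ i → i ℕ.< m → u i ≢ 0ℚ → (∀ k → k ℕ.< i → u k ≡ 0ℚ) → ⊥
        contradict i i<m ui≢0 zeros = ui≢0 (trans (sym (trans (cong (u i *_) (trans (cong f degree) monic)) (ℚ.*-identityʳ (u i))))
            (trans (sym (sumℚ-single m (λ j → u j * f (suc j ℕ.+ t)) i i<m others)) (zero-W t)))
          where
          t = m ℕ.∸ suc i
          degree : suc i ℕ.+ t ≡ m
          degree = ℕ.m+[n∸m]≡n i<m
          others : ∀ k → k ≢ i → u k * f (suc k ℕ.+ t) ≡ 0ℚ
          others k k≢i = split (ℕ.<-cmp k i)
            where
            open import Relation.Binary.Definitions using (Tri; tri<; tri≈; tri>)
            split : Tri (k ℕ.< i) (k ≡ i) (i ℕ.< k) → u k * f (suc k ℕ.+ t) ≡ 0ℚ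
            split (tri< k<i _ _) = trans (cong (_* f (suc k ℕ.+ t)) (zeros k k<i)) (ℚ.*-zeroˡ (f (suc k ℕ.+ t)))
            split (tri≈ _ k≡i _) = ⊥-elim (k≢i k≡i)
            split (tri> _ _ i<k) = trans (cong (u k *_) (below (suc k ℕ.+ t)
              (subst (ℕ._< suc k ℕ.+ t) degree (ℕ.+-monoˡ-< t (s≤s i<k))))) (ℚ.*-zeroʳ (u k))

    bezoutian-det≢0 : ∀ m f g → Minimal m f → Below 0ℚ (suc m) g → ¬ V (suc m) g →
      det m (bezoutian (real ∘ g) (real ∘ f)) ≢ 0ᵍ
    bezoutian-det≢0 m f g min hg ¬Vg e = analyse (det-zero⇒dependent m B e)
      where
      B = bezoutian (real ∘ g) (real ∘ f)
      analyse : Dependent m m B → ⊥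
      analyse (u , (j , j<m , uj≢0) , rel) = split (Re (u j) ℚ.≟ 0ℚ) (Im (u j) ℚ.≟ 0ℚ)
        where
        eta : ∀ w → Re w ≡ 0ℚ → Im w ≡ 0ℚ → w ≡ 0ᵍ
        eta (a ⊹ b) refl refl = refl
        split : Dec (Re (u j) ≡ 0ℚ) → Dec (Im (u j) ≡ 0ℚ) → ⊥
        split (yes r) (yes i) = uj≢0 (eta (u j) r i)
        split (no r) _ = no-rational-kernel m f g min hg ¬Vg (Re ∘ u) j j<m r
          λ i i<m → trans (sym (Re-sum m u (λ j → B j i) (λ j → bezoutian-real g f j i))) (cong (real ∘ Re) (rel i i<m))
        split _ (no r) = no-rational-kernel m f g min hg ¬Vg (Im ∘ u) j j<m r
          λ i i<m → trans (sym (Im-sum m u (λ j → B j i) (λ j → bezoutian-real g f j i))) (cong (real ∘ Im) (rel i i<m))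

-- Bounds for the distance of two roots in terms of the height

module UpperBound where
  import Data.Integer.Base as ℤ
  open import Data.Integer.Base using (ℤ)
  open import Data.Rational.Base using (_+_; _*_; _-_; -_; _≤_; _<_)
  open import Tactic.RingSolver using (solve-∀)
  open Rationals
  open Gaussian
  open ExteriorAlgebra
  open Polynomials
  open Bounds
  open Resultants
  open Coprime
  open Discriminant
  open GaussLemma
  open Division
  open Places
  open Nonvanishing

  largest : ∀ n p → Below 0ᵍ (suc n) p → ∃ λ i → i ℕ.< suc n × ∀ j → ‖ p j ‖ ≤ ‖ p i ‖
  largest zero p h = 0 , s≤s z≤n , λ
    { zero → ℚ.≤-refl ; (suc j) → ≤-zero (h (suc j) (s≤s z≤n)) (‖‖-nonNeg (p 0)) }
  largest (suc n) p h = let i , i<n , max = largest n (p ∘ suc) (below-tail (suc n) h) in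
      choose i i<n max (ℚ.≤-total (‖ p 0 ‖) (‖ p (suc i) ‖))
    where
    choose : ∀ i → i ℕ.< suc n → (∀ j → ‖ p (suc j) ‖ ≤ ‖ p (suc i) ‖) → ‖ p 0 ‖ ≤ ‖ p (suc i) ‖ ⊎ ‖ p (suc i) ‖ ≤ ‖ p 0 ‖ →
      ∃ λ i → i ℕ.< suc (suc n) × ∀ j → ‖ p j ‖ ≤ ‖ p i ‖
    choose i i<n max (inj₁ le) = suc i , s≤s i<n , λ { zero → le ; (suc j) → max j }
    choose i i<n max (inj₂ ge) = 0 , s≤s z≤n , λ { zero → ℚ.≤-refl ; (suc j) → ℚ.≤-trans (max j) ge }

  distance : (ℕ → 𝔾) → (ℕ → 𝔾) → ℕ → ℚ
  distance z y k = ‖ y k -ᵍ z k ‖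

  -- The points `z k` are bounded and the distances stay above `σ`, so that one tolerance `η` serves
  -- all late indices.
  close-eventually : ∀ e z y σ → BoundedG z → 0ℚ < σ → (Eventually λ k → σ ≤ distance z y k) →
    ∃ λ η → 0ℚ < η × Eventually λ k → distance z y k ≤ 1ℚ → Close e (z k) (y k) (distance z y k) η
  close-eventually e z y σ (X , 1≤X , bounded) 0<σ apart = η , 0<η , eventually-map close (bounded ∩ apart)
    where
    Y = (2ℚ * (X + 1ℚ)) ^ (e ℕ.+ e)
    shrunk = shrink Y (σ * σ) (*-pos 0<σ 0<σ)
    η = proj₁ shrunk
    0<η = proj₁ (proj₂ shrunk)
    close : ∀ k → ‖ z k ‖ ≤ X × σ ≤ distance z y k → distance z y k ≤ 1ℚ → Close e (z k) (y k) (distance z y k) η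
    close k (zk≤X , σ≤) δ≤1 = record
      { 0<δ = ℚ.<-≤-trans 0<σ σ≤ ; δ≤1 = δ≤1 ; near = ℚ.≤-refl ; 0≤η = ℚ.<⇒≤ 0<η
      ; small = ℚ.≤-trans (*-monoʳ (ℚ.<⇒≤ 0<η) (^-mono (e ℕ.+ e) (*-nonNeg {2ℚ} (ℚ.<⇒≤ 0<2) (+-nonNeg (‖‖-nonNeg (z k)) 0≤1))
                  (*-monoʳ {c = 2ℚ} (ℚ.<⇒≤ 0<2) (ℚ.+-monoˡ-≤ 1ℚ zk≤X))))
          (ℚ.≤-trans (ℚ.≤-reflexive (ℚ.*-comm η Y)) (ℚ.≤-trans (proj₂ (proj₂ shrunk)) (*-mono (ℚ.<⇒≤ 0<σ) (ℚ.≤-trans (ℚ.<⇒≤ 0<σ) σ≤) σ≤ σ≤))) }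

  Integers : (ℕ → ℚ) → Set
  Integers f = ∀ i → IsInteger (real (f i))

  1≤top : ∀ {n} (f : ℕ → ℚ) {B} → f n ≡ 1ℚ → ‖ real (f n) ‖ ≤ B → 1ℚ ≤ B
  1≤top f e h = subst (_≤ _) (trans (cong (λ t → ‖ real t ‖) e) ‖1‖) h

  -- The summand 1 pays for the value `f(z)`; the other one comes from `‖ t − z ‖ ≤ 2 δ` and a
  -- divided difference at points of norm at most `3 G`.
  linearConstant : ℕ → ℚ
  linearConstant a = 1ℚ + 2ℚ * (fromℕ (suc a ℕ.* suc a) * (1ℚ + 2ℚ) ^ (a ℕ.∸ 1))

  eval-int : ∀ n p x → (∀ i → IsInteger (p i)) → IsInteger x → IsInteger (eval n p x)
  eval-int zero    p x h hx = ℤ.+ 0 , refl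
  eval-int (suc n) p x h hx = int-+ (h 0) (int-* hx (eval-int n (p ∘ suc) x (h ∘ suc) hx))

  module Cases (z y : ℕ → 𝔾) (cz : CauchyG z) (cy : CauchyG y) (σ : ℚ) (0<σ : 0ℚ < σ)
    (apart : Eventually λ k → σ ≤ distance z y k) (d : ℕ) (B : ℚ) where

    module Vz = Place z cz
    module Vy = Place y cy

    Bounded : ℚ → Set
    Bounded C = Eventually λ k → distance z y k ≤ 1ℚ → 1ℚ ≤ C * (distance z y k * B ^ (d ℕ.∸ 2))

    -- The case of two different minimal polynomials, the one of larger degree belonging to `z`.
    -- Coprimality takes the form `g-nonroot`, and `product` is Gelfond's bound.
    record Pair (a b : ℕ) (f g : ℕ → ℚ) : Set where
      field
        minimal  : Vz.Minimal (suc a) f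
        b≤a      : b ℕ.≤ a
        degrees  : suc a ℕ.+ suc b ℕ.≤ d
        g-monic  : g (suc b) ≡ 1ℚ
        g-below  : Below 0ℚ (suc (suc b)) g
        g-root   : Vy.V (suc (suc b)) g
        g-nonroot : ¬ Vz.V (suc (suc b)) g
        f-int    : Integers f
        g-int    : Integers g
        product  : ∀ i j → ‖ real (f i) ‖ * ‖ real (g j) ‖ ≤ B

    module PairBound {a b f g} (pair : Pair a b f g) where
      open Pair pair
      open Vz.Minimal minimal
      F-max = largest (suc a) (real ∘ f) (real-below below)
      G-max = largest (suc b) (real ∘ g) (real-below g-below)
      F = ‖ real (f (proj₁ F-max)) ‖
      G = ‖ real (g (proj₁ G-max)) ‖
      f≤F = proj₂ (proj₂ F-max)
      g≤G = proj₂ (proj₂ G-max)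
      1≤F : 1ℚ ≤ F
      1≤F = 1≤top f monic (f≤F (suc a))
      1≤G : 1ℚ ≤ G
      1≤G = 1≤top g g-monic (g≤G (suc b))
      0≤F = ℚ.≤-trans 0≤1 1≤F
      0≤G = ℚ.≤-trans 0≤1 1≤G
      FG≤B : F * G ≤ B
      FG≤B = product (proj₁ F-max) (proj₁ G-max)
      1≤FG : 1ℚ ≤ F * G
      1≤FG = ℚ.≤-trans 1≤F (≤-*ʳ 0≤F 1≤G)
      power≤ : ∀ {e} → e ℕ.≤ d ℕ.∸ 2 → (F * G) ^ e ≤ B ^ (d ℕ.∸ 2)
      power≤ {e} e≤ = ℚ.≤-trans (^-mono e (ℚ.≤-trans 0≤1 1≤FG) FG≤B) (^-monoʳ (ℚ.≤-trans 1≤FG FG≤B) e≤)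
      closeness = close-eventually (suc a) z y σ (cauchyG-bounded cz) 0<σ apart
      η = proj₁ closeness
      0<η = proj₁ (proj₂ closeness)

      -- If `g` has degree at least 2, then `f` has degree at most `d − 2`, which is the exponent in
      -- `coprime-separation`.
      coprime-bounded : 1 ℕ.≤ b → 0ℚ ≤ coprimeConstant (suc a) b → Bounded (coprimeConstant (suc a) b)
      coprime-bounded 1≤b 0≤C = eventually-map conclude (proj₂ (proj₂ closeness) ∩ vanishes η 0<η ∩ g-root η 0<η)
        where
        a≤ : suc a ℕ.≤ d ℕ.∸ 2
        a≤ = ℕ.m+n≤o⇒m≤o∸n (suc a) (ℕ.≤-trans (ℕ.+-monoʳ-≤ (suc a) (s≤s 1≤b)) degrees)
        conclude : ∀ k → _ → distance z y k ≤ 1ℚ → 1ℚ ≤ coprimeConstant (suc a) b * (distance z y k * B ^ (d ℕ.∸ 2))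
        conclude k ((close , fz) , gy) δ≤1 = ℚ.≤-trans
          (coprime-separation (suc a) b (real ∘ f) (real ∘ g) F G (z k) (y k) (distance z y k) η (s≤s b≤a) f-int g-int
            (real-below below) (real-below g-below) f≤F g≤G 1≤F 1≤G
            (bezoutian-det≢0 z cz (suc a) f g minimal (λ i h → g-below i (ℕ.≤-trans (s≤s (s≤s b≤a)) h))
              (λ V → g-nonroot (Vz.V-restrict (s≤s (s≤s b≤a)) g-below V)))
            (close δ≤1) (ℚ.<⇒≤ fz) (ℚ.<⇒≤ gy))
          (*-monoʳ 0≤C (*-monoʳ (‖‖-nonNeg (y k -ᵍ z k)) (power≤ a≤)))

      -- For linear `g` the exponent of `coprime-separation` could be `d − 1`. Instead the nonzero
      -- integer `f(t)` at the integer root `t` of `g` is estimated directly by `O(δ F G^a)`, which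
      -- is better because `F` enters only once.
      linear-bounded : b ≡ 0 → 3 ℕ.≤ d → Bounded (linearConstant (suc a))
      linear-bounded refl 3≤d = eventually-map conclude (proj₂ (proj₂ closeness) ∩ vanishes η 0<η ∩ g-root η 0<η)
        where
        t : 𝔾
        t = -ᵍ real (g 0)
        t-int : IsInteger t
        t-int = let c , e = g-int 0 in ℤ.- c , trans (cong (λ w → -ᵍ w) e) (cong real (sym (fromℤ-neg c)))
        g-at : ∀ x → eval 2 (real ∘ g) x ≡ x -ᵍ t
        g-at x = trans (cong (λ u → real (g 0) +ᵍ x *ᵍ (real u +ᵍ x *ᵍ 0ᵍ)) g-monic) (lemma (real (g 0)) x)
          where
          lemma : ∀ g x → g +ᵍ x *ᵍ (1ᵍ +ᵍ x *ᵍ 0ᵍ) ≡ x -ᵍ (-ᵍ g)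
          lemma = solve-∀ 𝔾-ring
        module D = Divide 0 g g-monic g-below
        n = suc (suc a)
        -- f(t) = 0 would make g divide f, so that g or the quotient vanishes at z.
        ft≢0 : eval n (real ∘ f) t ≢ 0ᵍ
        ft≢0 e = Vz.V-conv n 2 (D.quo n f) g q-below g-below
            (Vz.V-cong {n ℕ.+ 2} f≡ (Vz.V-extend (ℕ.m≤m+n n 2) below vanishes))
            λ { (inj₁ Vq) → quotient≢0 (least (D.quo n f) q-below′ (Vz.V-restrict (ℕ.n≤1+n (suc a)) q-below′ Vq))
              ; (inj₂ Vg) → g-nonroot Vg }
          where
          q-below′ : Below 0ℚ (suc a) (D.quo n f)
          q-below′ i a≤i = D.quo-below n f below i (subst (n ℕ.≤_) (ℕ.+-comm 1 i) (s≤s a≤i))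
          q-below : Below 0ℚ n (D.quo n f)
          q-below i h = q-below′ i (ℕ.≤-trans (ℕ.n≤1+n (suc a)) h)
          quotient≢0 : ¬ (∀ i → D.quo n f i ≡ 0ℚ)
          quotient≢0 zero-q = one≢zero (trans (sym monic) (trans (cong f (ℕ.+-comm 1 a)) (trans (sym top) (zero-q a))))
            where
            one≢zero : 1ℚ ≢ 0ℚ
            one≢zero ()
            n≡ : suc (a ℕ.+ 1) ≡ n
            n≡ = cong suc (ℕ.+-comm a 1)
            top : D.quo n f a ≡ f (a ℕ.+ 1)
            top = subst (λ m → D.quo m f a ≡ f (a ℕ.+ 1)) n≡ (D.quo-top a f (subst (λ m → Below 0ℚ m f) (sym n≡) below))
          rem≡0 : ∀ i → D.rem n f i ≡ 0ℚ
          rem≡0 (suc i) = D.rem-below n f (suc i) (s≤s z≤n)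
          rem≡0 zero    = real-injective {D.rem n f 0} {0ℚ} (trans (lemma₀ (real (D.rem n f 0)) t) (trans (sym evaluated) e))
            where
            lemma₀ : ∀ r t → r ≡ r +ᵍ t *ᵍ 0ᵍ
            lemma₀ = solve-∀ 𝔾-ring
            N = n ℕ.+ 2
            evaluated : eval n (real ∘ f) t ≡ eval 1 (real ∘ D.rem n f) t
            evaluated = begin
              eval n (real ∘ f) t
                ≡⟨ sym (eval-extend (ℕ.m≤m+n n 2) (real-below below) t) ⟩
              eval N (real ∘ f) t
                ≡⟨ eval-cong N {real ∘ f} {λ i → 1ᵍ *ᵍ real (convℚ (D.quo n f) g i) +ᵍ 1ᵍ *ᵍ real (D.rem n f i)}
                     (λ i _ → trans (cong real (D.division n f below i)) (one* (convℚ (D.quo n f) g i) (D.rem n f i))) t ⟩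
              eval N (λ i → 1ᵍ *ᵍ real (convℚ (D.quo n f) g i) +ᵍ 1ᵍ *ᵍ real (D.rem n f i)) t
                ≡⟨ eval-linear N 1ᵍ 1ᵍ (real ∘ convℚ (D.quo n f) g) (real ∘ D.rem n f) t ⟩
              1ᵍ *ᵍ eval N (real ∘ convℚ (D.quo n f) g) t +ᵍ 1ᵍ *ᵍ eval N (real ∘ D.rem n f) t
                ≡⟨ cong₂ (λ u v → 1ᵍ *ᵍ u +ᵍ 1ᵍ *ᵍ v)
                     (trans (eval-cong N {real ∘ convℚ (D.quo n f) g} {convᵍ (real ∘ D.quo n f) (real ∘ g)} (λ i _ → real-conv (D.quo n f) g i) t)
                       (trans (eval-conv n 2 (real ∘ D.quo n f) (real ∘ g) (real-below q-below) (real-below g-below) t)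
                       (cong (eval n (real ∘ D.quo n f) t *ᵍ_) (g-at t))))
                     (eval-extend {1} {N} (s≤s z≤n) (real-below (D.rem-below n f)) t) ⟩
              1ᵍ *ᵍ (eval n (real ∘ D.quo n f) t *ᵍ (t -ᵍ t)) +ᵍ 1ᵍ *ᵍ eval 1 (real ∘ D.rem n f) t
                ≡⟨ collapse (eval n (real ∘ D.quo n f) t) t (eval 1 (real ∘ D.rem n f) t) ⟩
              eval 1 (real ∘ D.rem n f) t ∎
              where
              open ≡-Reasoning
              one* : ∀ a b → real (a + b) ≡ 1ᵍ *ᵍ real a +ᵍ 1ᵍ *ᵍ real b
              one* a b = cong₂ _+ᵍ_ (unit* (real a)) (unit* (real b))
                where
                unit* : ∀ a → a ≡ 1ᵍ *ᵍ a
                unit* = solve-∀ 𝔾-ring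
              collapse : ∀ q t r → 1ᵍ *ᵍ (q *ᵍ (t -ᵍ t)) +ᵍ 1ᵍ *ᵍ r ≡ r
              collapse = solve-∀ 𝔾-ring
          f≡ : ∀ i → f i ≡ convℚ (D.quo n f) g i
          f≡ i = trans (D.division n f below i) (trans (cong (convℚ (D.quo n f) g i +_) (rem≡0 i)) (ℚ.+-identityʳ _))
        -- The product `F * G ^ a` is at most `(F * G) ^ e`. The maximum with 1 accounts for the
        -- factor `F` when `a = 0`, and then `e ≤ d ∸ 2` needs `3 ≤ d`.
        e : ℕ
        e = 1 ℕ.⊔ a
        e≤ : e ℕ.≤ d ℕ.∸ 2
        e≤ = ℕ.⊔-lub (ℕ.m+n≤o⇒m≤o∸n 1 3≤d) (ℕ.m+n≤o⇒m≤o∸n a (subst (ℕ._≤ d) (sym (trans (ℕ.+-suc a 1) refl)) degrees))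
        X = (1ℚ + 2ℚ) * G
        0≤3 : 0ℚ ≤ 1ℚ + 2ℚ
        0≤3 = +-nonNeg {1ℚ} {2ℚ} 0≤1 (ℚ.<⇒≤ 0<2)
        1≤X : 1ℚ ≤ X
        1≤X = ℚ.≤-trans 1≤G (≤-*ˡ {G} {1ℚ + 2ℚ} 0≤G (≤-+ʳ {1ℚ} {2ℚ} (ℚ.<⇒≤ 0<2)))
        t≤G : ‖ t ‖ ≤ G
        t≤G = ℚ.≤-trans (ℚ.≤-reflexive (‖neg‖ (real (g 0)))) (g≤G 0)
        s = fromℕ (n ℕ.* n)
        0≤s : 0ℚ ≤ s
        0≤s = fromℕ-nonNeg (n ℕ.* n)
        D′ : ℕ → ℚ
        D′ k = distance z y k
        conclude : ∀ k → ((D′ k ≤ 1ℚ → Close (suc a) (z k) (y k) (D′ k) η) × ‖ eval n (real ∘ f) (z k) ‖ < η) × ‖ eval 2 (real ∘ g) (y k) ‖ < η →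
          D′ k ≤ 1ℚ → 1ℚ ≤ linearConstant (suc a) * (D′ k * B ^ (d ℕ.∸ 2))
        conclude k ((close , fz) , gy) δ≤1 = begin
          1ℚ
            ≡⟨ sym ‖1‖ ⟩
          ‖ 1ᵍ ‖
            ≤⟨ *-integer≥1 1ᵍ (eval-int n (real ∘ f) t f-int t-int) ft≢0 ⟩
          ‖ 1ᵍ *ᵍ eval n (real ∘ f) t ‖
            ≡⟨ cong ‖_‖ (lemma₁ (eval n (real ∘ f) t) (eval n (real ∘ f) (z k))) ⟩
          ‖ eval n (real ∘ f) (z k) +ᵍ (eval n (real ∘ f) t -ᵍ eval n (real ∘ f) (z k)) ‖
            ≤⟨ ‖+‖ _ _ ⟩
          ‖ eval n (real ∘ f) (z k) ‖ + ‖ eval n (real ∘ f) t -ᵍ eval n (real ∘ f) (z k) ‖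
            ≤⟨ ℚ.+-mono-≤ (ℚ.≤-trans (ℚ.<⇒≤ fz) η≤δ) (ℚ.≤-trans (ℚ.≤-reflexive (cong ‖_‖ (eval-difference n (real ∘ f) (z k) t)))
                 (ℚ.≤-trans (‖*‖ (t -ᵍ z k) _) (*-mono (‖‖-nonNeg (divided n (real ∘ f) (z k) t)) (+-nonNeg 0≤δ 0≤δ) tz
                   (divided-bound n a ℕ.≤-refl 0≤F 1≤X f≤F z≤X t≤X)))) ⟩
          δ + (δ + δ) * (s * (F * X ^ a))
            ≡⟨ cong (λ w → δ + (δ + δ) * (s * (F * w))) (^-distrib-* (1ℚ + 2ℚ) G a) ⟩
          δ + (δ + δ) * (s * (F * ((1ℚ + 2ℚ) ^ a * G ^ a)))
            ≡⟨ lemma₂ δ s F ((1ℚ + 2ℚ) ^ a) (G ^ a) ⟩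
          δ * 1ℚ + 2ℚ * (s * (1ℚ + 2ℚ) ^ a) * (δ * (F * G ^ a))
            ≤⟨ ℚ.+-mono-≤ (*-monoʳ 0≤δ (ℚ.≤-trans (1≤^ e 1≤FG) (power≤ e≤)))
                 (*-monoʳ (*-nonNeg {2ℚ} (ℚ.<⇒≤ 0<2) (*-nonNeg 0≤s (^-nonNeg a 0≤3))) (*-monoʳ 0≤δ (ℚ.≤-trans FGᵃ≤ (power≤ e≤)))) ⟩
          δ * B ^ (d ℕ.∸ 2) + 2ℚ * (s * (1ℚ + 2ℚ) ^ a) * (δ * B ^ (d ℕ.∸ 2))
            ≡⟨ lemma₃ (δ * B ^ (d ℕ.∸ 2)) (2ℚ * (s * (1ℚ + 2ℚ) ^ a)) ⟩
          linearConstant (suc a) * (δ * B ^ (d ℕ.∸ 2)) ∎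
          where
          open ℚ.≤-Reasoning
          δ = D′ k
          module C = CloseProperties (close δ≤1)
          0≤δ = C.0≤δ
          1≤‖‖ : 1ℚ ≤ 2ℚ * (‖ z k ‖ + 1ℚ)
          1≤‖‖ = ℚ.≤-trans (≤-+ˡ (‖‖-nonNeg (z k))) (≤-*ˡ {‖ z k ‖ + 1ℚ} {2ℚ} (+-nonNeg (‖‖-nonNeg (z k)) 0≤1) 1≤2)
          η≤δ : η ≤ δ
          η≤δ = ℚ.≤-trans (C.η≤δδ ℚ.≤-refl 1≤‖‖) C.δδ≤δ
          tz : ‖ t -ᵍ z k ‖ ≤ δ + δ
          tz = begin
            ‖ t -ᵍ z k ‖  ≡⟨ cong ‖_‖ (lemma₄ t (y k) (z k)) ⟩
            ‖ (y k -ᵍ z k) -ᵍ (y k -ᵍ t) ‖  ≤⟨ ‖-‖ _ _ ⟩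
            δ + ‖ y k -ᵍ t ‖  ≤⟨ ℚ.+-monoʳ-≤ δ (ℚ.≤-trans (ℚ.≤-reflexive (cong ‖_‖ (sym (g-at (y k))))) (ℚ.≤-trans (ℚ.<⇒≤ gy) η≤δ)) ⟩
            δ + δ  ∎
            where
            lemma₄ : ∀ t y z → t -ᵍ z ≡ (y -ᵍ z) -ᵍ (y -ᵍ t)
            lemma₄ = solve-∀ 𝔾-ring
          t≤X : ‖ t ‖ ≤ X
          t≤X = ℚ.≤-trans t≤G (≤-*ˡ {G} {1ℚ + 2ℚ} 0≤G (≤-+ʳ {1ℚ} {2ℚ} (ℚ.<⇒≤ 0<2)))
          z≤X : ‖ z k ‖ ≤ X
          z≤X = begin
            ‖ z k ‖  ≤⟨ ≤-triangle (z k) t ⟩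
            ‖ t ‖ + ‖ z k -ᵍ t ‖  ≤⟨ ℚ.+-mono-≤ t≤G (ℚ.≤-trans (ℚ.≤-reflexive (‖-‖-comm (z k) t)) (ℚ.≤-trans tz (ℚ.+-mono-≤ δ≤1 δ≤1))) ⟩
            G + (1ℚ + 1ℚ)  ≤⟨ ℚ.+-monoʳ-≤ G (≤-*ʳ {2ℚ} (ℚ.<⇒≤ 0<2) 1≤G) ⟩
            G + 2ℚ * G  ≡⟨ lemma₅ G 2ℚ ⟩
            X  ∎
            where
            lemma₅ : ∀ G t → G + t * G ≡ (1ℚ + t) * G
            lemma₅ = solve-∀ ℚ-ring
          FGᵃ≤ : F * G ^ a ≤ (F * G) ^ e
          FGᵃ≤ = begin
            F * G ^ a  ≡⟨ cong (_* G ^ a) (sym (ℚ.*-identityʳ F)) ⟩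
            F ^ 1 * G ^ a  ≤⟨ *-mono (^-nonNeg a 0≤G) (^-nonNeg e 0≤F) (^-monoʳ 1≤F (ℕ.m≤m⊔n 1 a)) (^-monoʳ 1≤G (ℕ.m≤n⊔m 1 a)) ⟩
            F ^ e * G ^ e  ≡⟨ sym (^-distrib-* F G e) ⟩
            (F * G) ^ e  ∎
          lemma₁ : ∀ u v → 1ᵍ *ᵍ u ≡ v +ᵍ (u -ᵍ v)
          lemma₁ = solve-∀ 𝔾-ring
          lemma₂ : ∀ d s F T G → d + (d + d) * (s * (F * (T * G))) ≡ d * 1ℚ + (1ℚ + 1ℚ) * (s * T) * (d * (F * G))
          lemma₂ = solve-∀ ℚ-ring
          lemma₃ : ∀ a b → a + b * a ≡ (1ℚ + b) * a
          lemma₃ = solve-∀ ℚ-ring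

    -- The discriminant bounds the square of the distance; squaring the other cases too avoids a
    -- square root of its constant.
    Bounded² : ℚ → Set
    Bounded² C = Eventually λ k → distance z y k ≤ 1ℚ → 1ℚ ≤ C * (distance z y k * B ^ (d ℕ.∸ 2) * (distance z y k * B ^ (d ℕ.∸ 2)))

    derivativeℚ : (ℕ → ℚ) → ℕ → ℚ
    derivativeℚ f i = fromℕ (suc i) * f (suc i)

    repeated-bounded : ∀ k f → Vz.Minimal (suc (suc k)) f → Vy.V (suc (suc (suc k))) f → Integers f → (∀ i → ‖ real (f i) ‖ ≤ B) →
      suc (suc (suc k)) ℕ.≤ d → 0ℚ ≤ discriminantConstant k → Bounded² (discriminantConstant k)
    repeated-bounded k f minimal root-y f-int f≤B m<d 0≤C =
      eventually-map conclude (proj₂ (proj₂ closeness) ∩ vanishes η 0<η ∩ root-y η 0<η)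
      where
      open Vz.Minimal minimal
      m = suc (suc k)
      closeness = close-eventually m z y σ (cauchyG-bounded cz) 0<σ apart
      η = proj₁ closeness
      0<η = proj₁ (proj₂ closeness)
      F-max = largest m (real ∘ f) (real-below below)
      F = ‖ real (f (proj₁ F-max)) ‖
      f≤F = proj₂ (proj₂ F-max)
      1≤F : 1ℚ ≤ F
      1≤F = 1≤top f monic (f≤F m)
      g = derivativeℚ f
      g-below : Below 0ℚ m g
      g-below i m≤i = trans (cong (fromℕ (suc i) *_) (below (suc i) (s≤s m≤i))) (ℚ.*-zeroʳ (fromℕ (suc i)))
      g≢0 : ¬ (∀ i → g i ≡ 0ℚ)
      g≢0 h = ℚ.<-irrefl (sym (trans (sym (trans (cong (fromℕ m *_) monic) (ℚ.*-identityʳ (fromℕ m)))) (h (suc k)))) (fromℕ-mono< {0} {m} (s≤s z≤n))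
      -- The derivative is a nonzero polynomial of smaller degree than the minimal polynomial, so
      -- that it does not vanish at `z`.
      det≢0 : det m (bezoutian (derivative (real ∘ f)) (real ∘ f)) ≢ 0ᵍ
      det≢0 e = bezoutian-det≢0 z cz m f g minimal (λ i h → g-below i (ℕ.≤-trans (ℕ.n≤1+n m) h))
        (λ V → g≢0 (least g g-below (Vz.V-restrict (ℕ.n≤1+n m) g-below V)))
        (trans (sym (det-cong m (bezoutian-congˡ {derivative (real ∘ f)} {real ∘ g} (real ∘ f) g≡))) e)
        where
        g≡ : ∀ i → derivative (real ∘ f) i ≡ real (g i)
        g≡ i = sym (real-* (fromℕ (suc i)) (f (suc i)))
      power≤ : F ^ suc k ≤ B ^ (d ℕ.∸ 2)
      power≤ = ℚ.≤-trans (^-mono (suc k) (ℚ.≤-trans 0≤1 1≤F) F≤B) (^-monoʳ (ℚ.≤-trans 1≤F F≤B)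
        (ℕ.m+n≤o⇒m≤o∸n (suc k) (subst (ℕ._≤ d) (cong suc (ℕ.+-comm 2 k)) m<d)))
        where F≤B = f≤B (proj₁ F-max)
      conclude : ∀ i → ((distance z y i ≤ 1ℚ → Close m (z i) (y i) (distance z y i) η) × ‖ eval (suc m) (real ∘ f) (z i) ‖ < η) × ‖ eval (suc m) (real ∘ f) (y i) ‖ < η →
        distance z y i ≤ 1ℚ → 1ℚ ≤ discriminantConstant k * (distance z y i * B ^ (d ℕ.∸ 2) * (distance z y i * B ^ (d ℕ.∸ 2)))
      conclude i ((close , fz) , fy) δ≤1 = ℚ.≤-trans
        (discriminant-separation k (real ∘ f) F (z i) (y i) η f-int (real-below below) (cong real monic) f≤F 1≤F det≢0 (close δ≤1) (ℚ.<⇒≤ fz) (ℚ.<⇒≤ fy))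
        (*-monoʳ 0≤C (*-mono 0≤δF (ℚ.≤-trans 0≤δF δF≤) δF≤ δF≤))
        where
        0≤δ = ‖‖-nonNeg (y i -ᵍ z i)
        0≤δF = *-nonNeg 0≤δ (^-nonNeg (suc k) (ℚ.≤-trans 0≤1 1≤F))
        δF≤ = *-monoʳ 0≤δ power≤

    repeated-linear : ∀ f → f 1 ≡ 1ℚ → Vz.V 2 f → Vy.V 2 f → ⊥
    repeated-linear f f1 hz hy = let N , h = apart ∩ hz (½ * σ) (half>0 σ 0<σ) ∩ hy (½ * σ) (half>0 σ 0<σ)
                                     (σ≤ , fz) , fy = h N ℕ.≤-refl
      in ℚ.<-irrefl refl (ℚ.<-≤-trans (ℚ.≤-<-trans (ℚ.≤-reflexive (cong ‖_‖ (difference (y N) (z N)))) (ℚ.≤-<-trans (‖-‖ _ _)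
           (ℚ.<-≤-trans (ℚ.+-mono-< fy fz) (ℚ.≤-reflexive (half+half σ))))) σ≤)
      where
      open import Data.Rational.Base using (½)
      difference : ∀ y z → y -ᵍ z ≡ eval 2 (real ∘ f) y -ᵍ eval 2 (real ∘ f) z
      difference y z = trans (lemma (real (f 0)) y z) (cong (λ u → real (f 0) +ᵍ y *ᵍ (real u +ᵍ y *ᵍ 0ᵍ) -ᵍ (real (f 0) +ᵍ z *ᵍ (real u +ᵍ z *ᵍ 0ᵍ))) (sym f1))
        where
        lemma : ∀ f y z → y -ᵍ z ≡ f +ᵍ y *ᵍ (1ᵍ +ᵍ y *ᵍ 0ᵍ) -ᵍ (f +ᵍ z *ᵍ (1ᵍ +ᵍ z *ᵍ 0ᵍ))
        lemma = solve-∀ 𝔾-ring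

-- Separation of the roots of a reducible monic polynomial

module Separation where
  open import Data.Rational.Base using (_+_; _*_; _-_; -_; _≤_; _<_)
  open import Tactic.RingSolver using (solve-∀)
  open Rationals
  open Gaussian
  open ExteriorAlgebra
  open Polynomials
  open Bounds
  open Coprime
  open Discriminant
  open GaussLemma
  open Gelfond
  open Division
  open Places
  open UpperBound

  member-sum : ∀ n f i → (∀ i → 0ℚ ≤ f i) → i ℕ.< n → f i ≤ sumℚ n f
  member-sum (suc n) f zero    h _         = ≤-+ʳ (sumℚ-nonNeg n (h ∘ suc))
  member-sum (suc n) f (suc i) h (s≤s i<n) = ℚ.≤-trans (member-sum n (f ∘ suc) i (h ∘ suc) i<n) (≤-+ˡ (h 0))

  total : ℕ → (ℕ → ℕ → ℚ) → ℚ
  total n c = sumℚ n (λ a → sumℚ n (c a))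

  total-nonNeg : ∀ n c → (∀ a b → 0ℚ ≤ c a b) → 0ℚ ≤ total n c
  total-nonNeg n c h = sumℚ-nonNeg n λ a → sumℚ-nonNeg n (h a)

  member-total : ∀ n c a b → (∀ a b → 0ℚ ≤ c a b) → a ℕ.< n → b ℕ.< n → c a b ≤ total n c
  member-total n c a b h a<n b<n = ℚ.≤-trans (member-sum n (c a) b (h a) b<n)
    (member-sum n (λ a → sumℚ n (c a)) a (λ a → sumℚ-nonNeg n (h a)) a<n)

  0≤2 : 0ℚ ≤ 2ℚ
  0≤2 = ℚ.<⇒≤ 0<2

  gelfondConstant-nonNeg : ∀ a b → 0ℚ ≤ gelfondConstant a b
  gelfondConstant-nonNeg a b = *-nonNeg (*-nonNeg (interpolationConstant-nonNeg (suc a) (a ℕ.+ b)) (interpolationConstant-nonNeg (suc b) (a ℕ.+ b)))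
    (*-nonNeg 0≤2 (*-nonNeg (fromℕ-nonNeg (suc a ℕ.+ suc b)) (^-nonNeg (suc a ℕ.+ suc b) (fromℕ-nonNeg (suc (a ℕ.+ b))))))

  quotientConstant-nonNeg : ∀ m → 0ℚ ≤ quotientConstant m
  quotientConstant-nonNeg m = *-nonNeg (^-nonNeg (suc m) 0≤2) (fromℕ-nonNeg (suc m))

  4ⁿ-nonNeg : ∀ n → 0ℚ ≤ (2ℚ * 2ℚ) ^ n
  4ⁿ-nonNeg n = ^-nonNeg n (*-nonNeg {2ℚ} {2ℚ} 0≤2 0≤2)

  coprimeConstant-nonNeg : ∀ a b → 0ℚ ≤ coprimeConstant a b
  coprimeConstant-nonNeg a b = *-nonNeg (4ⁿ-nonNeg b) (^-nonNeg a
    (+-nonNeg (*-nonNeg (fromℕ-nonNeg a) (*-nonNeg 0≤2 (fromℕ-nonNeg a)))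
      (*-nonNeg (fromℕ-nonNeg a) (+-nonNeg (*-nonNeg (+-nonNeg 0≤1 (fromℕ-nonNeg (suc (suc b) ℕ.* suc (suc b)))) (quotientConstant-nonNeg a)) (fromℕ-nonNeg a)))))

  discriminantConstant-nonNeg : ∀ k → 0ℚ ≤ discriminantConstant k
  discriminantConstant-nonNeg k = *-nonNeg (*-nonNeg (*-nonNeg 0≤2 (*-nonNeg (4ⁿ-nonNeg k) (4ⁿ-nonNeg k))) (*-nonNeg slope≥0 slope≥0))
      (^-nonNeg m (*-nonNeg M≥0 (+-nonNeg (+-nonNeg (*-nonNeg (*-nonNeg 0≤2 M≥0) M≥0) (+-nonNeg (quotientConstant-nonNeg m) (*-nonNeg M≥0 M≥0)))
        (+-nonNeg 0≤1 (*-nonNeg (*-nonNeg M≥0 M≥0) M≥0)))))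
    where
    m = suc (suc k)
    M≥0 = fromℕ-nonNeg m
    slope≥0 : 0ℚ ≤ slopeConstant m
    slope≥0 = *-nonNeg 0≤2 (+-nonNeg 0≤2 (fromℕ-nonNeg (suc m ℕ.* suc m ℕ.* suc m)))

  caseConstant : ℕ → ℕ → ℚ
  caseConstant a b = coprimeConstant a b * coprimeConstant a b + (linearConstant a * linearConstant a + discriminantConstant a)

  caseConstant-nonNeg : ∀ a b → 0ℚ ≤ caseConstant a b
  caseConstant-nonNeg a b = +-nonNeg (square-nonNeg (coprimeConstant a b)) (+-nonNeg (square-nonNeg (linearConstant a)) (discriminantConstant-nonNeg a))

  -- Sums over all degrees up to `d` in place of maxima: the terms are nonnegative, so that the sum
  -- dominates each of them and depends on `d` alone.
  separationConstant factorConstant : ℕ → ℚ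
  separationConstant d = total (suc d) caseConstant
  factorConstant d = 1ℚ + total (suc d) gelfondConstant

  1≤factorConstant : ∀ d → 1ℚ ≤ factorConstant d
  1≤factorConstant d = ≤-+ʳ (total-nonNeg (suc d) gelfondConstant gelfondConstant-nonNeg)

  gelfond≤ : ∀ d a b → a ℕ.≤ d → b ℕ.≤ d → gelfondConstant a b ≤ factorConstant d
  gelfond≤ d a b a≤d b≤d = ℚ.≤-trans (member-total (suc d) gelfondConstant a b gelfondConstant-nonNeg (s≤s a≤d) (s≤s b≤d)) (≤-+ˡ 0≤1)

  factor-bound : ∀ d a b p q r H → a ℕ.≤ d → b ℕ.≤ d → Below 0ℚ (suc a) p → Below 0ℚ (suc b) q → (∀ k → r k ≡ convℚ p q k) →
    0ℚ ≤ H → (∀ k → ‖ real (r k) ‖ ≤ H) → ∀ i j → ‖ real (p i) ‖ * ‖ real (q j) ‖ ≤ factorConstant d * H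
  factor-bound d a b p q r H a≤d b≤d hp hq e 0≤H r≤H i j =
    let i₀ , i₀<a , p-max = largest a (real ∘ p) (real-below hp)
        j₀ , j₀<b , q-max = largest b (real ∘ q) (real-below hq)
    in ℚ.≤-trans (*-mono (‖‖-nonNeg (real (q j))) (‖‖-nonNeg (real (p i₀))) (p-max i) (q-max j))
       (ℚ.≤-trans (gelfond a b (real ∘ p) (real ∘ q) (real ∘ r) i₀ j₀ H i₀<a j₀<b 0≤H r≤H product)
         (*-monoˡ 0≤H (gelfond≤ d a b a≤d b≤d)))
    where
    product : ∀ x → eval (suc a ℕ.+ suc b) (real ∘ r) x ≡ eval (suc a) (real ∘ p) x *ᵍ eval (suc b) (real ∘ q) x
    product x = trans (eval-cong (suc a ℕ.+ suc b) (λ k _ → trans (cong real (e k)) (real-conv p q k)) x)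
      (eval-conv (suc a) (suc b) (real ∘ p) (real ∘ q) (real-below hp) (real-below hq) x)

  convℚ-zeroˡ : ∀ A B → (∀ i → A i ≡ 0ℚ) → ∀ k → convℚ A B k ≡ 0ℚ
  convℚ-zeroˡ A B h zero    = trans (cong (_* B 0) (h 0)) (ℚ.*-zeroˡ (B 0))
  convℚ-zeroˡ A B h (suc k) = trans (cong₂ (λ u v → u * B (suc k) + v) (h 0) (convℚ-zeroˡ (A ∘ suc) B (h ∘ suc) k))
    (trans (ℚ.+-identityʳ _) (ℚ.*-zeroˡ (B (suc k))))

  convℚ-top : ∀ a b A B → Below 0ℚ (suc a) A → Below 0ℚ (suc b) B → convℚ A B (a ℕ.+ b) ≡ A a * B b
  convℚ-top zero    zero    A B hA hB = refl
  convℚ-top zero    (suc b) A B hA hB = trans (cong (A 0 * B (suc b) +_) (convℚ-zeroˡ (A ∘ suc) B (λ i → hA (suc i) (s≤s z≤n)) b)) (ℚ.+-identityʳ _)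
  convℚ-top (suc a) b A B hA hB = trans (cong₂ (λ u v → A 0 * u + v) (hB (suc (a ℕ.+ b)) (s≤s (ℕ.m≤n+m b a))) (convℚ-top a b (A ∘ suc) B (below-tail (suc a) hA) hB))
    (lemma (A 0) _)
    where
    lemma : ∀ a t → a * 0ℚ + t ≡ t
    lemma = solve-∀ ℚ-ring

  convℚ-below : ∀ a b A B → Below 0ℚ (suc a) A → Below 0ℚ (suc b) B → ∀ k → suc (a ℕ.+ b) ℕ.≤ k → convℚ A B k ≡ 0ℚ
  convℚ-below zero    b A B hA hB (suc k) (s≤s b≤k) = trans (cong₂ (λ u v → A 0 * u + v) (hB (suc k) (s≤s b≤k)) (convℚ-zeroˡ (A ∘ suc) B (λ i → hA (suc i) (s≤s z≤n)) k)) (trans (ℚ.+-identityʳ _) (ℚ.*-zeroʳ (A 0)))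
  convℚ-below (suc a) b A B hA hB (suc k) (s≤s h) = trans (cong₂ (λ u v → A 0 * u + v) (hB (suc k) (s≤s (ℕ.≤-trans (ℕ.m≤n+m b (suc a)) h))) (convℚ-below a b (A ∘ suc) B (below-tail (suc a) hA) hB k h)) (trans (ℚ.+-identityʳ _) (ℚ.*-zeroʳ (A 0)))

  module _ (z : ℕ → 𝔾) (cz : CauchyG z) where
    open Place z cz

    record Cofactor (d m : ℕ) (f P : ℕ → ℚ) : Set where
      field
        e       : ℕ
        degree  : e ℕ.+ suc m ≡ d
        q       : ℕ → ℚ
        q-monic : q e ≡ 1ℚ
        q-below : Below 0ℚ (suc e) q
        q-int   : Integers q
        f-int   : Integers f
        product : ∀ k → P k ≡ convℚ q f k

    cofactor : ∀ d m f → Minimal (suc m) f → suc m ℕ.≤ d → ∀ P → P d ≡ 1ℚ → Below 0ℚ (suc d) P → (∀ k → ∃ λ c → P k ≡ fromℤ c) → V (suc d) P →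
      Cofactor d m f P
    cofactor d m f min m<d P P-monic P-below P-int VP = record
      { e = e ; degree = degree ; q = q ; q-monic = q-monic ; q-below = q-below ; product = product
      ; q-int = λ i → proj₁ integral i , cong real (proj₁ (proj₂ (proj₂ integral)) i)
      ; f-int = λ i → proj₁ (proj₂ integral) i , cong real (proj₂ (proj₂ (proj₂ integral)) i) }
      where
      open Minimal min
      module D = Divide m f monic below
      e = d ℕ.∸ suc m
      degree : e ℕ.+ suc m ≡ d
      degree = ℕ.m∸n+n≡m m<d
      q = D.quo (suc d) P
      q-monic : q e ≡ 1ℚ
      q-monic = trans (subst (λ n → D.quo (suc n) P e ≡ P n) degree (D.quo-top e P (subst (λ n → Below 0ℚ (suc n) P) (sym degree) P-below))) P-monic
      q-below : Below 0ℚ (suc e) q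
      q-below i e<i = D.quo-below (suc d) P P-below i (subst (ℕ._≤ i ℕ.+ suc m) (cong suc degree) (ℕ.+-monoˡ-≤ (suc m) e<i))
      product = minimal-divides m f min (suc d) P P-below VP
      integral = monic-factors-integral e (suc m) q f (λ k → proj₁ (P-int k)) q-monic monic q-below below
        (λ k → trans (sym (proj₂ (P-int k))) (product k))

  integer-values : ∀ {q : ℕ → ℚ} → Integers q → ∀ k → ∃ λ c → q k ≡ fromℤ c
  integer-values h k = proj₁ (h k) , real-injective (proj₂ (h k))

  module _ (d : ℕ) (3≤d : 3 ℕ.≤ d) (P : ℕ → ℚ) (P-monic : P d ≡ 1ℚ) (P-below : Below 0ℚ (suc d) P)
    (P-int : ∀ k → ∃ λ c → P k ≡ fromℤ c) (H : ℚ) (P≤H : ∀ k → ‖ real (P k) ‖ ≤ H) where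

    1≤H : 1ℚ ≤ H
    1≤H = 1≤top P P-monic (P≤H d)
    0≤H = ℚ.≤-trans 0≤1 1≤H
    -- Gelfond's inequality is applied twice, to `P = q f` and to the factorisation of `q` that
    -- splits off `g`; hence two factors `K`.
    K B : ℚ
    K = factorConstant d
    B = K * (K * H)
    1≤K = 1≤factorConstant d
    0≤K = ℚ.≤-trans 0≤1 1≤K
    0≤KH = *-nonNeg 0≤K 0≤H

    module Points (z y : ℕ → 𝔾) (cz : CauchyG z) (cy : CauchyG y) (σ : ℚ) (0<σ : 0ℚ < σ)
      (apart : Eventually λ k → σ ≤ distance z y k) where
      open Cases z y cz cy σ 0<σ apart d B public

      Separated : Set
      Separated = Bounded² (separationConstant d)

      enlarge : ∀ {C} → C ≤ separationConstant d → Bounded² C → Separated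
      enlarge C≤ = eventually-map λ k h δ≤1 → ℚ.≤-trans (h δ≤1) (*-monoˡ (square-nonNeg (distance z y k * B ^ (d ℕ.∸ 2))) C≤)

      squared : ∀ {C} → Bounded C → Bounded² (C * C)
      squared {C} = eventually-map λ k h δ≤1 → ℚ.≤-trans (h δ≤1) (ℚ.≤-trans (≤-*ʳ (ℚ.≤-trans 0≤1 (h δ≤1)) (h δ≤1)) (ℚ.≤-reflexive (lemma C _)))
        where
        lemma : ∀ c x → c * x * (c * x) ≡ c * c * (x * x)
        lemma = solve-∀ ℚ-ring

      case≤ : ∀ a b → a ℕ.≤ d → b ℕ.≤ d → caseConstant a b ≤ separationConstant d
      case≤ a b a≤d b≤d = member-total (suc d) caseConstant a b caseConstant-nonNeg (s≤s a≤d) (s≤s b≤d)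

      pair-separated : ∀ {a b f g} → Pair a b f g → Separated
      pair-separated {a} {zero} pair = enlarge {linearConstant (suc a) * linearConstant (suc a)} (ℚ.≤-trans (≤-+ʳ {linearConstant (suc a) * linearConstant (suc a)} (discriminantConstant-nonNeg (suc a)))
          (ℚ.≤-trans (≤-+ˡ (square-nonNeg (coprimeConstant (suc a) 0))) (case≤ (suc a) 0 (ℕ.m+n≤o⇒m≤o (suc a) (Pair.degrees pair)) z≤n)))
        (squared {linearConstant (suc a)} (PairBound.linear-bounded pair refl 3≤d))
      pair-separated {a} {suc b} pair = enlarge {coprimeConstant (suc a) (suc b) * coprimeConstant (suc a) (suc b)} (ℚ.≤-trans (≤-+ʳ {coprimeConstant (suc a) (suc b) * coprimeConstant (suc a) (suc b)} (+-nonNeg (square-nonNeg (linearConstant (suc a))) (discriminantConstant-nonNeg (suc a))))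
          (case≤ (suc a) (suc b) (ℕ.m+n≤o⇒m≤o (suc a) (Pair.degrees pair)) (ℕ.≤-trans (ℕ.n≤1+n (suc b)) (ℕ.m+n≤o⇒n≤o (suc a) (Pair.degrees pair)))))
        (squared {coprimeConstant (suc a) (suc b)} (PairBound.coprime-bounded pair (s≤s z≤n) (coprimeConstant-nonNeg (suc a) (suc b))))

      repeated-separated : ∀ m f → Vz.Minimal (suc m) f → Vy.V (suc (suc m)) f → Integers f → (∀ i → ‖ real (f i) ‖ ≤ B) → suc (suc m) ℕ.≤ d → Separated
      repeated-separated zero    f min root-y f-int f≤B m<d = ⊥-elim (repeated-linear f (Vz.Minimal.monic min) (Vz.Minimal.vanishes min) root-y)
      repeated-separated (suc k) f min root-y f-int f≤B m<d = enlarge {discriminantConstant k} (ℚ.≤-trans (≤-+ˡ {discriminantConstant k} (square-nonNeg (linearConstant k)))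
          (ℚ.≤-trans (≤-+ˡ (square-nonNeg (coprimeConstant k 0))) (case≤ k 0 (ℕ.≤-trans (ℕ.m≤n+m k 3) m<d) z≤n)))
        (repeated-bounded k f min root-y f-int f≤B m<d (discriminantConstant-nonNeg k))

    module Main (z y : ℕ → 𝔾) (cz : CauchyG z) (cy : CauchyG y) (σ : ℚ) (0<σ : 0ℚ < σ)
      (apart : Eventually λ k → σ ≤ distance z y k) where

      apart′ : Eventually λ k → σ ≤ distance y z k
      apart′ = eventually-map (λ k → subst (σ ≤_) (‖-‖-comm (y k) (z k))) apart

      module P₁ = Points z y cz cy σ 0<σ apart
      module P₂ = Points y z cy cz σ 0<σ apart′
      open P₁ using (module Vz; module Vy; Separated)

      swap-separated : P₂.Separated → Separated
      swap-separated = eventually-map λ k → subst (λ δ → δ ≤ 1ℚ → 1ℚ ≤ separationConstant d * (δ * B ^ (d ℕ.∸ 2) * (δ * B ^ (d ℕ.∸ 2)))) (‖-‖-comm (z k) (y k))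

      -- Let `f` be the minimal polynomial of `z`. Either `y` is a root of `f`, and the discriminant
      -- applies, or `y` is a root of the cofactor `q`. Then its minimal polynomial `g` divides `q`,
      -- the degrees add up to at most `d`, and the polynomial of larger degree takes the first
      -- place in `Pair`, exchanging `z` and `y` if necessary.
      from-minimal : ∀ m f → Vz.Minimal (suc m) f → suc (suc m) ℕ.≤ d → Vz.V (suc d) P → Vy.V (suc d) P → ¬ ¬ Separated
      from-minimal m f min m<d VzP VyP ¬sep =
          Vy.V-conv (suc e) (suc (suc m)) q f q-below below
            (Vy.V-cong {suc e ℕ.+ suc (suc m)} product (Vy.V-extend lengths P-below VyP)) λ
            { (inj₂ Vf) → ¬Vyf Vf
            ; (inj₁ Vq) → Vy.minimal-exists e q q-monic q-below Vq λ { zero g _ gmin → Vy.minimal-degree {g} gmin ; (suc b) g b<e gmin → second b g b<e gmin Vq } }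
        where
        open Vz.Minimal min
        open Cofactor (cofactor z cz d m f min (ℕ.≤-trans (ℕ.n≤1+n (suc m)) m<d) P P-monic P-below P-int VzP)
        lengths : suc d ℕ.≤ suc e ℕ.+ suc (suc m)
        lengths = s≤s (subst (ℕ._≤ e ℕ.+ suc (suc m)) degree (ℕ.+-monoʳ-≤ e (ℕ.n≤1+n (suc m))))
        e≤d : e ℕ.≤ d
        e≤d = subst (e ℕ.≤_) degree (ℕ.m≤m+n e (suc m))
        m≤d : suc m ℕ.≤ d
        m≤d = ℕ.≤-trans (ℕ.n≤1+n (suc m)) m<d
        qf≤ : ∀ i j → ‖ real (q i) ‖ * ‖ real (f j) ‖ ≤ K * H
        qf≤ = factor-bound d e (suc m) q f P H e≤d m≤d q-below below product 0≤H P≤H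
        f≤B : ∀ j → ‖ real (f j) ‖ ≤ B
        f≤B j = ℚ.≤-trans (ℚ.≤-trans (ℚ.≤-reflexive (sym (ℚ.*-identityˡ _)))
            (ℚ.≤-trans (*-monoˡ (‖‖-nonNeg (real (f j))) (ℚ.≤-reflexive (sym (trans (cong (λ t → ‖ real t ‖) q-monic) ‖1‖)))) (qf≤ e j)))
          (≤-*ˡ 0≤KH 1≤K)
        ¬Vyf : ¬ Vy.V (suc (suc m)) f
        ¬Vyf Vf = ¬sep (P₁.repeated-separated m f min Vf f-int f≤B m<d)
        second : ∀ b g → suc b ℕ.≤ e → Vy.Minimal (suc b) g → Vy.V (suc e) q → ⊥
        second b g b<e gmin Vq = compare (ℕ.≤-total b m)
          where
          module g = Vy.Minimal gmin
          module C = Cofactor (cofactor y cy e b g gmin b<e q q-monic q-below (integer-values q-int) Vq)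
          degrees : suc m ℕ.+ suc b ℕ.≤ d
          degrees = subst (suc m ℕ.+ suc b ℕ.≤_) (trans (ℕ.+-comm (suc m) e) degree) (ℕ.+-monoʳ-≤ (suc m) b<e)
          C≤d : C.e ℕ.≤ d
          C≤d = ℕ.≤-trans (subst (C.e ℕ.≤_) C.degree (ℕ.m≤m+n C.e (suc b))) e≤d
          fg≤B : ∀ i j → ‖ real (f i) ‖ * ‖ real (g j) ‖ ≤ B
          fg≤B i j = let i₀ , i₀<e , q-max = largest e (real ∘ q) (real-below q-below) in begin
            ‖ real (f i) ‖ * ‖ real (g j) ‖
              ≤⟨ *-monoʳ (‖‖-nonNeg (real (f i))) (ℚ.≤-trans (ℚ.≤-reflexive (trans (sym (ℚ.*-identityˡ _)) (cong (_* ‖ real (g j) ‖) (sym (trans (cong (λ t → ‖ real t ‖) C.q-monic) ‖1‖)))))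
                   (factor-bound d C.e (suc b) C.q g q (‖ real (q i₀) ‖) C≤d (ℕ.≤-trans b<e e≤d) C.q-below g.below C.product (‖‖-nonNeg (real (q i₀))) q-max C.e j)) ⟩
            ‖ real (f i) ‖ * (K * ‖ real (q i₀) ‖)
              ≡⟨ lemma (‖ real (f i) ‖) K (‖ real (q i₀) ‖) ⟩
            K * (‖ real (q i₀) ‖ * ‖ real (f i) ‖)
              ≤⟨ *-monoʳ 0≤K (qf≤ i₀ i) ⟩
            B ∎
            where
            open ℚ.≤-Reasoning
            lemma : ∀ a b c → a * (b * c) ≡ b * (c * a)
            lemma = solve-∀ ℚ-ring
          ¬Vzg : b ℕ.≤ m → ¬ Vz.V (suc (suc b)) g
          ¬Vzg b≤m Vg = split (ℕ.m≤n⇒m<n∨m≡n b≤m)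
            where
            one≢zero : 1ℚ ≢ 0ℚ
            one≢zero ()
            split : b ℕ.< m ⊎ b ≡ m → ⊥
            split (inj₁ b<m) = one≢zero (trans (sym g.monic) (least g (λ i h → g.below i (ℕ.≤-trans (s≤s b<m) h)) (Vz.V-extend (s≤s b<m) g.below Vg) (suc b)))
            -- For equal degrees `g − f` has smaller degree and vanishes at `z`, so that `g = f`;
            -- but `y` is not a root of `f`.
            split (inj₂ refl) = ¬Vyf (Vy.V-cong {suc (suc b)} g≡f g.vanishes)
              where
              difference : ℕ → ℚ
              difference i = 1ℚ * g i + - 1ℚ * f i
              difference-below : Below 0ℚ (suc b) difference
              difference-below i b<i = at (ℕ.m≤n⇒m<n∨m≡n b<i)
                where
                at : suc b ℕ.< i ⊎ suc b ≡ i → difference i ≡ 0ℚ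
                at (inj₁ h)    = cong₂ (λ u v → 1ℚ * u + - 1ℚ * v) (g.below i h) (below i h)
                at (inj₂ refl) = cong₂ (λ u v → 1ℚ * u + - 1ℚ * v) g.monic monic
              V-difference : Vz.V (suc (suc b)) difference
              V-difference = Vz.V-linear (suc (suc b)) 1ℚ (- 1ℚ) g f Vg vanishes
              g≡f : ∀ i → g i ≡ f i
              g≡f i = trans (restore (g i) (f i)) (trans (cong (_+ f i) (least difference difference-below (Vz.V-restrict (ℕ.n≤1+n (suc b)) difference-below V-difference) i)) (ℚ.+-identityˡ (f i)))
                where
                restore : ∀ a b → a ≡ 1ℚ * a + - 1ℚ * b + b
                restore = solve-∀ ℚ-ring
          compare : b ℕ.≤ m ⊎ m ℕ.≤ b → ⊥
          compare (inj₁ b≤m) = ¬sep (P₁.pair-separated {m} {b} {f} {g} record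
            { minimal = min ; b≤a = b≤m ; degrees = degrees ; g-monic = g.monic ; g-below = g.below ; g-root = g.vanishes
            ; g-nonroot = ¬Vzg b≤m ; f-int = f-int ; g-int = C.f-int ; product = fg≤B })
          compare (inj₂ m≤b) = ¬sep (swap-separated (P₂.pair-separated {b} {m} {g} {f} record
            { minimal = gmin ; b≤a = m≤b ; degrees = subst (ℕ._≤ d) (ℕ.+-comm (suc m) (suc b)) degrees ; g-monic = monic ; g-below = below ; g-root = vanishes
            ; g-nonroot = ¬Vyf ; f-int = C.f-int ; g-int = f-int
            ; product = λ i j → ℚ.≤-trans (ℚ.≤-reflexive (ℚ.*-comm (‖ real (g i) ‖) (‖ real (f j) ‖))) (fg≤B j i) }))

      -- Reducibility enters here: `z` is a root of one of the two factors, so that its minimal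
      -- polynomial has degree less than `d`, as the discriminant estimate demands.
      roots-separated : ∀ a b A C → 1 ℕ.≤ a → 1 ℕ.≤ b → A a ≢ 0ℚ → C b ≢ 0ℚ → Below 0ℚ (suc a) A → Below 0ℚ (suc b) C →
        (∀ k → P k ≡ convℚ A C k) → Vz.V (suc d) P → Vy.V (suc d) P → ¬ ¬ Separated
      roots-separated a b A C 1≤a 1≤b Aa≢0 Cb≢0 hA hC product VzP VyP ¬sep =
        Vz.V-conv (suc a) (suc b) A C hA hC (Vz.V-cong {suc a ℕ.+ suc b} product (Vz.V-resize P-below P-below′ VzP)) λ
          { (inj₁ VA) → go a A a≤ hA Aa≢0 VA ; (inj₂ VC) → go b C b≤ hC Cb≢0 VC }
        where
        P-below′ : Below 0ℚ (suc a ℕ.+ suc b) P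
        P-below′ i h = P-below i (ℕ.≤-trans (s≤s d≤) h)
          where
          one≢zero : 1ℚ ≢ 0ℚ
          one≢zero ()
          d≤ : d ℕ.≤ a ℕ.+ suc b
          d≤ = ℕ.≮⇒≥ λ h → one≢zero (trans (sym P-monic) (trans (product d) (convℚ-below a b A C hA hC d (subst (ℕ._≤ d) (ℕ.+-suc a b) (ℕ.<⇒≤ h)))))
        *≢0 : ∀ {x y} → x ≢ 0ℚ → y ≢ 0ℚ → x * y ≢ 0ℚ
        *≢0 {x} {y} x≢0 y≢0 e = y≢0 (let c , cx≡1 = Vz.inverse≢ x x≢0 in
          trans (sym (ℚ.*-identityˡ y)) (trans (cong (_* y) (sym cx≡1)) (trans (ℚ.*-assoc c x y) (trans (cong (c *_) e) (ℚ.*-zeroʳ c)))))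
        a+b≤d : a ℕ.+ b ℕ.≤ d
        a+b≤d = ℕ.≮⇒≥ λ d<a+b → *≢0 Aa≢0 Cb≢0 (trans (sym (convℚ-top a b A C hA hC)) (trans (sym (product (a ℕ.+ b))) (P-below (a ℕ.+ b) d<a+b)))
        a≤ : suc a ℕ.≤ d
        a≤ = ℕ.≤-trans (subst (ℕ._≤ a ℕ.+ b) (ℕ.+-comm a 1) (ℕ.+-monoʳ-≤ a 1≤b)) a+b≤d
        b≤ : suc b ℕ.≤ d
        b≤ = ℕ.≤-trans (ℕ.+-monoˡ-≤ b 1≤a) a+b≤d
        go : ∀ n p → suc n ℕ.≤ d → Below 0ℚ (suc n) p → p n ≢ 0ℚ → Vz.V (suc n) p → ⊥
        go n p n<d hp pn≢0 Vp = let t , f , t≤n , ft , hf , Vf = Vz.normalise (suc n) p n hp pn≢0 Vp in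
          Vz.minimal-exists t f ft hf Vf λ
            { zero g _ gmin → Vz.minimal-degree {g} gmin
            ; (suc m) g m≤t gmin → from-minimal m g gmin (ℕ.≤-trans (s≤s (ℕ.≤-trans m≤t (ℕ.≤-pred t≤n))) n<d) VzP VyP ¬sep }

-- The upper bound d - 2

module UpperMain where
  open import Data.Integer.Base as ℤ using (ℤ; +_; -[1+_])
  import Data.Integer.Properties as ℤ
  open import Data.List.Base using (length)
  open import Data.Rational.Base using (_+_; _*_; _-_; -_; _≤_; _<_; ↥_; ↧ₙ_; mkℚ)
  open import Tactic.RingSolver using (solve-∀)
  open Rationals
  open Gaussian
  open Polynomials
  open Places
  open UpperBound using (distance)
  open Separation using (factorConstant; separationConstant; 0≤2; total-nonNeg; caseConstant; caseConstant-nonNeg; module Main)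
  open Complex
  open Logarithms using (^ℤ-neg)

  -- The ℓ¹ norm `Δ` satisfies `Δ² ≤ 2 ∣α − β∣²`. The approximation of the squared modulus by `s²`
  -- costs at most `σ² / 4 ≤ Δ² / 4`, which can be absorbed on the left and accounts for the second
  -- factor 2.
  modulus-bounds : ∀ α β s σ → 0ℚ < σ → (Eventually λ k → σ ≤ distance (at β) (at α) k) → IsModulus (α -ᶜ β) s →
    Eventually λ k → distance (at β) (at α) k * distance (at β) (at α) k ≤ 2ℚ * 2ℚ * (seq s k * seq s k)
  modulus-bounds α β s σ 0<σ apart (_ , ss≈) = eventually-map bound (apart ∩ ss≈ (½ * (½ * (σ * σ))) 0<ε)
    where
    0<ε : 0ℚ < ½ * (½ * (σ * σ))
    0<ε = half>0 _ (half>0 _ (*-pos 0<σ 0<σ))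
    bound : ∀ k → _ × _ → distance (at β) (at α) k * distance (at β) (at α) k ≤ 2ℚ * 2ℚ * (seq s k * seq s k)
    bound k (σ≤ , close) = ≤-by-difference (subst (0ℚ ≤_) (rearranged (Δ * Δ) S)
        (+-nonNeg (*-nonNeg {2ℚ} 0≤2 (difference-nonNeg {Δ * Δ} (ℚ.≤-trans (‖z‖²≤2∣z∣² w) (*-monoʳ {c = 2ℚ} 0≤2 N≤)))) h))
      where
      w = at α k -ᵍ at β k
      Δ = distance (at β) (at α) k
      S = seq s k * seq s k
      N = ∣z∣² w
      h : 0ℚ ≤ Δ * Δ - σ * σ
      h = difference-nonNeg (*-mono (ℚ.<⇒≤ 0<σ) (ℚ.≤-trans (ℚ.<⇒≤ 0<σ) σ≤) σ≤ σ≤)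
      N≤ : N ≤ S + ½ * (½ * (σ * σ))
      N≤ = ℚ.≤-trans (ℚ.≤-reflexive (lemma N S)) (ℚ.+-monoʳ-≤ S (ℚ.<⇒≤ (ℚ.≤-<-trans (ℚ.≤-trans (p≤∣p∣ (N - S)) (ℚ.≤-reflexive (∣p-q∣≡∣q-p∣ N S))) close)))
        where
        lemma : ∀ n s → n ≡ s + (n - s)
        lemma = solve-∀ ℚ-ring
      rearranged : ∀ D S → (1ℚ + 1ℚ) * ((1ℚ + 1ℚ) * (S + ½ * (½ * (σ * σ))) - D) + (D - σ * σ) ≡ (1ℚ + 1ℚ) * (1ℚ + 1ℚ) * S - D
      rearranged = lemma σ
        where
        lemma : ∀ σ D S → (1ℚ + 1ℚ) * ((1ℚ + 1ℚ) * (S + ½ * (½ * (σ * σ))) - D) + (D - σ * σ) ≡ (1ℚ + 1ℚ) * (1ℚ + 1ℚ) * S - D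
        lemma = solve-∀ ℚ-ring

  -- Since `n ≥ c v`, the hypothesis on `s` makes `(s b^c)^v` at most `1 / b`. The denied inequality
  -- would then force `C ^ v ≥ b²`, whereas `C ^ v < b`: the spare factor from `suc n` instead of
  -- `n` beats the constant.
  power-contradiction : ∀ C s b v c n → 0ℚ ≤ C → 0ℚ ≤ s → 1ℚ ≤ b → s ^ v * b ^ suc n < 1ℚ → c ℕ.* v ℕ.≤ n → C ^ v < b →
    ¬ (1ℚ ≤ C * (s * b ^ c * (s * b ^ c)))
  power-contradiction C s b v c n 0≤C 0≤s 1≤b small cv≤n large h = ℚ.<-irrefl refl (begin-strict
    C ^ v  <⟨ large ⟩
    b  ≤⟨ ≤-*ʳ 0≤b 1≤b ⟩
    b * b  ≤⟨ ≤-*ˡ (*-nonNeg 0≤b 0≤b) (1≤^ v h) ⟩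
    (C * (X * X)) ^ v * (b * b)  ≡⟨ cong (_* (b * b)) (trans (^-distrib-* C (X * X) v) (cong (C ^ v *_) (^-distrib-* X X v))) ⟩
    C ^ v * (X ^ v * X ^ v) * (b * b)  ≡⟨ lemma (C ^ v) (X ^ v) b ⟩
    C ^ v * (X ^ v * b * (X ^ v * b))  ≤⟨ *-monoʳ (^-nonNeg v 0≤C) (*-mono {X ^ v * b} {1ℚ} {X ^ v * b} {1ℚ} 0≤Y 0≤1 Y≤1 Y≤1) ⟩
    C ^ v * (1ℚ * 1ℚ)  ≡⟨ ℚ.*-identityʳ (C ^ v) ⟩
    C ^ v  ∎)
    where
    open ℚ.≤-Reasoning
    X = s * b ^ c
    0≤b = ℚ.≤-trans 0≤1 1≤b
    0≤Y : 0ℚ ≤ X ^ v * b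
    0≤Y = *-nonNeg (^-nonNeg v (*-nonNeg 0≤s (^-nonNeg c 0≤b))) 0≤b
    lemma : ∀ c x b → c * (x * x) * (b * b) ≡ c * (x * b * (x * b))
    lemma = solve-∀ ℚ-ring
    regroup : ∀ s y b → s * y * b ≡ s * (b * y)
    regroup = solve-∀ ℚ-ring
    Y≤1 : X ^ v * b ≤ 1ℚ
    Y≤1 = begin
      X ^ v * b  ≡⟨ cong (_* b) (trans (^-distrib-* s (b ^ c) v) (cong (s ^ v *_) (sym (^-* b c v)))) ⟩
      s ^ v * b ^ (c ℕ.* v) * b  ≡⟨ regroup (s ^ v) (b ^ (c ℕ.* v)) b ⟩
      s ^ v * b ^ suc (c ℕ.* v)  ≤⟨ *-monoʳ (^-nonNeg v 0≤s) (^-monoʳ {b} {suc (c ℕ.* v)} {suc n} 1≤b (s≤s cv≤n)) ⟩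
      s ^ v * b ^ suc n  ≤⟨ ℚ.<⇒≤ small ⟩
      1ℚ  ∎

  module _ (d : ℕ) (3≤d : 3 ℕ.≤ d) (v n : ℕ) (large : (d ℕ.∸ 2) ℕ.* v ℕ.≤ n) where

    c = d ℕ.∸ 2
    κ C : ℚ
    κ = factorConstant d * factorConstant d
    C = separationConstant d * (2ℚ * 2ℚ * (κ ^ c * κ ^ c))

    0≤S : 0ℚ ≤ separationConstant d
    0≤S = total-nonNeg (suc d) caseConstant caseConstant-nonNeg
    0≤C : 0ℚ ≤ C
    0≤C = *-nonNeg 0≤S (*-nonNeg {2ℚ * 2ℚ} (*-nonNeg {2ℚ} {2ℚ} 0≤2 0≤2) (square-nonNeg (κ ^ c)))

    -- Beyond this height `C ^ v` is negligible, and the summand `2ℚ ^ v` makes the two roots closer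
    -- than 1, which the separation estimate presupposes.
    threshold : ℕ
    threshold = suc (proj₁ (archimedean (C ^ v + 2ℚ ^ v)))

    above : ∀ b → threshold ℕ.≤ b → C ^ v + 2ℚ ^ v < fromℕ b
    above b h = ℚ.≤-<-trans (proj₂ (archimedean (C ^ v + 2ℚ ^ v))) (fromℕ-mono< h)

    not-separated : ∀ (s b Δ : ℚ) → 1ℚ ≤ b → 0ℚ ≤ s → 0ℚ ≤ Δ → C ^ v + 2ℚ ^ v < b → s ^ v * b ^ suc n < 1ℚ →
      Δ * Δ ≤ 2ℚ * 2ℚ * (s * s) →
      (Δ ≤ 1ℚ → 1ℚ ≤ separationConstant d * (Δ * (factorConstant d * (factorConstant d * b)) ^ c * (Δ * (factorConstant d * (factorConstant d * b)) ^ c))) → ⊥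
    not-separated s b Δ 1≤b 0≤s 0≤Δ b-large small Δ≤ separated =
      power-contradiction C s b v c n 0≤C 0≤s 1≤b small large (ℚ.≤-<-trans (≤-+ʳ (^-nonNeg v 0≤2)) b-large)
        (ℚ.≤-trans (separated Δ≤1) (begin
          separationConstant d * (Δ * B * (Δ * B))
            ≡⟨ cong (λ t → separationConstant d * (Δ * t * (Δ * t))) (trans (cong (_^ c) (sym (ℚ.*-assoc (factorConstant d) (factorConstant d) b))) (^-distrib-* κ b c)) ⟩
          separationConstant d * (Δ * (κ ^ c * b ^ c) * (Δ * (κ ^ c * b ^ c)))
            ≡⟨ cong (separationConstant d *_) (regroup Δ (κ ^ c) (b ^ c)) ⟩
          separationConstant d * (Δ * Δ * (κ ^ c * b ^ c * (κ ^ c * b ^ c)))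
            ≤⟨ *-monoʳ 0≤S (*-monoˡ (square-nonNeg (κ ^ c * b ^ c)) Δ≤) ⟩
          separationConstant d * (2ℚ * 2ℚ * (s * s) * (κ ^ c * b ^ c * (κ ^ c * b ^ c)))
            ≡⟨ regroup′ (separationConstant d) (2ℚ * 2ℚ) s (κ ^ c) (b ^ c) ⟩
          C * (s * b ^ c * (s * b ^ c)) ∎))
      where
      open ℚ.≤-Reasoning
      B = (factorConstant d * (factorConstant d * b)) ^ c
      regroup : ∀ δ k y → δ * (k * y) * (δ * (k * y)) ≡ δ * δ * (k * y * (k * y))
      regroup = solve-∀ ℚ-ring
      regroup′ : ∀ S t s k y → S * (t * (s * s) * (k * y * (k * y))) ≡ S * (t * (k * k)) * (s * y * (s * y))
      regroup′ = solve-∀ ℚ-ring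
      doubled : (2ℚ * s) ^ v < 1ℚ ^ v
      doubled = ℚ.≤-<-trans (begin
        (2ℚ * s) ^ v  ≡⟨ trans (^-distrib-* 2ℚ s v) (ℚ.*-comm (2ℚ ^ v) (s ^ v)) ⟩
        s ^ v * 2ℚ ^ v  ≤⟨ *-monoʳ (^-nonNeg v 0≤s) (ℚ.≤-trans (≤-+ˡ (^-nonNeg v 0≤C)) (ℚ.≤-trans (ℚ.<⇒≤ b-large) (≤-*ʳ (ℚ.≤-trans 0≤1 1≤b) (1≤^ n 1≤b)))) ⟩
        s ^ v * b ^ suc n ∎) (ℚ.<-≤-trans small (ℚ.≤-reflexive (sym (1^n≡1 v))))
      2s<1 : 2ℚ * s < 1ℚ
      2s<1 = ^-cancel< v 0≤1 doubled
      Δ≤1 : Δ ≤ 1ℚ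
      Δ≤1 = square-cancel-≤ 0≤1 (ℚ.≤-trans Δ≤ (ℚ.≤-trans (ℚ.≤-reflexive (squares 2ℚ s)) (*-mono {2ℚ * s} {1ℚ} {2ℚ * s} {1ℚ} (*-nonNeg 0≤2 0≤s) 0≤1 (ℚ.<⇒≤ 2s<1) (ℚ.<⇒≤ 2s<1))))
        where
        squares : ∀ t s → t * t * (s * s) ≡ t * s * (t * s)
        squares = solve-∀ ℚ-ring

    -- The relation `x ≤ᴿ fromℚ q` is a negation, so that the separation of the roots may be used
    -- although it is only doubly negated. If `q < x`, then `IsPower` at `− q` gives
    -- `s ^ v < H ^ −(n + 1)`, too small for separated roots.
    no-exponent : ∀ q → ↥ q ≡ + suc n → ↧ₙ q ≡ v → ∀ x → ExponentsFrom d threshold x → x ≤ᴿ fromℚ q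
    no-exponent (mkℚ .(+ suc n) v-1 cop) refl refl x
      (P , ((P-nonzero , P-degree) , P-monic) , (A , A′ , (a , 1≤a , A-top , A-degree) , (a′ , 1≤a′ , A′-top , A′-degree) , product) , _ , tall ,
        nt , s , ((α , β , root-α , root-β , α≉β , modulus) , _) , (ε , 0<ε , s-pos) , _ , below)
      (η , 0<η , q<x) =
      not-null⇒apart (difference-cauchy α β) (λ null → α≉β (null⇒≈ {α} {β} null)) λ (σ , 0<σ , apart) →
        Main.roots-separated d 3≤d p (cong fromℤ P-monic) p-below (λ k → ℤ[X].coeff P k , refl) H (coeffℚ-height P)
          (at β) (at α) (at-cauchy β) (at-cauchy α) σ 0<σ apart
          a a′ (ℚ[X].coeff A) (ℚ[X].coeff A′) 1≤a 1≤a′ A-top A′-top A-degree A′-degree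
          (λ k → trans (sym (coeff-map/1 P k)) (trans (product k) (coeff-⊛ A A′ k)))
          (resize (at β) (at-cauchy β) (root⇒null P β root-β)) (resize (at α) (at-cauchy α) (root⇒null P α root-α))
          λ separated → conclude (separated ∩ modulus-bounds α β s σ 0<σ apart modulus ∩ (proj₂ (proj₂ s<)) ∩ s-pos)
      where
      p = coeffℚ P
      H = fromℕ (height P)
      p-below : Below 0ℚ (suc d) p
      p-below k h = cong fromℤ (P-degree k h)
      resize : ∀ z cz → Place.V z cz (length P) p → Place.V z cz (suc d) p
      resize z cz = Place.V-resize z cz (coeffℚ-below P) p-below
      1≤H : 1ℚ ≤ H
      1≤H = 1≤fromℕ (ℕ.<⇒≤ (ℕ.nonTrivial⇒n>1 (height P) {{nt}}))
      -x<-q : (-ᴿ x) <ᴿ fromℚ (- mkℚ (+ suc n) v-1 cop)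
      -x<-q = η , 0<η , eventually-map (λ k h → <-by-difference (subst (0ℚ <_) (lemma (seq x k) (mkℚ (+ suc n) v-1 cop) η) (difference-pos h))) q<x
        where
        lemma : ∀ x q η → x - (q + η) ≡ - q - (- x + η)
        lemma = solve-∀ ℚ-ring
      s< : (s ^ᴿ v) <ᴿ fromℚ (_^ℤ_ (height P) {{nt}} -[1+ n ])
      s< = below (- mkℚ (+ suc n) v-1 cop) -x<-q
      conclude : ¬ Eventually _
      conclude (N , h) = let ((sep , Δ≤) , s^<) , 0<s = h N ℕ.≤-refl in
        not-separated (seq s N) H (distance (at β) (at α) N) 1≤H
          (ℚ.<⇒≤ (ℚ.<-trans 0<ε (subst (_< seq s N) (ℚ.+-identityˡ ε) 0<s))) (‖‖-nonNeg (at α N -ᵍ at β N)) (above (height P) tall)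
          (subst (seq s N ^ v * H ^ suc n <_) (^ℤ-neg (height P) {{nt}} n)
            (*-mono<ˡ (^-pos (suc n) (ℚ.<-≤-trans 0<1 1≤H)) (ℚ.≤-<-trans (ℚ.≤-trans (ℚ.≤-reflexive (sym (seq-^ s v N))) (≤-+ʳ (ℚ.<⇒≤ (proj₁ (proj₂ s<))))) s^<)))
          Δ≤ sep

  -- Each rational `q > d − 2` is itself a bound from some height on: in `q = suc n / v` the
  -- numerator exceeds `(d − 2) v`, and being an integer it does so by at least 1.
  upper-bound : ∀ d → 3 ℕ.≤ d → e*ᵣ d ᴱ≤ fromℕ (d ℕ.∸ 2)
  upper-bound d 3≤d q c<q = q , positive (↥ q) refl , ℚ.≤-refl
    where
    v = ↧ₙ q
    0<v : 0ℚ < fromℕ v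
    0<v = ℚ.<-≤-trans 0<1 (1≤fromℕ (1≤denominator q))
    cv< : fromℕ ((d ℕ.∸ 2) ℕ.* v) < fromℤ (↥ q)
    cv< = subst₂ _<_ (sym (fromℕ-* (d ℕ.∸ 2) v)) (numerator/denominator q) (*-mono<ˡ 0<v c<q)
    positive : ∀ a → ↥ q ≡ a → e*ᵣ d q
    positive (+ zero) e = ⊥-elim (ℚ.<-irrefl refl (ℚ.<-≤-trans cv< (subst (λ t → fromℤ t ≤ fromℕ ((d ℕ.∸ 2) ℕ.* v)) (sym e) (fromℕ-nonNeg ((d ℕ.∸ 2) ℕ.* v)))))
    positive (+ suc n) e = threshold d 3≤d v n large , no-exponent d 3≤d v n large q e refl
      where
      large : (d ℕ.∸ 2) ℕ.* v ℕ.≤ n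
      large = ℕ.≤-pred (fromℕ-cancel< (subst (λ t → fromℕ ((d ℕ.∸ 2) ℕ.* v) < fromℤ t) e cv<))
    positive -[1+ n ] e = ⊥-elim (ℚ.<-irrefl refl (ℚ.<-≤-trans cv< (ℚ.≤-trans (subst (λ t → fromℤ t ≤ 0ℚ) (sym e) (fromℤ-mono { -[1+ n ] } {+ 0} ℤ.-≤+)) (fromℕ-nonNeg ((d ℕ.∸ 2) ℕ.* v)))))

-- Coefficients, degree and roots of a product of integer polynomials

module Products where
  open import Data.Integer.Base as ℤ using (ℤ; +_)
  import Data.Integer.Properties as ℤ
  open import Data.List.Base using ([]; _∷_; map; length)
  open import Data.Rational.Base using (_+_; _*_; ∣_∣; _≤_)
  open import Tactic.RingSolver using (solve-∀)
  open Rationals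
  open Gaussian
  open Polynomials
  open Places
  open Separation using (convℚ-top; convℚ-below)
  open Complex

  coeffℚ-⊕ : ∀ p q k → coeffℚ (p ℤ[X].⊕ q) k ≡ coeffℚ p k + coeffℚ q k
  coeffℚ-⊕ []      q       k       = sym (ℚ.+-identityˡ _)
  coeffℚ-⊕ (a ∷ p) []      k       = sym (ℚ.+-identityʳ _)
  coeffℚ-⊕ (a ∷ p) (b ∷ q) zero    = fromℤ-+ a b
  coeffℚ-⊕ (a ∷ p) (b ∷ q) (suc k) = coeffℚ-⊕ p q k

  coeffℚ-map* : ∀ a q k → coeffℚ (map (a ℤ.*_) q) k ≡ fromℤ a * coeffℚ q k
  coeffℚ-map* a []      k       = sym (ℚ.*-zeroʳ (fromℤ a))
  coeffℚ-map* a (b ∷ q) zero    = fromℤ-* a b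
  coeffℚ-map* a (b ∷ q) (suc k) = coeffℚ-map* a q k

  convℚ-zero : ∀ q k → convℚ (λ _ → 0ℚ) q k ≡ 0ℚ
  convℚ-zero q zero    = ℚ.*-zeroˡ (q 0)
  convℚ-zero q (suc k) = cong₂ _+_ (ℚ.*-zeroˡ (q (suc k))) (convℚ-zero q k)

  coeffℚ-⊛ : ∀ p q k → coeffℚ (p ℤ[X].⊛ q) k ≡ convℚ (coeffℚ p) (coeffℚ q) k
  coeffℚ-⊛ []      q k       = sym (convℚ-zero (coeffℚ q) k)
  coeffℚ-⊛ (a ∷ p) q zero    = trans (coeffℚ-⊕ (map (a ℤ.*_) q) (+ 0 ∷ p ℤ[X].⊛ q) 0)
    (trans (ℚ.+-identityʳ _) (coeffℚ-map* a q 0))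
  coeffℚ-⊛ (a ∷ p) q (suc k) = trans (coeffℚ-⊕ (map (a ℤ.*_) q) (+ 0 ∷ p ℤ[X].⊛ q) (suc k))
    (cong₂ _+_ (coeffℚ-map* a q (suc k)) (coeffℚ-⊛ p q k))

  convℚ-cong : ∀ {p p′ q q′ : ℕ → ℚ} → (∀ i → p i ≡ p′ i) → (∀ i → q i ≡ q′ i) → ∀ k → convℚ p q k ≡ convℚ p′ q′ k
  convℚ-cong e e′ zero    = cong₂ _*_ (e 0) (e′ 0)
  convℚ-cong e e′ (suc k) = cong₂ _+_ (cong₂ _*_ (e 0) (e′ (suc k))) (convℚ-cong (e ∘ suc) e′ k)

  convℚ-bound : ∀ p q X Y → 0ℚ ≤ X → 0ℚ ≤ Y → (∀ i → ∣ p i ∣ ≤ X) → (∀ i → ∣ q i ∣ ≤ Y) → ∀ k → ∣ convℚ p q k ∣ ≤ fromℕ (suc k) * (X * Y)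
  convℚ-bound p q X Y 0≤X 0≤Y p≤ q≤ k = go p p≤ k
    where
    term : ∀ a b → ∣ a ∣ ≤ X → ∣ b ∣ ≤ Y → ∣ a * b ∣ ≤ X * Y
    term a b a≤ b≤ = ℚ.≤-trans (ℚ.≤-reflexive (ℚ.∣p*q∣≡∣p∣*∣q∣ a b)) (*-mono (ℚ.0≤∣p∣ b) 0≤X a≤ b≤)
    go : ∀ (p : ℕ → ℚ) → (∀ i → ∣ p i ∣ ≤ X) → ∀ k → ∣ convℚ p q k ∣ ≤ fromℕ (suc k) * (X * Y)
    go p p≤ zero    = ℚ.≤-trans (term (p 0) (q 0) (p≤ 0) (q≤ 0)) (ℚ.≤-reflexive (sym (ℚ.*-identityˡ (X * Y))))
    go p p≤ (suc k) = ℚ.≤-trans (ℚ.∣p+q∣≤∣p∣+∣q∣ (p 0 * q (suc k)) (convℚ (p ∘ suc) q k))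
      (ℚ.≤-trans (ℚ.+-mono-≤ (term (p 0) (q (suc k)) (p≤ 0) (q≤ (suc k))) (go (p ∘ suc) (p≤ ∘ suc) k))
        (ℚ.≤-reflexive (trans (lemma (fromℕ (suc k)) (X * Y)) (cong (_* (X * Y)) (sym (fromℕ-+ 1 (suc k)))))))
      where
      lemma : ∀ n x → x + n * x ≡ (1ℚ + n) * x
      lemma = solve-∀ ℚ-ring

  height≤ : ∀ P N → (∀ k → ∣ coeffℚ P k ∣ ≤ fromℕ N) → height P ℕ.≤ N
  height≤ []      N h = z≤n
  height≤ (a ∷ P) N h = ℕ.⊔-lub (ℕ.≮⇒≥ λ N<a → ℚ.<-irrefl refl (ℚ.<-≤-trans (fromℕ-mono< N<a) (subst (_≤ fromℕ N) (∣fromℤ∣ a) (h 0)))) (height≤ P N (h ∘ suc))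

  module Product (F G : ℤ[X].Poly) (a b : ℕ) (F-top : coeffℚ F a ≡ 1ℚ) (G-top : coeffℚ G b ≡ 1ℚ)
    (F-below : Below 0ℚ (suc a) (coeffℚ F)) (G-below : Below 0ℚ (suc b) (coeffℚ G)) where

    P : ℤ[X].Poly
    P = F ℤ[X].⊛ G

    top : coeffℚ P (a ℕ.+ b) ≡ 1ℚ
    top = trans (coeffℚ-⊛ F G (a ℕ.+ b)) (trans (convℚ-top a b (coeffℚ F) (coeffℚ G) F-below G-below) (cong₂ _*_ F-top G-top))

    below : Below 0ℚ (suc (a ℕ.+ b)) (coeffℚ P)
    below k h = trans (coeffℚ-⊛ F G k) (convℚ-below a b (coeffℚ F) (coeffℚ G) F-below G-below k h)

    private
      top-ℤ : ℤ[X].coeff P (a ℕ.+ b) ≡ + 1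
      top-ℤ = fromℤ-injective {ℤ[X].coeff P (a ℕ.+ b)} {+ 1} top
      1≢0 : + 1 ≢ + 0
      1≢0 ()

    monic : ℤ[X].Monic P (a ℕ.+ b)
    monic = ((λ e → 1≢0 (trans (sym top-ℤ) e)) , λ k h → fromℤ-injective {ℤ[X].coeff P k} {+ 0} (below k h)) , top-ℤ

    private
      degree : ∀ Q n → coeffℚ Q n ≡ 1ℚ → Below 0ℚ (suc n) (coeffℚ Q) → ℚ[X].HasDegree (map fromℤ Q) n
      degree Q n Q-top Q-below = (λ e → one≢zero (trans (sym Q-top) (trans (sym (coeff-map/1 Q n)) e))) , λ k h → trans (coeff-map/1 Q k) (Q-below k h)
        where
        one≢zero : 1ℚ ≢ 0ℚ
        one≢zero ()

    reducible : 1 ℕ.≤ a → 1 ℕ.≤ b → ReducibleOverℚ P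
    reducible 1≤a 1≤b = map fromℤ F , map fromℤ G , (a , 1≤a , degree F a F-top F-below) , (b , 1≤b , degree G b G-top G-below) ,
      λ k → trans (coeff-map/1 P k) (trans (coeffℚ-⊛ F G k) (trans (convℚ-cong (λ i → sym (coeff-map/1 F i)) (λ i → sym (coeff-map/1 G i)) k)
        (sym (coeff-⊛ (map fromℤ F) (map fromℤ G) k))))

    value : ℤ[X].Poly → ℂ → ℕ → 𝔾
    value Q α k = eval (length Q) (real ∘ coeffℚ Q) (at α k)

    private
      bounded : ∀ Q α → BoundedG (value Q α)
      bounded Q α = eval-bounded (length Q) (real ∘ coeffℚ Q) (real-below (coeffℚ-below Q)) (cauchyG-bounded (at-cauchy α))

      root : ∀ α → Null (λ k → value F α k *ᵍ value G α k) → Root P α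
      root α h = null⇒root P α (Place.V-resize (at α) (at-cauchy α) (λ k le → trans (coeffℚ-⊛ F G k) (conv-below k le)) (coeffℚ-below P)
        (null-cong (λ k → sym (trans (eval-cong (length F ℕ.+ length G) (λ i _ → trans (cong real (coeffℚ-⊛ F G i)) (real-conv (coeffℚ F) (coeffℚ G) i)) (at α k))
          (eval-conv (length F) (length G) (real ∘ coeffℚ F) (real ∘ coeffℚ G) (real-below (coeffℚ-below F)) (real-below (coeffℚ-below G)) (at α k)))) h))
        where
        conv-below : Below 0ℚ (length F ℕ.+ length G) (convℚ (coeffℚ F) (coeffℚ G))
        conv-below = beyond (length F) (coeffℚ F) (coeffℚ-below F)
          where
          beyond : ∀ n (p : ℕ → ℚ) → Below 0ℚ n p → Below 0ℚ (n ℕ.+ length G) (convℚ p (coeffℚ G))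
          beyond zero    p h k       _        = trans (convℚ-cong (λ i → h i z≤n) (λ _ → refl) k) (convℚ-zero (coeffℚ G) k)
          beyond (suc n) p h (suc k) (s≤s le) = cong₂ _+_ (trans (cong (p 0 *_) (coeffℚ-below G (suc k) (ℕ.≤-trans (ℕ.m≤n+m (length G) n) (ℕ.m≤n⇒m≤1+n le)))) (ℚ.*-zeroʳ (p 0)))
            (beyond n (p ∘ suc) (below-tail n h) k le)

    rootʳ : ∀ α → Null (value G α) → Root P α
    rootʳ α h = root α (null-*-bounded (bounded F α) h)

    rootˡ : ∀ α → Null (value F α) → Root P α
    rootˡ α h = root α (null-cong (λ k → comm (value G α k) (value F α k)) (null-*-bounded (bounded G α) h))
      where
      comm : ∀ u v → u *ᵍ v ≡ v *ᵍ u
      comm = solve-∀ 𝔾-ring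

-- The polynomials for the lower bounds

module Family where
  open import Data.Integer.Base as ℤ using (ℤ; +_)
  import Data.Integer.Properties as ℤ
  open import Data.List.Base using ([]; _∷_; length)
  open import Data.Rational.Base using (_+_; _*_; _-_; -_; ∣_∣; _≤_; _<_)
  open import Tactic.RingSolver using (solve-∀)
  open Rationals
  open Gaussian
  open Polynomials
  open Places
  open Complex
  open Cuts using (module MonotoneRoot)
  open Products

  -- The degree of `geometricSum`, unfolding in steps of two like that polynomial.
  double : ℕ → ℕ
  double zero    = 0
  double (suc j) = suc (suc (double j))

  module Parameter (m : ℕ) (1≤m : 1 ℕ.≤ m) where

    M : ℚ
    M = fromℕ m
    1≤M : 1ℚ ≤ M
    1≤M = 1≤fromℕ 1≤m
    0≤M = ℚ.≤-trans 0≤1 1≤M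
    0<M = ℚ.<-≤-trans 0<1 1≤M

    M^-nonNeg : ∀ n → 0ℚ ≤ M ^ n
    M^-nonNeg n = ^-nonNeg n 0≤M

    -- geometricSum j is (x^(2j+2) − m^(j+1)) / (x² − m)
    geometricSum : ℕ → ℤ[X].Poly
    geometricSum zero    = + 1 ∷ []
    geometricSum (suc j) = + (m ℕ.^ suc j) ∷ + 0 ∷ geometricSum j

    -- The value of `geometricSum`, that is the sum of `M ^ (j − l) * x ^ (2 l)` for `l ≤ j`: an
    -- even function, increasing for `x ≥ 0` and at least `M ^ j`.
    E : ℕ → ℚ → ℚ
    E zero    x = 1ℚ
    E (suc j) x = M ^ suc j + x * x * E j x

    E-even : ∀ j x → E j (- x) ≡ E j x
    E-even zero    x = refl
    E-even (suc j) x = cong₂ (λ u v → M ^ suc j + u * v) (neg*neg x) (E-even j x)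

    E-geometric : ∀ j x → E j x * (x * x - M) ≡ (x * x) ^ suc j - M ^ suc j
    E-geometric zero    x = lemma (x * x) M
      where
      lemma : ∀ y M → 1ℚ * (y - M) ≡ y * 1ℚ - M * 1ℚ
      lemma = solve-∀ ℚ-ring
    E-geometric (suc j) x = trans (expand (M ^ suc j) (x * x) (E j x) M) (trans (cong (λ t → M ^ suc j * (x * x - M) + x * x * t) (E-geometric j x))
        (collect (M ^ suc j) (x * x) M ((x * x) ^ suc j)))
      where
      expand : ∀ p y e M → (p + y * e) * (y - M) ≡ p * (y - M) + y * (e * (y - M))
      expand = solve-∀ ℚ-ring
      collect : ∀ p y M z → p * (y - M) + y * (z - p) ≡ y * z - M * p
      collect = solve-∀ ℚ-ring

    M^j≤E : ∀ j x → M ^ j ≤ E j x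
    M^j≤E zero    x = ℚ.≤-refl
    M^j≤E (suc j) x = ≤-+ʳ (*-nonNeg (square-nonNeg x) (ℚ.≤-trans (M^-nonNeg j) (M^j≤E j x)))

    1≤E : ∀ j x → 1ℚ ≤ E j x
    1≤E j x = ℚ.≤-trans (1≤^ j 1≤M) (M^j≤E j x)

    0≤E : ∀ j x → 0ℚ ≤ E j x
    0≤E j x = ℚ.≤-trans 0≤1 (1≤E j x)

    E-mono : ∀ j {a b} → 0ℚ ≤ a → a ≤ b → E j a ≤ E j b
    E-mono zero    0≤a a≤b = ℚ.≤-refl
    E-mono (suc j) {a} {b} 0≤a a≤b = ℚ.+-monoʳ-≤ (M ^ suc j) (*-mono (0≤E j a) (square-nonNeg b) (*-mono 0≤a (ℚ.≤-trans 0≤a a≤b) a≤b a≤b) (E-mono j 0≤a a≤b))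

    4ℚ : ℚ
    4ℚ = 2ℚ * 2ℚ
    0≤4 : 0ℚ ≤ 4ℚ
    0≤4 = *-nonNeg {2ℚ} {2ℚ} (ℚ.<⇒≤ 0<2) (ℚ.<⇒≤ 0<2)

    E-lipschitz : ∀ j → ∃ λ L → 0ℚ ≤ L × (∀ a b → 0ℚ ≤ a → a ≤ b → b ≤ 2ℚ → E j b - E j a ≤ L * (b - a))
    E-lipschitz zero    = 0ℚ , ℚ.≤-refl , λ a b _ _ _ → ℚ.≤-reflexive (lemma (b - a))
      where
      lemma : ∀ t → 1ℚ - 1ℚ ≡ 0ℚ * t
      lemma = solve-∀ ℚ-ring
    E-lipschitz (suc j) = let L , 0≤L , h = E-lipschitz j in
      4ℚ * E j 2ℚ + 4ℚ * L , +-nonNeg (*-nonNeg 0≤4 (0≤E j 2ℚ)) (*-nonNeg 0≤4 0≤L) , λ a b 0≤a a≤b b≤2 → step L a b 0≤a a≤b b≤2 (h a b 0≤a a≤b b≤2)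
      where
      step : ∀ L a b → 0ℚ ≤ a → a ≤ b → b ≤ 2ℚ → E j b - E j a ≤ L * (b - a) → E (suc j) b - E (suc j) a ≤ (4ℚ * E j 2ℚ + 4ℚ * L) * (b - a)
      step L a b 0≤a a≤b b≤2 h = begin
        M ^ suc j + b * b * E j b - (M ^ suc j + a * a * E j a)  ≡⟨ split (M ^ suc j) a b (E j a) (E j b) ⟩
        (b + a) * E j b * (b - a) + a * a * (E j b - E j a)  ≤⟨ ℚ.+-mono-≤ (*-monoˡ (difference-nonNeg a≤b) (*-mono (0≤E j b) 0≤4 (ℚ.+-mono-≤ b≤2 a≤2) (E-mono j 0≤b b≤2)))
                                                                         (*-mono {b = 4ℚ} (difference-nonNeg (E-mono j 0≤a a≤b)) 0≤4 (*-mono {b = 2ℚ} {d = 2ℚ} 0≤a (ℚ.<⇒≤ 0<2) a≤2 a≤2) h) ⟩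
        4ℚ * E j 2ℚ * (b - a) + 4ℚ * (L * (b - a))  ≡⟨ collect 4ℚ (E j 2ℚ) L (b - a) ⟩
        (4ℚ * E j 2ℚ + 4ℚ * L) * (b - a)  ∎
        where
        open ℚ.≤-Reasoning
        0≤b = ℚ.≤-trans 0≤a a≤b
        a≤2 = ℚ.≤-trans a≤b b≤2
        split : ∀ p a b x y → p + b * b * y - (p + a * a * x) ≡ (b + a) * y * (b - a) + a * a * (y - x)
        split = solve-∀ ℚ-ring
        collect : ∀ f e L t → f * e * t + f * (L * t) ≡ (f * e + f * L) * t
        collect = solve-∀ ℚ-ring

    module Member (i : ℕ) where

      j : ℕ
      j = suc i

      F G : ℤ[X].Poly
      F = + 1 ∷ geometricSum j
      G = ℤ.- (+ m) ∷ ℤ.- (+ (m ℕ.^ suc j)) ∷ + 1 ∷ []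

      -- With `k = suc j` these are `f(t) = −F(−t)` and `g(t) = G(−t)`. The change of sign moves the
      -- relevant negative roots into the interval from 0 to 1, where both functions increase.
      f g : ℚ → ℚ
      f t = t * E j t - 1ℚ
      g t = t * t + M ^ suc j * t - M

      f-growth : ∀ a b → 0ℚ ≤ a → a ≤ b → b - a ≤ f b - f a
      f-growth a b 0≤a a≤b = ℚ.≤-trans (≤-*ʳ (difference-nonNeg a≤b) (1≤E j b)) (ℚ.≤-trans (≤-+ʳ (*-nonNeg 0≤a (difference-nonNeg (E-mono j 0≤a a≤b)))) (ℚ.≤-reflexive (lemma a b (E j a) (E j b))))
        where
        lemma : ∀ a b x y → (b - a) * y + a * (y - x) ≡ b * y - 1ℚ - (a * x - 1ℚ)
        lemma = solve-∀ ℚ-ring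

      Lf Lg : ℚ
      Lf = E j 2ℚ + 2ℚ * proj₁ (E-lipschitz j)
      Lg = 4ℚ + M ^ suc j

      f-lipschitz : ∀ a b → 0ℚ ≤ a → a ≤ b → b ≤ 2ℚ → f b - f a ≤ Lf * (b - a)
      f-lipschitz a b 0≤a a≤b b≤2 = begin
        b * E j b - 1ℚ - (a * E j a - 1ℚ)  ≡⟨ split a b (E j a) (E j b) ⟩
        E j b * (b - a) + a * (E j b - E j a)  ≤⟨ ℚ.+-mono-≤ (*-monoˡ (difference-nonNeg a≤b) (E-mono j (ℚ.≤-trans 0≤a a≤b) b≤2))
                                                              (*-mono {b = 2ℚ} (difference-nonNeg (E-mono j 0≤a a≤b)) (ℚ.<⇒≤ 0<2) (ℚ.≤-trans a≤b b≤2) (proj₂ (proj₂ (E-lipschitz j)) a b 0≤a a≤b b≤2)) ⟩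
        E j 2ℚ * (b - a) + 2ℚ * (proj₁ (E-lipschitz j) * (b - a))  ≡⟨ collect (E j 2ℚ) 2ℚ (proj₁ (E-lipschitz j)) (b - a) ⟩
        Lf * (b - a)  ∎
        where
        open ℚ.≤-Reasoning
        split : ∀ a b x y → b * y - 1ℚ - (a * x - 1ℚ) ≡ y * (b - a) + a * (y - x)
        split = solve-∀ ℚ-ring
        collect : ∀ e f L t → e * t + f * (L * t) ≡ (e + f * L) * t
        collect = solve-∀ ℚ-ring

      g-difference : ∀ a b → g b - g a ≡ (b + a + M ^ suc j) * (b - a)
      g-difference a b = lemma a b (M ^ suc j) M
        where
        lemma : ∀ a b p M → b * b + p * b - M - (a * a + p * a - M) ≡ (b + a + p) * (b - a)
        lemma = solve-∀ ℚ-ring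

      -- The slope `M ^ suc j` is kept and not weakened to 1 as in `g-growth`: it contributes
      -- `suc j` to the exponent `agreement`.
      g-growth′ : ∀ a b → 0ℚ ≤ a → a ≤ b → M ^ suc j * (b - a) ≤ g b - g a
      g-growth′ a b 0≤a a≤b = ℚ.≤-trans (*-monoˡ (difference-nonNeg a≤b) (≤-+ˡ (+-nonNeg (ℚ.≤-trans 0≤a a≤b) 0≤a))) (ℚ.≤-reflexive (sym (g-difference a b)))

      g-growth : ∀ a b → 0ℚ ≤ a → a ≤ b → b - a ≤ g b - g a
      g-growth a b 0≤a a≤b = ℚ.≤-trans (≤-*ˡ (difference-nonNeg a≤b) (1≤^ (suc j) 1≤M)) (g-growth′ a b 0≤a a≤b)

      g-lipschitz : ∀ a b → 0ℚ ≤ a → a ≤ b → b ≤ 2ℚ → g b - g a ≤ Lg * (b - a)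
      g-lipschitz a b 0≤a a≤b b≤2 = ℚ.≤-trans (ℚ.≤-reflexive (g-difference a b))
        (*-monoˡ (difference-nonNeg a≤b) (ℚ.+-monoˡ-≤ (M ^ suc j) (ℚ.+-mono-≤ {b} {2ℚ} {a} {2ℚ} b≤2 (ℚ.≤-trans a≤b b≤2))))

      f0≤0 : f 0ℚ ≤ 0ℚ
      f0≤0 = ℚ.≤-trans (ℚ.≤-reflexive (lemma (E j 0ℚ))) (ℚ.neg-antimono-≤ 0≤1)
        where
        lemma : ∀ e → 0ℚ * e - 1ℚ ≡ - 1ℚ
        lemma = solve-∀ ℚ-ring

      0<f1 : 0ℚ < f 1ℚ
      0<f1 = ℚ.<-≤-trans 0<1 (≤-by-difference (subst (0ℚ ≤_) (lemma (M ^ suc i) (E i 1ℚ)) (+-nonNeg (difference-nonNeg (1≤^ (suc i) 1≤M)) (difference-nonNeg (1≤E i 1ℚ)))))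
        where
        lemma : ∀ p e → p - 1ℚ + (e - 1ℚ) ≡ 1ℚ * (p + 1ℚ * 1ℚ * e) - 1ℚ - 1ℚ
        lemma = solve-∀ ℚ-ring

      g0≤0 : g 0ℚ ≤ 0ℚ
      g0≤0 = ℚ.≤-trans (ℚ.≤-reflexive (lemma (M ^ suc j) M)) (ℚ.neg-antimono-≤ 0≤M)
        where
        lemma : ∀ p M → 0ℚ * 0ℚ + p * 0ℚ - M ≡ - M
        lemma = solve-∀ ℚ-ring

      0<g1 : 0ℚ < g 1ℚ
      0<g1 = ℚ.<-≤-trans 0<1 (≤-by-difference (subst (0ℚ ≤_) (lemma (M ^ j) M) (*-nonNeg 0≤M (difference-nonNeg (1≤^ j 1≤M)))))
        where
        lemma : ∀ p M → M * (p - 1ℚ) ≡ 1ℚ * 1ℚ + M * p * 1ℚ - M - 1ℚ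
        lemma = solve-∀ ℚ-ring

      module f-root = MonotoneRoot f Lf f0≤0 0<f1 f-growth f-lipschitz
      module g-root = MonotoneRoot g Lg g0≤0 0<g1 g-growth g-lipschitz

      t u : ℕ → ℚ
      t = seq f-root.root
      u = seq g-root.root

      α β : ℂ
      α = (-ᴿ f-root.root) +i 0ᴿ
      β = (-ᴿ g-root.root) +i 0ᴿ

      private
        geometric-value : ∀ j x → eval (length (geometricSum j)) (real ∘ coeffℚ (geometricSum j)) (real x) ≡ real (E j x)
        geometric-value zero    x = lemma (real x)
          where
          lemma : ∀ x → 1ᵍ +ᵍ x *ᵍ 0ᵍ ≡ 1ᵍ
          lemma = solve-∀ 𝔾-ring
        geometric-value (suc j) x = trans (cong₂ (λ a e → real a +ᵍ real x *ᵍ (0ᵍ +ᵍ real x *ᵍ e)) (fromℕ-^ m (suc j)) (geometric-value j x))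
          (trans (lemma (real (M ^ suc j)) (real x) (real (E j x))) (cong (real (M ^ suc j) +ᵍ_) (sym (trans (real-* (x * x) (E j x)) (cong (_*ᵍ real (E j x)) (real-* x x))))))
          where
          lemma : ∀ a x e → a +ᵍ x *ᵍ (0ᵍ +ᵍ x *ᵍ e) ≡ a +ᵍ x *ᵍ x *ᵍ e
          lemma = solve-∀ 𝔾-ring

        F-value : ∀ x → eval (length F) (real ∘ coeffℚ F) (real (- x)) ≡ real (- f x)
        F-value x = trans (cong (λ e → 1ᵍ +ᵍ real (- x) *ᵍ e) (trans (geometric-value j (- x)) (cong real (E-even j x))))
          (trans (cong (1ᵍ +ᵍ_) (sym (real-* (- x) (E j x)))) (cong real (lemma x (E j x))))
          where
          lemma : ∀ x e → 1ℚ + - x * e ≡ - (x * e - 1ℚ)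
          lemma = solve-∀ ℚ-ring

        G-value : ∀ x → eval (length G) (real ∘ coeffℚ G) (real (- x)) ≡ real (g x)
        G-value x = trans (cong₂ (λ a b → real a +ᵍ real (- x) *ᵍ (real b +ᵍ real (- x) *ᵍ (1ᵍ +ᵍ real (- x) *ᵍ 0ᵍ))) (fromℤ-neg (+ m)) (trans (fromℤ-neg (+ (m ℕ.^ suc j))) (cong -_ (fromℕ-^ m (suc j)))))
          (trans (cong (λ z → real (- M) +ᵍ real (- x) *ᵍ (real (- (M ^ suc j)) +ᵍ z)) (last (real (- x))))
          (trans (cong (real (- M) +ᵍ_) (sym (real-* (- x) (- (M ^ suc j) + - x)))) (cong real (lemma x (M ^ suc j) M))))
          where
          last : ∀ z → z *ᵍ (1ᵍ +ᵍ z *ᵍ 0ᵍ) ≡ z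
          last = solve-∀ 𝔾-ring
          lemma : ∀ x p M → - M + - x * (- p + - x) ≡ x * x + p * x - M
          lemma = solve-∀ ℚ-ring

        coefficients≤ : ∀ j k → ∣ coeffℚ (geometricSum j) k ∣ ≤ M ^ j
        coefficients≤ zero    zero          = ℚ.≤-refl
        coefficients≤ zero    (suc k)       = 0≤1
        coefficients≤ (suc j) zero          = ℚ.≤-reflexive (trans (∣fromℤ∣ (+ (m ℕ.^ suc j))) (fromℕ-^ m (suc j)))
        coefficients≤ (suc j) (suc zero)    = M^-nonNeg (suc j)
        coefficients≤ (suc j) (suc (suc k)) = ℚ.≤-trans (coefficients≤ j k) (≤-*ˡ (M^-nonNeg j) 1≤M)

        F≤ : ∀ k → ∣ coeffℚ F k ∣ ≤ M ^ j
        F≤ zero    = 1≤^ j 1≤M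
        F≤ (suc k) = coefficients≤ j k

        G≤ : ∀ k → ∣ coeffℚ G k ∣ ≤ M ^ suc j
        G≤ zero                = ℚ.≤-trans (ℚ.≤-reflexive (trans (∣fromℤ∣ (ℤ.- (+ m))) (cong fromℕ (ℤ.∣-i∣≡∣i∣ (+ m))))) (≤-*ʳ 0≤M (1≤^ j 1≤M))
        G≤ (suc zero)          = ℚ.≤-reflexive (trans (∣fromℤ∣ (ℤ.- (+ (m ℕ.^ suc j)))) (trans (cong fromℕ (ℤ.∣-i∣≡∣i∣ (+ (m ℕ.^ suc j)))) (fromℕ-^ m (suc j))))
        G≤ (suc (suc zero))    = 1≤^ (suc j) 1≤M
        G≤ (suc (suc (suc k))) = M^-nonNeg (suc j)

        geometric-top : ∀ j → coeffℚ (geometricSum j) (double j) ≡ 1ℚ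
        geometric-top zero    = refl
        geometric-top (suc j) = geometric-top j

        geometric-below : ∀ j → Below 0ℚ (suc (double j)) (coeffℚ (geometricSum j))
        geometric-below zero    (suc k)       _             = refl
        geometric-below (suc j) (suc (suc k)) (s≤s (s≤s h)) = geometric-below j k h

        F-below : Below 0ℚ (suc (suc (double j))) (coeffℚ F)
        F-below (suc k) (s≤s h) = geometric-below j k h

        G-below : Below 0ℚ 3 (coeffℚ G)
        G-below (suc (suc (suc k))) _ = refl
        G-below (suc (suc zero)) (s≤s (s≤s ()))
        G-below (suc zero) (s≤s ())

      open Product F G (suc (double j)) 2 (geometric-top j) refl F-below G-below public

      degree : ℕ
      degree = suc (double j) ℕ.+ 2

      -- The constant term of the product is `−m`; in particular the heights are unbounded as `m`
      -- grows.
      height-lower : m ℕ.≤ height P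
      height-lower = subst (ℕ._≤ height P) (trans (cong ℤ.∣_∣ constant) (ℤ.∣-i∣≡∣i∣ (+ m))) (coeff-height P 0)
        where
        constant : ℤ[X].coeff P 0 ≡ ℤ.- (+ m)
        constant = fromℤ-injective (trans (coeffℚ-⊛ F G 0) (ℚ.*-identityˡ (fromℤ (ℤ.- (+ m)))))

      height-upper : height P ℕ.≤ suc degree ℕ.* (m ℕ.^ j ℕ.* m ℕ.^ suc j)
      height-upper = height≤ P _ bound
        where
        N = suc degree ℕ.* (m ℕ.^ j ℕ.* m ℕ.^ suc j)
        N≡ : fromℕ N ≡ fromℕ (suc degree) * (M ^ j * M ^ suc j)
        N≡ = trans (fromℕ-* (suc degree) (m ℕ.^ j ℕ.* m ℕ.^ suc j)) (cong (fromℕ (suc degree) *_) (trans (fromℕ-* (m ℕ.^ j) (m ℕ.^ suc j)) (cong₂ _*_ (fromℕ-^ m j) (fromℕ-^ m (suc j)))))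
        0≤XY = *-nonNeg (M^-nonNeg j) (M^-nonNeg (suc j))
        bound : ∀ k → ∣ coeffℚ P k ∣ ≤ fromℕ N
        bound k = split (ℕ.<-cmp k (suc degree))
          where
          open import Relation.Binary.Definitions using (Tri; tri<; tri≈; tri>)
          zeros : suc degree ℕ.≤ k → ∣ coeffℚ P k ∣ ≤ fromℕ N
          zeros h = ℚ.≤-trans (ℚ.≤-reflexive (cong ∣_∣ (below k h))) (fromℕ-nonNeg N)
          split : Tri (k ℕ.< suc degree) (k ≡ suc degree) (suc degree ℕ.< k) → ∣ coeffℚ P k ∣ ≤ fromℕ N
          split (tri< k< _ _) = ℚ.≤-trans (ℚ.≤-reflexive (cong ∣_∣ (coeffℚ-⊛ F G k)))
            (ℚ.≤-trans (convℚ-bound (coeffℚ F) (coeffℚ G) (M ^ j) (M ^ suc j) (M^-nonNeg j) (M^-nonNeg (suc j)) F≤ G≤ k)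
              (ℚ.≤-trans (*-monoˡ 0≤XY (fromℕ-mono {suc k} {suc degree} k<)) (ℚ.≤-reflexive (sym N≡))))
          split (tri≈ _ e _) = zeros (ℕ.≤-reflexive (sym e))
          split (tri> _ _ h) = zeros (ℕ.<⇒≤ h)

      root-α : Root P α
      root-α = rootˡ α λ ε 0<ε → eventually-map (λ n → ℚ.≤-<-trans (ℚ.≤-reflexive (trans (cong ‖_‖ (F-value (t n))) (trans (‖real‖ (- f (t n))) (ℚ.∣-p∣≡∣p∣ (f (t n))))))) (f-root.f-null ε 0<ε)

      root-β : Root P β
      root-β = rootʳ β λ ε 0<ε → eventually-map (λ n → ℚ.≤-<-trans (ℚ.≤-reflexive (trans (cong ‖_‖ (G-value (u n))) (‖real‖ (g (u n)))))) (g-root.f-null ε 0<ε)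

      -- F(x) (x² − m) = x^(2k+1) + G(x) at x = −t, so that t is almost a root of g.
      g-at-t : ∀ t → g t ≡ (t * t) ^ suc j * t - f t * (t * t - M)
      g-at-t t = trans (lemma t (M ^ suc j) M ((t * t) ^ suc j)) (trans (cong (λ z → (t * t) ^ suc j * t - (t * z - (t * t - M))) (sym (E-geometric j t))) (collect t (E j t) ((t * t) ^ suc j) M))
        where
        lemma : ∀ t p M y → t * t + p * t - M ≡ y * t - (t * (y - p) - (t * t - M))
        lemma = solve-∀ ℚ-ring
        collect : ∀ t e y M → y * t - (t * (e * (t * t - M)) - (t * t - M)) ≡ y * t - (t * e - 1ℚ) * (t * t - M)
        collect = solve-∀ ℚ-ring

-- Existence of the minimal distance between roots

module RootSeparation where
  open import Data.List.Base using (List; []; _∷_; length; cartesianProduct)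
  open import Data.List.Membership.Propositional using (_∈_; find)
  open import Data.List.Membership.Propositional.Properties using (∈-cartesianProduct⁺)
  open import Data.List.Relation.Unary.All as All using (All; []; _∷_)
  open import Data.List.Relation.Unary.All.Properties using (¬Any⇒All¬)
  open import Data.List.Relation.Unary.AllPairs using (AllPairs; []; _∷_)
  open import Data.List.Relation.Unary.Any using (Any)
  open import Data.Rational.Base using (_+_; _*_; _-_; -_; ∣_∣; _≤_; _<_)
  open import Tactic.RingSolver using (solve-∀)
  open Rationals
  open Gaussian
  open Polynomials
  open Gelfond using (quotient; eval-quotient; quotient-step; quotient-top)
  open Places
  open Complex
  open Reals
  open Cuts using (module SquareRoot; <⇒≱)

  null-neg : ∀ {u v : ℕ → 𝔾} → Null (λ k → u k -ᵍ v k) → Null (λ k → v k -ᵍ u k)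
  null-neg {u} {v} h ε 0<ε = eventually-map (λ k → subst (_< ε) (‖-‖-comm (u k) (v k))) (h ε 0<ε)

  quotient-monic : ∀ n p c → p (suc n) ≡ 1ᵍ → quotient (suc (suc n)) p c n ≡ 1ᵍ
  quotient-monic n p c monic = trans (sym (trans (quotient-step (suc n) p c n ℕ.≤-refl)
    (trans (cong (λ t → quotient (suc (suc n)) p c n -ᵍ c *ᵍ t) (quotient-top (suc n) p c)) (lemma _ c)))) monic
    where
    lemma : ∀ q c → q -ᵍ c *ᵍ 0ᵍ ≡ q
    lemma = solve-∀ 𝔾-ring

  quotient-null : ∀ n (p : ℕ → ℕ → 𝔾) α β → ¬ α ≈ᶜ β → ¬ ¬ Null (λ k → eval (suc n) (p k) (at α k)) → ¬ ¬ Null (λ k → eval (suc n) (p k) (at β k)) →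
    ¬ ¬ Null (λ k → eval n (quotient (suc n) (p k) (at α k)) (at β k))
  quotient-null n p α β α≉β root-α root-β ¬null = root-α λ null-α → root-β λ null-β →
    not-null⇒apart (difference-cauchy β α) (λ h → α≉β (null⇒≈ {α} {β} (null-neg {at β} {at α} h))) λ apart →
      ¬null (apart-product apart (null-cong (λ k → eval-quotient n (p k) (at α k) (at β k)) (difference null-β null-α)))
    where
    difference : ∀ {u v : ℕ → 𝔾} → Null u → Null v → Null (λ k → u k -ᵍ v k)
    difference {u} {v} hu hv ε 0<ε = eventually-map (λ k h → ℚ.≤-<-trans (‖-‖ (u k) (v k)) (ℚ.<-≤-trans (ℚ.+-mono-< (proj₁ h) (proj₂ h)) (ℚ.≤-reflexive (half+half ε))))
      (hu (½ * ε) (half>0 ε 0<ε) ∩ hv (½ * ε) (half>0 ε 0<ε))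

  -- The coefficients of `p` may depend on `k`, because `x − α` is divided out with the `k`-th
  -- approximation of `α`, which leaves different quotients for different `k`.
  too-many-roots : ∀ n (p : ℕ → ℕ → 𝔾) → (∀ k → p k n ≡ 1ᵍ) → ∀ L → n ℕ.< length L → AllPairs (λ α β → ¬ α ≈ᶜ β) L →
    All (λ α → ¬ ¬ Null (λ k → eval (suc n) (p k) (at α k))) L → ⊥
  too-many-roots zero p monic (α ∷ L) _ _ (root ∷ _) = root λ null → let N , h = null 1ℚ 0<1 in
    ℚ.<-irrefl refl (subst (_< 1ℚ) (trans (cong ‖_‖ (trans (lemma (p N 0) (at α N)) (monic N))) ‖1‖) (h N ℕ.≤-refl))
    where
    lemma : ∀ a z → a +ᵍ z *ᵍ 0ᵍ ≡ a
    lemma = solve-∀ 𝔾-ring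
  too-many-roots (suc n) p monic (α ∷ L) (s≤s long) (α∉L ∷ distinct) (root ∷ roots) =
    too-many-roots n (λ k → quotient (suc (suc n)) (p k) (at α k)) (λ k → quotient-monic n (p k) (at α k) (monic k)) L long distinct
      (All.zipWith (λ {β} (α≉β , root-β) → quotient-null (suc n) p α β α≉β root root-β) (α∉L , roots))

  module _ (P : ℤ[X].Poly) (d : ℕ) (monic : coeffℚ P d ≡ 1ℚ) (below : Below 0ℚ (suc d) (coeffℚ P)) where

    Complete : List ℂ → Set
    Complete L = All (Root P) L × (∀ α → Root P α → ¬ ¬ Any (α ≈ᶜ_) L)

    -- A list of distinct roots that misses some root can be extended by it. As more than `d`
    -- distinct roots are impossible, this must stop before the fuel is exhausted.
    extend-list : ∀ fuel L → AllPairs (λ α β → ¬ α ≈ᶜ β) L → All (Root P) L → d ℕ.< fuel ℕ.+ length L → ¬ ¬ ∃ Complete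
    extend-list zero L distinct roots long _ = too-many-roots d (λ k → real ∘ coeffℚ P) (λ k → cong real monic) L long distinct
      (All.map (λ {α} root → λ k → k (Place.V-resize (at α) (at-cauchy α) (coeffℚ-below P) below (root⇒null P α root))) roots)
    extend-list (suc fuel) L distinct roots long none = none (L , roots , λ α root ¬any →
      extend-list fuel (α ∷ L) (¬Any⇒All¬ L ¬any ∷ distinct) (root ∷ roots) (subst (d ℕ.<_) (sym (ℕ.+-suc fuel (length L))) long) none)

    all-roots : ¬ ¬ ∃ Complete
    all-roots = extend-list (suc d) [] [] [] (subst (d ℕ.<_) (sym (ℕ.+-identityʳ (suc d))) ℕ.≤-refl)

  <ᴿ-irrefl : ∀ x → ¬ (x <ᴿ x)
  <ᴿ-irrefl x (ε , 0<ε , N , h) = <⇒≱ (h N ℕ.≤-refl) (≤-+ʳ (ℚ.<⇒≤ 0<ε))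

  <ᴿ-trans : ∀ x y z → x <ᴿ y → y <ᴿ z → x <ᴿ z
  <ᴿ-trans x y z (ε , 0<ε , h) (η , 0<η , h′) = ε , 0<ε , eventually-map (λ k (a , b) → ℚ.<-trans a (ℚ.≤-<-trans (≤-+ʳ (ℚ.<⇒≤ 0<η)) b)) (h ∩ h′)

  -- Neither the order of real numbers nor the property `Q` is decidable, so that even over a finite
  -- list the minimum exists only under a double negation.
  minimum : ∀ {X : Set} (f : X → ℝ) (Q : X → Set) xs → ¬ ¬ (All (λ x → ¬ Q x) xs ⊎ ∃ λ m → Q m × All (λ x → Q x → f m ≤ᴿ f x) xs)
  minimum f Q []       k = k (inj₁ [])
  minimum f Q (x ∷ xs) k = minimum f Q xs λ
    { (inj₁ none) → k (inj₁ ((λ qx → k (inj₂ (x , qx , (λ _ → <ᴿ-irrefl (f x)) ∷ All.map (λ ¬q q → ⊥-elim (¬q q)) none))) ∷ none))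
    ; (inj₂ (m , qm , least)) → k (inj₂ (m , qm , (λ qx x<m → k (inj₂ (x , qx ,
          (λ _ → <ᴿ-irrefl (f x)) ∷ All.map (λ {y} m≤y qy y<x → m≤y qy (<ᴿ-trans (f y) (f x) (f m) y<x x<m)) least))) ∷ least)) }

  norm² : ℂ × ℂ → ℝ
  norm² (α , β) = re (α -ᶜ β) *ᴿ re (α -ᶜ β) +ᴿ im (α -ᶜ β) *ᴿ im (α -ᶜ β)

  norm²-difference : ∀ u w → ∣ ∣z∣² u - ∣z∣² w ∣ ≤ ‖ u -ᵍ w ‖ * (‖ u ‖ + ‖ w ‖)
  norm²-difference u@(a ⊹ b) w@(c ⊹ d) = begin
    ∣ a * a + b * b - (c * c + d * d) ∣  ≡⟨ cong ∣_∣ (factor a b c d) ⟩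
    ∣ (a - c) * (a + c) + (b - d) * (b + d) ∣  ≤⟨ ℚ.∣p+q∣≤∣p∣+∣q∣ ((a - c) * (a + c)) ((b - d) * (b + d)) ⟩
    ∣ (a - c) * (a + c) ∣ + ∣ (b - d) * (b + d) ∣  ≡⟨ cong₂ _+_ (ℚ.∣p*q∣≡∣p∣*∣q∣ (a - c) (a + c)) (ℚ.∣p*q∣≡∣p∣*∣q∣ (b - d) (b + d)) ⟩
    ∣ a - c ∣ * ∣ a + c ∣ + ∣ b - d ∣ * ∣ b + d ∣  ≤⟨ ℚ.+-mono-≤ (*-monoʳ {c = ∣ a - c ∣} (ℚ.0≤∣p∣ (a - c)) (≤-+ʳ (ℚ.0≤∣p∣ (b + d)))) (*-monoʳ {c = ∣ b - d ∣} (ℚ.0≤∣p∣ (b - d)) (≤-+ˡ (ℚ.0≤∣p∣ (a + c)))) ⟩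
    ∣ a - c ∣ * S + ∣ b - d ∣ * S  ≡⟨ sym (ℚ.*-distribʳ-+ S (∣ a - c ∣) (∣ b - d ∣)) ⟩
    (∣ a - c ∣ + ∣ b - d ∣) * S  ≡⟨ cong₂ _*_ (sym (‖⊹‖ (a - c) (b - d))) (sym (‖⊹‖ (a + c) (b + d))) ⟩
    ‖ u -ᵍ w ‖ * ‖ u +ᵍ w ‖  ≤⟨ *-monoʳ (‖‖-nonNeg (u -ᵍ w)) (‖+‖ u w) ⟩
    ‖ u -ᵍ w ‖ * (‖ u ‖ + ‖ w ‖)  ∎
    where
    open ℚ.≤-Reasoning
    S = ∣ a + c ∣ + ∣ b + d ∣
    factor : ∀ a b c d → a * a + b * b - (c * c + d * d) ≡ (a - c) * (a + c) + (b - d) * (b + d)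
    factor = solve-∀ ℚ-ring

  norm²-cong : ∀ α β γ δ → γ ≈ᶜ α → δ ≈ᶜ β → norm² (γ , δ) ≈ᴿ norm² (α , β)
  norm²-cong α β γ δ γ≈α δ≈β ε 0<ε = close (cauchyG-bounded u-cauchy) (cauchyG-bounded w-cauchy)
    where
    u w : ℕ → 𝔾
    u k = at γ k -ᵍ at δ k
    w k = at α k -ᵍ at β k
    u-cauchy : CauchyG u
    u-cauchy = difference-cauchy γ δ
    w-cauchy : CauchyG w
    w-cauchy = difference-cauchy α β
    lemma : ∀ a b c d → (a -ᵍ b) +ᵍ (d -ᵍ c) ≡ (a -ᵍ c) -ᵍ (b -ᵍ d)
    lemma = solve-∀ 𝔾-ring
    u-w : Null (λ k → u k -ᵍ w k)
    u-w = null-cong (λ k → lemma (at γ k) (at α k) (at δ k) (at β k)) (null-+ (≈⇒null {γ} {α} γ≈α) (null-neg {at δ} {at β} (≈⇒null {δ} {β} δ≈β)))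
    close : BoundedG u → BoundedG w → Eventually λ k → ∣ ∣z∣² (u k) - ∣z∣² (w k) ∣ < ε
    close (X , 1≤X , u≤X) (Y , 1≤Y , w≤Y) = let η , 0<η , le = shrink (X + Y) ε 0<ε in
      eventually-map (λ k ((hu , hw) , hk) → ℚ.≤-<-trans (norm²-difference (u k) (w k))
        (ℚ.≤-<-trans (*-monoʳ (‖‖-nonNeg (u k -ᵍ w k)) (ℚ.+-mono-≤ hu hw))
          (ℚ.<-≤-trans (*-mono<ˡ (ℚ.<-≤-trans 0<1 (ℚ.≤-trans 1≤X (≤-+ʳ (ℚ.≤-trans 0≤1 1≤Y)))) hk) (ℚ.≤-trans (ℚ.≤-reflexive (ℚ.*-comm η (X + Y))) le)))) (u≤X ∩ w≤Y ∩ u-w η 0<η)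

  -- Minimality in terms of squares, so that it can be applied to a pair of roots without first
  -- constructing the modulus of their difference.
  SmallerThanDistances : ℤ[X].Poly → ℝ → Set
  SmallerThanDistances P s = ∀ α β → Root P α → Root P β → ¬ (α ≈ᶜ β) → ∀ ε → 0ℚ < ε → ¬ ¬ Eventually λ k → seq s k * seq s k < seq (norm² (α , β)) k + ε

  Separated : ℤ[X].Poly → ℝ → Set
  Separated P s = IsSep P s × (∃ λ σ → 0ℚ < σ × Eventually λ k → σ ≤ seq s k) × SmallerThanDistances P s × (∀ k → 0ℚ ≤ seq s k)

  -- Factor `s² − t² = (s − t)(s + t)`. Nonnegativity of `t` is available only up to `ε / 4`, which
  -- still leaves `s + t ≥ ε / 2`.
  square-gap : ∀ s t ε → 0ℚ < ε → t + ε < s → 0ℚ < t + ½ * (½ * ε) → t * t + ½ * (ε * ε) ≤ s * s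
  square-gap s t ε 0<ε t<s 0<t = ≤-by-difference (subst (0ℚ ≤_) (lemma s t ε) (difference-nonNeg
      (*-mono {½ * ε} {s + t} {ε} {s - t} (ℚ.<⇒≤ 0<ε) (ℚ.≤-trans (ℚ.<⇒≤ (half>0 ε 0<ε)) ½ε≤) ½ε≤ ε≤)))
    where
    lemma : ∀ s t ε → (s + t) * (s - t) - ½ * ε * ε ≡ s * s - (t * t + ½ * (ε * ε))
    lemma = solve-∀ ℚ-ring
    move : ∀ s t ε → s - (t + ε) ≡ s - t - ε
    move = solve-∀ ℚ-ring
    ε≤ : ε ≤ s - t
    ε≤ = ≤-by-difference (subst (0ℚ ≤_) (move s t ε) (ℚ.<⇒≤ (difference-pos t<s)))
    sum : ∀ s t ε → s - (t + ε) + (1ℚ + 1ℚ) * (t + ½ * (½ * ε)) ≡ s + t - ½ * ε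
    sum = solve-∀ ℚ-ring
    ½ε≤ : ½ * ε ≤ s + t
    ½ε≤ = ≤-by-difference (subst (0ℚ ≤_) (sum s t ε) (+-nonNeg (ℚ.<⇒≤ (difference-pos t<s)) (*-nonNeg {2ℚ} (ℚ.<⇒≤ 0<2) (ℚ.<⇒≤ 0<t))))

  quarters : ∀ ε → ½ * (½ * (½ * (ε * ε))) + ½ * (½ * (½ * (ε * ε))) + (½ * (½ * (½ * (ε * ε))) + ½ * (½ * (½ * (ε * ε)))) ≡ ½ * (ε * ε)
  quarters = solve-∀ ℚ-ring

  squares-gap : ∀ t N X s M ε η → η + η + (η + η) ≡ ½ * (ε * ε) → 0ℚ < ε → 0ℚ < η → t + ε < s → 0ℚ < t + ½ * (½ * ε) →
    ∣ t * t - N ∣ < η → ∣ N - X ∣ < η → s * s ≤ M → X + η < M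
  squares-gap t N X s M ε η four 0<ε 0<η lt pos near near′ s²≤M = <-by-difference (subst (0ℚ <_) (lemma (t * t) N X (s * s) M η)
      (+-pos-nonNeg (ℚ.+-mono-< (ℚ.+-mono-< (difference-pos (ℚ.≤-<-trans (-p≤∣p∣ (t * t - N)) near)) (difference-pos (ℚ.≤-<-trans (-p≤∣p∣ (N - X)) near′))) 0<η)
        (+-nonNeg (difference-nonNeg (subst (λ E → t * t + E ≤ s * s) (sym four) (square-gap s t ε 0<ε lt pos))) (difference-nonNeg s²≤M))))
    where
    lemma : ∀ t N X s M η → (η - - (t - N)) + (η - - (N - X)) + η + ((s - (t + (η + η + (η + η)))) + (M - s)) ≡ M - (X + η)
    lemma = solve-∀ ℚ-ring

  -- The square root of the least squared distance over pairs from a complete list of roots. Any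
  -- other pair of distinct roots agrees with one from the list up to `_≈ᶜ_`, hence has the same
  -- squared distance.
  separation-exists : ∀ P d → coeffℚ P d ≡ 1ℚ → Below 0ℚ (suc d) (coeffℚ P) → HasDistinctRoots P → ¬ ¬ ∃ (Separated P)
  separation-exists P d monic below (α₀ , β₀ , root-α₀ , root-β₀ , α₀≉β₀) none =
    all-roots P d monic below λ (L , roots , complete) → minimum norm² Q (cartesianProduct L L) (minimal L roots complete)
    where
    Q : ℂ × ℂ → Set
    Q (α , β) = Root P α × Root P β × ¬ (α ≈ᶜ β)

    module _ (L : List ℂ) (roots : All (Root P) L) (complete : ∀ α → Root P α → ¬ ¬ Any (α ≈ᶜ_) L) where

      represented : ∀ γ δ → Q (γ , δ) → (∀ x → x ∈ cartesianProduct L L → Q x → norm² (γ , δ) ≈ᴿ norm² x → ⊥) → ⊥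
      represented γ δ (root-γ , root-δ , γ≉δ) use = complete γ root-γ λ any-γ → complete δ root-δ λ any-δ →
        let α , α∈L , γ≈α = find any-γ
            β , β∈L , δ≈β = find any-δ
        in use (α , β) (∈-cartesianProduct⁺ α∈L β∈L) (All.lookup roots α∈L , All.lookup roots β∈L , λ α≈β →
             γ≉δ (null⇒≈ {γ} {δ} (null-cong (λ k → lemma (at γ k) (at α k) (at β k) (at δ k))
               (null-+ (null-+ (≈⇒null {γ} {α} γ≈α) (≈⇒null {α} {β} α≈β)) (null-neg {at δ} {at β} (≈⇒null {δ} {β} δ≈β))))))
           (norm²-cong α β γ δ γ≈α δ≈β)
        where
        lemma : ∀ c a b d → (c -ᵍ a) +ᵍ (a -ᵍ b) +ᵍ (b -ᵍ d) ≡ c -ᵍ d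
        lemma = solve-∀ 𝔾-ring

      minimal : ¬ (All (λ x → ¬ Q x) (cartesianProduct L L) ⊎ ∃ λ m → Q m × All (λ x → Q x → norm² m ≤ᴿ norm² x) (cartesianProduct L L))
      minimal (inj₁ empty) = represented α₀ β₀ (root-α₀ , root-β₀ , α₀≉β₀) λ x x∈ qx _ → All.lookup empty x∈ qx
      minimal (inj₂ (m@(α , β) , (root-α , root-β , α≉β) , least)) =
        not-null⇒apart (difference-cauchy α β) (λ h → α≉β (null⇒≈ {α} {β} h)) λ (σ , 0<σ , apart) → none (sqrt ,
          ((α , β , root-α , root-β , α≉β , sqrt≥0 , sqrt²) , λ t (γ , δ , root-γ , root-δ , γ≉δ , t≥0 , t²≈) t<s →
              represented γ δ (root-γ , root-δ , γ≉δ) λ x x∈ qx close → All.lookup least x∈ qx (smaller t t≥0 t<s (norm² (γ , δ)) t²≈ (norm² x) close)) ,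
          (½ * σ , half>0 σ 0<σ , eventually-map (λ k (σ≤ , close) → positive σ 0<σ k σ≤ close)
              (apart ∩ s²-close (½ * (½ * (σ * σ))) (half>0 _ (half>0 _ (*-pos 0<σ 0<σ))))) ,
          (λ γ δ root-γ root-δ γ≉δ ε 0<ε fail → represented γ δ (root-γ , root-δ , γ≉δ) λ x x∈ qx close →
              fail (eventually-map (λ k (le , near) → bound (seq (norm² m) k) (seq (norm² x) k) (seq (norm² (γ , δ)) k) ε k (s²≤y k) le near)
                (≤ᴿ⇒eventually (norm² m) (norm² x) (All.lookup least x∈ qx) (½ * ε) (half>0 ε 0<ε) ∩ close (½ * ε) (half>0 ε 0<ε)))) ,
          s-nonNeg)
        where
        open SquareRoot (norm² m) (λ k → ∣z∣²-nonNeg (at α k -ᵍ at β k))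
        sqrt≥0 : 0ᴿ ≤ᴿ sqrt
        sqrt≥0 (ε , 0<ε , N , h) = <⇒≱ (h N ℕ.≤-refl) (+-nonNeg (s-nonNeg N) (ℚ.<⇒≤ 0<ε))
        positive : ∀ σ → 0ℚ < σ → ∀ k → σ ≤ ‖ at α k -ᵍ at β k ‖ → seq (norm² m) k - seq sqrt k * seq sqrt k < ½ * (½ * (σ * σ)) → ½ * σ ≤ seq sqrt k
        positive σ 0<σ k σ≤ close = square-cancel-≤ (s-nonNeg k) (≤-by-difference (subst (0ℚ ≤_) (lemma σ (seq (norm² m) k) (seq sqrt k))
            (+-nonNeg (ℚ.<⇒≤ (difference-pos close)) (*-nonNeg {½} (ℚ.nonNegative⁻¹ ½)
              (difference-nonNeg (ℚ.≤-trans (*-mono (ℚ.<⇒≤ 0<σ) (‖‖-nonNeg (at α k -ᵍ at β k)) σ≤ σ≤) (‖z‖²≤2∣z∣² (at α k -ᵍ at β k))))))))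
          where
          lemma : ∀ σ N s → ½ * (½ * (σ * σ)) - (N - s * s) + ½ * ((1ℚ + 1ℚ) * N - σ * σ) ≡ s * s - ½ * σ * (½ * σ)
          lemma = solve-∀ ℚ-ring
        bound : ∀ M X N ε k → seq sqrt k * seq sqrt k ≤ M → M < X + ½ * ε → ∣ N - X ∣ < ½ * ε → seq sqrt k * seq sqrt k < N + ε
        bound M X N ε k s²≤M M< near = ℚ.≤-<-trans s²≤M (ℚ.<-trans M< (subst₂ _<_ (recentred N X ε) (collect N ε)
            (ℚ.+-monoʳ-< (N + ½ * ε) (ℚ.≤-<-trans (-p≤∣p∣ (N - X)) near))))
          where
          recentred : ∀ N X ε → N + ½ * ε + - (N - X) ≡ X + ½ * ε
          recentred = solve-∀ ℚ-ring
          collect : ∀ N ε → N + ½ * ε + ½ * ε ≡ N + ε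
          collect = solve-∀ ℚ-ring
        smaller : ∀ t → 0ᴿ ≤ᴿ t → t <ᴿ sqrt → ∀ N → t *ᴿ t ≈ᴿ N → ∀ X → N ≈ᴿ X → X <ᴿ norm² m
        smaller t t≥0 (ε , 0<ε , t<s) N t²≈N X N≈X = η , 0<η , eventually-map
            (λ k (((lt , pos) , near) , near′) → squares-gap (seq t k) (seq N k) (seq X k) (seq sqrt k) (seq (norm² m) k) ε η (quarters ε) 0<ε 0<η lt pos near near′ (s²≤y k))
            (t<s ∩ ≤ᴿ⇒eventually 0ᴿ t t≥0 (½ * (½ * ε)) (half>0 _ (half>0 ε 0<ε)) ∩ t²≈N η 0<η ∩ N≈X η 0<η)
          where
          η = ½ * (½ * (½ * (ε * ε)))
          0<η : 0ℚ < η
          0<η = half>0 _ (half>0 _ (half>0 _ (*-pos 0<ε 0<ε)))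

-- Two close roots of the family

module FamilyRoots where
  open import Data.Rational.Base using (_+_; _*_; _-_; -_; ∣_∣; _≤_; _<_)
  open import Tactic.RingSolver using (solve-∀)
  open Rationals
  open Gaussian using (2ℚ)
  open Places using (_∩_; eventually-map)
  open Cuts using (<⇒≱)
  open RootSeparation using (norm²)
  open Family

  -- The power `x ^ (2 n + 1)`, in the form in which it occurs in `g-at-t`.
  odd-power : ℕ → ℚ → ℚ
  odd-power n x = (x * x) ^ n * x

  odd-power-* : ∀ n a b → odd-power n (a * b) ≡ odd-power n a * odd-power n b
  odd-power-* n a b = trans (cong (_* (a * b)) (trans (cong (_^ n) (square a b)) (^-distrib-* (a * a) (b * b) n))) (regroup ((a * a) ^ n) ((b * b) ^ n) a b)
    where
    square : ∀ a b → a * b * (a * b) ≡ a * a * (b * b)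
    square = solve-∀ ℚ-ring
    regroup : ∀ x y a b → x * y * (a * b) ≡ x * a * (y * b)
    regroup = solve-∀ ℚ-ring

  odd-power-mono : ∀ n {a b} → 0ℚ ≤ a → a ≤ b → odd-power n a ≤ odd-power n b
  odd-power-mono n {a} {b} 0≤a a≤b = *-mono 0≤a (^-nonNeg n (square-nonNeg b)) (^-mono n (square-nonNeg a) (*-mono 0≤a (ℚ.≤-trans 0≤a a≤b) a≤b a≤b)) a≤b

  odd-power-pos : ∀ n {a} → 0ℚ < a → 0ℚ < odd-power n a
  odd-power-pos n 0<a = *-pos (^-pos n (*-pos 0<a 0<a)) 0<a

  odd-power-1 : ∀ n → odd-power n 1ℚ ≡ 1ℚ
  odd-power-1 n = trans (ℚ.*-identityʳ _) (1^n≡1 n)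

  odd-power-^ : ∀ n a j → odd-power n (a ^ j) ≡ a ^ ((j ℕ.+ j) ℕ.* n ℕ.+ j)
  odd-power-^ n a j = trans (cong (_* a ^ j) (trans (cong (_^ n) (sym (^-+ a j j))) (sym (^-* a (j ℕ.+ j) n)))) (sym (^-+ a ((j ℕ.+ j) ℕ.* n) j))

  ≤-triangleℚ : ∀ a b → ∣ a ∣ ≤ ∣ b ∣ + ∣ a - b ∣
  ≤-triangleℚ a b = subst (λ x → ∣ x ∣ ≤ ∣ b ∣ + ∣ a - b ∣) (recover b a) (ℚ.∣p+q∣≤∣p∣+∣q∣ b (a - b))

  module Approximation (m : ℕ) (1≤m : 1 ℕ.≤ m) (i : ℕ) where
    open Parameter m 1≤m
    open Member i public

    -- This is `2 k² − 1` for `k = suc j`. The first summand `suc j` comes from the slope of `g`;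
    -- the rest is `j (2 k + 1)`, from `t ≤ m^(−j)` raised to the power `2 k + 1`.
    agreement : ℕ
    agreement = suc j ℕ.+ ((j ℕ.+ j) ℕ.* suc j ℕ.+ j)

    private
      by-order : ∀ (R : ℚ → ℚ → Set) (a b : ℚ) → (∀ a b → R a b → R b a) → (∀ a b → 0ℚ ≤ a → a ≤ b → b ≤ 1ℚ → R a b) → 0ℚ ≤ a → 0ℚ ≤ b → a ≤ 1ℚ → b ≤ 1ℚ → R a b
      by-order R a b symmetric h 0≤a 0≤b a≤1 b≤1 = decide (ℚ.≤-total a b)
        where
        decide : a ≤ b ⊎ b ≤ a → R a b
        decide (inj₁ a≤b) = h a b 0≤a a≤b b≤1
        decide (inj₂ b≤a) = symmetric b a (h b a 0≤b b≤a a≤1)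

      expansion : ∀ a b → 0ℚ ≤ a → 0ℚ ≤ b → a ≤ 1ℚ → b ≤ 1ℚ → M ^ suc j * ∣ a - b ∣ ≤ ∣ g a - g b ∣
      expansion a b = by-order (λ a b → M ^ suc j * ∣ a - b ∣ ≤ ∣ g a - g b ∣) a b
        (λ a b → subst₂ (λ x y → M ^ suc j * x ≤ y) (∣p-q∣≡∣q-p∣ a b) (∣p-q∣≡∣q-p∣ (g a) (g b)))
        (λ a b 0≤a a≤b _ → subst₂ (λ x y → M ^ suc j * x ≤ y) (trans (sym (ℚ.0≤p⇒∣p∣≡p (difference-nonNeg a≤b))) (∣p-q∣≡∣q-p∣ b a)) (∣p-q∣≡∣q-p∣ (g b) (g a))
          (ℚ.≤-trans (g-growth′ a b 0≤a a≤b) (p≤∣p∣ (g b - g a))))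

      0≤Lg : 0ℚ ≤ Lg
      0≤Lg = +-nonNeg 0≤4 (M^-nonNeg (suc j))

      contraction : ∀ a b → 0ℚ ≤ a → 0ℚ ≤ b → a ≤ 1ℚ → b ≤ 1ℚ → ∣ g a - g b ∣ ≤ Lg * ∣ a - b ∣
      contraction a b = by-order (λ a b → ∣ g a - g b ∣ ≤ Lg * ∣ a - b ∣) a b
        (λ a b → subst₂ (λ x y → x ≤ Lg * y) (∣p-q∣≡∣q-p∣ (g a) (g b)) (∣p-q∣≡∣q-p∣ a b))
        (λ a b 0≤a a≤b b≤1 → subst₂ (λ x y → x ≤ Lg * y)
          (trans (sym (ℚ.0≤p⇒∣p∣≡p (ℚ.≤-trans (difference-nonNeg a≤b) (g-growth a b 0≤a a≤b)))) (∣p-q∣≡∣q-p∣ (g b) (g a)))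
          (trans (sym (ℚ.0≤p⇒∣p∣≡p (difference-nonNeg a≤b))) (∣p-q∣≡∣q-p∣ b a))
          (g-lipschitz a b 0≤a a≤b (ℚ.≤-trans b≤1 (≤-+ʳ {1ℚ} 0≤1))))

      ∣t²-M∣≤M : ∀ x → 0ℚ ≤ x → x ≤ 1ℚ → ∣ x * x - M ∣ ≤ M
      ∣t²-M∣≤M x 0≤x x≤1 = ∣p∣≤ {x * x - M} (≤-by-difference (subst (0ℚ ≤_) (lemma (x * x) M) (+-nonNeg (difference-nonNeg (ℚ.≤-trans (*-mono {b = 1ℚ} {d = 1ℚ} 0≤x 0≤1 x≤1 x≤1) 1≤M)) 0≤M)))
          (≤-by-difference (subst (0ℚ ≤_) (lemma′ (x * x) M) (square-nonNeg x)))
        where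
        lemma : ∀ y M → M - y + M ≡ M - (y - M)
        lemma = solve-∀ ℚ-ring
        lemma′ : ∀ y M → y ≡ M - - (y - M)
        lemma′ = solve-∀ ℚ-ring

      correction : ∀ x → 0ℚ ≤ x → x ≤ 1ℚ → ∣ f x * (x * x - M) ∣ ≤ M * ∣ f x ∣
      correction x 0≤x x≤1 = ℚ.≤-trans (ℚ.≤-reflexive (trans (ℚ.∣p*q∣≡∣p∣*∣q∣ (f x) (x * x - M)) (ℚ.*-comm (∣ f x ∣) (∣ x * x - M ∣)))) (*-monoˡ (ℚ.0≤∣p∣ (f x)) (∣t²-M∣≤M x 0≤x x≤1))

      Z : ℚ
      Z = odd-power (suc j) (M ^ j)
      0≤Z : 0ℚ ≤ Z
      0≤Z = *-nonNeg (^-nonNeg (suc j) (square-nonNeg (M ^ j))) (M^-nonNeg j)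

      Z*t^≤1 : ∀ x → 0ℚ ≤ x → f x ≤ 0ℚ → Z * odd-power (suc j) x ≤ 1ℚ
      Z*t^≤1 x 0≤x fx≤0 = subst₂ _≤_ (odd-power-* (suc j) (M ^ j) x) (odd-power-1 (suc j)) (odd-power-mono (suc j) (*-nonNeg (M^-nonNeg j) 0≤x) scaled≤1)
        where
        lemma : ∀ x e → x * e ≡ x * e - 1ℚ + 1ℚ
        lemma = solve-∀ ℚ-ring
        scaled≤1 : M ^ j * x ≤ 1ℚ
        scaled≤1 = ℚ.≤-trans (*-monoˡ 0≤x (M^j≤E j x)) (ℚ.≤-trans (ℚ.≤-reflexive (trans (ℚ.*-comm (E j x) x) (lemma x (E j x)))) (ℚ.+-monoˡ-≤ 1ℚ fx≤0))

      -- As `f(x) ≤ 0`, we have `x ≤ M^(−j)`, so that the term `x^(2k+1)` in `g-at-t` is at most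
      -- `1 / Z`. The slope of `g` turns the smallness of `g(x)` and `g(y)` into closeness of `x`
      -- and `y`; the values of `f` and `g` remain as error terms.
      close-pointwise : ∀ x y → 0ℚ ≤ x → 0ℚ ≤ y → x ≤ 1ℚ → y ≤ 1ℚ → f x ≤ 0ℚ → Z * (M ^ suc j * ∣ x - y ∣) ≤ 1ℚ + Z * (M * ∣ f x ∣ + ∣ g y ∣)
      close-pointwise x y 0≤x 0≤y x≤1 y≤1 fx≤0 = begin
        Z * (M ^ suc j * ∣ x - y ∣)  ≤⟨ *-monoʳ 0≤Z (ℚ.≤-trans (expansion x y 0≤x 0≤y x≤1 y≤1) (triangle (g x) (g y))) ⟩
        Z * (∣ g x ∣ + ∣ g y ∣)  ≤⟨ *-monoʳ 0≤Z (ℚ.+-monoˡ-≤ (∣ g y ∣) g-bound) ⟩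
        Z * (odd-power (suc j) x + M * ∣ f x ∣ + ∣ g y ∣)  ≡⟨ regroup Z (odd-power (suc j) x) (M * ∣ f x ∣) (∣ g y ∣) ⟩
        Z * odd-power (suc j) x + Z * (M * ∣ f x ∣ + ∣ g y ∣)  ≤⟨ ℚ.+-monoˡ-≤ (Z * (M * ∣ f x ∣ + ∣ g y ∣)) (Z*t^≤1 x 0≤x fx≤0) ⟩
        1ℚ + Z * (M * ∣ f x ∣ + ∣ g y ∣)  ∎
        where
        open ℚ.≤-Reasoning
        regroup : ∀ z w a b → z * (w + a + b) ≡ z * w + z * (a + b)
        regroup = solve-∀ ℚ-ring
        triangle : ∀ a b → ∣ a - b ∣ ≤ ∣ a ∣ + ∣ b ∣
        triangle a b = ℚ.≤-trans (ℚ.∣p+q∣≤∣p∣+∣q∣ a (- b)) (ℚ.≤-reflexive (cong (∣ a ∣ +_) (ℚ.∣-p∣≡∣p∣ b)))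
        g-bound : ∣ g x ∣ ≤ odd-power (suc j) x + M * ∣ f x ∣
        g-bound = ℚ.≤-trans (ℚ.≤-reflexive (cong ∣_∣ (g-at-t x))) (ℚ.≤-trans (triangle (odd-power (suc j) x) (f x * (x * x - M)))
          (ℚ.+-mono-≤ (ℚ.≤-reflexive (ℚ.0≤p⇒∣p∣≡p (*-nonNeg (^-nonNeg (suc j) (square-nonNeg x)) 0≤x))) (correction x 0≤x x≤1)))

    close : Eventually λ n → M ^ agreement * ∣ t n - u n ∣ ≤ 2ℚ
    close = let η , 0<η , le = shrink (Z * (M + 1ℚ)) 1ℚ 0<1 in
      eventually-map (λ n (hf , hg) → bound n η hf hg le) (f-root.f-null η 0<η ∩ g-root.f-null η 0<η)
      where
      regroup : ∀ z M η → z * (M + 1ℚ) * η ≡ z * (M * η + η)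
      regroup = solve-∀ ℚ-ring
      bound : ∀ n η → ∣ f (t n) ∣ < η → ∣ g (u n) ∣ < η → Z * (M + 1ℚ) * η ≤ 1ℚ → M ^ agreement * ∣ t n - u n ∣ ≤ 2ℚ
      bound n η hf hg le = begin
        M ^ agreement * ∣ t n - u n ∣  ≡⟨ cong (_* ∣ t n - u n ∣) (trans (^-+ M (suc j) ((j ℕ.+ j) ℕ.* suc j ℕ.+ j)) (trans (ℚ.*-comm (M ^ suc j) (M ^ ((j ℕ.+ j) ℕ.* suc j ℕ.+ j))) (cong (_* M ^ suc j) (sym (odd-power-^ (suc j) M j))))) ⟩
        Z * M ^ suc j * ∣ t n - u n ∣  ≡⟨ ℚ.*-assoc Z (M ^ suc j) (∣ t n - u n ∣) ⟩
        Z * (M ^ suc j * ∣ t n - u n ∣)  ≤⟨ close-pointwise (t n) (u n) (f-root.t-nonNeg n) (g-root.t-nonNeg n) (f-root.t≤1 n) (g-root.t≤1 n) (f-root.f≤0 n) ⟩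
        1ℚ + Z * (M * ∣ f (t n) ∣ + ∣ g (u n) ∣)  ≤⟨ ℚ.+-monoʳ-≤ 1ℚ (*-monoʳ 0≤Z (ℚ.+-mono-≤ (*-monoʳ 0≤M (ℚ.<⇒≤ hf)) (ℚ.<⇒≤ hg))) ⟩
        1ℚ + Z * (M * η + η)  ≡⟨ cong (λ z → 1ℚ + z) (sym (regroup Z M η)) ⟩
        1ℚ + Z * (M + 1ℚ) * η  ≤⟨ ℚ.+-monoʳ-≤ 1ℚ le ⟩
        2ℚ  ∎
        where open ℚ.≤-Reasoning

    norm²-value : ∀ n → seq (norm² (α , β)) n ≡ ∣ t n - u n ∣ * ∣ t n - u n ∣
    norm²-value n = trans (lemma (t n) (u n)) (sym (∣p∣*∣p∣≡p*p (t n - u n)))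
      where
      lemma : ∀ t u → (- t - - u) * (- t - - u) + (0ℚ - 0ℚ) * (0ℚ - 0ℚ) ≡ (t - u) * (t - u)
      lemma = solve-∀ ℚ-ring

    private
      ∣-∣ : ∀ a b → ∣ - a - - b ∣ ≡ ∣ a - b ∣
      ∣-∣ a b = trans (cong ∣_∣ (lemma a b)) (ℚ.∣-p∣≡∣p∣ (a - b))
        where
        lemma : ∀ a b → - a - - b ≡ - (a - b)
        lemma = solve-∀ ℚ-ring

      -- A common root `t` of `f` and `g` would satisfy `t^(2k+1) = 0` by `g-at-t`, while `f(t) = 0`
      -- means `t · E j t = 1` and keeps `t` above `1 / U`. The constants are parameters, so that
      -- the argument uses only their stated properties; `θ` is one half.
      module Distinct (θ : ℚ) (0<θ : 0ℚ < θ) (θ+θ≡1 : θ + θ ≡ 1ℚ) (U : ℚ) (0<U : 0ℚ < U) (E≤U : ∀ x → 0ℚ ≤ x → x ≤ 1ℚ → E j x ≤ U)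
        (L : ℚ) (0≤L : 0ℚ ≤ L) (contracts : ∀ a b → 0ℚ ≤ a → 0ℚ ≤ b → a ≤ 1ℚ → b ≤ 1ℚ → ∣ g a - g b ∣ ≤ L * ∣ a - b ∣) where

        D ω : ℚ
        D = odd-power (suc j) U
        ω = odd-power (suc j) θ
        0<ω : 0ℚ < ω
        0<ω = odd-power-pos (suc j) 0<θ
        0≤D : 0ℚ ≤ D
        0≤D = ℚ.<⇒≤ (odd-power-pos (suc j) 0<U)
        0<θω : 0ℚ < θ * ω
        0<θω = *-pos 0<θ 0<ω
        θω<ω : θ * ω < ω
        θω<ω = subst₂ _<_ (ℚ.+-identityʳ (θ * ω)) (trans (sym (ℚ.*-distribʳ-+ ω θ θ)) (trans (cong (_* ω) θ+θ≡1) (ℚ.*-identityˡ ω))) (ℚ.+-monoʳ-< (θ * ω) 0<θω)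

        solved : ∀ w c gx → gx ≡ w - c → w ≡ gx + c
        solved w c gx refl = lemma w c
          where
          lemma : ∀ w c → w ≡ w - c + c
          lemma = solve-∀ ℚ-ring

        impossible : ∀ x y η → 0ℚ ≤ x → x ≤ 1ℚ → 0ℚ ≤ y → y ≤ 1ℚ → ∣ f x ∣ < η → ∣ g y ∣ < η → ∣ x - y ∣ < η → ∣ f x ∣ < θ → D * (1ℚ + L + M) * η ≤ θ * ω → ⊥
        impossible x y η 0≤x x≤1 0≤y y≤1 hf hg ht hf′ le = <⇒≱ θω<ω (begin
          ω  ≤⟨ odd-power-mono (suc j) (ℚ.<⇒≤ 0<θ) θ≤Ux ⟩
          odd-power (suc j) (U * x)  ≡⟨ odd-power-* (suc j) U x ⟩
          D * odd-power (suc j) x  ≤⟨ *-monoʳ 0≤D W≤ ⟩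
          D * (η + L * η + M * η)  ≡⟨ regroup D L M η ⟩
          D * (1ℚ + L + M) * η  ≤⟨ le ⟩
          θ * ω  ∎)
          where
          open ℚ.≤-Reasoning
          regroup : ∀ d l M η → d * (η + l * η + M * η) ≡ d * (1ℚ + l + M) * η
          regroup = solve-∀ ℚ-ring
          lemma : ∀ x e θ → θ - - (x * e - 1ℚ) ≡ x * e - (1ℚ - θ)
          lemma = solve-∀ ℚ-ring
          1-θ : 1ℚ - θ ≡ θ
          1-θ = trans (cong (_- θ) (sym θ+θ≡1)) (cancel θ)
            where
            cancel : ∀ θ → θ + θ - θ ≡ θ
            cancel = solve-∀ ℚ-ring
          θ≤Ux : θ ≤ U * x
          θ≤Ux = ℚ.≤-trans (subst (_≤ x * E j x) 1-θ (≤-by-difference (subst (0ℚ ≤_) (lemma x (E j x) θ) (difference-nonNeg (ℚ.≤-trans (-p≤∣p∣ (f x)) (ℚ.<⇒≤ hf′))))))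
            (ℚ.≤-trans (*-monoʳ 0≤x (E≤U x 0≤x x≤1)) (ℚ.≤-reflexive (ℚ.*-comm x U)))
          W≤ : odd-power (suc j) x ≤ η + L * η + M * η
          W≤ = begin
            odd-power (suc j) x  ≡⟨ solved (odd-power (suc j) x) (f x * (x * x - M)) (g x) (g-at-t x) ⟩
            g x + f x * (x * x - M)  ≤⟨ ℚ.+-mono-≤ (ℚ.≤-trans (p≤∣p∣ (g x)) (≤-triangleℚ (g x) (g y))) (ℚ.≤-trans (p≤∣p∣ (f x * (x * x - M))) (correction x 0≤x x≤1)) ⟩
            ∣ g y ∣ + ∣ g x - g y ∣ + M * ∣ f x ∣  ≤⟨ ℚ.+-mono-≤ (ℚ.+-mono-≤ (ℚ.<⇒≤ hg) (ℚ.≤-trans (contracts x y 0≤x 0≤y x≤1 y≤1) (*-monoʳ 0≤L (ℚ.<⇒≤ ht)))) (*-monoʳ 0≤M (ℚ.<⇒≤ hf)) ⟩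
            η + L * η + M * η  ∎

        distinct-roots : ¬ (α ≈ᶜ β)
        distinct-roots (near , _) =
          let η , 0<η , le = shrink (D * (1ℚ + L + M)) (θ * ω) 0<θω
              N , h = f-root.f-null η 0<η ∩ g-root.f-null η 0<η ∩ near η 0<η ∩ f-root.f-null θ 0<θ
              (((hf , hg) , ht) , hf′) = h N ℕ.≤-refl
          in impossible (t N) (u N) η (f-root.t-nonNeg N) (f-root.t≤1 N) (g-root.t-nonNeg N) (g-root.t≤1 N) hf hg (subst (_< η) (∣-∣ (t N) (u N)) ht) hf′ le

    distinct : ¬ (α ≈ᶜ β)
    distinct = Distinct.distinct-roots ½ (ℚ.positive⁻¹ ½) refl (E j 1ℚ) (ℚ.<-≤-trans 0<1 (1≤E j 1ℚ)) (λ x → E-mono j {x} {1ℚ}) Lg 0≤Lg contraction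

-- The lower bounds

module LowerMain where
  open import Data.Integer.Base as ℤ using (ℤ; +_; -[1+_])
  import Data.Integer.Properties as ℤ
  open import Data.Nat.Base using (NonTrivial)
  open import Data.Rational.Base using (_+_; _*_; _-_; -_; ∣_∣; _≤_; _<_; ↥_; ↧ₙ_; _/_; _⊔_; _⊓_)
  open import Tactic.RingSolver using (solve-∀)
  open Rationals
  open Gaussian using (2ℚ; 0<2)
  open Places using (_∩_; eventually-map)
  open Reals
  open Cuts using (<⇒≱)
  open Logarithms using (module Logarithm; 3ℚ; 1≤3)
  open RootSeparation
  open Family
  open FamilyRoots

  ⊓-glb-< : ∀ {a b c} → c < a → c < b → c < a ⊓ b
  ⊓-glb-< {a} {b} {c} c<a c<b = select (ℚ.⊓-sel a b)
    where
    select : a ⊓ b ≡ a ⊎ a ⊓ b ≡ b → c < a ⊓ b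
    select (inj₁ e) = subst (c <_) (sym e) c<a
    select (inj₂ e) = subst (c <_) (sym e) c<b

  ⊔-lub-< : ∀ {a b c} → a < c → b < c → a ⊔ b < c
  ⊔-lub-< {a} {b} {c} a<c b<c = select (ℚ.⊔-sel a b)
    where
    select : a ⊔ b ≡ a ⊎ a ⊔ b ≡ b → a ⊔ b < c
    select (inj₁ e) = subst (_< c) (sym e) a<c
    select (inj₂ e) = subst (_< c) (sym e) b<c

  -- From s ≤ 3 m⁻ᴬ and H ≤ C mᴮ with w B < A v, so that e = −log s / log H exceeds w/v.
  power-estimate : ∀ (s M H C : ℚ) A B v w → 0ℚ ≤ s → 1ℚ ≤ M → 0ℚ ≤ H → 0ℚ ≤ C → s * M ^ A ≤ 3ℚ → H ≤ C * M ^ B → w ℕ.* B ℕ.< A ℕ.* v →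
    3ℚ ^ v * C ^ w ≤ M → s ^ v * H ^ w ≤ 1ℚ
  power-estimate s M H C A B v w 0≤s 1≤M 0≤H 0≤C s≤ H≤ gap large = *-cancel≤ʳ {c = M ^ (A ℕ.* v)} (^-pos (A ℕ.* v) (ℚ.<-≤-trans 0<1 1≤M)) (begin
    M ^ (A ℕ.* v) * (s ^ v * H ^ w)  ≡⟨ cong (_* (s ^ v * H ^ w)) (^-* M A v) ⟩
    (M ^ A) ^ v * (s ^ v * H ^ w)  ≡⟨ regroup ((M ^ A) ^ v) (s ^ v) (H ^ w) ⟩
    s ^ v * (M ^ A) ^ v * H ^ w  ≡⟨ cong (_* H ^ w) (sym (^-distrib-* s (M ^ A) v)) ⟩
    (s * M ^ A) ^ v * H ^ w  ≤⟨ *-mono (^-nonNeg w 0≤H) (^-nonNeg v 0≤3) (^-mono v (*-nonNeg 0≤s (^-nonNeg A 0≤M)) s≤) (^-mono w 0≤H H≤) ⟩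
    3ℚ ^ v * (C * M ^ B) ^ w  ≡⟨ cong (3ℚ ^ v *_) (^-distrib-* C (M ^ B) w) ⟩
    3ℚ ^ v * (C ^ w * (M ^ B) ^ w)  ≡⟨ sym (ℚ.*-assoc (3ℚ ^ v) (C ^ w) ((M ^ B) ^ w)) ⟩
    3ℚ ^ v * C ^ w * (M ^ B) ^ w  ≤⟨ *-monoˡ (^-nonNeg w (^-nonNeg B 0≤M)) large ⟩
    M * (M ^ B) ^ w  ≡⟨ cong (M *_) (trans (sym (^-* M B w)) (cong (M ^_) (ℕ.*-comm B w))) ⟩
    M ^ suc (w ℕ.* B)  ≤⟨ ^-monoʳ 1≤M gap ⟩
    M ^ (A ℕ.* v)  ≡⟨ sym (ℚ.*-identityʳ _) ⟩
    M ^ (A ℕ.* v) * 1ℚ  ∎)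
    where
    open ℚ.≤-Reasoning
    0≤M = ℚ.≤-trans 0≤1 1≤M
    0≤3 : 0ℚ ≤ 3ℚ
    0≤3 = ℚ.≤-trans 0≤1 1≤3
    regroup : ∀ a b c → a * (b * c) ≡ b * a * c
    regroup = solve-∀ ℚ-ring

  -- The estimate is `(s Z)² ≤ (Z δ)² + Z² η ≤ 4 + 1 ≤ 9`.
  square-estimate : ∀ s δ N Z → 0ℚ ≤ s → 1ℚ ≤ Z → 0ℚ ≤ δ → Z * δ ≤ 2ℚ → N ≡ δ * δ → ∀ η → Z * Z * η ≤ 1ℚ → s * s < N + η → s * Z ≤ 3ℚ
  square-estimate s δ N Z 0≤s 1≤Z 0≤δ Zδ≤2 refl η Zη≤1 s²< = square-cancel-≤ 0≤3 (begin
    s * Z * (s * Z)  ≡⟨ squares s Z ⟩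
    Z * Z * (s * s)  ≤⟨ *-monoʳ (square-nonNeg Z) (ℚ.<⇒≤ s²<) ⟩
    Z * Z * (δ * δ + η)  ≡⟨ expand Z δ η ⟩
    Z * δ * (Z * δ) + Z * Z * η  ≤⟨ ℚ.+-mono-≤ (*-mono {Z * δ} {2ℚ} {Z * δ} {2ℚ} (*-nonNeg (ℚ.≤-trans 0≤1 1≤Z) 0≤δ) (ℚ.<⇒≤ 0<2) Zδ≤2 Zδ≤2) Zη≤1 ⟩
    2ℚ * 2ℚ + 1ℚ  ≤⟨ ≤-+ʳ {2ℚ * 2ℚ + 1ℚ} (*-nonNeg {2ℚ} {2ℚ} (ℚ.<⇒≤ 0<2) (ℚ.<⇒≤ 0<2)) ⟩
    2ℚ * 2ℚ + 1ℚ + 2ℚ * 2ℚ  ≡⟨⟩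
    3ℚ * 3ℚ  ∎)
    where
    open ℚ.≤-Reasoning
    0≤3 : 0ℚ ≤ 3ℚ
    0≤3 = ℚ.≤-trans 0≤1 1≤3
    squares : ∀ s z → s * z * (s * z) ≡ z * z * (s * s)
    squares = solve-∀ ℚ-ring
    expand : ∀ z δ η → z * z * (δ * δ + η) ≡ z * δ * (z * δ) + z * z * η
    expand = solve-∀ ℚ-ring

  module LowerBound (i : ℕ) where

    -- For `k = suc j` these are `A = 2 k² − 1`, the exponent `agreement` of the closeness of the
    -- roots, `B = 2 k − 1`, the exponent of the height, and `d = 2 k + 1`.
    j A B d : ℕ
    j = suc i
    A = suc j ℕ.+ ((j ℕ.+ j) ℕ.* suc j ℕ.+ j)
    B = j ℕ.+ suc j
    d = suc (double j) ℕ.+ 2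

    C : ℚ
    C = fromℕ (suc d)

    -- The fraction `r = w / v` lies strictly between `q` and `A / B`. The distance to `A / B`
    -- absorbs the constants for large `m`, and the distance to `q` makes the exponent exceed `q` by
    -- a fixed amount.
    module Exceeds (q : ℚ) (v-1 w : ℕ) (r : ℚ) (q<r : q < r) (rv≡w : r * fromℕ (suc v-1) ≡ fromℕ w) (gap : w ℕ.* B ℕ.< A ℕ.* suc v-1)
      (H₀ : ℕ) (upper : ∀ x → ExponentsFrom d H₀ x → x ≤ᴿ fromℚ q) where

      v : ℕ
      v = suc v-1

      threshold : ∃ λ N → 3ℚ ^ v * C ^ w ≤ fromℕ N
      threshold = archimedean (3ℚ ^ v * C ^ w)

      m : ℕ
      -- The summand 6 turns `s * M ^ A ≤ 3ℚ` into `s ≤ ½`, so that the logarithm is defined; `H₀`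
      -- makes the height large enough, and the threshold outweighs the constants in
      -- `power-estimate`.
      m = 6 ℕ.+ (H₀ ℕ.+ proj₁ threshold)

      open Approximation m (s≤s z≤n) i using (P; α; β; root-α; root-β; distinct; close; t; u; norm²-value; height-lower; height-upper; monic; reducible; top; below)

      M : ℚ
      M = fromℕ m
      1≤M : 1ℚ ≤ M
      1≤M = 1≤fromℕ {m} (s≤s z≤n)
      0≤M = ℚ.≤-trans 0≤1 1≤M

      large : 3ℚ ^ v * C ^ w ≤ M
      large = ℚ.≤-trans (proj₂ threshold) (fromℕ-mono {proj₁ threshold} {m} (ℕ.≤-trans (ℕ.m≤n+m (proj₁ threshold) H₀) (ℕ.m≤n+m (H₀ ℕ.+ proj₁ threshold) 6)))

      nontrivial : NonTrivial (height P)
      nontrivial = ℕ.n>1⇒nonTrivial (ℕ.≤-trans (s≤s (s≤s z≤n)) height-lower)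

      H : ℚ
      H = fromℕ (height P)

      H≤ : H ≤ C * M ^ B
      H≤ = ℚ.≤-trans (fromℕ-mono height-upper) (ℚ.≤-reflexive (trans (fromℕ-* (suc d) (m ℕ.^ j ℕ.* m ℕ.^ suc j))
        (cong (C *_) (trans (cong fromℕ (sym (ℕ.^-distribˡ-+-* m j (suc j)))) (fromℕ-^ m B)))))

      module _ (s : ℝ) (s-nonNeg : ∀ k → 0ℚ ≤ seq s k) (σ : ℚ) (0<σ : 0ℚ < σ) where

        upper-eventually : ∀ η → M ^ A * M ^ A * η ≤ 1ℚ → (Eventually λ k → seq s k * seq s k < seq (norm² (α , β)) k + η) → Eventually λ k → seq s k * M ^ A ≤ 3ℚ
        upper-eventually η Mη≤1 s≤ = eventually-map (λ k (near , less) →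
            square-estimate (seq s k) (∣ t k - u k ∣) (seq (norm² (α , β)) k) (M ^ A) (s-nonNeg k) (1≤^ A 1≤M) (ℚ.0≤∣p∣ (t k - u k)) near (norm²-value k) η Mη≤1 less)
          (close ∩ s≤)

        half-bound : ∀ x → 0ℚ ≤ x → x * M ^ A ≤ 3ℚ → x + ½ ≤ 1ℚ
        half-bound x 0≤x h = ℚ.+-monoˡ-≤ ½ {x} {½} (*-cancel≤ʳ {x} {½} {fromℕ 6} (fromℕ-mono< {0} {6} (s≤s z≤n)) (ℚ.≤-trans (ℚ.≤-trans (*-monoˡ 0≤x (fromℕ-mono {6} {m} (ℕ.m≤m+n 6 (H₀ ℕ.+ proj₁ threshold))))
            (ℚ.≤-trans (*-monoˡ 0≤x (subst (M ≤_) refl (≤-*ʳ 0≤M (1≤^ (j ℕ.+ ((j ℕ.+ j) ℕ.* suc j ℕ.+ j)) 1≤M)))) (ℚ.≤-reflexive (ℚ.*-comm (M ^ A) x)))) h))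

        conclude : IsSep P s → (Eventually λ k → σ ≤ seq s k) → (Eventually λ k → seq s k * M ^ A ≤ 3ℚ) → ⊥
        conclude isSep σ≤s s≤3 = upper exponent
            (P , monic , reducible (s≤s z≤n) (s≤s z≤n) , (α , β , root-α , root-β , distinct) ,
              ℕ.≤-trans (ℕ.≤-trans (ℕ.m≤m+n H₀ (proj₁ threshold)) (ℕ.m≤n+m (H₀ ℕ.+ proj₁ threshold) 6)) height-lower , nontrivial , s , isSep , isPower)
            (½ * (r - q) , half>0 (r - q) (difference-pos q<r) , eventually-map (λ k (h , small) → above k h small)
              (exponent-lower w v-1 (eventually-map (λ k h → power-estimate (seq s k) M H C A B v w (s-nonNeg k) 1≤M (fromℕ-nonNeg (height P)) (fromℕ-nonNeg (suc d)) h H≤ gap large) s≤3)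
                ∩ step-small (½ * (r - q)) (half>0 (r - q) (difference-pos q<r))))
          where
          bounds : Eventually λ k → σ ⊓ ½ ≤ seq s k × seq s k + σ ⊓ ½ ≤ 1ℚ
          bounds = eventually-map (λ k (lo , hi) → ℚ.≤-trans (ℚ.p⊓q≤p σ ½) lo , ℚ.≤-trans (ℚ.+-monoʳ-≤ (seq s k) (ℚ.p⊓q≤q σ ½)) (half-bound (seq s k) (s-nonNeg k) hi)) (σ≤s ∩ s≤3)
          open Logarithm (height P) {{nontrivial}} s (σ ⊓ ½) (⊓-glb-< 0<σ (ℚ.positive⁻¹ ½)) (proj₁ bounds) (proj₂ bounds) using (exponent; exponent-lower; isPower)
          lemma : ∀ e h r q → e + h - r + (½ * (r - q) - h) ≡ e - (q + ½ * (r - q))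
          lemma = solve-∀ ℚ-ring
          above : ∀ k → fromℕ w < (seq exponent k + step k) * fromℕ v → step k < ½ * (r - q) → q + ½ * (r - q) < seq exponent k
          above k h small = <-by-difference (subst (0ℚ <_) (lemma (seq exponent k) (step k) r q) (ℚ.+-mono-< (difference-pos r<) (difference-pos small)))
            where
            r< : r < seq exponent k + step k
            r< = *-cancel<ʳ {c = fromℕ v} (fromℕ-nonNeg v) (subst₂ _<_ (trans (sym rv≡w) (ℚ.*-comm r (fromℕ v))) (ℚ.*-comm (seq exponent k + step k) (fromℕ v)) h)

      -- The goal being `⊥`, the separation whose existence is only doubly negated may be assumed.
      contradiction : ⊥
      contradiction = separation-exists P d top below (α , β , root-α , root-β , distinct) λ (s , isSep , (σ , 0<σ , σ≤s) , s≤ , s-nonNeg) →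
        let η , 0<η , Mη≤1 = shrink (M ^ A * M ^ A) 1ℚ 0<1
        in s≤ α β root-α root-β distinct η 0<η λ less → conclude s s-nonNeg σ 0<σ isSep σ≤s (upper-eventually s s-nonNeg σ 0<σ η Mη≤1 less)

    lower-bound : (+ A / B) ≤ᴱ e*ᵣ d
    -- The midpoint is taken between `q ⊔ 0ℚ` and `c`, so that `r` is positive and its numerator a
    -- natural number even if `q` is negative.
    lower-bound q (H₀ , upper) = ℚ.≮⇒≥ λ q<c → go q<c (½ * (q ⊔ 0ℚ + c)) refl
      where
      c = + A / B
      0<c : 0ℚ < c
      0<c = *-cancel<ʳ {0ℚ} {c} {fromℕ B} (fromℕ-nonNeg B) (subst₂ _<_ (sym (ℚ.*-zeroʳ (fromℕ B))) (trans (sym (divide-cancel (+ A) B)) (ℚ.*-comm c (fromℕ B))) (fromℕ-mono< {0} {A} (s≤s z≤n)))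
      midpoint-< : ∀ a b → a < b → a < ½ * (a + b) × ½ * (a + b) < b
      midpoint-< a b a<b = <-by-difference (subst (0ℚ <_) (left a b) (half>0 (b - a) (difference-pos a<b))) , <-by-difference (subst (0ℚ <_) (right a b) (half>0 (b - a) (difference-pos a<b)))
        where
        left : ∀ a b → ½ * (b - a) ≡ ½ * (a + b) - a
        left = solve-∀ ℚ-ring
        right : ∀ a b → ½ * (b - a) ≡ b - ½ * (a + b)
        right = solve-∀ ℚ-ring
      go : q < c → ∀ r → r ≡ ½ * (q ⊔ 0ℚ + c) → ⊥
      go q<c r e = numerator (↥ r) refl
        where
        q⁺<c : q ⊔ 0ℚ < c
        q⁺<c = ⊔-lub-< q<c 0<c
        0<r : 0ℚ < r
        0<r = subst (0ℚ <_) (sym e) (ℚ.≤-<-trans (ℚ.p≤q⊔p q 0ℚ) (proj₁ (midpoint-< (q ⊔ 0ℚ) c q⁺<c)))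
        q<r : q < r
        q<r = subst (q <_) (sym e) (ℚ.≤-<-trans (ℚ.p≤p⊔q q 0ℚ) (proj₁ (midpoint-< (q ⊔ 0ℚ) c q⁺<c)))
        r<c : r < c
        r<c = subst (_< c) (sym e) (proj₂ (midpoint-< (q ⊔ 0ℚ) c q⁺<c))
        0<v : 0ℚ < fromℕ (↧ₙ r)
        0<v = ℚ.<-≤-trans 0<1 (1≤fromℕ (1≤denominator r))
        rv = numerator/denominator r
        numerator : ∀ a → ↥ r ≡ a → ⊥
        numerator (+ w) e′ = Exceeds.contradiction q (ℕ.pred (↧ₙ r)) w r q<r (subst (λ v → r * fromℕ v ≡ fromℕ w) v≡ rv′) (subst (λ v → w ℕ.* B ℕ.< A ℕ.* v) v≡ gap) H₀ upper
          where
          v≡ : ↧ₙ r ≡ suc (ℕ.pred (↧ₙ r))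
          v≡ = sym (ℕ.suc-pred (↧ₙ r) {{ℕ.>-nonZero (1≤denominator r)}})
          rv′ : r * fromℕ (↧ₙ r) ≡ fromℕ w
          rv′ = trans rv (cong fromℤ e′)
          swap : ∀ r v b → r * v * b ≡ r * b * v
          swap = solve-∀ ℚ-ring
          0<B : 0ℚ < fromℕ B
          0<B = fromℕ-mono< {0} {B} (s≤s z≤n)
          gap : w ℕ.* B ℕ.< A ℕ.* ↧ₙ r
          gap = fromℕ-cancel< {w ℕ.* B} {A ℕ.* ↧ₙ r} (subst₂ _<_ (trans (swap r (fromℕ B) (fromℕ (↧ₙ r))) (trans (cong (_* fromℕ B) rv′) (sym (fromℕ-* w B))))
            (trans (cong (_* fromℕ (↧ₙ r)) (divide-cancel (+ A) B)) (sym (fromℕ-* A (↧ₙ r))))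
            (*-mono<ˡ 0<v (*-mono<ˡ 0<B r<c)))
        numerator -[1+ n ] e′ = <⇒≱ (*-pos 0<r 0<v) (ℚ.≤-trans (ℚ.≤-reflexive (trans rv (cong fromℤ e′))) (fromℤ-mono { -[1+ n ] } {+ 0} ℤ.-≤+))

open import Data.Integer.Base using (+_)
open import Data.Rational.Base using (_/_)

corollary1 :
  ((+ 7 / 3) ≤ᴱ e*ᵣ 5 × e*ᵣ 5 ᴱ≤ (+ 3 / 1)) ×
  ((+ 17 / 5) ≤ᴱ e*ᵣ 7 × e*ᵣ 7 ᴱ≤ (+ 5 / 1)) ×
  ((+ 31 / 7) ≤ᴱ e*ᵣ 9 × e*ᵣ 9 ᴱ≤ (+ 7 / 1))
-- The arguments 0, 1, 2 are `k − 2` for `k = 2, 3, 4`, and `A / B` computes to 7/3, 17/5 and 31/7.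
corollary1 =
  (LowerMain.LowerBound.lower-bound 0 , UpperMain.upper-bound 5 (s≤s (s≤s (s≤s z≤n)))) ,
  (LowerMain.LowerBound.lower-bound 1 , UpperMain.upper-bound 7 (s≤s (s≤s (s≤s z≤n)))) ,
  (LowerMain.LowerBound.lower-bound 2 , UpperMain.upper-bound 9 (s≤s (s≤s (s≤s z≤n))))
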